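{- Let $p$ be a prime. The transcendence degree of the field $\mathbb{F}_p(x)\big(\overline{E}_p(cx)\big)_{c\in\mathbb{F}_p^\times}$ over $\mathbb{F}_p(x)$ equals $\phi(p-1)$, where $\phi$ is Euler's totient function.
   Context: $\overline{E}_p(x)\in\mathbb{F}_p[[x]]$ denotes the reduction modulo $p$ of the Artin–Hasse exponential $E_p(x)=\exp\left(\sum_{n\ge0}x^{p^n}/p^n\right)\in\mathbb{Z}_{(p)}[[x]]$, and $\overline{E}_p(cx)$ is obtained by substituting $cx$ for $x$. The field $\mathbb{F}_p(x)\big(\overline{E}_p(cx)\big)_{c\in\mathbb{F}_p^\times}$ is the subfield of $\mathbb{F}_p((x))$ generated over $\mathbb{F}_p(x)$ by these series. -}

module Defs where

open import Data.Nat using (ℕ; zero; suc; _+_; _*_; _∸_; _^_; _!; NonZero; _%_; _≟_)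
open import Data.Nat.Properties using (m^n≢0; _!≢0)
open import Data.Nat.GCD using (gcd)
open import Data.Integer using (ℤ; +_; _%ℕ_)
open import Data.Rational using (ℚ; 0ℚ; 1ℚ; ↥_; ↧ₙ_) renaming (_+_ to _+ℚ_; _*_ to _*ℚ_; _/_ to _/ℚ_)
open import Data.List using (List; []; _∷_; map; upTo; foldr; filter; length)
open import Data.Nat.ListAction using (sum)
open import Data.List.Relation.Unary.All using (All)
open import Data.Vec using (Vec; []; _∷_; tabulate)
import Data.Vec.Relation.Unary.All as VAll
open import Data.Fin using (Fin; toℕ)
open import Data.Product using (Σ; _×_; ∃)
open import Relation.Binary.PropositionalEquality using (_≡_)
open import Relation.Nullary using (¬_; yes; no)

totient : ℕ → ℕ
totient n = length (filter (λ k → gcd k n ≟ 1) (map suc (upTo n)))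

-- Everything below is relative to a fixed modulus p (a prime in the theorem).
-- Elements of 𝔽_p are represented by natural numbers, compared modulo p.

module _ (p : ℕ) .{{_ : NonZero p}} where

  SeriesQ : Set
  SeriesQ = ℕ → ℚ

  sumQ : List ℚ → ℚ
  sumQ = foldr _+ℚ_ 0ℚ

  mulQ : SeriesQ → SeriesQ → SeriesQ
  mulQ s t n = sumQ (map (λ i → s i *ℚ t (n ∸ i)) (upTo (suc n)))

  oneQ : SeriesQ
  oneQ zero    = 1ℚ
  oneQ (suc _) = 0ℚ

  -- g(x) = Σ_{j≥0} x^{p^j}/p^j ; coefficient of x^m (only j ≤ m can satisfy p^j = m)
  ahLog : SeriesQ
  ahLog m = sumQ (map term (upTo (suc m)))
    where
    term : ℕ → ℚ
    term j with p ^ j ≟ m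
    ... | yes _ = (+ 1 /ℚ (p ^ j)) {{m^n≢0 p j}}
    ... | no  _ = 0ℚ

  powQ : SeriesQ → ℕ → SeriesQ
  powQ s zero    = oneQ
  powQ s (suc k) = mulQ s (powQ s k)

  -- exp(g) = Σ_k g^k / k! ; since g(0) = 0, only k ≤ n contribute to x^n
  artinHasse : SeriesQ
  artinHasse n = sumQ (map (λ k → powQ ahLog k n *ℚ (+ 1 /ℚ (k !)) {{k !≢0}}) (upTo (suc n)))

  -- reduction modulo p of a (normalised) rational number a/b with p ∤ b:
  -- a · b^{p-2} mod p  (b^{p-2} is the inverse of b in 𝔽_p by Fermat)
  redQ : ℚ → ℕ
  redQ q = (((↥ q) %ℕ p) * (↧ₙ q) ^ (p ∸ 2)) % p

  Series : Set
  Series = ℕ → ℕ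

  EpBar : ℕ → Series
  EpBar c n = redQ (artinHasse n) * c ^ n

  _+ₛ_ : Series → Series → Series
  (s +ₛ t) n = s n + t n

  _*ₛ_ : Series → Series → Series
  (s *ₛ t) n = sum (map (λ i → s i * t (n ∸ i)) (upTo (suc n)))

  shift : ℕ → Series → Series
  shift zero    s         = s
  shift (suc k) s zero    = 0
  shift (suc k) s (suc n) = shift k s n

  -- (k , s) represents the Laurent series x^{-k} · s ∈ 𝔽_p((x))
  Laurent : Set
  Laurent = ℕ × Series

  open Data.Product using (_,_)

  _+ᴸ_ : Laurent → Laurent → Laurent
  (k , s) +ᴸ (l , t) = (k + l , (shift l s +ₛ shift k t))

  _*ᴸ_ : Laurent → Laurent → Laurent
  (k , s) *ᴸ (l , t) = (k + l , (s *ₛ t))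

  zeroᴸ : Laurent
  zeroᴸ = (0 , λ _ → 0)

  _≈ᴸ_ : Laurent → Laurent → Set
  (k , s) ≈ᴸ (l , t) = ∀ n → shift l s n % p ≡ shift k t n % p

  -- Polynomials in m variables with coefficients in 𝔽_p[x]
  -- (algebraic relations over 𝔽_p(x) can be taken with coefficients
  --  in 𝔽_p[x] after clearing denominators)

  -- 𝔽_p[x] as coefficient lists; Poly (suc m) = polynomials in the first
  -- variable with coefficients in Poly m (list of coefficients, constant first)
  Poly : ℕ → Set
  Poly zero    = List ℕ
  Poly (suc m) = List (Poly m)

  IsZeroPoly : (m : ℕ) → Poly m → Set
  IsZeroPoly zero    cs = All (λ c → c % p ≡ 0) cs
  IsZeroPoly (suc m) cs = All (IsZeroPoly m) cs

  coeffs : List ℕ → Series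
  coeffs []       n       = 0
  coeffs (c ∷ cs) zero    = c
  coeffs (c ∷ cs) (suc n) = coeffs cs n

  eval : (m : ℕ) → Poly m → Vec Laurent m → Laurent
  eval zero    cs       []       = (0 , coeffs cs)
  eval (suc m) []       (a ∷ as) = zeroᴸ
  eval (suc m) (c ∷ cs) (a ∷ as) = eval m c as +ᴸ (a *ᴸ eval (suc m) cs (a ∷ as))

  AlgIndep : (m : ℕ) → Vec Laurent m → Set
  AlgIndep m as = (P : Poly m) → ¬ IsZeroPoly m P → ¬ (eval m P as ≈ᴸ zeroᴸ)

  gens : Vec Laurent (p ∸ 1)
  gens = tabulate (λ i → (0 , EpBar (suc (toℕ i))))

  InL : Laurent → Set
  InL a = Σ (Poly (p ∸ 1)) λ P → Σ (Poly (p ∸ 1)) λ Q →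
            ¬ (eval (p ∸ 1) Q gens ≈ᴸ zeroᴸ) × ((a *ᴸ eval (p ∸ 1) Q gens) ≈ᴸ eval (p ∸ 1) P gens)

  TrDegIs : ℕ → Set
  TrDegIs n = (Σ (Vec Laurent n) λ as → VAll.All InL as × AlgIndep n as)
            × ((as : Vec Laurent (suc n)) → VAll.All InL as → ¬ AlgIndep (suc n) as)

{-# OPTIONS --safe #-}
-- Let O = ℤ_p, let [c] be the Teichmüller lift of c, Y = Σ x^(p^j) and θ = x d/dx.  The Artin–Hasse series is the
-- solution E of θE = YE with E(0) = 1, so the monomial M = ∏ E([c]x)^(k_c) solves θM = βYM with β = Σ k_c [c] and
-- depends only on β.  The lift ζ of a primitive root mod p is a primitive (p-1)-th root of unity, so 1, ζ, …,
-- ζ^(φ(p-1)-1) are linearly independent over ℤ and span all [c] over ℚ.  Solutions with distinct β are linearly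
-- independent modulo p over 𝔽_p(x), by comparison with their conjugates under Y ↦ Y + σ; this gives the lower bound.
-- For the upper bound one counts: there are more polynomials of bounded degree in φ(p-1) + 1 elements of the field
-- than values that they can take.
module Submission where

-- Modulo p the derivation θ sees β only modulo p, so Wronskians cannot separate all β. They are
-- replaced by the operators binom(θ, q-1), q a power of p, which modulo p select the exponents
-- congruent to -1 mod q. Conjugation by A^b, where θA = YA, turns θ into θ + bY. Since θY = Σ p^j
-- x^(p^j) has coefficients tending to 0, these operators applied to c A^b and divided by A^b give,
-- up to a power of p, polynomials in Y with such coefficients. Y ↦ Y + σ shifts exponents by σb,
-- and for σ a power of p beyond the orders of the coefficients of a relation the leading exponents
-- lie in different classes mod q, so that no relation is possible there. The obstacle is to carry a
-- relation from σ = 0 to this σ: no automorphism of the series ring does it, as Y + 1 is a unit and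
-- Y is not. Instead, a polynomial as above that vanishes modulo p for one σ is shown to vanish for
-- all; traces and norms along σ reduce this to Y not being rational modulo p. Choices that depend
-- on whether a series vanishes are made under double negation; the conclusions are negations or
-- stable.

module RingKit where

  open import Algebra.Bundles using (CommutativeRing; RawRing)
  open import Level using (0ℓ)
  import Algebra.Properties.Ring
  import Algebra.Properties.Monoid.Mult
  import Algebra.Properties.Semiring.Mult
  import Algebra.Properties.Semiring.Exp
  import Algebra.Properties.CommutativeSemiring.Exp
  import Algebra.Properties.CommutativeSemiring.Binomial
  import Algebra.Properties.Monoid.Sum
  import Algebra.Solver.Ring
  import Algebra.Solver.Ring.AlmostCommutativeRing as ACR
  import Relation.Binary.Reasoning.Setoid
  open import Data.Fin as Fin using (Fin)
  import Data.Fin.Properties as Fin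
  open import Data.Integer as ℤ using (ℤ; +_; -[1+_]; _⊖_)
  import Data.Integer.Properties as ℤ
  open import Data.Maybe using (Maybe; just; nothing)
  open import Data.Nat as ℕ using (ℕ; zero; suc; s≤s; z≤n)
  import Data.Nat.Properties as ℕ
  open import Data.Nat.Combinatorics as C using (_C_)
  open import Data.Nat.Divisibility as ℕ using () renaming (_∣_ to _∣ₙ_)
  open import Data.Nat.Primality using (Prime; euclidsLemma; prime⇒nonZero; prime⇒nonTrivial)
  open import Data.Product using (Σ; _×_; _,_; proj₁; proj₂)
  open import Data.Sum using (inj₁; inj₂)
  open import Relation.Binary.PropositionalEquality as ≡ using (_≡_)
  open import Relation.Nullary using (yes; no; ¬_)
  open import Data.Empty using (⊥-elim)

  -- Commutative rings: integer multiples, powers, the freshman's dream, quotients.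

  module Raw {A : Set} (_+_ _*_ : A → A → A) (0# 1# : A) where

    infixr 8 _^_

    fromℕ : ℕ → A
    fromℕ zero    = 0#
    fromℕ (suc n) = 1# + fromℕ n

    _^_ : A → ℕ → A
    x ^ zero  = 1#
    x ^ suc n = x * (x ^ n)

  module Kit (R : CommutativeRing 0ℓ 0ℓ) where

    open CommutativeRing R
    open Algebra.Properties.Ring ring using (-‿distribˡ-*; -‿distribʳ-*; -‿+-comm; -0#≈0#; -‿involutive)
    open Relation.Binary.Reasoning.Setoid setoid
    open Algebra.Properties.Monoid.Mult +-monoid using (×-congʳ) renaming (_×_ to _·_)
    open Algebra.Properties.Semiring.Mult semiring using (×-assoc-*)
    open Algebra.Properties.Semiring.Exp semiring using () renaming (_^_ to _^′_)
    open Raw _+_ _*_ 0# 1# public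

    ·1≡fromℕ : ∀ n → n · 1# ≡ fromℕ n
    ·1≡fromℕ zero    = ≡.refl
    ·1≡fromℕ (suc n) = ≡.cong (λ z → 1# + z) (·1≡fromℕ n)

    ^′≡^ : ∀ x n → x ^′ n ≡ x ^ n
    ^′≡^ x zero    = ≡.refl
    ^′≡^ x (suc n) = ≡.cong (x *_) (^′≡^ x n)

    fromℕ-+ : ∀ m n → fromℕ (m ℕ.+ n) ≈ fromℕ m + fromℕ n
    fromℕ-+ zero    n = sym (+-identityˡ _)
    fromℕ-+ (suc m) n = trans (+-congˡ (fromℕ-+ m n)) (sym (+-assoc _ _ _))

    fromℕ-* : ∀ m n → fromℕ (m ℕ.* n) ≈ fromℕ m * fromℕ n
    fromℕ-* zero    n = sym (zeroˡ _)
    fromℕ-* (suc m) n = trans (fromℕ-+ n (m ℕ.* n)) (trans (+-cong (sym (*-identityˡ _)) (fromℕ-* m n)) (sym (distribʳ _ _ _)))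

    ^-cong : ∀ n {x y} → x ≈ y → x ^ n ≈ y ^ n
    ^-cong zero    e = refl
    ^-cong (suc n) e = *-cong e (^-cong n e)

    ^-+ : ∀ x m n → x ^ (m ℕ.+ n) ≈ x ^ m * x ^ n
    ^-+ x zero    n = sym (*-identityˡ _)
    ^-+ x (suc m) n = trans (*-congˡ (^-+ x m n)) (sym (*-assoc _ _ _))

    1^ : ∀ n → 1# ^ n ≈ 1#
    1^ zero    = refl
    1^ (suc n) = trans (*-identityˡ _) (1^ n)

    ·≈fromℕ* : ∀ n x → n · x ≈ fromℕ n * x
    ·≈fromℕ* n x = trans (×-congʳ n (sym (*-identityˡ x))) (trans (sym (×-assoc-* n 1# x)) (*-congʳ (reflexive (·1≡fromℕ n))))

    fromℕ-^ : ∀ m n → fromℕ (m ℕ.^ n) ≈ fromℕ m ^ n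
    fromℕ-^ m zero    = +-identityʳ 1#
    fromℕ-^ m (suc n) = trans (fromℕ-* m (m ℕ.^ n)) (*-congˡ (fromℕ-^ m n))

    fromℤ : ℤ → Carrier
    fromℤ (+ n)    = fromℕ n
    fromℤ -[1+ n ] = - fromℕ (suc n)

    private
      cancel₁ : ∀ a b → (1# + a) - (1# + b) ≈ a - b
      cancel₁ a b = begin
        (1# + a) + - (1# + b)       ≈⟨ +-cong (+-comm a 1#) (-‿+-comm 1# b) ⟨
        (a + 1#) + (- 1# + - b)     ≈⟨ +-assoc a 1# _ ⟩
        a + (1# + (- 1# + - b))     ≈⟨ +-congˡ (+-assoc 1# (- 1#) _) ⟨
        a + ((1# + - 1#) + - b)     ≈⟨ +-congˡ (trans (+-congʳ (-‿inverseʳ 1#)) (+-identityˡ _)) ⟩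
        a - b                       ∎

      fromℤ-⊖ : ∀ m n → fromℤ (m ⊖ n) ≈ fromℕ m - fromℕ n
      fromℤ-⊖ zero zero = sym (-‿inverseʳ 0#)
      fromℤ-⊖ zero (suc n) = sym (+-identityˡ _)
      fromℤ-⊖ (suc m) zero = sym (trans (+-congˡ -0#≈0#) (+-identityʳ _))
      fromℤ-⊖ (suc m) (suc n) = begin
        fromℤ (suc m ⊖ suc n)              ≡⟨ ≡.cong fromℤ (ℤ.[1+m]⊖[1+n]≡m⊖n m n) ⟩
        fromℤ (m ⊖ n)                      ≈⟨ fromℤ-⊖ m n ⟩
        fromℕ m - fromℕ n                  ≈⟨ cancel₁ _ _ ⟨
        fromℕ (suc m) - fromℕ (suc n)      ∎

    fromℤ-+ : ∀ a b → fromℤ (a ℤ.+ b) ≈ fromℤ a + fromℤ b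
    fromℤ-+ (+ m) (+ n) = fromℕ-+ m n
    fromℤ-+ (+ m) -[1+ n ] = fromℤ-⊖ m (suc n)
    fromℤ-+ -[1+ m ] (+ n) = trans (fromℤ-⊖ n (suc m)) (+-comm _ _)
    fromℤ-+ -[1+ m ] -[1+ n ] = begin
      - fromℕ (suc (suc (m ℕ.+ n)))              ≡⟨ ≡.cong (λ k → - fromℕ (suc k)) (ℕ.+-suc m n) ⟨
      - fromℕ (suc m ℕ.+ suc n)                  ≈⟨ -‿cong (fromℕ-+ (suc m) (suc n)) ⟩
      - (fromℕ (suc m) + fromℕ (suc n))          ≈⟨ -‿+-comm _ _ ⟨
      - fromℕ (suc m) + - fromℕ (suc n)          ∎

    fromℤ-neg : ∀ a → fromℤ (ℤ.- a) ≈ - fromℤ a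
    fromℤ-neg (+ zero)  = sym -0#≈0#
    fromℤ-neg (+ suc n) = refl
    fromℤ-neg -[1+ n ]  = sym (-‿involutive _)

    fromℤ-* : ∀ a b → fromℤ (a ℤ.* b) ≈ fromℤ a * fromℤ b
    fromℤ-* (+ m) (+ n) = begin
      fromℤ (+ m ℤ.* + n)     ≡⟨ ≡.cong fromℤ (ℤ.pos-* m n) ⟨
      fromℕ (m ℕ.* n)         ≈⟨ fromℕ-* m n ⟩
      fromℕ m * fromℕ n       ∎
    fromℤ-* (+ m) -[1+ n ] = begin
      fromℤ (+ m ℤ.* -[1+ n ])       ≡⟨ ≡.cong fromℤ (ℤ.neg-distribʳ-* (+ m) (+ suc n)) ⟨
      fromℤ (ℤ.- (+ m ℤ.* + suc n))  ≈⟨ fromℤ-neg (+ m ℤ.* + suc n) ⟩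
      - fromℤ (+ m ℤ.* + suc n)      ≈⟨ -‿cong (fromℤ-* (+ m) (+ suc n)) ⟩
      - (fromℕ m * fromℕ (suc n))    ≈⟨ -‿distribʳ-* _ _ ⟩
      fromℕ m * - fromℕ (suc n)      ∎
    fromℤ-* -[1+ m ] (+ n) = begin
      fromℤ (-[1+ m ] ℤ.* + n)       ≡⟨ ≡.cong fromℤ (ℤ.neg-distribˡ-* (+ suc m) (+ n)) ⟨
      fromℤ (ℤ.- (+ suc m ℤ.* + n))  ≈⟨ fromℤ-neg (+ suc m ℤ.* + n) ⟩
      - fromℤ (+ suc m ℤ.* + n)      ≈⟨ -‿cong (fromℤ-* (+ suc m) (+ n)) ⟩
      - (fromℕ (suc m) * fromℕ n)    ≈⟨ -‿distribˡ-* _ _ ⟩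
      - fromℕ (suc m) * fromℕ n      ∎
    fromℤ-* -[1+ m ] -[1+ n ] = begin
      fromℕ (suc m ℕ.* suc n)                ≈⟨ fromℕ-* (suc m) (suc n) ⟩
      fromℕ (suc m) * fromℕ (suc n)          ≈⟨ -‿involutive _ ⟨
      - - (fromℕ (suc m) * fromℕ (suc n))    ≈⟨ -‿cong (-‿distribˡ-* _ _) ⟩
      - (- fromℕ (suc m) * fromℕ (suc n))    ≈⟨ -‿distribʳ-* _ _ ⟩
      - fromℕ (suc m) * - fromℕ (suc n)      ∎

    module Solver where
      private
        ℤ-raw : RawRing 0ℓ 0ℓ
        ℤ-raw = CommutativeRing.rawRing ℤ.+-*-commutativeRing

        morphism : ℤ-raw ACR.-Raw-AlmostCommutative⟶ ACR.fromCommutativeRing R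
        morphism = record
          -- `+ 1` is sent to `1#` itself and not to `fromℤ (+ 1)`, which is `1# + 0#`, so that
          -- `con (+ 1)` matches the units that occur in goals.
          { ⟦_⟧    = λ { (+ 1) → 1# ; a → fromℤ a }
          ; +-homo = λ a b → trans (η (a ℤ.+ b)) (trans (fromℤ-+ a b) (sym (+-cong (η a) (η b))))
          ; *-homo = λ a b → trans (η (a ℤ.* b)) (trans (fromℤ-* a b) (sym (*-cong (η a) (η b))))
          ; -‿homo = λ a → trans (η (ℤ.- a)) (trans (fromℤ-neg a) (sym (-‿cong (η a))))
          ; 0-homo = refl
          ; 1-homo = refl
          }
          where
          η : ∀ a → _ ≈ fromℤ a
          η (+ 0) = refl
          η (+ 1) = sym (+-identityʳ 1#)
          η (+ suc (suc n)) = refl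
          η -[1+ n ] = refl

        _≟ᶜ_ : ∀ a b → Maybe (ACR.Induced-equivalence morphism a b)
        a ≟ᶜ b with a ℤ.≟ b
        ... | yes ≡.refl = just refl
        ... | no _       = nothing

      open Algebra.Solver.Ring ℤ-raw (ACR.fromCommutativeRing R) morphism _≟ᶜ_ public
        using (solve; _:=_; _:+_; _:*_; _:-_; :-_; _:^_; con; Polynomial)

    ^-distrib-* : ∀ x y n → (x * y) ^ n ≈ x ^ n * y ^ n
    ^-distrib-* x y zero    = sym (*-identityˡ _)
    ^-distrib-* x y (suc n) = trans (*-congˡ (^-distrib-* x y n))
      (solve 4 (λ x y a b → x :* y :* (a :* b) := x :* a :* (y :* b)) refl x y _ _)
      where open Solver

    ^-* : ∀ x m n → x ^ (m ℕ.* n) ≈ (x ^ m) ^ n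
    ^-* x m zero    = reflexive (≡.cong (x ^_) (ℕ.*-zeroʳ m))
    ^-* x m (suc n) = trans (reflexive (≡.cong (x ^_) (ℕ.*-suc m n))) (trans (^-+ x m (m ℕ.* n)) (*-congˡ (^-* x m n)))

    x-y≈0⇒x≈y : ∀ {x y} → x - y ≈ 0# → x ≈ y
    x-y≈0⇒x≈y {x} {y} e = begin
      x             ≈⟨ solve 2 (λ x y → x := (x :- y) :+ y) refl x y ⟩
      (x - y) + y   ≈⟨ +-congʳ e ⟩
      0# + y        ≈⟨ +-identityˡ y ⟩
      y             ∎
      where open Solver

    x≈y⇒x-y≈0 : ∀ {x y} → x ≈ y → x - y ≈ 0#
    x≈y⇒x-y≈0 {x} {y} e = trans (+-congʳ e) (-‿inverseʳ y)

    -- Carried through `freshman` so that the cofactor of p is known to stay in a chosen subring.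
    -- This matters for ℤ[ζ], where divisibility by a prime has to be witnessed inside ℤ[ζ].
    record Subring (P : Carrier → Set) : Set where
      field
        resp : ∀ {x y} → x ≈ y → P x → P y
        zero∈ : P 0#
        one∈ : P 1#
        add∈ : ∀ {x y} → P x → P y → P (x + y)
        mul∈ : ∀ {x y} → P x → P y → P (x * y)

      pow∈ : ∀ {x} n → P x → P (x ^ n)
      pow∈ zero    px = one∈
      pow∈ (suc n) px = mul∈ px (pow∈ n px)

      mult∈ : ∀ {x} n → P x → P (n · x)
      mult∈ zero    px = zero∈
      mult∈ (suc n) px = add∈ px (mult∈ n px)

  binomial-absorption : ∀ n k → suc k ℕ.* (suc n C suc k) ≡ suc n ℕ.* (n C k)
  binomial-absorption zero zero    = ≡.refl
  binomial-absorption zero (suc k) = ≡.trans (≡.cong (suc (suc k) ℕ.*_) (C.k>n⇒nCk≡0 {1} {suc (suc k)} (s≤s (s≤s z≤n))))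
    (≡.trans (ℕ.*-zeroʳ k) (≡.sym (≡.cong (1 ℕ.*_) (C.k>n⇒nCk≡0 {0} {suc k} (s≤s z≤n)))))
  binomial-absorption (suc n) zero = ≡.trans (ℕ.*-identityˡ _) (≡.trans (C.nC1≡n (suc (suc n))) (≡.sym (ℕ.*-identityʳ _)))
  binomial-absorption (suc n) (suc k) = begin
    suc (suc k) ℕ.* (suc (suc n) C suc (suc k))
      ≡⟨ ≡.cong (suc (suc k) ℕ.*_) (C.nCk+nC[k+1]≡[n+1]C[k+1] (suc n) (suc k)) ⟨
    suc (suc k) ℕ.* (c ℕ.+ c′)
      ≡⟨ ℕ.*-distribˡ-+ (suc (suc k)) c c′ ⟩
    (c ℕ.+ suc k ℕ.* c) ℕ.+ suc (suc k) ℕ.* c′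
      ≡⟨ ≡.cong₂ (λ u v → (c ℕ.+ u) ℕ.+ v) (binomial-absorption n k) (binomial-absorption n (suc k)) ⟩
    (c ℕ.+ suc n ℕ.* (n C k)) ℕ.+ suc n ℕ.* (n C suc k)
      ≡⟨ ℕ.+-assoc c _ _ ⟩
    c ℕ.+ (suc n ℕ.* (n C k) ℕ.+ suc n ℕ.* (n C suc k))
      ≡⟨ ≡.cong (c ℕ.+_) (ℕ.*-distribˡ-+ (suc n) (n C k) (n C suc k)) ⟨
    c ℕ.+ suc n ℕ.* (n C k ℕ.+ n C suc k)
      ≡⟨ ≡.cong (λ z → c ℕ.+ suc n ℕ.* z) (C.nCk+nC[k+1]≡[n+1]C[k+1] n k) ⟩
    suc (suc n) ℕ.* c ∎
    where
    open ≡.≡-Reasoning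
    c  = suc n C suc k
    c′ = suc n C suc (suc k)

  -- Absorption gives k binom(p, k) = p binom(p-1, k-1); by Euclid's lemma p divides one of the
  -- factors on the left, and it does not divide k.
  prime∣binomial : ∀ {p} → Prime p → ∀ k → 0 ℕ.< k → k ℕ.< p → p ∣ₙ p C k
  prime∣binomial {suc p-1} pr (suc k) _ k<p
    with euclidsLemma (suc k) (suc p-1 C suc k) pr
           (ℕ.divides (p-1 C k) (≡.trans (binomial-absorption p-1 k) (ℕ.*-comm (suc p-1) _)))
  ... | inj₂ d = d
  ... | inj₁ d = ⊥-elim (ℕ.<⇒≱ k<p (ℕ.∣⇒≤ d))

  module Frobenius (R : CommutativeRing 0ℓ 0ℓ) {p : ℕ} (pr : Prime p) where

    open CommutativeRing R
    open Kit R
    open Relation.Binary.Reasoning.Setoid setoid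
    open Algebra.Properties.Monoid.Mult +-monoid using (×-congʳ) renaming (_×_ to _·_)
    open Algebra.Properties.Monoid.Sum +-monoid using (sum; sum-init-last)
    open Algebra.Properties.CommutativeSemiring.Binomial commutativeSemiring using (theorem; binomialTerm)

    open Algebra.Properties.Semiring.Exp semiring using () renaming (_^_ to _^′_)

    module _ {P : Carrier → Set} (sub : Subring P) where

      open Subring sub

      private
        sum-divisible : ∀ n (t : Fin n → Carrier) → (∀ i → Σ Carrier λ u → P u × t i ≈ fromℕ p * u) →
                        Σ Carrier λ u → P u × sum t ≈ fromℕ p * u
        sum-divisible zero    t h = 0# , zero∈ , sym (zeroʳ _)
        sum-divisible (suc n) t h with h Fin.zero | sum-divisible n (λ i → t (Fin.suc i)) (λ i → h (Fin.suc i))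
        ... | u , pu , e | v , pv , e′ = u + v , add∈ pu pv , trans (+-cong e e′) (sym (distribˡ _ u v))

      freshman : ∀ x y → P x → P y → Σ Carrier λ u → P u × (x + y) ^ p ≈ (x ^ p + y ^ p) + fromℕ p * u
      freshman x y px py = go p ≡.refl
        where
        go : ∀ q → q ≡ p → Σ Carrier λ u → P u × (x + y) ^ q ≈ (x ^ q + y ^ q) + fromℕ p * u
        go zero e = ⊥-elim (ℕ.≢-nonZero⁻¹ p {{prime⇒nonZero pr}} (≡.sym e))
        go q@(suc r) q≡p = proj₁ middle , proj₁ (proj₂ middle) , eq
          where
          pow′ : ∀ x k → P x → P (x ^′ k)
          pow′ x k px = ≡.subst P (≡.sym (^′≡^ x k)) (pow∈ k px)

          t : Fin (suc q) → Carrier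
          t = binomialTerm x y q

          termk : ∀ k → 0 ℕ.< k → k ℕ.< q → Σ Carrier λ u → P u × (q C k) · (x ^′ k * y ^′ (q ℕ.∸ k)) ≈ fromℕ p * u
          termk k 0<k k<q with prime∣binomial pr k 0<k (≡.subst (k ℕ.<_) q≡p k<q)
          ... | ℕ.divides c e = c · m , mult∈ c (mul∈ (pow′ x k px) (pow′ y (q ℕ.∸ k) py)) , (begin
            (q C k) · m                ≡⟨ ≡.cong (λ z → (z C k) · m) q≡p ⟩
            (p C k) · m                ≡⟨ ≡.cong (_· m) (≡.trans e (ℕ.*-comm c p)) ⟩
            (p ℕ.* c) · m              ≈⟨ ·≈fromℕ* (p ℕ.* c) m ⟩
            fromℕ (p ℕ.* c) * m        ≈⟨ *-congʳ (fromℕ-* p c) ⟩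
            (fromℕ p * fromℕ c) * m    ≈⟨ *-assoc _ _ m ⟩
            fromℕ p * (fromℕ c * m)    ≈⟨ *-congˡ (·≈fromℕ* c m) ⟨
            fromℕ p * (c · m)          ∎)
            where m = x ^′ k * y ^′ (q ℕ.∸ k)

          middle : Σ Carrier λ u → P u × sum (λ (i : Fin r) → t (Fin.suc (Fin.inject₁ i))) ≈ fromℕ p * u
          middle = sum-divisible r _ (λ i →
            termk (suc (Fin.toℕ (Fin.inject₁ i))) (s≤s z≤n)
              (s≤s (≡.subst (ℕ._< r) (≡.sym (Fin.toℕ-inject₁ i)) (Fin.toℕ<n i))))

          first : t Fin.zero ≈ y ^′ q
          first = trans (+-identityʳ _) (*-identityˡ _)

          last : t (Fin.fromℕ q) ≈ x ^′ q
          last = begin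
            (q C Fin.toℕ (Fin.fromℕ q)) · (x ^′ Fin.toℕ (Fin.fromℕ q) * y ^′ (q ℕ.∸ Fin.toℕ (Fin.fromℕ q)))
              ≡⟨ ≡.cong (λ k → (q C k) · (x ^′ k * y ^′ (q ℕ.∸ k))) (Fin.toℕ-fromℕ q) ⟩
            (q C q) · (x ^′ q * y ^′ (q ℕ.∸ q))
              ≡⟨ ≡.cong₂ (λ c k → c · (x ^′ q * y ^′ k)) (C.nCn≡1 q) (ℕ.n∸n≡0 q) ⟩
            1 · (x ^′ q * 1#)
              ≈⟨ trans (+-identityʳ _) (*-identityʳ _) ⟩
            x ^′ q ∎

          eq : (x + y) ^ q ≈ (x ^ q + y ^ q) + fromℕ p * proj₁ middle
          eq = begin
            (x + y) ^ q                                        ≡⟨ ^′≡^ (x + y) q ⟨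
            (x + y) ^′ q                                        ≈⟨ theorem q x y ⟩
            t Fin.zero + sum (λ i → t (Fin.suc i))             ≈⟨ +-cong first (sum-init-last (λ i → t (Fin.suc i))) ⟩
            y ^′ q + (sum (λ (i : Fin r) → t (Fin.suc (Fin.inject₁ i))) + t (Fin.fromℕ q))
                                                               ≈⟨ +-congˡ (+-cong (proj₂ (proj₂ middle)) last) ⟩
            y ^′ q + (fromℕ p * proj₁ middle + x ^′ q)           ≈⟨ +-comm _ _ ⟩
            (fromℕ p * proj₁ middle + x ^′ q) + y ^′ q           ≈⟨ +-assoc _ _ _ ⟩
            fromℕ p * proj₁ middle + (x ^′ q + y ^′ q)           ≈⟨ +-comm _ _ ⟩
            (x ^′ q + y ^′ q) + fromℕ p * proj₁ middle         ≡⟨ ≡.cong₂ (λ a b → (a + b) + fromℕ p * proj₁ middle) (^′≡^ x q) (^′≡^ y q) ⟩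
            (x ^ q + y ^ q) + fromℕ p * proj₁ middle           ∎

  -- R/cR with the carrier of R and a coarser equality. A series over O is thus its own reduction
  -- modulo p, and an equation over O can be reused modulo p without applying a map.
  module Quotient (R : CommutativeRing 0ℓ 0ℓ) (c : CommutativeRing.Carrier R) where

    open CommutativeRing R
    open Kit.Solver R

    infix 4 _∼_
    record _∼_ (a b : Carrier) : Set where
      constructor _,_
      field
        witness : Carrier
        eq      : a ≈ b + c * witness

    ≈⇒∼ : ∀ {a b} → a ≈ b → a ∼ b
    ≈⇒∼ e = 0# , trans e (sym (trans (+-congˡ (zeroʳ c)) (+-identityʳ _)))

    quotient : CommutativeRing 0ℓ 0ℓ
    quotient = record
      { Carrier = Carrier ; _≈_ = _∼_ ; _+_ = _+_ ; _*_ = _*_ ; -_ = -_ ; 0# = 0# ; 1# = 1#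
      ; isCommutativeRing = record
        { isRing = record
          { +-isAbelianGroup = record
            { isGroup = record
              { isMonoid = record
                { isSemigroup = record
                  { isMagma = record
                    { isEquivalence = record
                      { refl = ≈⇒∼ refl
                      ; sym = λ { {a} {b} (h , e) → - h , trans (solve 3 (λ b c h → b := (b :+ c :* h) :+ c :* (:- h)) refl b c h) (+-congʳ (sym e)) }
                      ; trans = λ { (h , e) (h′ , e′) → h + h′ , trans e (trans (+-congʳ e′) (solve 4 (λ b c h k → (b :+ c :* k) :+ c :* h := b :+ c :* (h :+ k)) refl _ c h h′)) } }
                    ; ∙-cong = λ { (h , e) (h′ , e′) → h + h′ , trans (+-cong e e′)
                        (solve 5 (λ a b c h k → (a :+ c :* h) :+ (b :+ c :* k) := (a :+ b) :+ c :* (h :+ k)) refl _ _ c h h′) } }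
                  ; assoc = λ a b d → ≈⇒∼ (+-assoc a b d) }
                ; identity = (λ a → ≈⇒∼ (+-identityˡ a)) , (λ a → ≈⇒∼ (+-identityʳ a)) }
              ; inverse = (λ a → ≈⇒∼ (-‿inverseˡ a)) , (λ a → ≈⇒∼ (-‿inverseʳ a))
              ; ⁻¹-cong = λ { (h , e) → - h , trans (-‿cong e) (solve 3 (λ b c h → :- (b :+ c :* h) := :- b :+ c :* (:- h)) refl _ c h) } }
            ; comm = λ a b → ≈⇒∼ (+-comm a b) }
          ; *-cong = λ { {_} {b} {_} {d} (h , e) (k , e′) → h * d + b * k + c * (h * k) , trans (*-cong e e′)
              (solve 5 (λ b d c h k → (b :+ c :* h) :* (d :+ c :* k) := b :* d :+ c :* (h :* d :+ b :* k :+ c :* (h :* k))) refl b d c h k) }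
          ; *-assoc = λ a b d → ≈⇒∼ (*-assoc a b d)
          ; *-identity = (λ a → ≈⇒∼ (*-identityˡ a)) , (λ a → ≈⇒∼ (*-identityʳ a))
          ; distrib = (λ a b d → ≈⇒∼ (distribˡ a b d)) , (λ a b d → ≈⇒∼ (distribʳ a b d)) }
        ; *-comm = λ a b → ≈⇒∼ (*-comm a b) } }

-- Formal power series over a commutative ring, with the Euler derivation x d/dx.

module PowerSeries where

  open RingKit
  open import Algebra.Bundles using (CommutativeRing)
  open import Level using (0ℓ)
  import Algebra.Properties.Ring
  import Algebra.Properties.CommutativeSemiring.Exp
  import Relation.Binary.Reasoning.Setoid
  open import Data.Integer as ℤ using (+_)
  open import Data.Nat as ℕ using (ℕ; zero; suc; s≤s; z≤n; NonZero)
  import Data.Nat.Properties as ℕ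
  open import Data.Product using (Σ; _×_; _,_; proj₁; proj₂)
  open import Relation.Binary.PropositionalEquality as ≡ using (_≡_)
  open import Relation.Nullary using (yes; no; ¬_)
  open import Data.Empty using (⊥-elim)

  module RawSeries {A : Set} (_+_ _*_ : A → A → A) (0# 1# : A) where

    open Raw _+_ _*_ 0# 1#

    S : Set
    S = ℕ → A

    tail : S → S
    tail f n = f (suc n)

    -- Recursion on the left factor, f g = f(0) g + x (tail f) g, instead of a sum over an
    -- antidiagonal; the product laws are inductions along it.
    conv : S → S → S
    conv f g zero    = f 0 * g 0
    conv f g (suc n) = (f 0 * g (suc n)) + conv (tail f) g n

    const : A → S
    const c zero    = c
    const c (suc n) = 0#

    X : S
    X 1 = 1#
    X _ = 0#

    shift : ℕ → S → S
    shift zero    f n       = f n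
    shift (suc k) f zero    = 0#
    shift (suc k) f (suc n) = shift k f n

    θ : S → S
    θ f n = fromℕ n * f n

    scale : A → S → S
    scale c f n = (c ^ n) * f n

  module Series (R : CommutativeRing 0ℓ 0ℓ) where

    open CommutativeRing R
    open Algebra.Properties.Ring ring using (-‿distribˡ-*; -0#≈0#)
    open Relation.Binary.Reasoning.Setoid setoid
    open Kit R using (fromℕ; fromℕ-+; _^_; module Solver)
    open RawSeries _+_ _*_ 0# 1# public
    open Solver

    infix 4 _≐_
    _≐_ : S → S → Set
    f ≐ g = ∀ n → f n ≈ g n

    conv-cong-terms : ∀ n {f g f′ g′ : S} → (∀ a b → a ℕ.+ b ≡ n → f a * g b ≈ f′ a * g′ b) → conv f g n ≈ conv f′ g′ n
    conv-cong-terms zero    h = h 0 0 ≡.refl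
    conv-cong-terms (suc n) h = +-cong (h 0 (suc n) ≡.refl) (conv-cong-terms n (λ a b e → h (suc a) b (≡.cong suc e)))

    conv-cong : ∀ {f g f′ g′} → f ≐ f′ → g ≐ g′ → conv f g ≐ conv f′ g′
    conv-cong e e′ n = conv-cong-terms n (λ a b _ → *-cong (e a) (e′ b))

    conv-zero : ∀ n {f g : S} → (∀ a b → a ℕ.+ b ≡ n → f a * g b ≈ 0#) → conv f g n ≈ 0#
    conv-zero zero    h = h 0 0 ≡.refl
    conv-zero (suc n) h = trans (+-cong (h 0 (suc n) ≡.refl) (conv-zero n (λ a b e → h (suc a) b (≡.cong suc e)))) (+-identityˡ 0#)

    conv-single : ∀ i j {f g : S} → (∀ a b → a ℕ.+ b ≡ i ℕ.+ j → ¬ a ≡ i → f a * g b ≈ 0#) → conv f g (i ℕ.+ j) ≈ f i * g j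
    conv-single zero zero    h = refl
    conv-single zero (suc j) h = trans (+-congˡ (conv-zero j (λ a b e → h (suc a) b (≡.cong suc e) (λ ())))) (+-identityʳ _)
    conv-single (suc i) j    h = trans (+-cong (h 0 _ ≡.refl (λ ()))
      (conv-single i j (λ a b e ne → h (suc a) b (≡.cong suc e) (λ q → ne (ℕ.suc-injective q))))) (+-identityˡ _)

    private
      conv-sucʳ : ∀ f g n → conv f g (suc n) ≈ conv f (tail g) n + f (suc n) * g 0
      conv-sucʳ f g zero    = refl
      conv-sucʳ f g (suc n) = trans (+-congˡ (conv-sucʳ (tail f) g n)) (sym (+-assoc _ _ _))

      conv-comm : ∀ f g → conv f g ≐ conv g f
      conv-comm f g zero    = *-comm _ _
      conv-comm f g (suc n) = begin
        f 0 * g (suc n) + conv (tail f) g n   ≈⟨ +-cong (*-comm _ _) (conv-comm (tail f) g n) ⟩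
        g (suc n) * f 0 + conv g (tail f) n   ≈⟨ +-comm _ _ ⟩
        conv g (tail f) n + g (suc n) * f 0   ≈⟨ conv-sucʳ g f n ⟨
        conv g f (suc n)                      ∎

      conv-distribʳ : ∀ h f g → conv (λ n → f n + g n) h ≐ (λ n → conv f h n + conv g h n)
      conv-distribʳ h f g zero    = distribʳ _ _ _
      conv-distribʳ h f g (suc n) = trans (+-cong (distribʳ _ _ _) (conv-distribʳ h (tail f) (tail g) n))
        (solve 4 (λ a b c d → (a :+ b) :+ (c :+ d) := (a :+ c) :+ (b :+ d)) refl _ _ _ _)

    conv-scaleˡ : ∀ c f g → conv (λ n → c * f n) g ≐ (λ n → c * conv f g n)
    conv-scaleˡ c f g zero    = *-assoc _ _ _
    conv-scaleˡ c f g (suc n) = trans (+-cong (*-assoc _ _ _) (conv-scaleˡ c (tail f) g n)) (sym (distribˡ _ _ _))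

    private
      conv-assoc : ∀ f g h → conv (conv f g) h ≐ conv f (conv g h)
      conv-assoc f g h zero    = *-assoc _ _ _
      conv-assoc f g h (suc n) = begin
        f 0 * g 0 * h (suc n) + conv (tail (conv f g)) h n
          ≈⟨ +-congˡ (conv-distribʳ h (λ n → f 0 * tail g n) (conv (tail f) g) n) ⟩
        f 0 * g 0 * h (suc n) + (conv (λ n → f 0 * tail g n) h n + conv (conv (tail f) g) h n)
          ≈⟨ +-congˡ (+-cong (conv-scaleˡ (f 0) (tail g) h n) (conv-assoc (tail f) g h n)) ⟩
        f 0 * g 0 * h (suc n) + (f 0 * conv (tail g) h n + conv (tail f) (conv g h) n)
          ≈⟨ solve 5 (λ a b c d e → a :* b :* c :+ (a :* d :+ e) := a :* (b :* c :+ d) :+ e) refl _ _ _ _ _ ⟩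
        f 0 * conv g h (suc n) + conv (tail f) (conv g h) n ∎

    conv-const : ∀ c f → conv (const c) f ≐ (λ n → c * f n)
    conv-const c f zero    = refl
    conv-const c f (suc n) = trans (+-congˡ (conv-zero n (λ _ _ _ → zeroˡ _))) (+-identityʳ _)

    infix 4 _≋_
    -- A record around `≐`, so that unification can recover both series from the type.
    record _≋_ (f g : S) : Set where
      constructor pw
      field at : f ≐ g
    open _≋_ public

    series : CommutativeRing 0ℓ 0ℓ
    series = record
      { Carrier = S
      ; _≈_ = _≋_
      ; _+_ = λ f g n → f n + g n
      ; _*_ = conv
      ; -_ = λ f n → - f n
      ; 0# = λ _ → 0#
      ; 1# = const 1#
      ; isCommutativeRing = record
        { isRing = record
          { +-isAbelianGroup = record
            { isGroup = record
              { isMonoid = record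
                { isSemigroup = record
                  { isMagma = record
                    { isEquivalence = record { refl = pw (λ n → refl) ; sym = λ e → pw (λ n → sym (at e n)) ; trans = λ e e′ → pw (λ n → trans (at e n) (at e′ n)) }
                    ; ∙-cong = λ e e′ → pw (λ n → +-cong (at e n) (at e′ n)) }
                  ; assoc = λ f g h → pw (λ n → +-assoc _ _ _) }
                ; identity = (λ f → pw (λ n → +-identityˡ _)) , (λ f → pw (λ n → +-identityʳ _)) }
              ; inverse = (λ f → pw (λ n → -‿inverseˡ _)) , (λ f → pw (λ n → -‿inverseʳ _))
              ; ⁻¹-cong = λ e → pw (λ n → -‿cong (at e n)) }
            ; comm = λ f g → pw (λ n → +-comm _ _) }
          ; *-cong = λ e e′ → pw (conv-cong (at e) (at e′))
          ; *-assoc = λ f g h → pw (conv-assoc f g h)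
          ; *-identity = (λ f → pw (λ n → trans (conv-const 1# f n) (*-identityˡ _)))
                       , (λ f → pw (λ n → trans (conv-comm f (const 1#) n) (trans (conv-const 1# f n) (*-identityˡ _))))
          ; distrib = (λ h f g → pw (λ n → trans (conv-comm h _ n) (trans (conv-distribʳ h f g n) (+-cong (conv-comm f h n) (conv-comm g h n)))))
                    , (λ h f g → pw (conv-distribʳ h f g)) }
        ; *-comm = λ f g → pw (conv-comm f g) }
      }

    shift-cong : ∀ k {f g} → f ≐ g → shift k f ≐ shift k g
    shift-cong zero    e n       = e n
    shift-cong (suc k) e zero    = refl
    shift-cong (suc k) e (suc n) = shift-cong k e n

    shift-apply : ∀ k f n → shift k f (k ℕ.+ n) ≈ f n
    shift-apply zero    f n = refl
    shift-apply (suc k) f n = shift-apply k f n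

    conv-shiftˡ : ∀ k f g → conv (shift k f) g ≐ shift k (conv f g)
    conv-shiftˡ zero    f g n       = refl
    conv-shiftˡ (suc k) f g zero    = zeroˡ _
    conv-shiftˡ (suc k) f g (suc n) = trans (+-congʳ (zeroˡ _)) (trans (+-identityˡ _) (conv-shiftˡ k f g n))

    X* : ∀ f → conv X f ≐ shift 1 f
    X* f zero = zeroˡ _
    X* f (suc n) = trans (+-cong (zeroˡ _) (conv-cong {f = tail X} {f′ = const 1#} (λ { zero → refl ; (suc n) → refl }) (λ _ → refl) n))
      (trans (+-identityˡ _) (trans (conv-const 1# f n) (*-identityˡ _)))

    θ-cong : ∀ {f g} → f ≐ g → θ f ≐ θ g
    θ-cong e n = *-congˡ (e n)

    θ-* : ∀ f g → θ (conv f g) ≐ (λ n → conv (θ f) g n + conv f (θ g) n)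
    θ-* f g zero = solve 2 (λ a b → con (+ 0) :* (a :* b) := (con (+ 0) :* a) :* b :+ a :* (con (+ 0) :* b)) refl _ _
    θ-* f g (suc n) = begin
      fromℕ (suc n) * (f 0 * g (suc n) + conv (tail f) g n)
        ≈⟨ solve 4 (λ m f g c → (con (+ 1) :+ m) :* (f :* g :+ c) := con (+ 0) :* f :* g :+ (f :* ((con (+ 1) :+ m) :* g) :+ (c :+ m :* c))) refl _ _ _ _ ⟩
      fromℕ 0 * f 0 * g (suc n) + (f 0 * (fromℕ (suc n) * g (suc n)) + (conv (tail f) g n + θ (conv (tail f) g) n))
        ≈⟨ +-congˡ (+-congˡ (+-congˡ (θ-* (tail f) g n))) ⟩
      fromℕ 0 * f 0 * g (suc n) + (f 0 * θ g (suc n) + (conv (tail f) g n + (conv (θ (tail f)) g n + conv (tail f) (θ g) n)))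
        ≈⟨ solve 5 (λ a b c d e → a :+ (b :+ (c :+ (d :+ e))) := (a :+ (c :+ d)) :+ (b :+ e)) refl _ _ _ _ _ ⟩
      (fromℕ 0 * f 0 * g (suc n) + (conv (tail f) g n + conv (θ (tail f)) g n)) + conv f (θ g) (suc n)
        ≈⟨ +-congʳ (+-congˡ (conv-distribʳ g (tail f) (θ (tail f)) n)) ⟨
      (fromℕ 0 * f 0 * g (suc n) + conv (λ n → tail f n + θ (tail f) n) g n) + conv f (θ g) (suc n)
        ≈⟨ +-congʳ (+-congˡ (conv-cong (λ n → solve 2 (λ m c → c :+ m :* c := (con (+ 1) :+ m) :* c) refl _ _) (λ _ → refl) n)) ⟩
      conv (θ f) g (suc n) + conv f (θ g) (suc n) ∎

    θ-+ : ∀ f g → θ (λ n → f n + g n) ≐ (λ n → θ f n + θ g n)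
    θ-+ f g n = distribˡ _ _ _

    θ-const : ∀ c → θ (const c) ≐ (λ _ → 0#)
    θ-const c zero    = zeroˡ _
    θ-const c (suc n) = zeroʳ _

    scale-cong : ∀ c {f g} → f ≐ g → scale c f ≐ scale c g
    scale-cong c e n = *-congˡ (e n)

    scale-θ : ∀ c f → scale c (θ f) ≐ θ (scale c f)
    scale-θ c f n = solve 3 (λ a b c → a :* (b :* c) := b :* (a :* c)) refl _ _ _

    scale-* : ∀ c f g → scale c (conv f g) ≐ conv (scale c f) (scale c g)
    scale-* c f g zero    = solve 2 (λ a b → con (+ 1) :* (a :* b) := (con (+ 1) :* a) :* (con (+ 1) :* b)) refl _ _
    scale-* c f g (suc n) = begin
      c ^ suc n * (f 0 * g (suc n) + conv (tail f) g n)
        ≈⟨ solve 5 (λ c d f g h → (c :* d) :* (f :* g :+ h) := (con (+ 1) :* f) :* ((c :* d) :* g) :+ c :* (d :* h)) refl _ _ _ _ _ ⟩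
      (1# * f 0) * (c ^ suc n * g (suc n)) + c * scale c (conv (tail f) g) n
        ≈⟨ +-congˡ (*-congˡ (scale-* c (tail f) g n)) ⟩
      (1# * f 0) * (c ^ suc n * g (suc n)) + c * conv (scale c (tail f)) (scale c g) n
        ≈⟨ +-congˡ (conv-scaleˡ c (scale c (tail f)) (scale c g) n) ⟨
      (1# * f 0) * (c ^ suc n * g (suc n)) + conv (λ n → c * scale c (tail f) n) (scale c g) n
        ≈⟨ +-congˡ (conv-cong (λ n → sym (*-assoc c _ _)) (λ _ → refl) n) ⟩
      conv (scale c f) (scale c g) (suc n) ∎

-- Divisibility in ℤ, and the p-adic integers as coherent sequences.

module Padic where

  open RingKit
  open import Algebra.Bundles using (CommutativeRing)
  open import Level using (0ℓ)
  open import Data.Nat as ℕ using (ℕ; zero; suc; NonZero)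
  import Data.Nat.Properties as ℕ
  import Data.Nat.Divisibility as ℕ
  open import Data.Nat.GCD using (module Bézout)
  open import Data.Nat.Coprimality as Coprime using (Coprime)
  open import Data.Nat.Primality using (Prime; euclidsLemma; prime⇒nonZero; prime⇒irreducible; ¬prime[1])
  open import Data.Integer as ℤ using (ℤ; +_; -[1+_]; _+_; _*_; -_; _-_)
  import Data.Integer.Properties as ℤ
  import Data.Integer.DivMod as ℤ
  open import Data.Integer.Divisibility.Signed
  open import Data.Integer.Solver using (module +-*-Solver)
  open import Data.Product using (Σ; _×_; _,_; proj₁; proj₂; ∃)
  open import Data.Sum as Sum using (_⊎_; inj₁; inj₂)
  open import Relation.Binary.PropositionalEquality as ≡ using (_≡_; refl; sym; trans; cong; cong₂; subst)
  open import Relation.Nullary using (Dec; yes; no; ¬_)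
  import Relation.Nullary.Decidable as Dec
  open import Data.Empty using (⊥; ⊥-elim)
  open +-*-Solver using (solve; _:=_; _:+_; _:*_; _:-_; :-_; con)

  bezout : ∀ {u m} → Coprime u m → ∃ λ v → + m ∣ v * + u - + 1
  bezout {u} {m} c with Coprime.coprime-Bézout c
  ... | Bézout.+- x y eq = + x , divides (+ y) (begin
      + x * + u - + 1               ≡⟨ cong (_- + 1) (ℤ.pos-* x u) ⟨
      + (x ℕ.* u) - + 1             ≡⟨ cong (λ z → + z - + 1) eq ⟨
      + (1 ℕ.+ y ℕ.* m) - + 1       ≡⟨ cong (_- + 1) (trans (ℤ.pos-+ 1 (y ℕ.* m)) (cong (λ z → + 1 + z) (ℤ.pos-* y m))) ⟩
      (+ 1 + + y * + m) - + 1       ≡⟨ solve 1 (λ a → (con (+ 1) :+ a) :- con (+ 1) := a) refl (+ y * + m) ⟩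
      + y * + m                     ∎)
    where open ≡.≡-Reasoning
  ... | Bézout.-+ x y eq = - + x , divides (- + y) (begin
      - + x * + u - + 1             ≡⟨ solve 2 (λ x u → :- x :* u :- con (+ 1) := :- (con (+ 1) :+ x :* u)) refl (+ x) (+ u) ⟩
      - (+ 1 + + x * + u)           ≡⟨ cong (λ z → - (+ 1 + z)) (ℤ.pos-* x u) ⟨
      - (+ 1 + + (x ℕ.* u))         ≡⟨ cong -_ (ℤ.pos-+ 1 (x ℕ.* u)) ⟨
      - + (1 ℕ.+ x ℕ.* u)           ≡⟨ cong (λ z → - + z) eq ⟩
      - + (y ℕ.* m)                 ≡⟨ cong -_ (ℤ.pos-* y m) ⟩
      - (+ y * + m)                 ≡⟨ ℤ.neg-distribˡ-* (+ y) (+ m) ⟩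
      - + y * + m                   ∎)
    where open ≡.≡-Reasoning

  coprime-cancel : ∀ {u m} → Coprime u m → ∀ a → + m ∣ a * + u → + m ∣ a
  coprime-cancel {u} {m} c a d with bezout c
  ... | v , e = subst (λ z → + m ∣ z) (solve 3 (λ a u v → v :* (a :* u) :- a :* (v :* u :- con (+ 1)) := a) refl a (+ u) v)
                  (∣m∣n⇒∣m-n (∣n⇒∣m*n v d) (∣n⇒∣m*n a e))

  prime-coprime : ∀ {p u} → Prime p → ¬ p ℕ.∣ u → Coprime u p
  prime-coprime pr ¬d (d₁ , d₂) with prime⇒irreducible pr d₂
  ... | inj₁ e = e
  ... | inj₂ refl = ⊥-elim (¬d d₁)

  coprime-^ : ∀ {u m} n → Coprime u m → Coprime u (m ℕ.^ n)
  coprime-^ zero    c (_ , d) = ℕ.∣1⇒≡1 d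
  coprime-^ {u} {m} (suc n) c {d} (d₁ , d₂) = coprime-^ n c
    (d₁ , Coprime.coprime-divisor (λ (e₁ , e₂) → c (ℕ.∣-trans e₁ d₁ , e₂)) d₂)

  euclid : ∀ {p} → Prime p → ∀ a b → + p ∣ a * b → + p ∣ a ⊎ + p ∣ b
  euclid {p} pr a b d with euclidsLemma ℤ.∣ a ∣ ℤ.∣ b ∣ pr (subst (p ℕ.∣_) (ℤ.abs-* a b) (∣⇒∣ᵤ d))
  ... | inj₁ x = inj₁ (∣ᵤ⇒∣ x)
  ... | inj₂ y = inj₂ (∣ᵤ⇒∣ y)

  ∣-resp : ∀ {m a b} → a ≡ b → m ∣ a → m ∣ b
  ∣-resp refl d = d

  -- Write a = b + h. Then a^p - b^p = p b^(p-1) h + h^2 w, and if p^(n+1) divides h, both summands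
  -- are divisible by p^(n+2).
  power-lift : ∀ p n a b → + (p ℕ.^ suc n) ∣ a - b → + (p ℕ.^ suc (suc n)) ∣ a ℤ.^ p - b ℤ.^ p
  power-lift p n a b (divides t e) = ∣-resp (sym eq) (∣m∣n⇒∣m+n
      (divides (t * b ℤ.^ (p ℕ.∸ 1)) (trans (solve 4 (λ p b t m → p :* b :* (t :* m) := t :* b :* (p :* m)) refl (+ p) (b ℤ.^ (p ℕ.∸ 1)) t (+ m))
        (cong (t * b ℤ.^ (p ℕ.∸ 1) *_) (sym (ℤ.pos-* p m)))))
      (divides (t * t * w * + (p ℕ.^ n)) (trans (via (solve 4 (λ t w p q → t :* (p :* q) :* (t :* (p :* q)) :* w := t :* t :* w :* q :* (p :* (p :* q))) refl t w (+ p) (+ (p ℕ.^ n))))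
         (cong (t * t * w * + (p ℕ.^ n) *_) (trans (cong (λ z → + p * z) (sym (ℤ.pos-* p (p ℕ.^ n)))) (sym (ℤ.pos-* p m)))))))
    where
    m = p ℕ.^ suc n
    h = t * + m

    expand : ∀ k b h → ∃ λ w → (b + h) ℤ.^ k ≡ b ℤ.^ k + + k * b ℤ.^ (k ℕ.∸ 1) * h + h * h * w
    expand zero b h = + 0 , solve 2 (λ b h → con (+ 1) := con (+ 1) :+ con (+ 0) :* con (+ 1) :* h :+ h :* h :* con (+ 0)) refl b h
    expand (suc zero) b h = + 0 , solve 2 (λ b h → (b :+ h) :* con (+ 1) := b :* con (+ 1) :+ con (+ 1) :* con (+ 1) :* h :+ h :* h :* con (+ 0)) refl b h
    expand (suc (suc k)) b h with expand (suc k) b h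
    ... | w , e = _ , trans (cong ((b + h) *_) e)
      (solve 5 (λ b h q k w → (b :+ h) :* (b :* q :+ k :* q :* h :+ h :* h :* w) :=
         b :* (b :* q) :+ (con (+ 1) :+ k) :* (b :* q) :* h :+ h :* h :* (k :* q :+ (b :+ h) :* w)) refl b h (b ℤ.^ k) (+ suc k) w)

    w = proj₁ (expand p b h)

    a≡ : a ≡ b + h
    a≡ = trans (solve 2 (λ a b → a := b :+ (a :- b)) refl a b) (cong (λ z → b + z) e)

    eq : a ℤ.^ p - b ℤ.^ p ≡ + p * b ℤ.^ (p ℕ.∸ 1) * h + h * h * w
    eq = trans (cong (λ z → z ℤ.^ p - b ℤ.^ p) a≡) (trans (cong (_- b ℤ.^ p) (proj₂ (expand p b h)))
      (solve 3 (λ b x y → b :+ x :+ y :- b := x :+ y) refl (b ℤ.^ p) _ _))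

    via : ∀ {z} → t * (+ p * + (p ℕ.^ n)) * (t * (+ p * + (p ℕ.^ n))) * w ≡ z → h * h * w ≡ z
    via q = trans (cong (λ z → t * z * (t * z) * w) (ℤ.pos-* p (p ℕ.^ n))) q

  module Zp (p : ℕ) (pr : Prime p) where

    private instance
      p≢0 : NonZero p
      p≢0 = prime⇒nonZero pr


    pw : ℕ → ℤ
    pw n = + (p ℕ.^ n)

    pw-+ : ∀ m n → pw (m ℕ.+ n) ≡ pw m * pw n
    pw-+ m n = trans (cong +_ (ℕ.^-distribˡ-+-* p m n)) (ℤ.pos-* (p ℕ.^ m) (p ℕ.^ n))

    pw-∣ : ∀ {m n} → m ℕ.≤ n → pw m ∣ pw n
    pw-∣ {m} {n} m≤n = divides (pw (n ℕ.∸ m)) (trans (cong pw (sym (ℕ.m∸n+n≡m m≤n))) (pw-+ (n ℕ.∸ m) m))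

    -- Entry n counts only modulo p^n; equality compares entries n modulo p^n, so no normal form is
    -- chosen.
    record Z : Set where
      constructor mkZ
      field
        seq : ℕ → ℤ
        coherent : ∀ n → pw n ∣ seq (suc n) - seq n

    open Z public

    infix 4 _≈_
    record _≈_ (a b : Z) : Set where
      constructor mk≈
      field at : ∀ n → pw n ∣ seq a n - seq b n
    open _≈_ public

    coherent-+ : ∀ a n k → pw n ∣ seq a (k ℕ.+ n) - seq a n
    coherent-+ a n zero    = divides (+ 0) (ℤ.+-inverseʳ (seq a n))
    coherent-+ a n (suc k) = ∣-resp (solve 3 (λ x y z → (x :- y) :+ (y :- z) := x :- z) refl (seq a (suc k ℕ.+ n)) (seq a (k ℕ.+ n)) (seq a n))
      (∣m∣n⇒∣m+n (∣-trans (pw-∣ (ℕ.m≤n+m n k)) (coherent a (k ℕ.+ n))) (coherent-+ a n k))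

    private
      pointwise : ∀ {a b : Z} → (∀ n → seq a n ≡ seq b n) → a ≈ b
      pointwise {a} {b} h .at n = divides (+ 0) (trans (cong (_- seq b n) (h n)) (ℤ.+-inverseʳ (seq b n)))

    infixl 6 _⊕_
    infixl 7 _⊗_

    _⊕_ _⊗_ : Z → Z → Z
    seq (a ⊕ b) n = seq a n + seq b n
    coherent (a ⊕ b) n = ∣-resp (solve 4 (λ a b c d → (a :- b) :+ (c :- d) := (a :+ c) :- (b :+ d)) refl (seq a (suc n)) (seq a n) (seq b (suc n)) (seq b n))
      (∣m∣n⇒∣m+n (coherent a n) (coherent b n))
    seq (a ⊗ b) n = seq a n * seq b n
    coherent (a ⊗ b) n = ∣-resp (solve 4 (λ a b c d → (a :- b) :* c :+ b :* (c :- d) := (a :* c) :- (b :* d)) refl (seq a (suc n)) (seq a n) (seq b (suc n)) (seq b n))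
      (∣m∣n⇒∣m+n (∣m⇒∣m*n _ (coherent a n)) (∣n⇒∣m*n (seq a n) (coherent b n)))

    ⊖_ : Z → Z
    seq (⊖ a) n = - seq a n
    coherent (⊖ a) n = ∣-resp (solve 2 (λ a b → :- (a :- b) := :- a :- :- b) refl (seq a (suc n)) (seq a n)) (∣m⇒∣-m (coherent a n))

    constant : ℤ → Z
    seq (constant z) n = z
    coherent (constant z) n = divides (+ 0) (ℤ.+-inverseʳ z)

    ring : CommutativeRing 0ℓ 0ℓ
    ring = record
      { Carrier = Z ; _≈_ = _≈_ ; _+_ = _⊕_ ; _*_ = _⊗_ ; -_ = ⊖_ ; 0# = constant (+ 0) ; 1# = constant (+ 1)
      ; isCommutativeRing = record
        { isRing = record
          { +-isAbelianGroup = record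
            { isGroup = record
              { isMonoid = record
                { isSemigroup = record
                  { isMagma = record
                    { isEquivalence = record
                      { refl = pointwise (λ _ → refl)
                      ; sym = λ {a} {b} e → mk≈ λ n → ∣-resp (solve 2 (λ a b → :- (a :- b) := b :- a) refl (seq a n) (seq b n)) (∣m⇒∣-m (at e n))
                      ; trans = λ {a} {b} {c} e e′ → mk≈ λ n → ∣-resp (solve 3 (λ a b c → (a :- b) :+ (b :- c) := a :- c) refl (seq a n) (seq b n) (seq c n)) (∣m∣n⇒∣m+n (at e n) (at e′ n)) }
                    ; ∙-cong = λ {a} {b} {c} {d} e e′ → mk≈ λ n → ∣-resp (solve 4 (λ a b c d → (a :- b) :+ (c :- d) := (a :+ c) :- (b :+ d)) refl (seq a n) (seq b n) (seq c n) (seq d n))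
                        (∣m∣n⇒∣m+n (at e n) (at e′ n)) }
                  ; assoc = λ a b c → pointwise (λ n → ℤ.+-assoc (seq a n) (seq b n) (seq c n)) }
                ; identity = (λ a → pointwise (λ n → ℤ.+-identityˡ _)) , (λ a → pointwise (λ n → ℤ.+-identityʳ _)) }
              ; inverse = (λ a → pointwise (λ n → ℤ.+-inverseˡ (seq a n))) , (λ a → pointwise (λ n → ℤ.+-inverseʳ (seq a n)))
              ; ⁻¹-cong = λ {a} {b} e → mk≈ λ n → ∣-resp (solve 2 (λ a b → :- (a :- b) := :- a :- :- b) refl (seq a n) (seq b n)) (∣m⇒∣-m (at e n)) }
            ; comm = λ a b → pointwise (λ n → ℤ.+-comm (seq a n) (seq b n)) }
          ; *-cong = λ {a} {b} {c} {d} e e′ → mk≈ λ n → ∣-resp (solve 4 (λ a b c d → (a :- b) :* c :+ b :* (c :- d) := (a :* c) :- (b :* d)) refl (seq a n) (seq b n) (seq c n) (seq d n))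
              (∣m∣n⇒∣m+n (∣m⇒∣m*n _ (at e n)) (∣n⇒∣m*n (seq b n) (at e′ n)))
          ; *-assoc = λ a b c → pointwise (λ n → ℤ.*-assoc (seq a n) (seq b n) (seq c n))
          ; *-identity = (λ a → pointwise (λ n → ℤ.*-identityˡ _)) , (λ a → pointwise (λ n → ℤ.*-identityʳ _))
          ; distrib = (λ a b c → pointwise (λ n → ℤ.*-distribˡ-+ (seq a n) (seq b n) (seq c n))) , (λ a b c → pointwise (λ n → ℤ.*-distribʳ-+ (seq a n) (seq b n) (seq c n))) }
        ; *-comm = λ a b → pointwise (λ n → ℤ.*-comm (seq a n) (seq b n)) } }

    open Kit ring using (fromℕ; fromℤ; _^_)

    seq-fromℕ : ∀ m n → seq (fromℕ m) n ≡ + m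
    seq-fromℕ zero    n = refl
    seq-fromℕ (suc m) n = cong (λ z → + 1 + z) (seq-fromℕ m n)

    constant≈fromℤ : ∀ z → constant z ≈ fromℤ z
    constant≈fromℤ (+ m)    = pointwise (λ n → sym (seq-fromℕ m n))
    constant≈fromℤ -[1+ m ] = pointwise (λ n → cong -_ (sym (seq-fromℕ (suc m) n)))

    -- The quotient has as entry n the entry k + n of `a` divided by p^k: the index advances by k
    -- because the division costs k digits of precision.
    ∣seq⇒∣ : ∀ k a → pw k ∣ seq a k → ∃ λ h → a ≈ fromℕ (p ℕ.^ k) ⊗ h
    ∣seq⇒∣ k a d = h , mk≈ λ n → ∣-resp (solve 2 (λ x y → :- (x :- y) := y :- x) refl (seq a (k ℕ.+ n)) (seq a n)) (∣m⇒∣-m (coherent-+ a n k))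
        ⟨ trans-eq n ⟩
      where
      d′ : ∀ n → pw k ∣ seq a (k ℕ.+ n)
      d′ n = ∣-resp (solve 2 (λ x y → (x :- y) :+ y := x) refl (seq a (k ℕ.+ n)) (seq a k))
        (∣m∣n⇒∣m+n (subst (λ m → pw k ∣ seq a m - seq a k) (ℕ.+-comm n k) (coherent-+ a k n)) d)

      q : ∀ n → seq a (k ℕ.+ n) ≡ pw k * _∣_.quotient (d′ n)
      q n = trans (_∣_.equality (d′ n)) (ℤ.*-comm _ (pw k))

      h : Z
      seq h n = _∣_.quotient (d′ n)
      coherent h n = *-cancelˡ-∣ (pw k) {{ℕ.m^n≢0 p k}} (∣-resp (trans (cong₂ _-_ (trans (cong (seq a) (sym (ℕ.+-suc k n))) (q (suc n))) (q n))
          (solve 3 (λ c x y → c :* x :- c :* y := c :* (x :- y)) refl (pw k) (seq h (suc n)) (seq h n))) (∣-resp′ (pw-+ k n) (coherent a (k ℕ.+ n))))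
        where
        ∣-resp′ : ∀ {x y z} → x ≡ y → x ∣ z → y ∣ z
        ∣-resp′ refl d = d

      infixl 1 _⟨_⟩
      _⟨_⟩ : ∀ {n} → pw n ∣ seq a n - seq a (k ℕ.+ n) → seq a (k ℕ.+ n) ≡ seq (fromℕ (p ℕ.^ k) ⊗ h) n → pw n ∣ seq a n - seq (fromℕ (p ℕ.^ k) ⊗ h) n
      _⟨_⟩ {n} d e = ∣-resp (cong (λ z → seq a n - z) e) d

      trans-eq : ∀ n → seq a (k ℕ.+ n) ≡ seq (fromℕ (p ℕ.^ k) ⊗ h) n
      trans-eq n = trans (q n) (cong (_* seq h n) (sym (seq-fromℕ (p ℕ.^ k) n)))

    ∣⇒∣seq : ∀ k a h → a ≈ fromℕ (p ℕ.^ k) ⊗ h → pw k ∣ seq a k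
    ∣⇒∣seq k a h e = ∣-resp (solve 2 (λ x y → (x :- y) :+ y := x) refl (seq a k) (seq (fromℕ (p ℕ.^ k) ⊗ h) k))
      (∣m∣n⇒∣m+n (at e k) (∣m⇒∣m*n (seq h k) (divides (+ 1) (trans (seq-fromℕ (p ℕ.^ k) k) (sym (ℤ.*-identityˡ _))))))

    separated : ∀ a → (∀ k → ∃ λ h → a ≈ fromℕ (p ℕ.^ k) ⊗ h) → a ≈ constant (+ 0)
    separated a d = mk≈ λ n → ∣-resp (sym (ℤ.+-identityʳ (seq a n))) (∣⇒∣seq n a (proj₁ (d n)) (proj₂ (d n)))

    approximate : ∀ a k → ∃ λ b → ∃ λ h → a ≈ fromℕ b ⊕ fromℕ (p ℕ.^ k) ⊗ h
    approximate a k = b , proj₁ r , mk≈ λ n → ∣-resp (solve 3 (λ x y z → (x :- y) :- z := x :- (y :+ z)) refl (seq a n) (seq (fromℕ b) n) (seq (fromℕ (p ℕ.^ k) ⊗ proj₁ r) n)) (at (proj₂ r) n)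
      where
      instance
        p^k≢0 : NonZero (p ℕ.^ k)
        p^k≢0 = ℕ.m^n≢0 p k
      b = seq a k ℤ.%ℕ (p ℕ.^ k)
      r = ∣seq⇒∣ k (a ⊕ ⊖ fromℕ b) (divides (seq a k ℤ./ℕ (p ℕ.^ k)) (trans (cong (λ z → seq a k - z) (seq-fromℕ b k))
           (trans (cong (_- + b) (ℤ.a≡a%ℕn+[a/ℕn]*n (seq a k) (p ℕ.^ k))) (solve 2 (λ x y → x :+ y :- x := y) refl (+ b) (seq a k ℤ./ℕ (p ℕ.^ k) * pw k)))))

    -- p^(n+1) divides p times entry n + 1, so p^n divides entry n + 1, which agrees with entry n
    -- modulo p^n. The digit lost by dividing is regained by going one level up.
    torsion-free : ∀ a → fromℕ p ⊗ a ≈ constant (+ 0) → a ≈ constant (+ 0)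
    torsion-free a e = mk≈ λ n → ∣-resp (solve 2 (λ x y → y :- (y :- x) := x :- con (+ 0)) refl (seq a n) (seq a (suc n)))
      (∣m∣n⇒∣m-n (*-cancelˡ-∣ (+ p) (∣-resp (trans (ℤ.+-identityʳ (seq (fromℕ p ⊗ a) (suc n))) (cong (_* seq a (suc n)) (seq-fromℕ p (suc n))))
        (subst (_∣ seq (fromℕ p ⊗ a) (suc n) - + 0) (ℤ.pos-* p (p ℕ.^ n)) (at e (suc n))))) (coherent a n))

    ∣seq⇒p∣ : ∀ a → + p ∣ seq a 1 → ∃ λ h → a ≈ fromℕ p ⊗ h
    ∣seq⇒p∣ a d = go (p ℕ.^ 1) (ℕ.*-identityʳ p) (∣seq⇒∣ 1 a (subst (_∣ seq a 1) (cong +_ (sym (ℕ.*-identityʳ p))) d))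
      where
      go : ∀ m → m ≡ p → (∃ λ h → a ≈ fromℕ m ⊗ h) → ∃ λ h → a ≈ fromℕ p ⊗ h
      go m refl d = d

    p∣⇒∣seq : ∀ a → (∃ λ h → a ≈ fromℕ p ⊗ h) → + p ∣ seq a 1
    p∣⇒∣seq a (h , e) = ∣-resp (solve 2 (λ x y → (x :- y) :+ y := x) refl (seq a 1) (seq (fromℕ p ⊗ h) 1))
      (∣m∣n⇒∣m+n (∣-trans (divides (+ 1) (trans (cong +_ (ℕ.*-identityʳ p)) (sym (ℤ.*-identityˡ (+ p))))) (at e 1))
        (∣m⇒∣m*n (seq h 1) (divides (+ 1) (trans (seq-fromℕ p 1) (sym (ℤ.*-identityˡ (+ p)))))))

    euclid-Z : ∀ a b → (∃ λ h → a ⊗ b ≈ fromℕ p ⊗ h) → (∃ λ h → a ≈ fromℕ p ⊗ h) ⊎ (∃ λ h → b ≈ fromℕ p ⊗ h)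
    euclid-Z a b d = Sum.map (∣seq⇒p∣ a) (∣seq⇒p∣ b) (euclid pr (seq a 1) (seq b 1) (p∣⇒∣seq (a ⊗ b) d))

    p∣? : ∀ a → Dec (∃ λ h → a ≈ fromℕ p ⊗ h)
    p∣? a = Dec.map′ (∣seq⇒p∣ a) (p∣⇒∣seq a) ((+ p) ∣? (seq a 1))

    ∣fromℕ : ∀ k m → (∃ λ h → fromℕ m ≈ fromℕ (p ℕ.^ k) ⊗ h) → p ℕ.^ k ℕ.∣ m
    ∣fromℕ k m (h , e) = ∣⇒∣ᵤ (subst (pw k ∣_) (seq-fromℕ m k) (∣⇒∣seq k (fromℕ m) h e))

    -- Bézout inverts u modulo each p^n. Two inverses agree modulo p^n because u can be cancelled
    -- there, and this is the coherence.
    inverse : ∀ u → ¬ p ℕ.∣ u → ∃ λ v → fromℕ u ⊗ v ≈ constant (+ 1)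
    inverse u ¬d = v , mk≈ λ n → ∣-resp (cong (_- + 1) (trans (ℤ.*-comm (seq v n) (+ u)) (cong (_* seq v n) (sym (seq-fromℕ u n))))) (proj₂ (b n))
      where
      c : ∀ n → Coprime u (p ℕ.^ n)
      c n = coprime-^ n (prime-coprime pr ¬d)

      b : ∀ n → ∃ λ v → pw n ∣ v * + u - + 1
      b n = bezout (c n)

      v : Z
      seq v n = proj₁ (b n)
      coherent v n = coprime-cancel (c n) (seq v (suc n) - seq v n) (∣-resp (solve 3 (λ x y u → (x :* u :- con (+ 1)) :- (y :* u :- con (+ 1)) := (x :- y) :* u) refl (proj₁ (b (suc n))) (proj₁ (b n)) (+ u))
        (∣m∣n⇒∣m-n (∣-trans (pw-∣ (ℕ.n≤1+n n)) (proj₂ (b (suc n)))) (proj₂ (b n))))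

    module Teichmüller (fermat : ∀ c → + p ∣ c ℤ.^ p - c) where

      private
        iterate : ∀ (c : ℤ) n → c ℤ.^ (p ℕ.^ suc n) ≡ (c ℤ.^ (p ℕ.^ n)) ℤ.^ p
        iterate c n = trans (cong (c ℤ.^_) (ℕ.*-comm p (p ℕ.^ n))) (sym (ℤ.^-*-assoc c (p ℕ.^ n) p))

        step : ∀ c n → pw (suc n) ∣ c ℤ.^ (p ℕ.^ suc n) - c ℤ.^ (p ℕ.^ n)
        step c zero    = subst₂ (λ m z → + m ∣ z) (sym (ℕ.*-identityʳ p))
          (cong₂ _-_ (cong (c ℤ.^_) (sym (ℕ.*-identityʳ p))) (sym (ℤ.*-identityʳ c))) (fermat c)
          where open ≡ using (subst₂)
        step c (suc n) = subst (pw (suc (suc n)) ∣_) (cong₂ _-_ (sym (iterate c (suc n))) (sym (iterate c n)))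
          (power-lift p n _ _ (step c n))

        lift : ∀ c d → + p ∣ c - d → ∀ n → pw (suc n) ∣ c ℤ.^ (p ℕ.^ n) - d ℤ.^ (p ℕ.^ n)
        lift c d e zero    = subst₂ (λ m z → + m ∣ z) (sym (ℕ.*-identityʳ p)) (cong₂ _-_ (sym (ℤ.*-identityʳ c)) (sym (ℤ.*-identityʳ d))) e
          where open ≡ using (subst₂)
        lift c d e (suc n) = subst (pw (suc (suc n)) ∣_) (cong₂ _-_ (sym (iterate c n)) (sym (iterate d n))) (power-lift p n _ _ (lift c d e n))

      -- The limit of c^(p^n). Fermat is the congruence at the first level, and each further p-th
      -- power gains one power of p by `power-lift`.
      teich : ℤ → Z
      seq (teich c) n = c ℤ.^ (p ℕ.^ n)
      coherent (teich c) n = ∣-trans (pw-∣ (ℕ.n≤1+n n)) (step c n)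

      teich-* : ∀ c d → teich (c * d) ≈ teich c ⊗ teich d
      teich-* c d = pointwise (λ n → ^-distrib (p ℕ.^ n))
        where
        ^-distrib : ∀ n → (c * d) ℤ.^ n ≡ c ℤ.^ n * d ℤ.^ n
        ^-distrib zero    = refl
        ^-distrib (suc n) = trans (cong (c * d *_) (^-distrib n))
          (solve 4 (λ c d x y → c :* d :* (x :* y) := c :* x :* (d :* y)) refl c d (c ℤ.^ n) (d ℤ.^ n))

      teich-1 : teich (+ 1) ≈ constant (+ 1)
      teich-1 = pointwise (λ n → ℤ.^-zeroˡ (p ℕ.^ n))

      teich-cong : ∀ c d → + p ∣ c - d → teich c ≈ teich d
      teich-cong c d e = mk≈ λ n → ∣-trans (pw-∣ (ℕ.n≤1+n n)) (lift c d e n)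

      teich-reduce : ∀ c → ∃ λ h → teich c ⊕ ⊖ fromℤ c ≈ fromℕ p ⊗ h
      teich-reduce c = ∣seq⇒p∣ (teich c ⊕ ⊖ fromℤ c) (subst (λ z → + p ∣ c ℤ.^ (p ℕ.^ 1) - z) (seq-fromℤ c)
          (subst (λ k → + p ∣ c ℤ.^ k - c) (sym (ℕ.*-identityʳ p)) (fermat c)))
        where
        seq-fromℤ : ∀ c → c ≡ seq (fromℤ c) 1
        seq-fromℤ (+ m)    = sym (seq-fromℕ m 1)
        seq-fromℤ -[1+ m ] = cong -_ (sym (seq-fromℕ (suc m) 1))

      teich-^ : ∀ c n → teich c ^ n ≈ teich (c ℤ.^ n)
      teich-^ c zero    = CommutativeRing.sym ring teich-1
      teich-^ c (suc n) = CommutativeRing.trans ring (CommutativeRing.*-congˡ ring {teich c} (teich-^ c n)) (CommutativeRing.sym ring (teich-* c (c ℤ.^ n)))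

      teich-frobenius : ∀ c → teich c ^ p ≈ teich c
      teich-frobenius c = CommutativeRing.trans ring (teich-^ c p) (teich-cong (c ℤ.^ p) c (fermat c))

-- The interface to the p-adic integers.

module PadicRing where

  open RingKit
  open Padic
  open import Algebra.Bundles using (CommutativeRing)
  open import Level using (0ℓ)
  open import Data.Nat as ℕ using (ℕ; zero; suc; NonZero)
  import Data.Nat.Properties as ℕ
  import Data.Nat.Divisibility as ℕ
  open import Data.Nat.Primality using (Prime; prime⇒nonZero)
  open import Data.Integer as ℤ using (ℤ; +_; -[1+_])
  import Data.Integer.Properties as ℤ
  open import Data.Integer.Divisibility.Signed as ℤ using (_∣_; divides; ∣m∣n⇒∣m+n; ∣m∣n⇒∣m-n)
  open import Data.Integer.Solver using (module +-*-Solver)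
  open import Data.Product using (Σ; _×_; _,_; proj₁; proj₂; ∃)
  open import Data.Sum as Sum using (_⊎_; inj₁; inj₂)
  open import Data.Unit using (⊤; tt)
  open import Relation.Binary.PropositionalEquality as ≡ using (_≡_)
  open import Relation.Nullary using (Dec; yes; no; ¬_)

  -- All that the sequel uses of O; coherent sequences are not looked at again. `separated`,
  -- `approximate` and `Div-fromℕ` say that O is p-adically separated, that ℕ is dense in it, and
  -- that p^k O meets ℕ in p^k ℕ.
  record PadicIntegers (p : ℕ) : Set₁ where
    field
      ring : CommutativeRing 0ℓ 0ℓ
    open CommutativeRing ring using (Carrier; _≈_; _+_; _*_; _-_; 0#; 1#)
    open Kit ring using (fromℕ; fromℤ; _^_)
    Div : ℕ → Carrier → Set
    Div m a = ∃ λ h → a ≈ fromℕ m * h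
    field
      torsion-free : ∀ a → fromℕ p * a ≈ 0# → a ≈ 0#
      p-prime      : ∀ a b → Div p (a * b) → Div p a ⊎ Div p b
      p∣?          : ∀ a → Dec (Div p a)
      separated    : ∀ a → (∀ k → Div (p ℕ.^ k) a) → a ≈ 0#
      approximate  : ∀ a k → ∃ λ b → ∃ λ h → a ≈ fromℕ b + fromℕ (p ℕ.^ k) * h
      Div-fromℕ    : ∀ k m → Div (p ℕ.^ k) (fromℕ m) → p ℕ.^ k ℕ.∣ m
      inverse      : ∀ u → ¬ p ℕ.∣ u → ∃ λ v → fromℕ u * v ≈ 1#
      teich        : ℕ → Carrier
      teich-*      : ∀ c d → teich (c ℕ.* d) ≈ teich c * teich d
      teich-1      : teich 1 ≈ 1#
      teich-cong   : ∀ c d → + p ∣ + c ℤ.- + d → teich c ≈ teich d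
      teich-reduce : ∀ c → Div p (teich c - fromℕ c)
      teich-^p     : ∀ c → teich c ^ p ≈ teich c

  -- Induction from 0 in both directions: by the freshman's dream c^p - c changes by a multiple of p
  -- between c and c + 1.
  fermat : ∀ {p} → Prime p → ∀ c → + p ∣ c ℤ.^ p ℤ.- c
  fermat {p} pr = go
    where
    open Frobenius ℤ.+-*-commutativeRing pr
    open Kit ℤ.+-*-commutativeRing
    open +-*-Solver using (solve; _:=_; _:+_; _:*_; _:-_; :-_; con)

    everything : Subring (λ _ → ⊤)
    everything = _

    ^≡ : ∀ c n → c ^ n ≡ c ℤ.^ n
    ^≡ c zero    = ≡.refl
    ^≡ c (suc n) = ≡.cong (c ℤ.*_) (^≡ c n)

    fromℕ≡ : ∀ n → fromℕ n ≡ + n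
    fromℕ≡ zero    = ≡.refl
    fromℕ≡ (suc n) = ≡.cong (λ z → + 1 ℤ.+ z) (fromℕ≡ n)

    next : ∀ c → ∃ λ u → (c ℤ.+ + 1) ℤ.^ p ≡ c ℤ.^ p ℤ.+ + 1 ℤ.+ + p ℤ.* u
    next c with freshman everything c (+ 1) tt tt
    ... | u , _ , e = u , ≡.trans (≡.sym (^≡ (c ℤ.+ + 1) p)) (≡.trans e
        (≡.cong₂ ℤ._+_ (≡.cong₂ ℤ._+_ (^≡ c p) (≡.trans (^≡ (+ 1) p) (ℤ.^-zeroˡ p))) (≡.cong (ℤ._* u) (fromℕ≡ p))))

    up : ∀ c → + p ∣ c ℤ.^ p ℤ.- c → + p ∣ (c ℤ.+ + 1) ℤ.^ p ℤ.- (c ℤ.+ + 1)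
    up c d with next c
    ... | u , e = ∣-resp (≡.sym (≡.trans (≡.cong (ℤ._- (c ℤ.+ + 1)) e)
        (solve 3 (λ x c y → x :+ con (+ 1) :+ y :- (c :+ con (+ 1)) := (x :- c) :+ y) ≡.refl (c ℤ.^ p) c (+ p ℤ.* u))))
        (∣m∣n⇒∣m+n d (divides u (ℤ.*-comm (+ p) u)))

    down : ∀ c → + p ∣ (c ℤ.+ + 1) ℤ.^ p ℤ.- (c ℤ.+ + 1) → + p ∣ c ℤ.^ p ℤ.- c
    down c d with next c
    ... | u , e = ∣-resp (≡.trans (≡.cong (λ z → (z ℤ.- (c ℤ.+ + 1)) ℤ.- + p ℤ.* u) e)
        (solve 3 (λ x c y → x :+ con (+ 1) :+ y :- (c :+ con (+ 1)) :- y := x :- c) ≡.refl (c ℤ.^ p) c (+ p ℤ.* u)))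
        (∣m∣n⇒∣m-n d (divides u (ℤ.*-comm (+ p) u)))

    zero-case : ∀ q → NonZero q → + q ∣ (+ 0) ℤ.^ q ℤ.- + 0
    zero-case (suc q) _ = divides (+ 0) ≡.refl

    go : ∀ c → + p ∣ c ℤ.^ p ℤ.- c
    go (+ zero)      = zero-case p (prime⇒nonZero pr)
    go (+ suc n)     = ≡.subst (λ c → + p ∣ c ℤ.^ p ℤ.- c) (ℤ.+-comm (+ n) (+ 1)) (up (+ n) (go (+ n)))
    go -[1+ zero ]   = down -[1+ 0 ] (go (+ 0))
    go -[1+ suc n ]  = down -[1+ suc n ] (go -[1+ n ])

  padicRing : ∀ p → Prime p → PadicIntegers p
  padicRing p pr = record
    { ring         = Z.ring
    ; torsion-free = Z.torsion-free
    ; p-prime      = Z.euclid-Z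
    ; p∣?          = Z.p∣?
    ; separated    = Z.separated
    ; approximate  = Z.approximate
    ; Div-fromℕ    = Z.∣fromℕ
    ; inverse      = Z.inverse
    ; teich        = λ c → T.teich (+ c)
    ; teich-*      = λ c d → CommutativeRing.trans Z.ring (CommutativeRing.reflexive Z.ring (≡.cong T.teich (ℤ.pos-* c d))) (T.teich-* (+ c) (+ d))
    ; teich-1      = T.teich-1
    ; teich-cong   = λ c d → T.teich-cong (+ c) (+ d)
    ; teich-reduce = λ c → T.teich-reduce (+ c)
    ; teich-^p     = λ c → T.teich-frobenius (+ c)
    }
    where
    module Z = Zp p pr
    module T = Z.Teichmüller (fermat pr)

-- Congruences of natural numbers, counting of failures, folds along arithmetic progressions.

module NatMod where

  open Padic using (bezout; ∣-resp)
  open import Algebra.Bundles using (CommutativeMonoid)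
  open import Level using (0ℓ)
  open import Data.Integer as ℤ using (ℤ; +_)
  import Data.Integer.Properties as ℤ
  import Data.Integer.DivMod as ℤ
  open import Data.Integer.Divisibility.Signed using (_∣_; divides; ∣m∣n⇒∣m-n; ∣m⇒∣m*n)
  import Data.Integer.Solver as ℤS
  open import Data.Sum using (_⊎_; inj₁; inj₂)
  open import Data.Nat as ℕ using (ℕ; zero; suc; NonZero; s≤s; z≤n; _+_; _*_; _<_; _≤_)
  import Data.Nat.Properties as ℕ
  open import Data.Nat.DivMod as ℕ using (_/_; _%_)
  import Data.Nat.Divisibility as ℕ
  open import Data.Nat.Coprimality as Coprime using (Coprime)
  open import Data.Nat.GCD using (module Bézout)
  open import Data.Nat.Solver using (module +-*-Solver)
  open import Data.Product using (Σ; _×_; _,_; proj₁; proj₂; ∃)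
  open import Relation.Binary.PropositionalEquality as ≡ using (_≡_)
  open import Relation.Nullary using (Dec; yes; no; ¬_; contradiction)
  open import Data.Empty using (⊥; ⊥-elim)

  infix 4 _≡_[mod_]
  _≡_[mod_] : ℕ → ℕ → ℕ → Set
  a ≡ b [mod m ] = + m ∣ + a ℤ.- + b

  ≡mod⇒multiple : ∀ {a b m} → a ≡ b [mod m ] → (∃ λ k → a ≡ k * m + b) ⊎ (∃ λ k → b ≡ k * m + a)
  ≡mod⇒multiple {a} {b} {m} (divides (+ k) e) = inj₁ (k , ℤ.+-injective (≡.trans (split (+ a) (+ b)) (≡.trans (≡.cong (ℤ._+ + b) (≡.trans e (≡.sym (ℤ.pos-* k m)))) (≡.sym (ℤ.pos-+ (k * m) b)))))
    where
    open ℤS.+-*-Solver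
    split : ∀ x y → x ≡ (x ℤ.- y) ℤ.+ y
    split = solve 2 (λ x y → x := (x :- y) :+ y) ≡.refl
  ≡mod⇒multiple {a} {b} {m} (divides ℤ.-[1+ k ] e) = inj₂ (suc k , ℤ.+-injective (≡.trans (split (+ a) (+ b)) (≡.trans (≡.cong (λ z → ℤ.- z ℤ.+ + a) e)
      (≡.trans (≡.cong (ℤ._+ + a) (≡.trans (ℤ.neg-distribˡ-* ℤ.-[1+ k ] (+ m)) (≡.sym (ℤ.pos-* (suc k) m)))) (≡.sym (ℤ.pos-+ (suc k * m) a))))))
    where
    open ℤS.+-*-Solver
    split : ∀ x y → y ≡ ℤ.- (x ℤ.- y) ℤ.+ x
    split = solve 2 (λ x y → y := :- (x :- y) :+ x) ≡.refl

  mod-inverse : ∀ {t m} .{{_ : NonZero m}} → Coprime t m → ∃ λ j → j * t ≡ 1 [mod m ]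
  mod-inverse {t} {m} c with bezout c
  ... | v , d = v ℤ.%ℕ m , ∣-resp eq (∣m∣n⇒∣m-n d (∣m⇒∣m*n (+ t) (divides (v ℤ./ℕ m) ≡.refl)))
    where
    open ℤS.+-*-Solver
    r = v ℤ.%ℕ m
    eq : (v ℤ.* + t ℤ.- + 1) ℤ.- (v ℤ./ℕ m ℤ.* + m) ℤ.* + t ≡ + (r * t) ℤ.- + 1
    eq = ≡.trans (≡.cong (λ z → (z ℤ.* + t ℤ.- + 1) ℤ.- (v ℤ./ℕ m ℤ.* + m) ℤ.* + t) (ℤ.a≡a%ℕn+[a/ℕn]*n v m))
      (≡.trans (solve 3 (λ r w t → ((r :+ w) :* t :- con (+ 1)) :- w :* t := r :* t :- con (+ 1)) ≡.refl (+ r) (v ℤ./ℕ m ℤ.* + m) (+ t)) (≡.cong (ℤ._- + 1) (≡.sym (ℤ.pos-* r t))))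

  inverse-scaled : ∀ {j t m} q → j * t ≡ 1 [mod m ] → ∀ σ → j * (t * q) + σ ≡ q + σ [mod m * q ]
  inverse-scaled {j} {t} {m} q (divides w e) σ = divides w (begin
    + (j * (t * q) + σ) ℤ.- + (q + σ)
      ≡⟨ ≡.cong₂ ℤ._-_ (≡.trans (ℤ.pos-+ (j * (t * q)) σ) (≡.cong (ℤ._+ + σ) (≡.trans (≡.cong +_ (≡.sym (ℕ.*-assoc j t q))) (ℤ.pos-* (j * t) q)))) (ℤ.pos-+ q σ) ⟩
    (+ (j * t) ℤ.* + q ℤ.+ + σ) ℤ.- (+ q ℤ.+ + σ)
      ≡⟨ solve 3 (λ a q s → (a :* q :+ s) :- (q :+ s) := (a :- con (+ 1)) :* q) ≡.refl (+ (j * t)) (+ q) (+ σ) ⟩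
    (+ (j * t) ℤ.- + 1) ℤ.* + q
      ≡⟨ ≡.cong (ℤ._* + q) e ⟩
    (w ℤ.* + m) ℤ.* + q
      ≡⟨ ≡.trans (ℤ.*-assoc w (+ m) (+ q)) (≡.cong (w ℤ.*_) (≡.sym (ℤ.pos-* m q))) ⟩
    w ℤ.* + (m * q) ∎)
    where
    open ≡.≡-Reasoning
    open ℤS.+-*-Solver

  -- `u₀ + (Q ∸ 1) * u` represents u₀ - u modulo Q, so i times that many steps of length t lead from
  -- u to u₀.
  inverse-reaches : ∀ {i t Q} .{{_ : NonZero Q}} u₀ u → i * t ≡ 1 [mod Q ] → i * (u₀ + (Q ℕ.∸ 1) * u) * t + u ≡ u₀ [mod Q ]
  inverse-reaches {i} {t} {Q} u₀ u (divides w e) = divides (w ℤ.* + v ℤ.+ + u) (begin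
    + (i * v * t + u) ℤ.- + u₀
      ≡⟨ ≡.cong (ℤ._- + u₀) (≡.trans (ℤ.pos-+ (i * v * t) u) (≡.cong (ℤ._+ + u) (≡.trans (≡.cong +_ (swap i v t)) (ℤ.pos-* (i * t) v)))) ⟩
    (+ (i * t) ℤ.* + v ℤ.+ + u) ℤ.- + u₀
      ≡⟨ solve 4 (λ a v u z → (a :* v :+ u) :- z := (a :- con (+ 1)) :* v :+ ((v :+ u) :- z)) ≡.refl (+ (i * t)) (+ v) (+ u) (+ u₀) ⟩
    (+ (i * t) ℤ.- + 1) ℤ.* + v ℤ.+ ((+ v ℤ.+ + u) ℤ.- + u₀)
      ≡⟨ ≡.cong₂ (λ x y → x ℤ.* + v ℤ.+ (y ℤ.- + u₀)) e (≡.trans (≡.sym (ℤ.pos-+ v u)) (≡.trans (≡.cong +_ v+u) (≡.trans (ℤ.pos-+ u₀ (u * Q)) (≡.cong (λ z → + u₀ ℤ.+ z) (ℤ.pos-* u Q))))) ⟩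
    (w ℤ.* + Q) ℤ.* + v ℤ.+ ((+ u₀ ℤ.+ + u ℤ.* + Q) ℤ.- + u₀)
      ≡⟨ solve 5 (λ w q v z u → (w :* q) :* v :+ ((z :+ u :* q) :- z) := (w :* v :+ u) :* q) ≡.refl w (+ Q) (+ v) (+ u₀) (+ u) ⟩
    (w ℤ.* + v ℤ.+ + u) ℤ.* + Q ∎)
    where
    open ≡.≡-Reasoning
    open ℤS.+-*-Solver
    v = u₀ + (Q ℕ.∸ 1) * u
    swap : ∀ a v t → a * v * t ≡ (a * t) * v
    swap = N.solve 3 (λ a v t → a N.:* v N.:* t N.:= (a N.:* t) N.:* v) ≡.refl
      where module N = +-*-Solver
    v+u : v + u ≡ u₀ + u * Q
    v+u = ≡.trans (ℕ.+-assoc u₀ ((Q ℕ.∸ 1) * u) u) (≡.cong (λ z → u₀ + z) (≡.trans (ℕ.+-comm ((Q ℕ.∸ 1) * u) u)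
      (≡.trans (≡.cong (_* u) (≡.trans (ℕ.+-comm 1 (Q ℕ.∸ 1)) (ℕ.m∸n+n≡m (ℕ.>-nonZero⁻¹ Q)))) (ℕ.*-comm Q u))))

  module _ {P : ℕ → Set} where

    failures : (∀ n → Dec (P n)) → ℕ → ℕ
    failures d zero    = 0
    failures d (suc n) with d n
    ... | yes _ = failures d n
    ... | no _  = suc (failures d n)

  -- Vanishing of a series cannot be decided, but finitely many instances may be decided together as
  -- long as the goal is a negation.
  ¬¬-decidable : ∀ {P : ℕ → Set} N → ¬ ¬ (∀ n → n < N → Dec (P n))
  ¬¬-decidable zero k = k (λ n ())
  ¬¬-decidable {P} (suc N) k = ¬¬-decidable {P} N (λ d → k′ d)
    where
    extend : (∀ n → n < N → Dec (P n)) → Dec (P N) → ∀ n → n < suc N → Dec (P n)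
    extend d dN n n<sN with n ℕ.≟ N
    ... | yes ≡.refl = dN
    ... | no n≢N = d n (ℕ.≤∧≢⇒< (ℕ.s≤s⁻¹ n<sN) n≢N)
    k′ : (∀ n → n < N → Dec (P n)) → ⊥
    k′ d = k (extend d (no (λ pN → k (extend d (yes pN)))))

  failures-≤ : ∀ {P Q : ℕ → Set} (d : ∀ n → Dec (P n)) (e : ∀ n → Dec (Q n)) N → (∀ n → n < N → P n → Q n) → failures e N ≤ failures d N
  failures-≤ d e zero    h = z≤n
  failures-≤ d e (suc N) h with d N | e N | failures-≤ d e N (λ n n<N → h n (ℕ.m<n⇒m<1+n n<N))
  ... | yes p | yes q | r = r
  ... | yes p | no ¬q | r = contradiction (h N ℕ.≤-refl p) ¬q
  ... | no ¬p | yes q | r = ℕ.m≤n⇒m≤1+n r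
  ... | no ¬p | no ¬q | r = s≤s r

  failures-< : ∀ {P Q : ℕ → Set} (d : ∀ n → Dec (P n)) (e : ∀ n → Dec (Q n)) N → (∀ n → n < N → P n → Q n) →
               ∀ m → m < N → ¬ P m → Q m → failures e N < failures d N
  failures-< d e (suc N) h m m<sN ¬pm qm with m ℕ.≟ N
  failures-< d e (suc N) h m m<sN ¬pm qm | yes ≡.refl with d N | e N | failures-≤ d e N (λ n n<N → h n (ℕ.m<n⇒m<1+n n<N))
  ... | yes p | _     | r = contradiction p ¬pm
  ... | no ¬p | no ¬q | r = contradiction qm ¬q
  ... | no ¬p | yes q | r = s≤s r
  failures-< d e (suc N) h m m<sN ¬pm qm | no m≢N
    with d N | e N | failures-< d e N (λ n n<N → h n (ℕ.m<n⇒m<1+n n<N)) m (ℕ.≤∧≢⇒< (ℕ.s≤s⁻¹ m<sN) m≢N) ¬pm qm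
  ... | yes p | yes q | r = r
  ... | yes p | no ¬q | r = contradiction (h N ℕ.≤-refl p) ¬q
  ... | no ¬p | yes q | r = ℕ.m≤n⇒m≤1+n r
  ... | no ¬p | no ¬q | r = s≤s r

  module Fold (M : CommutativeMonoid 0ℓ 0ℓ) where

    open CommutativeMonoid M

    -- Combines G at σ, q + σ, ..., (n-1)q + σ. For n = p and G of period pq this is the trace, or
    -- multiplicatively the norm, down to period q.
    fold : ℕ → ℕ → (ℕ → Carrier) → ℕ → Carrier
    fold zero    q G σ = ε
    fold (suc n) q G σ = fold n q G σ ∙ G (n * q + σ)

    fold-front : ∀ n q G σ → fold (suc n) q G σ ≈ G σ ∙ fold n q G (q + σ)
    fold-front zero    q G σ = comm ε (G σ)
    fold-front (suc n) q G σ = trans (∙-congʳ (fold-front n q G σ)) (trans (assoc (G σ) _ _)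
      (∙-congˡ (∙-congˡ (reflexive (≡.cong G (solve 3 (λ n q s → (con 1 :+ n) :* q :+ s := n :* q :+ (q :+ s)) ≡.refl n q σ))))))
      where open +-*-Solver

    -- Translation by q drops the first factor and appends one equal to it.
    fold-periodic : ∀ n q G → (∀ σ → G (suc n * q + σ) ≈ G σ) → ∀ σ → fold (suc n) q G (q + σ) ≈ fold (suc n) q G σ
    fold-periodic n q G h σ = trans (∙-congˡ (trans (reflexive (≡.cong G (solve 3 (λ n q s → n :* q :+ (q :+ s) := (con 1 :+ n) :* q :+ s) ≡.refl n q σ))) (h σ)))
      (trans (comm _ (G σ)) (sym (fold-front n q G σ)))
      where open +-*-Solver

    fold-single : ∀ n q G σ → (∀ i → i < n → G (suc i * q + σ) ≈ ε) → fold (suc n) q G σ ≈ G σ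
    fold-single n q G σ h = trans (fold-front n q G σ) (trans (∙-congˡ (go n h)) (identityʳ (G σ)))
      where
      open +-*-Solver
      go : ∀ n → (∀ i → i < n → G (suc i * q + σ) ≈ ε) → fold n q G (q + σ) ≈ ε
      go zero    h = refl
      go (suc n) h = trans (∙-cong (go n (λ i i<n → h i (ℕ.m<n⇒m<1+n i<n)))
        (trans (reflexive (≡.cong G (solve 3 (λ n q s → n :* q :+ (q :+ s) := (con 1 :+ n) :* q :+ s) ≡.refl n q σ))) (h n ℕ.≤-refl))) (identityˡ ε)

  mod-strip : ∀ o o′ b b′ σ v → o + σ * b ≡ o′ + σ * b′ [mod v * σ ] → o ≡ o′ [mod σ ]
  mod-strip o o′ b b′ σ v (divides w e) = divides (w ℤ.* + v ℤ.- (+ b ℤ.- + b′)) (begin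
    + o ℤ.- + o′
      ≡⟨ solve 5 (λ o o′ s b b′ → o :- o′ := ((o :+ s :* b) :- (o′ :+ s :* b′)) :- (b :- b′) :* s) ≡.refl (+ o) (+ o′) (+ σ) (+ b) (+ b′) ⟩
    ((+ o ℤ.+ + σ ℤ.* + b) ℤ.- (+ o′ ℤ.+ + σ ℤ.* + b′)) ℤ.- (+ b ℤ.- + b′) ℤ.* + σ
      ≡⟨ ≡.cong (ℤ._- (+ b ℤ.- + b′) ℤ.* + σ) (≡.trans (≡.sym (≡.cong₂ ℤ._-_ (cast o b) (cast o′ b′))) (≡.trans e (≡.cong (w ℤ.*_) (ℤ.pos-* v σ)))) ⟩
    w ℤ.* (+ v ℤ.* + σ) ℤ.- (+ b ℤ.- + b′) ℤ.* + σ
      ≡⟨ solve 4 (λ w v s d → w :* (v :* s) :- d :* s := (w :* v :- d) :* s) ≡.refl w (+ v) (+ σ) (+ b ℤ.- + b′) ⟩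
    (w ℤ.* + v ℤ.- (+ b ℤ.- + b′)) ℤ.* + σ ∎)
    where
    open ≡.≡-Reasoning
    open ℤS.+-*-Solver
    cast : ∀ o b → + (o + σ * b) ≡ + o ℤ.+ + σ ℤ.* + b
    cast o b = ≡.trans (ℤ.pos-+ o (σ * b)) (≡.cong (λ z → + o ℤ.+ z) (ℤ.pos-* σ b))

  mod-cancel : ∀ o o′ b b′ σ v .{{_ : NonZero σ}} → o ≡ o′ → o + σ * b ≡ o′ + σ * b′ [mod v * σ ] → b ≡ b′ [mod v ]
  mod-cancel o .o b b′ σ v ≡.refl (divides w e) = divides w (ℤ.*-cancelˡ-≡ (+ σ) (+ b ℤ.- + b′) (w ℤ.* + v) (begin
    + σ ℤ.* (+ b ℤ.- + b′)
      ≡⟨ solve 4 (λ o s b b′ → s :* (b :- b′) := (o :+ s :* b) :- (o :+ s :* b′)) ≡.refl (+ o) (+ σ) (+ b) (+ b′) ⟩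
    (+ o ℤ.+ + σ ℤ.* + b) ℤ.- (+ o ℤ.+ + σ ℤ.* + b′)
      ≡⟨ ≡.trans (≡.sym (≡.cong₂ ℤ._-_ (cast b) (cast b′))) (≡.trans e (≡.cong (w ℤ.*_) (ℤ.pos-* v σ))) ⟩
    w ℤ.* (+ v ℤ.* + σ)
      ≡⟨ solve 3 (λ w v s → w :* (v :* s) := s :* (w :* v)) ≡.refl w (+ v) (+ σ) ⟩
    + σ ℤ.* (w ℤ.* + v) ∎))
    where
    open ≡.≡-Reasoning
    open ℤS.+-*-Solver
    cast : ∀ b → + (o + σ * b) ≡ + o ℤ.+ + σ ℤ.* + b
    cast b = ≡.trans (ℤ.pos-+ o (σ * b)) (≡.cong (λ z → + o ℤ.+ z) (ℤ.pos-* σ b))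

  mod-small : ∀ {a b m} → a < m → b < m → a ≡ b [mod m ] → a ≡ b
  mod-small {a} {b} {m} a<m b<m d with ≡mod⇒multiple {a} {b} {m} d
  ... | inj₁ (zero , e)  = e
  ... | inj₁ (suc k , e) = contradiction (ℕ.≤-trans (ℕ.m≤m+n m (k * m + b)) (ℕ.≤-reflexive (≡.sym (≡.trans e (ℕ.+-assoc m (k * m) b))))) (ℕ.<⇒≱ a<m)
  ... | inj₂ (zero , e)  = ≡.sym e
  ... | inj₂ (suc k , e) = contradiction (ℕ.≤-trans (ℕ.m≤m+n m (k * m + a)) (ℕ.≤-reflexive (≡.sym (≡.trans e (ℕ.+-assoc m (k * m) a))))) (ℕ.<⇒≱ b<m)

  mod-difference : ∀ {a b t m} → m ℕ.∣ suc (a + t) → m ℕ.∣ suc (b + t) → a ≡ b [mod m ]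
  mod-difference {a} {b} {t} {m} (ℕ.divides k e) (ℕ.divides l e′) = divides (+ k ℤ.- + l) (begin
    + a ℤ.- + b
      ≡⟨ solve 3 (λ a b t → a :- b := (con (+ 1) :+ (a :+ t)) :- (con (+ 1) :+ (b :+ t))) ≡.refl (+ a) (+ b) (+ t) ⟩
    (+ 1 ℤ.+ (+ a ℤ.+ + t)) ℤ.- (+ 1 ℤ.+ (+ b ℤ.+ + t))
      ≡⟨ ≡.cong₂ ℤ._-_ (≡.trans (≡.cong +_ e) (ℤ.pos-* k m)) (≡.trans (≡.cong +_ e′) (ℤ.pos-* l m)) ⟩
    + k ℤ.* + m ℤ.- + l ℤ.* + m
      ≡⟨ solve 3 (λ k l m → k :* m :- l :* m := (k :- l) :* m) ≡.refl (+ k) (+ l) (+ m) ⟩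
    (+ k ℤ.- + l) ℤ.* + m ∎)
    where
    open ≡.≡-Reasoning
    open ℤS.+-*-Solver

-- Power series over O and modulo p, Dwork's construction, independence of exponentials.

module PadicSeries where

  open RingKit
  open PowerSeries
  open PadicRing
  open Padic using (∣-resp; prime-coprime; coprime-^)
  open NatMod
  open import Algebra.Bundles using (CommutativeRing)
  open import Level using (0ℓ)
  import Algebra.Properties.Ring
  import Relation.Binary.Reasoning.Setoid
  open import Data.Empty using (⊥; ⊥-elim)
  open import Data.Fin as Fin using (Fin)
  import Data.Fin.Properties as Fin
  open import Data.Integer as ℤ using (+_)
  import Data.Integer.Properties as ℤ
  import Data.Integer.Solver as ℤS
  open import Data.Nat as ℕ using (ℕ; zero; suc; NonZero; s≤s; z≤n; _!)
  import Data.Nat.Properties as ℕ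
  import Data.Nat.Divisibility as ℕ
  import Data.Nat.Solver as ℕS
  open import Data.Nat.Combinatorics as C using (_C_)
  open import Data.Nat.DivMod as ℕ using (_/_; _%_)
  open import Data.Nat.Induction using (<-rec)
  open import Data.Nat.Primality using (Prime; prime⇒nonZero; prime⇒nonTrivial; euclidsLemma)
  open import Data.Product using (Σ; _×_; _,_; proj₁; proj₂; ∃)
  open import Data.Sum as Sum using (_⊎_; inj₁; inj₂)
  open import Data.Unit using (⊤; tt)
  open import Relation.Binary.Definitions using (Tri; tri<; tri≈; tri>)
  open import Relation.Binary.PropositionalEquality as ≡ using (_≡_)
  open import Relation.Nullary using (Dec; yes; no; ¬_; contradiction)
  open import Relation.Nullary.Decidable using (decidable-stable)
  import Relation.Nullary.Decidable as Dec

  prime-split : ∀ {p} → Prime p → ∀ n → ¬ n ≡ 0 → ∃ λ v → ∃ λ u → n ≡ p ℕ.^ v ℕ.* u × ¬ p ℕ.∣ u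
  prime-split {p} pr = <-rec _ go
    where
    go : ∀ n → (∀ {m} → m ℕ.< n → ¬ m ≡ 0 → ∃ λ v → ∃ λ u → m ≡ p ℕ.^ v ℕ.* u × ¬ p ℕ.∣ u) →
         ¬ n ≡ 0 → ∃ λ v → ∃ λ u → n ≡ p ℕ.^ v ℕ.* u × ¬ p ℕ.∣ u
    go n rec n≢0 with p ℕ.∣? n
    ... | no ¬d = 0 , n , ≡.sym (ℕ.*-identityˡ n) , ¬d
    ... | yes (ℕ.divides m e) with rec {m} m<n m≢0
      where
      m≢0 : ¬ m ≡ 0
      m≢0 ≡.refl = n≢0 e
      m<n : m ℕ.< n
      m<n = ≡.subst (m ℕ.<_) (≡.sym e) (ℕ.m<m*n m p {{ℕ.≢-nonZero m≢0}} (ℕ.nonTrivial⇒n>1 p {{prime⇒nonTrivial pr}}))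
    ... | v , u , e′ , ¬d = suc v , u , ≡.trans e (≡.trans (ℕ.*-comm m p) (≡.trans (≡.cong (p ℕ.*_) e′) (≡.sym (ℕ.*-assoc p _ u)))) , ¬d

  -- Legendre's bound v_p(k!) < k, through (pq)! = p^q q! u.
  module _ {p : ℕ} (pr : Prime p) where

    private
      p≥2 : 2 ℕ.≤ p
      p≥2 = ℕ.nonTrivial⇒n>1 p {{prime⇒nonTrivial pr}}

      Unit : ℕ → Set
      Unit u = ¬ p ℕ.∣ u

      unit-* : ∀ {u v} → Unit u → Unit v → Unit (u ℕ.* v)
      unit-* {u} {v} a b d with euclidsLemma u v pr d
      ... | inj₁ x = a x
      ... | inj₂ x = b x

      unit-1 : Unit 1
      unit-1 d = ℕ.<⇒≱ p≥2 (ℕ.∣⇒≤ d)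

      partial : ∀ q r → r ℕ.< p → ∃ λ u → (q ℕ.* p ℕ.+ r) ! ≡ (q ℕ.* p) ! ℕ.* u × Unit u
      partial q zero    _ = 1 , ≡.trans (≡.cong _! (ℕ.+-identityʳ (q ℕ.* p))) (≡.sym (ℕ.*-identityʳ _)) , unit-1
      partial q (suc r) r<p with partial q r (ℕ.<-trans (ℕ.n<1+n r) r<p)
      ... | u , e , U = m ℕ.* u , eq , unit-* Um U
        where
        m = suc (q ℕ.* p ℕ.+ r)
        Um : Unit m
        Um d = ℕ.<⇒≱ r<p (ℕ.∣⇒≤ (ℕ.∣m+n∣m⇒∣n (≡.subst (p ℕ.∣_) (≡.sym (ℕ.+-suc (q ℕ.* p) r)) d) (ℕ.n∣m*n q)))
        eq : (q ℕ.* p ℕ.+ suc r) ! ≡ (q ℕ.* p) ! ℕ.* (m ℕ.* u)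
        eq = begin
          (q ℕ.* p ℕ.+ suc r) !        ≡⟨ ≡.cong _! (ℕ.+-suc (q ℕ.* p) r) ⟩
          m ℕ.* (q ℕ.* p ℕ.+ r) !      ≡⟨ ≡.cong (m ℕ.*_) e ⟩
          m ℕ.* ((q ℕ.* p) ! ℕ.* u)    ≡⟨ ≡.sym (ℕ.*-assoc m ((q ℕ.* p) !) u) ⟩
          m ℕ.* (q ℕ.* p) ! ℕ.* u      ≡⟨ ≡.cong (ℕ._* u) (ℕ.*-comm m ((q ℕ.* p) !)) ⟩
          (q ℕ.* p) ! ℕ.* m ℕ.* u      ≡⟨ ℕ.*-assoc ((q ℕ.* p) !) m u ⟩
          (q ℕ.* p) ! ℕ.* (m ℕ.* u)    ∎
          where open ≡.≡-Reasoning

      multiples : ∀ q → ∃ λ u → (q ℕ.* p) ! ≡ p ℕ.^ q ℕ.* q ! ℕ.* u × Unit u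
      multiples zero = 1 , ≡.refl , unit-1
      multiples (suc q) with multiples q | partial q (ℕ.pred p) (ℕ.≤-reflexive p-1)
        where
        p-1 : suc (ℕ.pred p) ≡ p
        p-1 = ℕ.suc-pred p {{prime⇒nonZero pr}}
      ... | u , e , U | u′ , e′ , U′ = u ℕ.* u′ , eq , unit-* U U′
        where
        p-1 : suc (ℕ.pred p) ≡ p
        p-1 = ℕ.suc-pred p {{prime⇒nonZero pr}}
        eq₀ : suc (q ℕ.* p ℕ.+ ℕ.pred p) ≡ suc q ℕ.* p
        eq₀ = ≡.trans (≡.sym (ℕ.+-suc (q ℕ.* p) (ℕ.pred p))) (≡.trans (≡.cong (q ℕ.* p ℕ.+_) p-1) (ℕ.+-comm (q ℕ.* p) p))
        open import Data.Nat.Solver using (module +-*-Solver)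
        open +-*-Solver
        eq : (suc q ℕ.* p) ! ≡ p ℕ.^ suc q ℕ.* suc q ! ℕ.* (u ℕ.* u′)
        eq = begin
          (suc q ℕ.* p) !                                            ≡⟨ ≡.cong _! eq₀ ⟨
          suc (q ℕ.* p ℕ.+ ℕ.pred p) ℕ.* (q ℕ.* p ℕ.+ ℕ.pred p) !    ≡⟨ ≡.cong₂ ℕ._*_ eq₀ e′ ⟩
          (suc q ℕ.* p) ℕ.* ((q ℕ.* p) ! ℕ.* u′)                     ≡⟨ ≡.cong (λ z → (suc q ℕ.* p) ℕ.* (z ℕ.* u′)) e ⟩
          (suc q ℕ.* p) ℕ.* (p ℕ.^ q ℕ.* q ! ℕ.* u ℕ.* u′)
            ≡⟨ solve 6 (λ s p P f u v → (s :* p) :* (P :* f :* u :* v) := (p :* P) :* (s :* f) :* (u :* v)) ≡.refl (suc q) p (p ℕ.^ q) (q !) u u′ ⟩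
          p ℕ.^ suc q ℕ.* suc q ! ℕ.* (u ℕ.* u′)                     ∎
          where open ≡.≡-Reasoning

    factorial-split : ∀ k → ∃ λ v → ∃ λ u → (suc k) ! ≡ p ℕ.^ v ℕ.* u × Unit u × v ℕ.≤ k
    factorial-split = <-rec _ go
      where
      go : ∀ k → (∀ {m} → m ℕ.< k → ∃ λ v → ∃ λ u → (suc m) ! ≡ p ℕ.^ v ℕ.* u × Unit u × v ℕ.≤ m) →
           ∃ λ v → ∃ λ u → (suc k) ! ≡ p ℕ.^ v ℕ.* u × Unit u × v ℕ.≤ k
      go k rec = cases (suc k / p) ≡.refl
        where
        instance _ = prime⇒nonZero pr
        r = suc k % p
        r<p : r ℕ.< p
        r<p = ℕ.m%n<n (suc k) p
        k≡ : ∀ q → suc k / p ≡ q → suc k ≡ q ℕ.* p ℕ.+ r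
        k≡ q ≡.refl = ≡.trans (ℕ.m≡m%n+[m/n]*n (suc k) p) (ℕ.+-comm r _)
        cases : ∀ q → suc k / p ≡ q → ∃ λ v → ∃ λ u → (suc k) ! ≡ p ℕ.^ v ℕ.* u × Unit u × v ℕ.≤ k
        cases zero e with partial 0 r r<p
        ... | u , e′ , U = 0 , u , ≡.trans (≡.cong _! (k≡ 0 e)) e′ , U , z≤n
        cases (suc q) e with rec {q} q<k | partial (suc q) r r<p | multiples (suc q)
          where
          q<k : q ℕ.< k
          q<k = ℕ.s≤s⁻¹ (ℕ.≤-trans (ℕ.≤-trans (s≤s (s≤s (ℕ.m≤m+n q q)))
              (ℕ.≤-trans (ℕ.≤-reflexive (≡.trans (≡.cong suc (≡.sym (ℕ.+-suc q q))) (≡.trans (≡.cong (suc q ℕ.+_) (≡.sym (ℕ.+-identityʳ (suc q)))) (ℕ.*-comm 2 (suc q))))) (ℕ.*-monoʳ-≤ (suc q) p≥2)))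
              (ℕ.≤-trans (ℕ.m≤m+n (suc q ℕ.* p) r) (ℕ.≤-reflexive (≡.sym (k≡ (suc q) e)))))
        ... | v , w , e₁ , W , v≤q | u , e₂ , U | u′ , e₃ , U′ =
          suc q ℕ.+ v , w ℕ.* (u′ ℕ.* u) , eq , unit-* W (unit-* U′ U) , bound
          where
          open import Data.Nat.Solver using (module +-*-Solver)
          open +-*-Solver
          eq : (suc k) ! ≡ p ℕ.^ (suc q ℕ.+ v) ℕ.* (w ℕ.* (u′ ℕ.* u))
          eq = begin
            (suc k) !                                    ≡⟨ ≡.cong _! (k≡ (suc q) e) ⟩
            (suc q ℕ.* p ℕ.+ r) !                        ≡⟨ e₂ ⟩
            (suc q ℕ.* p) ! ℕ.* u                        ≡⟨ ≡.cong (ℕ._* u) e₃ ⟩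
            p ℕ.^ suc q ℕ.* suc q ! ℕ.* u′ ℕ.* u         ≡⟨ ≡.cong (λ z → p ℕ.^ suc q ℕ.* z ℕ.* u′ ℕ.* u) e₁ ⟩
            p ℕ.^ suc q ℕ.* (p ℕ.^ v ℕ.* w) ℕ.* u′ ℕ.* u ≡⟨ solve 5 (λ P Q w u v → P :* (Q :* w) :* u :* v := (P :* Q) :* (w :* (u :* v))) ≡.refl (p ℕ.^ suc q) (p ℕ.^ v) w u′ u ⟩
            (p ℕ.^ suc q ℕ.* p ℕ.^ v) ℕ.* (w ℕ.* (u′ ℕ.* u)) ≡⟨ ≡.cong (ℕ._* (w ℕ.* (u′ ℕ.* u))) (≡.sym (ℕ.^-distribˡ-+-* p (suc q) v)) ⟩
            p ℕ.^ (suc q ℕ.+ v) ℕ.* (w ℕ.* (u′ ℕ.* u))   ∎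
            where open ≡.≡-Reasoning
          bound : suc q ℕ.+ v ℕ.≤ k
          bound = ℕ.s≤s⁻¹ (ℕ.≤-trans (s≤s (ℕ.+-monoʳ-≤ (suc q) v≤q)) (ℕ.≤-trans
              (ℕ.≤-reflexive (≡.trans (≡.sym (ℕ.+-suc (suc q) q)) (≡.trans (≡.cong (suc q ℕ.+_) (≡.sym (ℕ.+-identityʳ (suc q)))) (ℕ.*-comm 2 (suc q)))))
              (ℕ.≤-trans (ℕ.*-monoʳ-≤ (suc q) p≥2) (ℕ.≤-trans (ℕ.m≤m+n (suc q ℕ.* p) r) (ℕ.≤-reflexive (≡.sym (k≡ (suc q) e)))))))

  module CharP (R : CommutativeRing 0ℓ 0ℓ) {p : ℕ} (pr : Prime p)
               (char : CommutativeRing._≈_ R (Kit.fromℕ R p) (CommutativeRing.0# R)) where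

    open CommutativeRing R hiding (zero)
    open Kit R
    open Frobenius R pr

    freshman-char : ∀ x y → (x + y) ^ p ≈ x ^ p + y ^ p
    freshman-char x y with freshman {λ _ → ⊤} _ x y tt tt
    ... | u , _ , e = trans e (trans (+-congˡ (trans (*-congʳ char) (zeroˡ u))) (+-identityʳ _))

  -- The algebra behind `θD` in Dwork's argument, with π = p, G = φ(F), e = exp(px), q = F^(p-1), r
  -- the error of F and s = φ(r).
  dwork-identity : (R : CommutativeRing 0ℓ 0ℓ) → let open CommutativeRing R in ∀ π Y X G e q F r s →
    (π * ((Y - X) * G + s) * e + G * (π * (X * e))) - π * (q * (Y * F + r)) ≈ π * Y * (G * e - F * q) + π * (s * e - q * r)
  dwork-identity R = solve 9 (λ π Y X G e q F r s → (π :* ((Y :- X) :* G :+ s) :* e :+ G :* (π :* (X :* e))) :- π :* (q :* (Y :* F :+ r))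
      := π :* Y :* (G :* e :- F :* q) :+ π :* (s :* e :- q :* r)) (CommutativeRing.refl R)
    where open Kit.Solver R

  module SeriesPowers (R : CommutativeRing 0ℓ 0ℓ) where

    open CommutativeRing R hiding (zero)
    open Kit R
    open Series R
    module Ring = CommutativeRing series
    module K = Kit series

    fromℕ-const : ∀ n → K.fromℕ n ≋ const (fromℕ n)
    fromℕ-const n = pw (go n)
      where
      go : ∀ n k → K.fromℕ n k ≈ const (fromℕ n) k
      go zero    zero    = refl
      go zero    (suc k) = refl
      go (suc n) zero    = +-congˡ (go n zero)
      go (suc n) (suc k) = trans (+-identityˡ _) (go n (suc k))

    fromℕ*-apply : ∀ n f k → conv (K.fromℕ n) f k ≈ fromℕ n * f k
    fromℕ*-apply n f k = trans (conv-cong (at (fromℕ-const n)) (λ _ → refl) k) (conv-const (fromℕ n) f k)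

    const-* : ∀ a b → conv (const a) (const b) ≋ const (a * b)
    const-* a b = pw λ { zero → refl ; (suc n) → trans (conv-const a (const b) (suc n)) (zeroʳ a) }

    const-^ : ∀ a n → const a K.^ n ≋ const (a ^ n)
    const-^ a zero    = Ring.refl
    const-^ a (suc n) = Ring.trans (Ring.*-congˡ (const-^ a n)) (const-* a (a ^ n))

    X^* : ∀ k f → conv (X K.^ k) f ≋ shift k f
    X^* zero    f = Ring.*-identityˡ f
    X^* (suc k) f = Ring.trans (Ring.*-assoc X (X K.^ k) f) (pw λ n → trans (X* _ n) (step n))
      where
      step : ∀ n → shift 1 (conv (X K.^ k) f) n ≈ shift (suc k) f n
      step zero    = refl
      step (suc n) = at (X^* k f) n

    θ-^ : ∀ f n → θ (f K.^ suc n) ≋ conv (K.fromℕ (suc n)) (conv (f K.^ n) (θ f))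
    θ-^ f zero = pw λ n → trans (θ-cong (at (Ring.*-identityʳ f)) n)
      (sym (at (K.Solver.solve 1 (λ t → K.Solver._:*_ (K.Solver._:+_ (K.Solver.con (+ 1)) (K.Solver.con (+ 0))) (K.Solver._:*_ (K.Solver.con (+ 1)) t) K.Solver.:= t) Ring.refl (θ f)) n))
    θ-^ f (suc n) = Ring.trans (pw (θ-* f (f K.^ suc n))) (Ring.trans (Ring.+-congˡ (Ring.*-congˡ (θ-^ f n)))
      (solve 4 (λ f q t m → t :* (f :* q) :+ f :* ((con (+ 1) :+ m) :* (q :* t)) := (con (+ 1) :+ (con (+ 1) :+ m)) :* ((f :* q) :* t)) Ring.refl f (f K.^ n) (θ f) (K.fromℕ n)))
      where open K.Solver

    ^-coeff0 : ∀ f n → f 0 ≈ 1# → (f K.^ n) 0 ≈ 1#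
    ^-coeff0 f zero    e = refl
    ^-coeff0 f (suc n) e = trans (*-cong e (^-coeff0 f n e)) (*-identityˡ 1#)

    shift-+ : ∀ k f g → shift k (λ n → f n + g n) ≐ (λ n → shift k f n + shift k g n)
    shift-+ zero    f g n       = refl
    shift-+ (suc k) f g zero    = sym (+-identityˡ 0#)
    shift-+ (suc k) f g (suc n) = shift-+ k f g n

    shift-scale : ∀ k c f → shift k (λ n → c * f n) ≐ (λ n → c * shift k f n)
    shift-scale zero    c f n       = refl
    shift-scale (suc k) c f zero    = sym (zeroʳ c)
    shift-scale (suc k) c f (suc n) = shift-scale k c f n

    shift-small : ∀ k f n → n ℕ.< k → shift k f n ≈ 0#
    shift-small (suc k) f zero    _ = refl
    shift-small (suc k) f (suc n) (s≤s n<k) = shift-small k f n n<k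

    Agree : ℕ → S → S → Set
    Agree N f g = ∀ m → m ℕ.< N → f m ≈ g m

    shift-agree : ∀ k {N f g} → Agree N f g → Agree (k ℕ.+ N) (shift k f) (shift k g)
    shift-agree zero    h m       m<N       = h m m<N
    shift-agree (suc k) h zero    _         = refl
    shift-agree (suc k) h (suc m) (s≤s m<N) = shift-agree k h m m<N

    conv-agree : ∀ {N f g} h → Agree N f g → Agree N (conv h f) (conv h g)
    conv-agree h e m m<N = conv-cong-terms m (λ a b q → *-congˡ (e b (ℕ.≤-<-trans (≡.subst (b ℕ.≤_) q (ℕ.m≤n+m b a)) m<N)))

    -- 1/f is the fixed point of g ↦ 1 - x (tail f) g. Iteration from 0 settles one more coefficient
    -- each time, and the inverse is the diagonal of the iterates.
    module Inverse (f : S) (f0 : f 0 ≈ 1#) where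

      private
        approx : ℕ → S
        approx zero    = λ _ → 0#
        approx (suc N) = λ n → const 1# n - shift 1 (conv (tail f) (approx N)) n

        approx-agree : ∀ N → Agree N (approx N) (approx (suc N))
        approx-agree (suc N) m m<N = +-congˡ (-‿cong (shift-agree 1 (conv-agree (tail f) (approx-agree N)) m m<N))

        approx-agree′ : ∀ d N → Agree N (approx N) (approx (d ℕ.+ N))
        approx-agree′ zero    N m m<N = refl
        approx-agree′ (suc d) N m m<N = trans (approx-agree′ d N m m<N) (approx-agree (d ℕ.+ N) m (ℕ.<-≤-trans m<N (ℕ.m≤n+m N d)))

      inverse : S
      inverse n = approx (suc n) n

      private
        inverse-agree : ∀ N → Agree N inverse (approx N)
        inverse-agree N m m<N = trans (approx-agree′ (N ℕ.∸ suc m) (suc m) m ℕ.≤-refl) (reflexive (≡.cong (λ k → approx k m) (ℕ.m∸n+n≡m m<N)))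

      *-inverse : conv f inverse ≋ const 1#
      *-inverse = pw λ n → trans (step n) (cancel n)
        where
        step : ∀ n → conv f inverse n ≈ inverse n + shift 1 (conv (tail f) inverse) n
        step zero    = trans (*-congʳ f0) (trans (*-identityˡ _) (sym (+-identityʳ _)))
        step (suc n) = +-congʳ (trans (*-congʳ f0) (*-identityˡ _))
        cancel : ∀ n → inverse n + shift 1 (conv (tail f) inverse) n ≈ const 1# n
        cancel n = trans (+-congˡ (shift-agree 1 (conv-agree (tail f) (inverse-agree n)) n ℕ.≤-refl))
          (solve 2 (λ a b → (a :- b) :+ b := a) refl (const 1# n) (shift 1 (conv (tail f) (approx n)) n))
          where open Solver

  -- The recursion (k+1) binom(N, k+1) = (N - k) binom(N, k) without subtraction, valid also for k >
  -- N.
  binomial-step : ∀ N k → suc k ℕ.* (N C suc k) ℕ.+ k ℕ.* (N C k) ≡ N ℕ.* (N C k)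
  binomial-step N k = ℕ.+-cancelˡ-≡ (N C k) _ _ (begin
    N C k ℕ.+ (suc k ℕ.* (N C suc k) ℕ.+ k ℕ.* (N C k))  ≡⟨ solve 3 (λ c d k → c :+ ((con 1 :+ k) :* d :+ k :* c) := (con 1 :+ k) :* (c :+ d)) ≡.refl (N C k) (N C suc k) k ⟩
    suc k ℕ.* (N C k ℕ.+ N C suc k)                      ≡⟨ ≡.cong (suc k ℕ.*_) (C.nCk+nC[k+1]≡[n+1]C[k+1] N k) ⟩
    suc k ℕ.* (suc N C suc k)                            ≡⟨ binomial-absorption N k ⟩
    suc N ℕ.* (N C k)                                    ∎)
    where
    open ≡.≡-Reasoning
    open import Data.Nat.Solver using (module +-*-Solver)
    open +-*-Solver

  -- Finite sums and fraction-free linear algebra over a domain.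

  module FinSum (R : CommutativeRing 0ℓ 0ℓ) where

    open CommutativeRing R hiding (zero)
    open Kit.Solver R

    ∑ : ∀ r → (Fin r → Carrier) → Carrier
    ∑ zero    f = 0#
    ∑ (suc r) f = f Fin.zero + ∑ r (λ k → f (Fin.suc k))

    ∑-cong : ∀ r {f g : Fin r → Carrier} → (∀ k → f k ≈ g k) → ∑ r f ≈ ∑ r g
    ∑-cong zero    e = refl
    ∑-cong (suc r) e = +-cong (e Fin.zero) (∑-cong r (λ k → e (Fin.suc k)))

    ∑-zero : ∀ r {f : Fin r → Carrier} → (∀ k → f k ≈ 0#) → ∑ r f ≈ 0#
    ∑-zero zero    e = refl
    ∑-zero (suc r) e = trans (+-cong (e Fin.zero) (∑-zero r (λ k → e (Fin.suc k)))) (+-identityˡ 0#)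

    ∑-single : ∀ r {f : Fin r → Carrier} i → (∀ k → ¬ k ≡ i → f k ≈ 0#) → ∑ r f ≈ f i
    ∑-single (suc r) Fin.zero    h = trans (+-congˡ (∑-zero r (λ k → h (Fin.suc k) (λ ())))) (+-identityʳ _)
    ∑-single (suc r) (Fin.suc i) h = trans (+-cong (h Fin.zero (λ ())) (∑-single r i (λ k ne → h (Fin.suc k) (λ e → ne (Fin.suc-injective e))))) (+-identityˡ _)

    ∑-additive : ∀ r (φ : Carrier → Carrier) → φ 0# ≈ 0# → (∀ x y → φ (x + y) ≈ φ x + φ y) → ∀ f → ∑ r (λ k → φ (f k)) ≈ φ (∑ r f)
    ∑-additive zero    φ φ0 φ+ f = sym φ0
    ∑-additive (suc r) φ φ0 φ+ f = trans (+-congˡ (∑-additive r φ φ0 φ+ (λ k → f (Fin.suc k)))) (sym (φ+ (f Fin.zero) (∑ r (λ k → f (Fin.suc k)))))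

    ∑-scale : ∀ r a (f : Fin r → Carrier) → ∑ r (λ k → a * f k) ≈ a * ∑ r f
    ∑-scale zero    a f = sym (zeroʳ a)
    ∑-scale (suc r) a f = trans (+-congˡ (∑-scale r a (λ k → f (Fin.suc k)))) (sym (distribˡ a _ _))

    ∑-eliminate : ∀ r a b (g x y : Fin r → Carrier) → ∑ r (λ k → g k * (a * x k - y k * b)) ≈ a * ∑ r (λ k → g k * x k) - ∑ r (λ k → g k * y k) * b
    ∑-eliminate zero    a b g x y = solve 2 (λ a b → con (+ 0) := a :* con (+ 0) :- con (+ 0) :* b) refl a b
    ∑-eliminate (suc r) a b g x y = trans (+-congˡ (∑-eliminate r a b (λ k → g (Fin.suc k)) (λ k → x (Fin.suc k)) (λ k → y (Fin.suc k))))
      (solve 7 (λ a b g x y s t → g :* (a :* x :- y :* b) :+ (a :* s :- t :* b) := a :* (g :* x :+ s) :- (g :* y :+ t) :* b) refl a b (g Fin.zero) (x Fin.zero) (y Fin.zero) _ _)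

  module SeriesSum (R : CommutativeRing 0ℓ 0ℓ) where

    open CommutativeRing R hiding (zero)
    open Series R
    open FinSum series

    ∑-coefficient-zero : ∀ r (f : Fin r → S) n → (∀ k → f k n ≈ 0#) → ∑ r f n ≈ 0#
    ∑-coefficient-zero zero    f n h = refl
    ∑-coefficient-zero (suc r) f n h = trans (+-cong (h Fin.zero) (∑-coefficient-zero r (λ k → f (Fin.suc k)) n (λ k → h (Fin.suc k)))) (+-identityˡ 0#)

    ∑-coefficient : ∀ r (f : Fin r → S) n i → (∀ k → ¬ k ≡ i → f k n ≈ 0#) → ∑ r f n ≈ f i n
    ∑-coefficient (suc r) f n Fin.zero    h = trans (+-congˡ (∑-coefficient-zero r (λ k → f (Fin.suc k)) n (λ k → h (Fin.suc k) (λ ())))) (+-identityʳ _)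
    ∑-coefficient (suc r) f n (Fin.suc i) h = trans (+-cong (h Fin.zero (λ ())) (∑-coefficient r (λ k → f (Fin.suc k)) n i (λ k ne → h (Fin.suc k) (λ e → ne (Fin.suc-injective e))))) (+-identityˡ _)

  Domain : CommutativeRing 0ℓ 0ℓ → Set
  Domain R = ∀ x y → x * y ≈ 0# → ¬ x ≈ 0# → y ≈ 0#
    where open CommutativeRing R

  -- One step of fraction-free elimination with pivot w₀(i₀).
  module Elimination (R : CommutativeRing 0ℓ 0ℓ)
    (domain : Domain R)
    (1≉0 : ¬ CommutativeRing._≈_ R (CommutativeRing.1# R) (CommutativeRing.0# R)) where

    open CommutativeRing R hiding (zero)
    open Kit.Solver R
    open FinSum R

    -- A relation among r rows whose columns are indexed by an arbitrary set. `nontrivial` merely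
    -- denies that all coefficients vanish: for series the nonzero one cannot be located.
    record Dependent {I : Set} (r : ℕ) (w : Fin r → I → Carrier) : Set where
      field
        h          : Fin r → Carrier
        nontrivial : ¬ (∀ k → h k ≈ 0#)
        relation   : ∀ i → ∑ r (λ k → h k * w k i) ≈ 0#
    open Dependent public

    module _ {I : Set} {r : ℕ} (i₀ : I) (w : Fin (suc r) → I → Carrier) where

      private
        π : Carrier
        π = w Fin.zero i₀

      eliminate : Fin r → I → Carrier
      eliminate k i = π * w (Fin.suc k) i - w (Fin.suc k) i₀ * w Fin.zero i

      -- Column i₀ of the relation expresses π h₀ through the other coefficients, so h₀ drops out of
      -- the eliminated rows. Were the others all zero, π h₀ = 0 would force h₀ = 0.
      descend : ¬ π ≈ 0# → Dependent (suc r) w → Dependent r eliminate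
      descend n D = record { h = h′ ; nontrivial = nontrivial′ ; relation = relation′ }
        where
        h₀ : Carrier
        h₀ = h D Fin.zero
        h′ : Fin r → Carrier
        h′ k = h D (Fin.suc k)
        tail-sum : I → Carrier
        tail-sum i = ∑ r (λ k → h′ k * w (Fin.suc k) i)
        rest : ∀ i → tail-sum i ≈ - (h₀ * w Fin.zero i)
        rest i = trans (solve 2 (λ a b → b := (a :+ b) :- a) refl (h₀ * w Fin.zero i) (tail-sum i)) (trans (+-congʳ (relation D i)) (+-identityˡ _))
        nontrivial′ : ¬ (∀ k → h′ k ≈ 0#)
        nontrivial′ z = nontrivial D all-zero
          where
          tail-zero : tail-sum i₀ ≈ 0#
          tail-zero = ∑-zero r (λ k → trans (*-congʳ (z k)) (zeroˡ (w (Fin.suc k) i₀)))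
          πh : π * h₀ ≈ 0#
          πh = trans (solve 2 (λ π h → π :* h := :- (:- (h :* π))) refl π h₀)
            (trans (-‿cong (trans (sym (rest i₀)) tail-zero)) (solve 0 (:- con (+ 0) := con (+ 0)) refl))
          all-zero : ∀ k → h D k ≈ 0#
          all-zero Fin.zero    = domain π h₀ πh n
          all-zero (Fin.suc k) = z k
        relation′ : ∀ i → ∑ r (λ k → h′ k * eliminate k i) ≈ 0#
        relation′ i = trans (∑-eliminate r π (w Fin.zero i) h′ (λ k → w (Fin.suc k) i) (λ k → w (Fin.suc k) i₀)) (trans
          (+-cong (*-congˡ (rest i)) (-‿cong (*-congʳ (rest i₀))))
          (solve 3 (λ π h w → π :* (:- (h :* w)) :- (:- (h :* π)) :* w := con (+ 0)) refl π h₀ (w Fin.zero i)))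

      -- Expanding the eliminated rows gives the factor π to rows 1, ..., r and to row 0 minus the
      -- value of the combination at column i₀.
      ascend : ¬ π ≈ 0# → Dependent r eliminate → Dependent (suc r) w
      ascend n E = record { h = H ; nontrivial = λ z → nontrivial E (λ k → domain π (h E k) (z (Fin.suc k)) n) ; relation = H-relation }
        where
        s₀ : Carrier
        s₀ = ∑ r (λ k → h E k * w (Fin.suc k) i₀)
        H : Fin (suc r) → Carrier
        H Fin.zero    = - s₀
        H (Fin.suc k) = π * h E k
        H-relation : ∀ i → ∑ (suc r) (λ k → H k * w k i) ≈ 0#
        H-relation i = trans (+-congˡ (trans (∑-cong r (λ k → *-assoc π (h E k) (w (Fin.suc k) i))) (∑-scale r π (λ k → h E k * w (Fin.suc k) i))))
          (trans (solve 4 (λ s w π t → (:- s) :* w :+ π :* t := π :* t :- s :* w) refl s₀ (w Fin.zero i) π (∑ r (λ k → h E k * w (Fin.suc k) i)))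
            (trans (sym (∑-eliminate r π (w Fin.zero i) (h E) (λ k → w (Fin.suc k) i) (λ k → w (Fin.suc k) i₀))) (relation E i)))

    zero⇒dependent : ∀ {I r} (w : Fin (suc r) → I → Carrier) → (∀ i → w Fin.zero i ≈ 0#) → Dependent (suc r) w
    zero⇒dependent {r = r} w z = record { h = unit ; nontrivial = λ e → 1≉0 (e Fin.zero) ; relation = unit-relation }
      where
      unit : Fin (suc r) → Carrier
      unit Fin.zero    = 1#
      unit (Fin.suc _) = 0#
      unit-relation : ∀ i → ∑ (suc r) (λ k → unit k * w k i) ≈ 0#
      unit-relation i = trans (+-cong (trans (*-identityˡ (w Fin.zero i)) (z i)) (∑-zero r (λ k → zeroˡ (w (Fin.suc k) i)))) (+-identityˡ 0#)

  ¬¬-bound : ∀ {r} (P : Fin r → ℕ → Set) → (∀ k {v w} → v ℕ.≤ w → P k v → P k w) → (∀ k → ¬ ¬ ∃ (P k)) → ¬ ¬ ∃ λ v → ∀ k → P k v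
  ¬¬-bound {zero}  P mono h c = c (0 , λ ())
  ¬¬-bound {suc r} P mono h c = h Fin.zero (λ (v , pv) → ¬¬-bound (λ k → P (Fin.suc k)) (λ k → mono (Fin.suc k)) (λ k → h (Fin.suc k))
    (λ (w , pw) → c (v ℕ.+ w , λ { Fin.zero → mono Fin.zero (ℕ.m≤m+n v w) pv ; (Fin.suc k) → mono (Fin.suc k) (ℕ.m≤n+m w v) (pw k) })))

  ∃-bound : ∀ {r} (o : Fin r → ℕ) → ∃ λ b → ∀ k → o k ℕ.≤ b
  ∃-bound {zero}  o = 0 , λ ()
  ∃-bound {suc r} o with ∃-bound (λ k → o (Fin.suc k))
  ... | b , h = o Fin.zero ℕ.+ b , λ { Fin.zero → ℕ.m≤m+n _ b ; (Fin.suc k) → ℕ.≤-trans (h k) (ℕ.m≤n+m b _) }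

  -- Series over O and their reductions modulo p.

  module Padics (p : ℕ) (pr : Prime p) (𝕂 : PadicIntegers p) where

    open PadicIntegers 𝕂 public using (ring; Div; torsion-free; p-prime; p∣?; separated; approximate; Div-fromℕ; inverse; teich; teich-*; teich-1; teich-cong; teich-reduce; teich-^p)
    open CommutativeRing ring public hiding (ring; zero)
    open Kit ring public
    module Q = Quotient ring (fromℕ p)
    open Q public using (_∼_; ≈⇒∼)

    residue : CommutativeRing 0ℓ 0ℓ
    residue = Q.quotient

    module R = CommutativeRing residue
    module E = Series ring
    module M = Series residue
    open E public using (S; tail; conv; const; X; shift; θ; scale; at; pw; _≋_; series)
    module Ŝ = CommutativeRing series
    module S̄ = CommutativeRing M.series
    open M public using () renaming (_≋_ to _≡ₚ_; pw to pwₚ; at to atₚ)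

    0ₛ : S
    0ₛ = λ _ → 0#

    infixr 7 _·_
    _·_ : ℕ → S → S
    (m · f) n = fromℕ m * f n

    exact⇒mod : ∀ {f g} → f ≋ g → f ≡ₚ g
    exact⇒mod e = pwₚ (λ n → ≈⇒∼ (at e n))

    quotient : ∀ {f g} → f ≡ₚ g → ∃ λ h → ∀ n → f n ≈ g n + fromℕ p * h n
    quotient e = (λ n → _∼_.witness (atₚ e n)) , (λ n → _∼_.eq (atₚ e n))

    module _ where
      open Solver

      cancel-ℕ : ∀ n a → ¬ n ≡ 0 → fromℕ n * a ≈ 0# → a ≈ 0#
      cancel-ℕ n a n≢0 e with prime-split pr n n≢0
      ... | v , u , e′ , ¬d with inverse u ¬d
      ... | w , e″ = go v (begin
          fromℕ (p ℕ.^ v) * a                                   ≈⟨ solve 2 (λ x a → x :* a := x :* con (+ 1) :* a) refl _ a ⟩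
          fromℕ (p ℕ.^ v) * 1# * a                              ≈⟨ *-congʳ (*-congˡ e″) ⟨
          fromℕ (p ℕ.^ v) * (fromℕ u * w) * a                   ≈⟨ solve 4 (λ x u w a → x :* (u :* w) :* a := w :* ((x :* u) :* a)) refl _ _ _ _ ⟩
          w * ((fromℕ (p ℕ.^ v) * fromℕ u) * a)                 ≈⟨ *-congˡ (*-congʳ (fromℕ-* (p ℕ.^ v) u)) ⟨
          w * (fromℕ (p ℕ.^ v ℕ.* u) * a)                       ≡⟨ ≡.cong (λ z → w * (fromℕ z * a)) e′ ⟨
          w * (fromℕ n * a)                                     ≈⟨ *-congˡ e ⟩
          w * 0#                                                ≈⟨ zeroʳ w ⟩
          0#                                                    ∎)
        where
        open Relation.Binary.Reasoning.Setoid setoid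
        go : ∀ v → fromℕ (p ℕ.^ v) * a ≈ 0# → a ≈ 0#
        go zero    e = trans (sym (trans (*-congʳ (+-identityʳ 1#)) (*-identityˡ a))) e
        go (suc v) e = go v (torsion-free _ (trans (sym (*-assoc _ _ a)) (trans (*-congʳ (sym (fromℕ-* p (p ℕ.^ v)))) e)))

      cancel-ℕ′ : ∀ n {a b} → ¬ n ≡ 0 → fromℕ n * a ≈ fromℕ n * b → a ≈ b
      cancel-ℕ′ n {a} {b} n≢0 e = x-y≈0⇒x≈y (cancel-ℕ n _ n≢0 (trans (solve 3 (λ n a b → n :* (a :- b) := n :* a :- n :* b) refl _ a b) (x≈y⇒x-y≈0 e)))

      p≢0 : ¬ p ≡ 0
      p≢0 = ℕ.≢-nonZero⁻¹ p {{prime⇒nonZero pr}}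

      p>1 : 1 ℕ.< p
      p>1 = ℕ.nonTrivial⇒n>1 p {{prime⇒nonTrivial pr}}

      1≁0 : ¬ 1# ∼ 0#
      1≁0 (h Q., e) = ℕ.<⇒≱ p>1 (ℕ.∣⇒≤ (≡.subst (ℕ._∣ 1) (ℕ.*-identityʳ p) (Div-fromℕ 1 1 (h , trans (+-identityʳ 1#) (trans e (trans (+-identityˡ _)
          (*-congʳ (reflexive (≡.cong fromℕ (≡.sym (ℕ.*-identityʳ p)))))))))))

      infix 4 _∼?_
      _∼?_ : ∀ a b → Dec (a ∼ b)
      a ∼? b = Dec.map′ (λ (h , e) → h Q., trans (solve 2 (λ a b → a := b :+ (a :- b)) refl a b) (+-congˡ e))
                        (λ (h Q., e) → h , trans (+-congʳ e) (solve 2 (λ b h → (b :+ h) :- b := h) refl b _)) (p∣? (a - b))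

      ∼-domain : ∀ {a b} → a * b ∼ 0# → a ∼ 0# ⊎ b ∼ 0#
      ∼-domain {a} {b} (h Q., e) = Sum.map f f (p-prime a b (h , trans e (+-identityˡ _)))
        where
        f : ∀ {c} → Div p c → c ∼ 0#
        f (h , e) = h Q., trans e (sym (+-identityˡ _))

      Zero : S → Set
      Zero f = f ≡ₚ 0ₛ

      zero-stable : ∀ {f} → ¬ ¬ Zero f → Zero f
      zero-stable {f} nn = pwₚ (λ n → decidable-stable (f n ∼? 0#) (λ k → nn (λ z → k (atₚ z n))))

      -- Given some coefficient of f nonzero modulo p, the zeros in front of the first such
      -- coefficient are stripped, and then the coefficients of g vanish one by one. Such a
      -- coefficient exists only up to double negation, which `zero-stable` absorbs.
      series-domain : ∀ f g → conv f g ≡ₚ 0ₛ → ¬ Zero f → Zero g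
      series-domain f g e ¬f = zero-stable (λ ¬g → ¬f (pwₚ (λ n → decidable-stable (f n ∼? 0#) (λ c → ¬g (pwₚ (go n f e c))))))
        where
        leading : ∀ f → ¬ f 0 ∼ 0# → ∀ g → conv g f ≡ₚ 0ₛ → ∀ m → g m ∼ 0#
        leading f c g e zero with ∼-domain {g 0} {f 0} (atₚ e 0)
        ... | inj₁ z = z
        ... | inj₂ z = contradiction z c
        leading f c g e (suc m) = leading f c (tail g) (pwₚ λ n → R.trans
          (R.trans (R.sym (R.+-identityˡ _)) (R.+-congʳ (R.sym (R.trans (R.*-congʳ (leading f c g e 0)) (R.zeroˡ _))))) (atₚ e (suc n))) m

        go : ∀ n f → conv f g ≡ₚ 0ₛ → ¬ f n ∼ 0# → ∀ m → g m ∼ 0#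
        go n f e c m with f 0 ∼? 0#
        ... | no ¬z = leading f ¬z g (S̄.trans (S̄.*-comm g f) e) m
        go zero    f e c m | yes z = contradiction z c
        go (suc n) f e c m | yes z = go n (tail f) (pwₚ λ k → R.trans
          (R.trans (R.sym (R.+-identityˡ _)) (R.+-congʳ (R.sym (R.trans (R.*-congʳ z) (R.zeroˡ _))))) (atₚ e (suc k))) c m

      series-cancel-ℕ : ∀ n {f g} → ¬ n ≡ 0 → n · f ≋ n · g → f ≋ g
      series-cancel-ℕ n n≢0 e = pw (λ k → cancel-ℕ′ n n≢0 (at e k))

      -- As A(0) = 0, the coefficient of AD at j involves D only below j, so j D_j = 0 by induction,
      -- and O has no torsion. The bound m serves the truncated equations of Dwork's argument.
      ode-zero : ∀ {A D : S} m → A 0 ≈ 0# → D 0 ≈ 0# → (∀ j → j ℕ.< m → θ D j ≈ conv A D j) → ∀ j → j ℕ.< m → D j ≈ 0#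
      ode-zero {A} {D} m a0 d0 h = <-rec _ go
        where
        go : ∀ j → (∀ {i} → i ℕ.< j → i ℕ.< m → D i ≈ 0#) → j ℕ.< m → D j ≈ 0#
        go zero    rec _   = d0
        go (suc j) rec j<m = cancel-ℕ (suc j) _ (λ ()) (trans (h (suc j) j<m) (E.conv-zero (suc j) vanish))
          where
          vanish : ∀ a b → a ℕ.+ b ≡ suc j → A a * D b ≈ 0#
          vanish zero    b e = trans (*-congʳ a0) (zeroˡ _)
          vanish (suc a) b e = trans (*-congˡ (rec b<j (ℕ.<-trans b<j j<m))) (zeroʳ _)
            where
            b<j : b ℕ.< suc j
            b<j = ≡.subst (suc b ℕ.≤_) e (s≤s (ℕ.m≤n+m b a))

      ode-unique : ∀ {A f g : S} → A 0 ≈ 0# → θ f ≋ conv A f → θ g ≋ conv A g → f 0 ≈ g 0 → f ≋ g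
      ode-unique {A} {f} {g} a0 ef eg e0 = pw (λ n → x-y≈0⇒x≈y (ode-zero (suc n) a0 (x≈y⇒x-y≈0 e0) (λ j _ → eq j) n ℕ.≤-refl))
        where
        D : S
        D = f Ŝ.- g
        eq : ∀ j → θ D j ≈ conv A D j
        eq j = trans (solve 3 (λ n f g → n :* (f :- g) := n :* f :- n :* g) refl _ (f j) (g j))
          (trans (+-cong (at ef j) (-‿cong (at eg j))) (sym (at (K.solve 3 (λ a f g → a K.:* (f K.:- g) K.:= a K.:* f K.:- a K.:* g) Ŝ.refl A f g) j)))
          where module K = Kit.Solver series

    module SE = SeriesPowers ring
    module SM = SeriesPowers residue
    module KS = Kit series

    residue-char : fromℕ p ∼ 0#
    residue-char = 1# Q., trans (sym (*-identityʳ _)) (sym (+-identityˡ _))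

    series-char : Kit.fromℕ M.series p ≡ₚ 0ₛ
    series-char = S̄.trans (SM.fromℕ-const p) (pwₚ λ { zero → residue-char ; (suc n) → R.refl })

    residue-fermat : ∀ a → a ^ p ∼ a
    residue-fermat a with approximate a 1
    ... | b , h , e = R.trans (Kit.^-cong residue p a∼b) (R.trans (nat b) (R.sym a∼b))
      where
      a∼b : a ∼ fromℕ b
      a∼b = h Q., trans e (+-congˡ (*-congʳ (reflexive (≡.cong fromℕ (ℕ.*-identityʳ p)))))
      open CharP residue pr residue-char
      zero^ : ∀ q → NonZero q → 0# ^ q ∼ 0#
      zero^ (suc q) _ = R.zeroˡ _
      nat : ∀ b → fromℕ b ^ p ∼ fromℕ b
      nat zero    = zero^ p (prime⇒nonZero pr)
      nat (suc b) = R.trans (freshman-char 1# (fromℕ b)) (R.+-cong (Kit.1^ residue p) (nat b))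

    private
      p-1 : ℕ
      p-1 = ℕ.pred p

      suc-p-1 : suc p-1 ≡ p
      suc-p-1 = ℕ.suc-pred p {{prime⇒nonZero pr}}

      -- `gap j` puts j zeros before going on with `φ′`; j = p - 1 moves the k-th coefficient to
      -- x^(kp). The mutual form is structurally recursive in the index.
      gap : ℕ → S → S
      φ′ : S → S
      φ′ f zero    = f 0
      φ′ f (suc n) = gap p-1 (tail f) n
      gap zero    f n       = φ′ f n
      gap (suc j) f zero    = 0#
      gap (suc j) f (suc n) = gap j f n

      gap≡shift : ∀ j f n → gap j f n ≡ shift j (φ′ f) n
      gap≡shift zero    f n       = ≡.refl
      gap≡shift (suc j) f zero    = ≡.refl
      gap≡shift (suc j) f (suc n) = gap≡shift j f n

    -- φ is the substitution x ↦ x^p, a lift of the Frobenius.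
    φ : S → S
    φ = φ′

    φ-unfold : ∀ f n → φ f n ≈ const (f 0) n + shift (suc p-1) (φ (tail f)) n
    φ-unfold f zero    = sym (+-identityʳ _)
    φ-unfold f (suc n) = trans (reflexive (gap≡shift p-1 (tail f) n)) (sym (+-identityˡ _))

    -- By φ(f) = f(0) + x^p φ(tail f), a coefficient depends on earlier coefficients of φ(tail f)
    -- only. The bound N makes this a structural induction, here and for the next properties of φ.
    φ-cong : ∀ {f g} → f ≋ g → φ f ≋ φ g
    φ-cong {f} {g} e = pw λ n → go n (suc n) ℕ.≤-refl e
      where
      go : ∀ n N → n ℕ.< N → ∀ {f g} → f ≋ g → φ f n ≈ φ g n
      go n (suc N) n<N {f} {g} e = trans (φ-unfold f n) (trans (+-cong (const-cong n) (SE.shift-agree (suc p-1)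
          (λ m m<N → go m N m<N (pw (λ k → at e (suc k)))) n (ℕ.<-≤-trans n<N (s≤s (ℕ.m≤n+m N p-1))))) (sym (φ-unfold g n)))
        where
        const-cong : ∀ n → const (f 0) n ≈ const (g 0) n
        const-cong zero    = at e 0
        const-cong (suc n) = refl

    φ-linear : ∀ c f g → φ (λ n → c * f n + g n) ≋ (λ n → c * φ f n + φ g n)
    φ-linear c f g = pw λ n → go n (suc n) ℕ.≤-refl f g
      where
      go : ∀ n N → n ℕ.< N → ∀ f g → φ (λ n → c * f n + g n) n ≈ c * φ f n + φ g n
      go n (suc N) n<N f g = begin
        φ h n
          ≈⟨ φ-unfold h n ⟩
        const (h 0) n + shift (suc p-1) (φ (tail h)) n
          ≈⟨ +-cong (const-lin n) (SE.shift-agree (suc p-1) (λ m m<N → go m N m<N (tail f) (tail g)) n (ℕ.<-≤-trans n<N (s≤s (ℕ.m≤n+m N p-1)))) ⟩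
        (c * const (f 0) n + const (g 0) n) + shift (suc p-1) (λ m → c * φ (tail f) m + φ (tail g) m) n
          ≈⟨ +-congˡ (trans (SE.shift-+ (suc p-1) _ _ n) (+-congʳ (SE.shift-scale (suc p-1) c _ n))) ⟩
        (c * const (f 0) n + const (g 0) n) + (c * shift (suc p-1) (φ (tail f)) n + shift (suc p-1) (φ (tail g)) n)
          ≈⟨ solve 5 (λ c a b x y → (c :* a :+ b) :+ (c :* x :+ y) := c :* (a :+ x) :+ (b :+ y)) refl c _ _ _ _ ⟩
        c * (const (f 0) n + shift (suc p-1) (φ (tail f)) n) + (const (g 0) n + shift (suc p-1) (φ (tail g)) n)
          ≈⟨ +-cong (*-congˡ (φ-unfold f n)) (φ-unfold g n) ⟨
        c * φ f n + φ g n ∎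
        where
        open Relation.Binary.Reasoning.Setoid setoid
        open Solver
        h : S
        h n = c * f n + g n
        const-lin : ∀ n → const (h 0) n ≈ c * const (f 0) n + const (g 0) n
        const-lin zero    = refl
        const-lin (suc n) = sym (trans (+-congʳ (zeroʳ c)) (+-identityˡ 0#))

    φ-* : ∀ f g → φ (conv f g) ≋ conv (φ f) (φ g)
    φ-* f g = pw λ n → go n (suc n) ℕ.≤-refl f
      where
      go : ∀ n N → n ℕ.< N → ∀ f → φ (conv f g) n ≈ conv (φ f) (φ g) n
      go n (suc N) n<N f = begin
        φ (conv f g) n
          ≈⟨ φ-unfold (conv f g) n ⟩
        const (f 0 * g 0) n + sh (φ (tail (conv f g)))
          ≈⟨ +-congˡ (E.shift-cong (suc p-1) (at (φ-linear (f 0) (tail g) (conv (tail f) g))) n) ⟩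
        const (f 0 * g 0) n + sh (λ m → f 0 * φ (tail g) m + φ (conv (tail f) g) m)
          ≈⟨ +-cong (const-scale n) (SE.shift-+ (suc p-1) _ _ n) ⟩
        f 0 * const (g 0) n + (sh (λ m → f 0 * φ (tail g) m) + sh (φ (conv (tail f) g)))
          ≈⟨ +-congˡ (+-cong (SE.shift-scale (suc p-1) (f 0) _ n) (SE.shift-agree (suc p-1) (λ m m<N → go m N m<N (tail f)) n (ℕ.<-≤-trans n<N (s≤s (ℕ.m≤n+m N p-1))))) ⟩
        f 0 * const (g 0) n + (f 0 * sh (φ (tail g)) + sh (conv (φ (tail f)) (φ g)))
          ≈⟨ solve 4 (λ a b c d → a :* b :+ (a :* c :+ d) := a :* (b :+ c) :+ d) refl _ _ _ _ ⟩
        f 0 * (const (g 0) n + sh (φ (tail g))) + sh (conv (φ (tail f)) (φ g))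
          ≈⟨ +-cong (*-congˡ (φ-unfold g n)) (E.conv-shiftˡ (suc p-1) (φ (tail f)) (φ g) n) ⟨
        f 0 * φ g n + conv (shift (suc p-1) (φ (tail f))) (φ g) n
          ≈⟨ +-congʳ (E.conv-const (f 0) (φ g) n) ⟨
        conv (const (f 0)) (φ g) n + conv (shift (suc p-1) (φ (tail f))) (φ g) n
          ≈⟨ at (Ŝ.distribʳ (φ g) (const (f 0)) (shift (suc p-1) (φ (tail f)))) n ⟨
        conv (λ m → const (f 0) m + shift (suc p-1) (φ (tail f)) m) (φ g) n
          ≈⟨ E.conv-cong (φ-unfold f) (λ _ → refl) n ⟨
        conv (φ f) (φ g) n ∎
        where
        open Relation.Binary.Reasoning.Setoid setoid
        open Solver
        sh : S → Carrier
        sh f = shift (suc p-1) f n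
        const-scale : ∀ n → const (f 0 * g 0) n ≈ f 0 * const (g 0) n
        const-scale zero    = refl
        const-scale (suc n) = sym (zeroʳ _)

    φ-multiple : ∀ f k → φ f (k ℕ.* p) ≈ f k
    φ-multiple f k = ≡.subst (λ q → φ f (k ℕ.* q) ≈ f k) suc-p-1 (go f k)
      where
      go : ∀ f k → φ f (k ℕ.* suc p-1) ≈ f k
      go f zero    = refl
      go f (suc k) = trans (reflexive (gap≡shift p-1 (tail f) (p-1 ℕ.+ k ℕ.* suc p-1))) (trans (E.shift-apply p-1 (φ (tail f)) (k ℕ.* suc p-1)) (go (tail f) k))

    φ-nonmultiple : ∀ f n → ¬ p ℕ.∣ n → φ f n ≈ 0#
    φ-nonmultiple f n ¬d = go n (suc n) ℕ.≤-refl f (λ d → ¬d (≡.subst (ℕ._∣ n) suc-p-1 d))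
      where
      go : ∀ n N → n ℕ.< N → ∀ f → ¬ suc p-1 ℕ.∣ n → φ f n ≈ 0#
      go zero    (suc N) n<N f ¬d = ⊥-elim (¬d (ℕ.divides 0 ≡.refl))
      go (suc n) (suc N) (s≤s n<N) f ¬d with n ℕ.<? p-1
      ... | yes n<p-1 = trans (reflexive (gap≡shift p-1 (tail f) n)) (SE.shift-small p-1 _ n n<p-1)
      ... | no  n≮p-1 = trans (reflexive (≡.trans (gap≡shift p-1 (tail f) n) (≡.cong (shift p-1 (φ (tail f))) (≡.sym n≡))))
        (trans (E.shift-apply p-1 _ (n ℕ.∸ p-1)) (go (n ℕ.∸ p-1) N (ℕ.≤-<-trans (ℕ.m∸n≤m n p-1) n<N) (tail f)
          (λ d → ¬d (≡.subst (suc p-1 ℕ.∣_) (≡.cong suc n≡) (ℕ.∣m∣n⇒∣m+n ℕ.∣-refl d)))))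
        where
        n≡ : p-1 ℕ.+ (n ℕ.∸ p-1) ≡ n
        n≡ = ℕ.m+[n∸m]≡n (ℕ.≮⇒≥ n≮p-1)

    -- The chain rule for x ↦ x^p.
    θ-φ : ∀ f → θ (φ f) ≋ p · φ (θ f)
    θ-φ f = pw go
      where
      open Solver
      go : ∀ n → fromℕ n * φ f n ≈ fromℕ p * φ (θ f) n
      go n with p ℕ.∣? n
      ... | no ¬d = trans (*-congˡ (φ-nonmultiple f n ¬d)) (trans (zeroʳ _) (sym (trans (*-congˡ (φ-nonmultiple (θ f) n ¬d)) (zeroʳ _))))
      ... | yes (ℕ.divides k ≡.refl) = trans (*-cong (fromℕ-* k p) (φ-multiple f k))
        (trans (solve 3 (λ k p f → (k :* p) :* f := p :* (k :* f)) refl _ _ _) (*-congˡ (sym (φ-multiple (θ f) k))))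

    -- The Frobenius of 𝔽_p[[x]] is the substitution x ↦ x^p.
    frobenius : ∀ T → T KS.^ p ≡ₚ φ T
    frobenius T = pwₚ λ n → go n (suc n) ℕ.≤-refl T
      where
      module KM = Kit M.series
      open CharP M.series pr series-char
      go : ∀ n N → n ℕ.< N → ∀ T → (T KS.^ p) n ∼ φ T n
      go n (suc N) n<N T = R.trans (atₚ split n) (R.trans (R.+-cong (const-fermat n)
          (R.trans (≡.subst (λ q → shift p (tail T KS.^ p) n ∼ shift q (tail T KS.^ p) n) (≡.sym suc-p-1) R.refl)
            (SM.shift-agree (suc p-1) (λ m m<N → go m N m<N (tail T)) n (ℕ.<-≤-trans n<N (s≤s (ℕ.m≤n+m N p-1))))))
          (R.sym (≈⇒∼ (φ-unfold T n))))
        where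
        const-fermat : ∀ n → const (T 0 ^ p) n ∼ const (T 0) n
        const-fermat zero    = residue-fermat (T 0)
        const-fermat (suc n) = R.refl
        T≡ : T ≡ₚ const (T 0) S̄.+ conv X (tail T)
        T≡ = pwₚ λ { zero    → R.sym (R.trans (R.+-congˡ (M.X* (tail T) 0)) (R.+-identityʳ _))
                   ; (suc n) → R.sym (R.trans (R.+-congˡ (M.X* (tail T) (suc n))) (R.+-identityˡ _)) }
        split : T KS.^ p ≡ₚ const (T 0 ^ p) S̄.+ shift p (tail T KS.^ p)
        split = S̄.trans (KM.^-cong p T≡) (S̄.trans (freshman-char (const (T 0)) (conv X (tail T)))
          (S̄.+-cong (SM.const-^ (T 0) p) (S̄.trans (KM.^-distrib-* X (tail T) p) (SM.X^* p (tail T KS.^ p)))))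

    power? : ∀ m → Dec (∃ λ j → j ℕ.< suc m × p ℕ.^ j ≡ m)
    power? m = ℕ.anyUpTo? (λ j → p ℕ.^ j ℕ.≟ m) (suc m)

    j<p^j : ∀ j → j ℕ.< p ℕ.^ j
    j<p^j zero    = s≤s z≤n
    j<p^j (suc j) = ℕ.≤-trans (s≤s (j<p^j j)) (ℕ.≤-trans (ℕ.+-monoˡ-≤ (p ℕ.^ j) (ℕ.m^n>0 p {{prime⇒nonZero pr}} j))
      (ℕ.≤-trans (ℕ.≤-reflexive (≡.cong (p ℕ.^ j ℕ.+_) (≡.sym (ℕ.+-identityʳ _)))) (ℕ.*-monoˡ-≤ (p ℕ.^ j) p>1)))

    -- Y = Σ_j x^{p^j}
    Y : S
    Y m with power? m
    ... | yes _ = 1#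
    ... | no _  = 0#

    Y-power : ∀ j → Y (p ℕ.^ j) ≈ 1#
    Y-power j with power? (p ℕ.^ j)
    ... | yes _ = refl
    ... | no ¬e = ⊥-elim (¬e (j , ℕ.m<n⇒m<1+n (j<p^j j) , ≡.refl))

    Y-nonpower : ∀ m → (∀ j → ¬ p ℕ.^ j ≡ m) → Y m ≈ 0#
    Y-nonpower m h with power? m
    ... | yes (j , _ , e) = ⊥-elim (h j e)
    ... | no _ = refl

    Y0 : Y 0 ≈ 0#
    Y0 = Y-nonpower 0 (λ j e → ℕ.n≮0 (≡.subst (j ℕ.<_) e (j<p^j j)))

    -- Splitting off the term j = 0 of Y leaves Y(x^p). This functional equation is what Dwork's
    -- argument needs of Y besides Y(0) = 0.
    Y-frobenius : Y ≋ X Ŝ.+ φ Y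
    Y-frobenius = pw go
      where
      X-other : ∀ m → ¬ m ≡ 1 → X m ≈ 0#
      X-other zero          _  = refl
      X-other (suc zero)    ne = ⊥-elim (ne ≡.refl)
      X-other (suc (suc m)) _  = refl

      go : ∀ m → Y m ≈ X m + φ Y m
      go m with p ℕ.∣? m
      go m | yes (ℕ.divides k ≡.refl) = sym (trans (+-cong (X-other _ kp≢1) (φ-multiple Y k)) (trans (+-identityˡ _) (same (power? k))))
        where
        kp≢1 : ¬ k ℕ.* p ≡ 1
        kp≢1 e = ℕ.<⇒≱ p>1 (ℕ.∣⇒≤ (ℕ.divides k (≡.sym e)))
        same : Dec (∃ λ j → j ℕ.< suc k × p ℕ.^ j ≡ k) → Y k ≈ Y (k ℕ.* p)
        same (yes (j , _ , ≡.refl)) = trans (Y-power j) (sym (trans (reflexive (≡.cong Y (ℕ.*-comm (p ℕ.^ j) p))) (Y-power (suc j))))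
        same (no ¬e) = trans (Y-nonpower k h) (sym (Y-nonpower (k ℕ.* p) h′))
          where
          h : ∀ j → ¬ p ℕ.^ j ≡ k
          h j ≡.refl = ¬e (j , ℕ.m<n⇒m<1+n (j<p^j j) , ≡.refl)
          h′ : ∀ j → ¬ p ℕ.^ j ≡ k ℕ.* p
          h′ zero    e = kp≢1 (≡.sym e)
          h′ (suc j) e = h j (ℕ.*-cancelˡ-≡ (p ℕ.^ j) k p {{prime⇒nonZero pr}} (≡.trans e (ℕ.*-comm k p)))
      go m | no ¬d = sym (trans (+-congˡ (φ-nonmultiple Y m ¬d)) (trans (+-identityʳ _) (same m ¬d)))
        where
        same : ∀ m → ¬ p ℕ.∣ m → X m ≈ Y m
        same m ¬d with m ℕ.≟ 1
        ... | yes ≡.refl = sym (Y-power 0)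
        ... | no m≢1 = trans (X-other m m≢1) (sym (Y-nonpower m h))
          where
          h : ∀ j → ¬ p ℕ.^ j ≡ m
          h zero    e = m≢1 (≡.sym e)
          h (suc j) e = ¬d (≡.subst (p ℕ.∣_) e (ℕ.m∣m*n (p ℕ.^ j)))

    private
      -- (k+1)! = p^v u with v ≤ k and u prime to p, so p^(k+1)/(k+1)! is p times p^(k-v)/u.
      exp-coefficient : ∀ k → ∃ λ e → fromℕ (suc k !) * (fromℕ p * e) ≈ fromℕ p ^ suc k
      exp-coefficient k with factorial-split pr k
      ... | v , u , e , ¬d , v≤k with inverse u ¬d
      ... | w , e′ = fromℕ p ^ (k ℕ.∸ v) * w , (begin
        fromℕ (suc k !) * (π * (π ^ (k ℕ.∸ v) * w))                    ≡⟨ ≡.cong (λ z → fromℕ z * (π * (π ^ (k ℕ.∸ v) * w))) e ⟩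
        fromℕ (p ℕ.^ v ℕ.* u) * (π * (π ^ (k ℕ.∸ v) * w))              ≈⟨ *-congʳ (trans (fromℕ-* (p ℕ.^ v) u) (*-congʳ (fromℕ-^ p v))) ⟩
        (π ^ v * fromℕ u) * (π * (π ^ (k ℕ.∸ v) * w))                  ≈⟨ solve 5 (λ a u p b w → (a :* u) :* (p :* (b :* w)) := (p :* (a :* b)) :* (u :* w)) refl _ _ _ _ _ ⟩
        (π * (π ^ v * π ^ (k ℕ.∸ v))) * (fromℕ u * w)                  ≈⟨ *-cong (*-congˡ (sym (^-+ π v (k ℕ.∸ v)))) e′ ⟩
        (π * π ^ (v ℕ.+ (k ℕ.∸ v))) * 1#                               ≈⟨ *-identityʳ _ ⟩
        π * π ^ (v ℕ.+ (k ℕ.∸ v))                                      ≡⟨ ≡.cong (λ z → π * π ^ z) (ℕ.m+[n∸m]≡n v≤k) ⟩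
        π ^ suc k                                                      ∎)
        where
        open Relation.Binary.Reasoning.Setoid setoid
        open Solver
        π = fromℕ p

    -- The series exp(px); the factor p of each higher coefficient is kept visible for `expₚ≡1`.
    expₚ : S
    expₚ zero    = 1#
    expₚ (suc k) = fromℕ p * proj₁ (exp-coefficient k)

    private
      expₚ-coeff : ∀ k → fromℕ (k !) * expₚ k ≈ fromℕ p ^ k
      expₚ-coeff zero    = trans (*-identityʳ _) (+-identityʳ _)
      expₚ-coeff (suc k) = proj₂ (exp-coefficient k)

    θ-expₚ : θ expₚ ≋ conv (KS.fromℕ p) (conv X expₚ)
    θ-expₚ = pw λ n → trans (go n) (sym (trans (SE.fromℕ*-apply p (conv X expₚ) n) (*-congˡ (E.X* expₚ n))))
      where
      open Relation.Binary.Reasoning.Setoid setoid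
      open Solver
      go : ∀ n → fromℕ n * expₚ n ≈ fromℕ p * shift 1 expₚ n
      go zero    = trans (zeroˡ _) (sym (zeroʳ _))
      go (suc k) = cancel-ℕ′ (k !) (ℕ.≢-nonZero⁻¹ (k !) {{ℕ._!≢0 k}}) (begin
        fromℕ (k !) * (fromℕ (suc k) * expₚ (suc k))   ≈⟨ solve 3 (λ a b c → a :* (b :* c) := (b :* a) :* c) refl _ _ _ ⟩
        (fromℕ (suc k) * fromℕ (k !)) * expₚ (suc k)   ≈⟨ *-congʳ (fromℕ-* (suc k) (k !)) ⟨
        fromℕ (suc k !) * expₚ (suc k)                 ≈⟨ expₚ-coeff (suc k) ⟩
        fromℕ p * fromℕ p ^ k                          ≈⟨ *-congˡ (expₚ-coeff k) ⟨
        fromℕ p * (fromℕ (k !) * expₚ k)               ≈⟨ solve 3 (λ a b c → a :* (b :* c) := b :* (a :* c)) refl _ _ _ ⟩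
        fromℕ (k !) * (fromℕ p * expₚ k)               ∎)

    expₚ≡1 : expₚ ≡ₚ const 1#
    expₚ≡1 = pwₚ λ { zero → R.refl ; (suc k) → proj₁ (exp-coefficient k) Q., sym (+-identityˡ _) }

    -- Dwork's argument: if θT = YT below degree m, then D = φ(T)exp(px) - T^p solves θD = pYD below degree m,
    -- so D vanishes there, while D ≡ 0 mod p makes the obstruction in degree m divisible by m.
    private
      patch : S → ℕ → Carrier → S
      patch f m c n with n ℕ.≟ m
      ... | yes _ = c
      ... | no _  = f n

      patch-other : ∀ f m c n → ¬ n ≡ m → patch f m c n ≡ f n
      patch-other f m c n ne with n ℕ.≟ m
      ... | yes e = ⊥-elim (ne e)
      ... | no _  = ≡.refl

      patch-same : ∀ f m c → patch f m c m ≡ c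
      patch-same f m c with m ℕ.≟ m
      ... | yes _ = ≡.refl
      ... | no ne = ⊥-elim (ne ≡.refl)

      record Partial (m : ℕ) : Set where
        field
          body   : S
          body0  : body 0 ≈ 1#
          solves : ∀ j → j ℕ.< m → θ body j ≈ conv Y body j
      open Partial

      start : Partial 1
      start .body = const 1#
      start .body0 = refl
      start .solves zero (s≤s _) = trans (zeroˡ _) (sym (trans (*-congʳ Y0) (zeroˡ _)))

      module Step (m : ℕ) (0<m : 0 ℕ.< m) (t : Partial m) where

        F : S
        F = body t

        r : S
        r = θ F Ŝ.- conv Y F

        r≈0 : ∀ j → j ℕ.< m → r j ≈ 0#
        r≈0 j j<m = x≈y⇒x-y≈0 (solves t j j<m)

        D : S
        D = conv (φ F) expₚ Ŝ.- F KS.^ p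

        D≡0 : D ≡ₚ 0ₛ
        D≡0 = S̄.trans (S̄.+-cong (S̄.trans (S̄.*-congˡ expₚ≡1) (S̄.*-identityʳ (φ F))) (S̄.-‿cong (frobenius F))) (S̄.-‿inverseʳ (φ F))

        D0 : D 0 ≈ 0#
        D0 = x≈y⇒x-y≈0 (trans (trans (*-identityʳ _) (body0 t)) (sym (SE.^-coeff0 F p (body0 t))))

        π : S
        π = KS.fromℕ p

        error : S
        error = conv (φ r) expₚ Ŝ.- conv (F KS.^ p-1) r

        θF : θ F ≋ conv Y F Ŝ.+ r
        θF = solve 2 (λ a b → a := b :+ (a :- b)) Ŝ.refl (θ F) (conv Y F)
          where open Kit.Solver series

        φY : φ Y ≋ Y Ŝ.- X
        φY = Ŝ.trans (solve 2 (λ x y → y := (x :+ y) :- x) Ŝ.refl X (φ Y)) (Ŝ.+-congʳ (Ŝ.sym Y-frobenius))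
          where open Kit.Solver series

        φ-+ : ∀ f g → φ (f Ŝ.+ g) ≋ φ f Ŝ.+ φ g
        φ-+ f g = Ŝ.trans (φ-cong (pw λ n → +-congʳ (sym (*-identityˡ _)))) (Ŝ.trans (φ-linear 1# f g) (pw λ n → +-congʳ (*-identityˡ _)))

        -- φ turns θF = YF + r into p((Y - x) φF + φr), as φY = Y - x. The missing px is what the
        -- factor exp(px) of D supplies.
        θφF : θ (φ F) ≋ conv π (conv (Y Ŝ.- X) (φ F) Ŝ.+ φ r)
        θφF = Ŝ.trans (θ-φ F) (Ŝ.trans (pw λ n → sym (SE.fromℕ*-apply p _ n)) (Ŝ.*-congˡ
          (Ŝ.trans (φ-cong θF) (Ŝ.trans (φ-+ (conv Y F) r) (Ŝ.+-congʳ (Ŝ.trans (φ-* Y F) (Ŝ.*-congʳ φY)))))))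

        θF^p : θ (F KS.^ p) ≋ conv π (conv (F KS.^ p-1) (conv Y F Ŝ.+ r))
        θF^p = ≡.subst (λ q → θ (F KS.^ q) ≋ conv (KS.fromℕ q) (conv (F KS.^ p-1) (conv Y F Ŝ.+ r))) (ℕ.suc-pred p {{prime⇒nonZero pr}})
          (Ŝ.trans (SE.θ-^ F p-1) (Ŝ.*-congˡ (Ŝ.*-congˡ θF)))

        F^p : F KS.^ p ≋ conv F (F KS.^ p-1)
        F^p = ≡.subst (λ q → F KS.^ q ≋ conv F (F KS.^ p-1)) (ℕ.suc-pred p {{prime⇒nonZero pr}}) Ŝ.refl

        θD : θ D ≋ conv (conv π Y) D Ŝ.+ conv π error
        θD = begin
          θ D
            ≈⟨ pw (λ n → Solver.solve 3 (λ n a b → n Solver.:* (a Solver.:- b) Solver.:= n Solver.:* a Solver.:- n Solver.:* b) refl (fromℕ n) _ _) ⟩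
          θ (conv (φ F) expₚ) Ŝ.- θ (F KS.^ p)
            ≈⟨ Ŝ.+-cong (Ŝ.trans (pw (E.θ-* (φ F) expₚ)) (Ŝ.+-cong (Ŝ.*-congʳ θφF) (Ŝ.*-congˡ θ-expₚ))) (Ŝ.-‿cong θF^p) ⟩
          (conv (conv π (conv (Y Ŝ.- X) (φ F) Ŝ.+ φ r)) expₚ Ŝ.+ conv (φ F) (conv π (conv X expₚ))) Ŝ.- conv π (conv (F KS.^ p-1) (conv Y F Ŝ.+ r))
            ≈⟨ dwork-identity series π Y X (φ F) expₚ (F KS.^ p-1) F r (φ r) ⟩
          conv (conv π Y) (conv (φ F) expₚ Ŝ.- conv F (F KS.^ p-1)) Ŝ.+ conv π error
            ≈⟨ Ŝ.+-congʳ (Ŝ.*-congˡ (Ŝ.+-congˡ (Ŝ.-‿cong F^p))) ⟨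
          conv (conv π Y) D Ŝ.+ conv π error ∎
          where
          open Relation.Binary.Reasoning.Setoid Ŝ.setoid
          open Kit.Solver series

        -- Degree m itself is included: φr carries the k-th coefficient of r at kp, and kp ≤ m gives
        -- k < m.
        φr≈0 : ∀ j → j ℕ.≤ m → φ r j ≈ 0#
        φr≈0 j j≤m with p ℕ.∣? j
        ... | no ¬d = φ-nonmultiple r j ¬d
        ... | yes (ℕ.divides k ≡.refl) = trans (φ-multiple r k) (r≈0 k (k<m k j≤m))
          where
          k<m : ∀ k → k ℕ.* p ℕ.≤ m → k ℕ.< m
          k<m zero    _ = 0<m
          k<m (suc k) h = ℕ.<-≤-trans (ℕ.m<m*n (suc k) p p>1) h

        b≤ : ∀ {a b n} → a ℕ.+ b ≡ n → b ℕ.≤ n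
        b≤ {a} e = ≡.subst (_ ℕ.≤_) e (ℕ.m≤n+m _ a)

        a≤ : ∀ {a b n} → a ℕ.+ b ≡ n → a ℕ.≤ n
        a≤ {a} {b} e = ≡.subst (a ℕ.≤_) e (ℕ.m≤m+n a b)

        φr-term : ∀ j → j ℕ.≤ m → conv (φ r) expₚ j ≈ 0#
        φr-term j j≤m = E.conv-zero j (λ a b e → trans (*-congʳ (φr≈0 a (ℕ.≤-trans (a≤ e) j≤m))) (zeroˡ _))

        open Solver

        error-low : ∀ j → j ℕ.< m → error j ≈ 0#
        error-low j j<m = trans (+-cong (φr-term j (ℕ.<⇒≤ j<m)) (-‿cong (E.conv-zero j (λ a b e → trans (*-congˡ (r≈0 b (ℕ.≤-<-trans (b≤ {a} e) j<m))) (zeroʳ _)))))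
          (solve 0 (con (+ 0) :- con (+ 0) := con (+ 0)) refl)

        F^p-1r : conv (F KS.^ p-1) r m ≈ r m
        F^p-1r = trans (E.conv-single 0 m {F KS.^ p-1} {r} vanish) (trans (*-congʳ (SE.^-coeff0 F p-1 (body0 t))) (*-identityˡ (r m)))
          where
          vanish : ∀ a b → a ℕ.+ b ≡ m → ¬ a ≡ 0 → (F KS.^ p-1) a * r b ≈ 0#
          vanish zero    b e ne = ⊥-elim (ne ≡.refl)
          vanish (suc a) b e ne = trans (*-congˡ (r≈0 b (≡.subst (suc b ℕ.≤_) e (s≤s (ℕ.m≤n+m b a))))) (zeroʳ _)

        error-m : error m ≈ - r m
        error-m = trans (+-cong (φr-term m ℕ.≤-refl) (-‿cong F^p-1r)) (+-identityˡ (- r m))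

        πY0 : conv π Y 0 ≈ 0#
        πY0 = trans (*-congˡ Y0) (zeroʳ _)

        D-low : ∀ j → j ℕ.< m → D j ≈ 0#
        D-low = ode-zero m πY0 D0 (λ j j<m → trans (at θD j) (trans (+-congˡ (trans (SE.fromℕ*-apply p error j) (trans (*-congˡ (error-low j j<m)) (zeroʳ _)))) (+-identityʳ _)))

        YD : conv (conv π Y) D m ≈ 0#
        YD = E.conv-zero m {conv π Y} {D} vanish
          where
          vanish : ∀ a b → a ℕ.+ b ≡ m → conv π Y a * D b ≈ 0#
          vanish zero    b e = trans (*-congʳ πY0) (zeroˡ _)
          vanish (suc a) b e = trans (*-congˡ (D-low b (≡.subst (suc b ℕ.≤_) e (s≤s (ℕ.m≤n+m b a))))) (zeroʳ _)

        mD : fromℕ m * D m ≈ fromℕ p * - r m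
        mD = trans (at θD m) (trans (+-cong YD (trans (SE.fromℕ*-apply p error m) (*-congˡ error-m))) (+-identityˡ _))

        δ : Carrier
        δ = _∼_.witness (atₚ D≡0 m)

        Dδ : D m ≈ 0# + fromℕ p * δ
        Dδ = _∼_.eq (atₚ D≡0 m)

        mδ : fromℕ m * δ ≈ - r m
        mδ = cancel-ℕ′ p p≢0 (trans (swap (fromℕ p) (fromℕ m) δ) (trans (*-congˡ (sym Dδ)) mD))
          where
          swap : ∀ p m d → p * (m * d) ≈ m * (0# + p * d)
          swap = solve 3 (λ p m d → p :* (m :* d) := m :* (con (+ 0) :+ p :* d)) refl

        -- Changing the coefficient in degree m by δ cancels the error there, since mδ = -r_m; the
        -- product with Y is unaffected in degree m because Y(0) = 0.
        F⁺ : S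
        F⁺ = patch F m (F m + δ)

        F⁺-old : ∀ n → ¬ n ≡ m → F⁺ n ≈ F n
        F⁺-old n ne = reflexive (patch-other F m (F m + δ) n ne)

        F⁺-m : F⁺ m ≈ F m + δ
        F⁺-m = reflexive (patch-same F m (F m + δ))

        YF : ∀ j → j ℕ.≤ m → conv Y F⁺ j ≈ conv Y F j
        YF j j≤m = E.conv-cong-terms j {Y} {F⁺} {Y} {F} same
          where
          same : ∀ a b → a ℕ.+ b ≡ j → Y a * F⁺ b ≈ Y a * F b
          same zero    b e = trans (*-congʳ Y0) (trans (zeroˡ _) (sym (trans (*-congʳ Y0) (zeroˡ _))))
          same (suc a) b e = *-congˡ (F⁺-old b (ℕ.<⇒≢ (ℕ.<-≤-trans (≡.subst (suc b ℕ.≤_) e (s≤s (ℕ.m≤n+m b a))) j≤m)))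

        collapse : ∀ a b → a + - (a - b) ≈ b
        collapse = solve 2 (λ a b → a :+ :- (a :- b) := b) refl

        solves-m : fromℕ m * F⁺ m ≈ conv Y F⁺ m
        solves-m = trans (*-congˡ F⁺-m) (trans (distribˡ (fromℕ m) (F m) δ) (trans (+-congˡ mδ)
            (trans (collapse (θ F m) (conv Y F m)) (sym (YF m ℕ.≤-refl)))))

        solves⁺ : ∀ j → j ℕ.≤ m → Dec (j ≡ m) → θ F⁺ j ≈ conv Y F⁺ j
        solves⁺ j j≤m (no ne)      = trans (*-congˡ (F⁺-old j ne)) (trans (solves t j (ℕ.≤∧≢⇒< j≤m ne)) (sym (YF j j≤m)))
        solves⁺ j j≤m (yes ≡.refl) = solves-m

        next : Partial (suc m)
        next .body = F⁺
        next .body0 = trans (F⁺-old 0 (ℕ.<⇒≢ 0<m)) (body0 t)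
        next .solves j (s≤s j≤m) = solves⁺ j j≤m (j ℕ.≟ m)

      partials : ∀ m → Partial (suc m)
      partials zero    = start
      partials (suc m) = Step.next (suc m) (s≤s z≤n) (partials m)

      coherent : ∀ d j → body (partials (d ℕ.+ j)) j ≈ body (partials j) j
      coherent zero    j = refl
      coherent (suc d) j = trans (Step.F⁺-old (suc (d ℕ.+ j)) (s≤s z≤n) (partials (d ℕ.+ j)) j (ℕ.<⇒≢ (s≤s (ℕ.m≤n+m j d)))) (coherent d j)

    -- The diagonal of the partial solutions: solving in degree n + 1 leaves the coefficients up to
    -- n untouched.
    Ẽ : S
    Ẽ n = body (partials n) n

    Ẽ0 : Ẽ 0 ≈ 1#
    Ẽ0 = refl

    θẼ : θ Ẽ ≋ conv Y Ẽ
    θẼ = pw λ n → trans (solves (partials n) n ℕ.≤-refl) (E.conv-cong-terms n (λ a b e → *-congˡ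
      (≡.subst (λ m → body (partials m) b ≈ Ẽ b) e (coherent a b))))

    -- From here on only θA = YA is used, not the construction of A.
    module Conjugates (A : S) (A0 : A 0 ≈ 1#) (θA : θ A ≋ conv Y A) where

      open CommutativeRing series using () renaming (_+_ to _⊕_; _*_ to _⊛_; _-_ to _⊖_; -_ to ⊝_)
      open Ŝ using () renaming (refl to ≋-refl; sym to ≋-sym; trans to ≋-trans)
      private module KSS = Kit.Solver series

      -- Polynomials in Y + σ whose coefficients are series tending to 0 p-adically.

      record Divides (m : ℕ) (a : Carrier) : Set where
        constructor _,_
        field
          witness : Carrier
          eq      : a ≈ fromℕ m * witness

      Div-resp : ∀ {m a b} → a ≈ b → Divides m a → Divides m b
      Div-resp e (h , q) = h , trans (sym e) q

      Div-0 : ∀ {m} → Divides m 0#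
      Div-0 = 0# , sym (zeroʳ _)

      Div-+ : ∀ {m a b} → Divides m a → Divides m b → Divides m (a + b)
      Div-+ (h , e) (h′ , e′) = h + h′ , trans (+-cong e e′) (sym (distribˡ _ h h′))

      Div-*ʳ : ∀ {m a} b → Divides m a → Divides m (a * b)
      Div-*ʳ b (h , e) = h * b , trans (*-congʳ e) (*-assoc _ h b)

      Div-*ˡ : ∀ {m a} b → Divides m a → Divides m (b * a)
      Div-*ˡ b d = Div-resp (*-comm _ b) (Div-*ʳ b d)

      Div-conv : ∀ {m} n f g → (∀ a b → a ℕ.+ b ≡ n → Divides m (f a * g b)) → Divides m (conv f g n)
      Div-conv zero    f g h = h 0 0 ≡.refl
      Div-conv (suc n) f g h = Div-+ (h 0 (suc n) ≡.refl) (Div-conv n (tail f) g (λ a b e → h (suc a) b (≡.cong suc e)))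

      Div-cancel : ∀ a B x → Divides (p ℕ.^ (a ℕ.+ B)) (fromℕ (p ℕ.^ a) * x) → Divides (p ℕ.^ B) x
      Div-cancel a B x (h , e) = h , cancel-ℕ′ (p ℕ.^ a) (ℕ.≢-nonZero⁻¹ (p ℕ.^ a) {{ℕ.m^n≢0 p a {{prime⇒nonZero pr}}}})
        (trans e (trans (*-congʳ (trans (reflexive (≡.cong fromℕ (ℕ.^-distribˡ-+-* p a B))) (fromℕ-* (p ℕ.^ a) (p ℕ.^ B)))) (*-assoc _ _ h)))

      -- Series whose coefficients tend to 0 p-adically; modulo p they are polynomials.
      Tate : S → Set
      Tate f = ∀ B → ∃ λ D → ∀ m → D ℕ.≤ m → Divides (p ℕ.^ B) (f m)

      EventuallyZero : S → Set
      EventuallyZero f = ∃ λ D → ∀ m → D ℕ.≤ m → f m ∼ 0#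

      Tate-resp : ∀ {f g} → f ≋ g → Tate f → Tate g
      Tate-resp e t B = proj₁ (t B) , λ m h → Div-resp (at e m) (proj₂ (t B) m h)

      Tate-finite : ∀ {f} D → (∀ m → D ℕ.≤ m → f m ≈ 0#) → Tate f
      Tate-finite D h B = D , λ m D≤m → Div-resp (sym (h m D≤m)) Div-0

      Tate-const : ∀ c → Tate (const c)
      Tate-const c = Tate-finite 1 λ { (suc m) _ → refl }

      Tate-0 : Tate 0ₛ
      Tate-0 = Tate-finite 0 (λ _ _ → refl)

      Tate-+ : ∀ {f g} → Tate f → Tate g → Tate (f ⊕ g)
      Tate-+ t u B = proj₁ (t B) ℕ.+ proj₁ (u B) , λ m h →
        Div-+ (proj₂ (t B) m (ℕ.≤-trans (ℕ.m≤m+n _ _) h)) (proj₂ (u B) m (ℕ.≤-trans (ℕ.m≤n+m _ _) h))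

      Tate-* : ∀ {f g} → Tate f → Tate g → Tate (f ⊛ g)
      Tate-* {f} {g} t u B = D ℕ.+ D′ , λ m h → Div-conv m f g (λ a b e → term m h a b e)
        where
        D  = proj₁ (t B)
        D′ = proj₁ (u B)
        term : ∀ m → D ℕ.+ D′ ℕ.≤ m → ∀ a b → a ℕ.+ b ≡ m → Divides (p ℕ.^ B) (f a * g b)
        term m h a b e with D ℕ.≤? a
        ... | yes D≤a = Div-*ʳ (g b) (proj₂ (t B) a D≤a)
        ... | no  D≰a = Div-*ˡ (f a) (proj₂ (u B) b (ℕ.+-cancelˡ-≤ D D′ b (ℕ.≤-trans h (ℕ.≤-trans (ℕ.≤-reflexive (≡.sym e)) (ℕ.+-monoˡ-≤ b (ℕ.<⇒≤ (ℕ.≰⇒> D≰a)))))))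

      Tate-θ : ∀ {f} → Tate f → Tate (θ f)
      Tate-θ t B = proj₁ (t B) , λ m h → Div-*ˡ (fromℕ m) (proj₂ (t B) m h)

      -- θY = Σ p^j x^(p^j), and p^j tends to 0. Hence θ preserves polynomials in Y with Tate
      -- coefficients, although Y itself is not Tate.
      Tate-θY : Tate (θ Y)
      Tate-θY B = p ℕ.^ B , go
        where
        go : ∀ m → p ℕ.^ B ℕ.≤ m → Divides (p ℕ.^ B) (fromℕ m * Y m)
        go m h with power? m
        ... | no ¬e = Div-resp (sym (zeroʳ _)) Div-0
        ... | yes (j , _ , ≡.refl) = Div-*ʳ 1# (fromℕ (p ℕ.^ (j ℕ.∸ B)) , trans
            (reflexive (≡.cong fromℕ (≡.trans (≡.cong (p ℕ.^_) (≡.sym (ℕ.m+[n∸m]≡n B≤j))) (ℕ.^-distribˡ-+-* p B (j ℕ.∸ B))))) (fromℕ-* (p ℕ.^ B) (p ℕ.^ (j ℕ.∸ B))))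
          where
          B≤j : B ℕ.≤ j
          B≤j = ℕ.≮⇒≥ (λ j<B → ℕ.<⇒≱ (ℕ.^-monoʳ-< p p>1 j<B) h)

      Tate-cancel : ∀ a {f} → Tate (KS.fromℕ (p ℕ.^ a) ⊛ f) → Tate f
      Tate-cancel a {f} t B = proj₁ (t (a ℕ.+ B)) , λ m h → Div-cancel a B (f m) (Div-resp (SE.fromℕ*-apply (p ℕ.^ a) f m) (proj₂ (t (a ℕ.+ B)) m h))

      Tate⇒EventuallyZero : ∀ {f} → Tate f → EventuallyZero f
      Tate⇒EventuallyZero t = proj₁ (t 1) , λ m h → let open Divides (proj₂ (t 1) m h) in
        witness Q., trans eq (trans (*-congʳ (reflexive (≡.cong fromℕ (ℕ.*-identityʳ p)))) (sym (+-identityˡ _)))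

      -- T σ plays the role of the Galois conjugate Y + σ of Y.
      T : ℕ → S
      T σ = Y ⊕ KS.fromℕ σ

      T-suc : ∀ σ → T (suc σ) ≋ T σ ⊕ Ŝ.1#
      T-suc σ = KSS.solve 2 (λ y s → y KSS.:+ (KSS.con (+ 1) KSS.:+ s) KSS.:= (y KSS.:+ s) KSS.:+ KSS.con (+ 1)) ≋-refl Y (KS.fromℕ σ)

      -- Horner form with n coefficients, so of degree below n in T σ. The coefficients do not
      -- depend on σ: the family consists of the conjugates of one polynomial.
      data Pol : ℕ → (ℕ → S) → Set where
        nil  : ∀ {F} → (∀ σ → F σ ≋ 0ₛ) → Pol 0 F
        cons : ∀ {n F} f G → Tate f → Pol n G → (∀ σ → F σ ≋ f ⊕ T σ ⊛ G σ) → Pol (suc n) F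

      module _ where
        open KSS

        Pol-resp : ∀ {n F G} → (∀ σ → G σ ≋ F σ) → Pol n F → Pol n G
        Pol-resp e (nil z)          = nil (λ σ → ≋-trans (e σ) (z σ))
        Pol-resp e (cons f H t P q) = cons f H t P (λ σ → ≋-trans (e σ) (q σ))

        Pol-raise : ∀ {n F} → Pol n F → Pol (suc n) F
        Pol-raise {F = F} (nil z)  = cons 0ₛ F Tate-0 (nil z) (λ σ → ≋-trans (z σ) (≋-sym (≋-trans (Ŝ.+-identityˡ _) (≋-trans (Ŝ.*-congˡ (z σ)) (Ŝ.zeroʳ (T σ))))))
        Pol-raise (cons f G t P q) = cons f G t (Pol-raise P) q

        Pol-raise* : ∀ {n F} d → Pol n F → Pol (d ℕ.+ n) F
        Pol-raise* zero    P = P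
        Pol-raise* (suc d) P = Pol-raise (Pol-raise* d P)

        Pol-+ : ∀ {n F G} → Pol n F → Pol n G → Pol n (λ σ → F σ ⊕ G σ)
        Pol-+ (nil z) (nil z′) = nil (λ σ → ≋-trans (Ŝ.+-cong (z σ) (z′ σ)) (Ŝ.+-identityˡ _))
        Pol-+ (cons f G t P q) (cons f′ G′ t′ P′ q′) = cons (f ⊕ f′) _ (Tate-+ t t′) (Pol-+ P P′)
          (λ σ → ≋-trans (Ŝ.+-cong (q σ) (q′ σ)) (solve 5 (λ f f′ t g g′ → (f :+ t :* g) :+ (f′ :+ t :* g′) := (f :+ f′) :+ t :* (g :+ g′)) ≋-refl f f′ (T σ) (G σ) (G′ σ)))

        Pol-scale : ∀ {n F} f → Tate f → Pol n F → Pol n (λ σ → f ⊛ F σ)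
        Pol-scale f t (nil z) = nil (λ σ → ≋-trans (Ŝ.*-congˡ (z σ)) (Ŝ.zeroʳ f))
        Pol-scale f t (cons g G t′ P q) = cons (f ⊛ g) _ (Tate-* t t′) (Pol-scale f t P)
          (λ σ → ≋-trans (Ŝ.*-congˡ (q σ)) (solve 4 (λ f g t h → f :* (g :+ t :* h) := f :* g :+ t :* (f :* h)) ≋-refl f g (T σ) (G σ)))

        Pol-neg : ∀ {n F} → Pol n F → Pol n (λ σ → ⊝ F σ)
        Pol-neg {F = F} P = Pol-resp (λ σ → ≋-trans (solve 1 (λ x → :- x := (:- con (+ 1)) :* x) ≋-refl (F σ)) (Ŝ.*-congʳ neg1)) (Pol-scale (const (- 1#)) (Tate-const _) P)
          where
          neg1 : ⊝ Ŝ.1# ≋ const (- 1#)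
          neg1 = pw λ { zero → refl ; (suc n) → Solver.solve 0 (Solver.:- Solver.con (+ 0) Solver.:= Solver.con (+ 0)) refl }

        Pol-T : ∀ {n F} → Pol n F → Pol (suc n) (λ σ → T σ ⊛ F σ)
        Pol-T {F = F} P = cons 0ₛ F Tate-0 P (λ σ → ≋-sym (Ŝ.+-identityˡ _))

        Pol-zero : ∀ n {F} → (∀ σ → F σ ≋ 0ₛ) → Pol n F
        Pol-zero zero    z = nil z
        Pol-zero (suc n) z = Pol-raise (Pol-zero n z)

        Pol-const : ∀ f → Tate f → Pol 1 (λ _ → f)
        Pol-const f t = cons f _ t (nil (λ _ → ≋-refl {0ₛ})) (λ σ → ≋-sym (≋-trans (Ŝ.+-congˡ (Ŝ.zeroʳ (T σ))) (Ŝ.+-identityʳ f)))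

        Pol-* : ∀ {n m F G} → Pol n F → Pol m G → Pol (n ℕ.+ m) (λ σ → F σ ⊛ G σ)
        Pol-* {m = m} {G = G} (nil z) P = Pol-zero m (λ σ → ≋-trans (Ŝ.*-congʳ (z σ)) (Ŝ.zeroˡ (G σ)))
        Pol-* {suc n} {m} {G = G} (cons f H t P q) P′ = Pol-resp
          (λ σ → ≋-trans (Ŝ.*-congʳ (q σ)) (solve 4 (λ f t h g → (f :+ t :* h) :* g := f :* g :+ t :* (h :* g)) ≋-refl f (T σ) (H σ) (G σ)))
          (Pol-+ (Pol-raise* (suc n) (Pol-scale f t P′)) (Pol-T (Pol-* P P′)))

        θT : ∀ σ → θ (T σ) ≋ θ Y
        θT σ = pw λ n → trans (E.θ-+ Y (KS.fromℕ σ) n) (trans (+-congˡ (trans (*-congˡ (at (SE.fromℕ-const σ) n)) (E.θ-const (fromℕ σ) n))) (+-identityʳ _))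

        -- θ differentiates the coefficients, and θ(T σ) = θY is Tate and free of σ, so the degree
        -- does not grow.
        Pol-θ : ∀ {n F} → Pol n F → Pol n (λ σ → θ (F σ))
        Pol-θ (nil z) = nil (λ σ → pw λ n → trans (*-congˡ (at (z σ) n)) (zeroʳ _))
        Pol-θ {suc n} {F} (cons f G t P q) = Pol-resp eq (Pol-+ (cons (θ f) _ (Tate-θ t) (Pol-θ P) (λ σ → ≋-refl)) (Pol-raise (Pol-scale (θ Y) Tate-θY P)))
          where
          eq : ∀ σ → θ (F σ) ≋ (θ f ⊕ T σ ⊛ θ (G σ)) ⊕ θ Y ⊛ G σ
          eq σ = ≋-trans (pw (E.θ-cong (at (q σ)))) (≋-trans (pw (E.θ-+ f (T σ ⊛ G σ))) (≋-trans (Ŝ.+-congˡ (≋-trans (pw (E.θ-* (T σ) (G σ))) (Ŝ.+-congʳ (Ŝ.*-congʳ (θT σ)))))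
            (solve 5 (λ f y g t h → f :+ (y :* g :+ t :* h) := (f :+ t :* h) :+ y :* g) ≋-refl (θ f) (θ Y) (G σ) (T σ) (θ (G σ)))))

        Pol-shift : ∀ {n F} → Pol n F → Pol n (λ σ → F (suc σ))
        Pol-shift (nil z) = nil (λ σ → z (suc σ))
        Pol-shift {suc n} {F} (cons f G t P q) = Pol-resp eq (Pol-+ (cons f _ t (Pol-shift P) (λ σ → ≋-refl)) (Pol-raise (Pol-shift P)))
          where
          eq : ∀ σ → F (suc σ) ≋ (f ⊕ T σ ⊛ G (suc σ)) ⊕ G (suc σ)
          eq σ = ≋-trans (q (suc σ)) (≋-trans (Ŝ.+-congˡ (Ŝ.*-congʳ (T-suc σ)))
            (solve 3 (λ f t g → f :+ (t :+ con (+ 1)) :* g := (f :+ t :* g) :+ g) ≋-refl f (T σ) (G (suc σ))))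

        Δ : (ℕ → S) → ℕ → S
        Δ F σ = F (suc σ) ⊖ F σ

        Pol-Δ : ∀ {n F} → Pol (suc n) F → Pol n (Δ F)
        Pol-Δ {zero} {F} (cons f G t (nil z) q) = nil (λ σ → ≋-trans (Ŝ.+-cong (const-f (suc σ)) (Ŝ.-‿cong (const-f σ))) (Ŝ.-‿inverseʳ f))
          where
          const-f : ∀ σ → F σ ≋ f
          const-f σ = ≋-trans (q σ) (≋-trans (Ŝ.+-congˡ (≋-trans (Ŝ.*-congˡ (z σ)) (Ŝ.zeroʳ (T σ)))) (Ŝ.+-identityʳ f))
        Pol-Δ {suc n} {F} (cons f G t P q) = Pol-resp eq (Pol-+ (Pol-T (Pol-Δ P)) (Pol-shift P))
          where
          eq : ∀ σ → Δ F σ ≋ T σ ⊛ Δ G σ ⊕ G (suc σ)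
          eq σ = ≋-trans (Ŝ.+-cong (≋-trans (q (suc σ)) (Ŝ.+-congˡ (Ŝ.*-congʳ (T-suc σ)))) (Ŝ.-‿cong (q σ)))
            (solve 4 (λ f t g h → (f :+ (t :+ con (+ 1)) :* h) :- (f :+ t :* g) := t :* (h :- g) :+ h) ≋-refl f (T σ) (G σ) (G (suc σ)))

        -- T (q + σ) and T σ differ by q, and polynomials respect congruences.
        Pol-congruence : ∀ {n F} q → Pol n F → ∀ σ → ∃ λ H → F (q ℕ.+ σ) ≋ F σ ⊕ KS.fromℕ q ⊛ H
        Pol-congruence q (nil z) σ = 0ₛ , ≋-trans (z _) (≋-sym (≋-trans (Ŝ.+-cong (z σ) (Ŝ.zeroʳ _)) (Ŝ.+-identityˡ _)))
        Pol-congruence {F = F} q (cons f G t P e) σ with Pol-congruence q P σ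
        ... | H , e′ = G σ ⊕ (T σ ⊕ KS.fromℕ q) ⊛ H , ≋-trans (e (q ℕ.+ σ)) (≋-trans
            (Ŝ.+-congˡ (Ŝ.*-cong (Ŝ.+-congˡ (KS.fromℕ-+ q σ)) e′)) (≋-trans
            (solve 6 (λ f y q s g h → f :+ (y :+ (q :+ s)) :* (g :+ q :* h) := (f :+ (y :+ s) :* g) :+ q :* (g :+ ((y :+ s) :+ q) :* h)) ≋-refl f Y (KS.fromℕ q) (KS.fromℕ σ) (G σ) H)
            (Ŝ.+-congʳ (≋-sym (e σ)))))

      -- Binomial operators in θ, conjugated by powers of A.

      pᵃ : ℕ → S
      pᵃ a = KS.fromℕ (p ℕ.^ a)

      θA^ : ∀ b → θ (A KS.^ b) ≋ (KS.fromℕ b ⊛ Y) ⊛ (A KS.^ b)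
      θA^ zero    = ≋-trans (pw (E.θ-const 1#)) (≋-sym (≋-trans (Ŝ.*-congʳ (Ŝ.zeroˡ Y)) (Ŝ.zeroˡ _)))
      θA^ (suc b) = ≋-trans (SE.θ-^ A b) (≋-trans (Ŝ.*-congˡ (Ŝ.*-congˡ θA))
        (KSS.solve 4 (λ n q y a → n KSS.:* (q KSS.:* (y KSS.:* a)) KSS.:= (n KSS.:* y) KSS.:* (a KSS.:* q)) ≋-refl (KS.fromℕ (suc b)) (A KS.^ b) Y A))

      -- W b t c k σ = A^{-b} binom(θ + σb + t, k)(c A^b), where binom(θ, k) multiplies the coefficient of x^m by binom(m, k).
      module Binomial (b t : ℕ) (c : S) where

        Aᵇ : S
        Aᵇ = A KS.^ b

        open SE.Inverse Aᵇ (SE.^-coeff0 A b A0) public using () renaming (inverse to A⁻ᵇ; *-inverse to Aᵇ-inverse)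

        index : ℕ → ℕ → ℕ
        index σ m = m ℕ.+ (σ ℕ.* b ℕ.+ t)

        W : ℕ → ℕ → S
        W k σ = A⁻ᵇ ⊛ (λ m → fromℕ (index σ m C k) * (c ⊛ Aᵇ) m)

        U : ℕ → ℕ → S
        U k σ m = fromℕ (k ! ℕ.* (index σ m C k)) * (c ⊛ Aᵇ) m

        -- The falling factorial (θ + σb + t)(θ + σb + t - 1)⋯ with k factors, applied to c A^b and
        -- divided by A^b. Conjugation by A^b turns θ into θ + bY, so σ enters only through b(Y + σ)
        -- = b T σ.
        P : ℕ → ℕ → S
        P zero    σ = c
        P (suc k) σ = θ (P k σ) ⊕ (KS.fromℕ b ⊛ T σ ⊕ (KS.fromℕ t ⊖ KS.fromℕ k)) ⊛ P k σ

        private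
          falling : ∀ N k → fromℕ (suc k ! ℕ.* (N C suc k)) ≈ (fromℕ N - fromℕ k) * fromℕ (k ! ℕ.* (N C k))
          falling N k = begin
            fromℕ (suc k ! ℕ.* (N C suc k))
              ≈⟨ solve 2 (λ x y → x := (x :+ y) :- y) refl _ (fromℕ k * fromℕ (k ! ℕ.* (N C k))) ⟩
            (fromℕ (suc k ! ℕ.* (N C suc k)) + fromℕ k * fromℕ (k ! ℕ.* (N C k))) - fromℕ k * fromℕ (k ! ℕ.* (N C k))
              ≈⟨ +-congʳ (trans (+-congˡ (sym (fromℕ-* k _))) (trans (sym (fromℕ-+ (suc k ! ℕ.* (N C suc k)) _)) (trans (reflexive (≡.cong fromℕ eq)) (fromℕ-* N _)))) ⟩
            fromℕ N * fromℕ (k ! ℕ.* (N C k)) - fromℕ k * fromℕ (k ! ℕ.* (N C k))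
              ≈⟨ solve 3 (λ n k x → n :* x :- k :* x := (n :- k) :* x) refl _ _ _ ⟩
            (fromℕ N - fromℕ k) * fromℕ (k ! ℕ.* (N C k)) ∎
            where
            open Relation.Binary.Reasoning.Setoid setoid
            open Solver
            module N where
              open import Data.Nat.Solver using (module +-*-Solver)
              open +-*-Solver public
            eq : suc k ! ℕ.* (N C suc k) ℕ.+ k ℕ.* (k ! ℕ.* (N C k)) ≡ N ℕ.* (k ! ℕ.* (N C k))
            eq = ≡.trans (N.solve 4 (λ k f c d → (N.con 1 N.:+ k) N.:* f N.:* d N.:+ k N.:* (f N.:* c) N.:= f N.:* ((N.con 1 N.:+ k) N.:* d N.:+ k N.:* c)) ≡.refl k (k !) (N C k) (N C suc k))
              (≡.trans (≡.cong (k ! ℕ.*_) (binomial-step N k)) (N.solve 3 (λ f n c → f N.:* (n N.:* c) N.:= n N.:* (f N.:* c)) ≡.refl (k !) N (N C k)))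

          U-suc : ∀ k σ → U (suc k) σ ≋ θ (U k σ) ⊕ (KS.fromℕ (σ ℕ.* b ℕ.+ t) ⊖ KS.fromℕ k) ⊛ U k σ
          U-suc k σ = pw λ m → begin
            fromℕ (suc k ! ℕ.* (index σ m C suc k)) * (c ⊛ Aᵇ) m
              ≈⟨ *-congʳ (trans (falling (index σ m) k) (*-congʳ (+-congʳ (fromℕ-+ m s)))) ⟩
            ((fromℕ m + fromℕ s) - fromℕ k) * fromℕ (k ! ℕ.* (index σ m C k)) * (c ⊛ Aᵇ) m
              ≈⟨ Solver.solve 5 (λ m s k f g → ((m Solver.:+ s) Solver.:- k) Solver.:* f Solver.:* g Solver.:=
                   m Solver.:* (f Solver.:* g) Solver.:+ (s Solver.:- k) Solver.:* (f Solver.:* g)) refl (fromℕ m) (fromℕ s) (fromℕ k) (fromℕ (k ! ℕ.* (index σ m C k))) ((c ⊛ Aᵇ) m) ⟩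
            θ (U k σ) m + (fromℕ s - fromℕ k) * U k σ m
              ≈⟨ +-congˡ (trans (E.conv-cong {KS.fromℕ s ⊖ KS.fromℕ k} {U k σ} {const (fromℕ s - fromℕ k)} {U k σ} const-difference (λ _ → refl) m) (E.conv-const _ (U k σ) m)) ⟨
            θ (U k σ) m + ((KS.fromℕ s ⊖ KS.fromℕ k) ⊛ U k σ) m ∎
            where
            open Relation.Binary.Reasoning.Setoid setoid
            s = σ ℕ.* b ℕ.+ t
            const-difference : ∀ n → (KS.fromℕ s ⊖ KS.fromℕ k) n ≈ const (fromℕ s - fromℕ k) n
            const-difference zero    = +-cong (at (SE.fromℕ-const s) 0) (-‿cong (at (SE.fromℕ-const k) 0))
            const-difference (suc n) = trans (+-cong (at (SE.fromℕ-const s) (suc n)) (-‿cong (at (SE.fromℕ-const k) (suc n)))) (-‿inverseʳ 0#)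

          U≋AP : ∀ k σ → U k σ ≋ Aᵇ ⊛ P k σ
          U≋AP zero σ = ≋-trans (pw λ m → trans (*-congʳ (trans (reflexive (≡.cong fromℕ (≡.trans (ℕ.*-identityˡ _) (C0 (index σ m))))) (+-identityʳ 1#))) (*-identityˡ _)) (Ŝ.*-comm c Aᵇ)
            where
            C0 : ∀ n → n C 0 ≡ 1
            C0 n = ≡.trans (C.nCk≡nC[n∸k] {0} {n} z≤n) (C.nCn≡1 n)
          U≋AP (suc k) σ = begin
            U (suc k) σ
              ≈⟨ U-suc k σ ⟩
            θ (U k σ) ⊕ (KS.fromℕ (σ ℕ.* b ℕ.+ t) ⊖ KS.fromℕ k) ⊛ U k σ
              ≈⟨ Ŝ.+-cong (≋-trans (pw (E.θ-cong (at (U≋AP k σ)))) (≋-trans (pw (E.θ-* Aᵇ (P k σ))) (Ŝ.+-congʳ (Ŝ.*-congʳ (θA^ b)))))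
                          (Ŝ.*-cong (Ŝ.+-congʳ (≋-trans (KS.fromℕ-+ (σ ℕ.* b) t) (Ŝ.+-congʳ (KS.fromℕ-* σ b)))) (U≋AP k σ)) ⟩
            ((KS.fromℕ b ⊛ Y) ⊛ Aᵇ ⊛ P k σ ⊕ Aᵇ ⊛ θ (P k σ)) ⊕ ((KS.fromℕ σ ⊛ KS.fromℕ b ⊕ KS.fromℕ t) ⊖ KS.fromℕ k) ⊛ (Aᵇ ⊛ P k σ)
              ≈⟨ KSS.solve 8 (λ b y a q r s t k → (b KSS.:* y KSS.:* a KSS.:* q KSS.:+ a KSS.:* r) KSS.:+ ((s KSS.:* b KSS.:+ t) KSS.:- k) KSS.:* (a KSS.:* q)
                   KSS.:= a KSS.:* (r KSS.:+ (b KSS.:* (y KSS.:+ s) KSS.:+ (t KSS.:- k)) KSS.:* q)) ≋-refl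
                   (KS.fromℕ b) Y Aᵇ (P k σ) (θ (P k σ)) (KS.fromℕ σ) (KS.fromℕ t) (KS.fromℕ k) ⟩
            Aᵇ ⊛ P (suc k) σ ∎
            where open Relation.Binary.Reasoning.Setoid Ŝ.setoid

        -- W is visibly integral, as binomial coefficients are integers; P is visibly a polynomial
        -- in T σ. This equation lets W have both properties, the second up to the factor k!.
        W-multiple : ∀ k σ → KS.fromℕ (k !) ⊛ W k σ ≋ P k σ
        W-multiple k σ = begin
          KS.fromℕ (k !) ⊛ (A⁻ᵇ ⊛ V)     ≈⟨ KSS.solve 3 (λ n a v → n KSS.:* (a KSS.:* v) KSS.:= a KSS.:* (n KSS.:* v)) ≋-refl (KS.fromℕ (k !)) A⁻ᵇ V ⟩
          A⁻ᵇ ⊛ (KS.fromℕ (k !) ⊛ V)     ≈⟨ Ŝ.*-congˡ {A⁻ᵇ} {KS.fromℕ (k !) ⊛ V} {U k σ} (pw λ m → trans (SE.fromℕ*-apply (k !) V m) (trans (sym (*-assoc _ _ _)) (*-congʳ (sym (fromℕ-* (k !) _))))) ⟩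
          A⁻ᵇ ⊛ U k σ                    ≈⟨ Ŝ.*-congˡ (U≋AP k σ) ⟩
          A⁻ᵇ ⊛ (Aᵇ ⊛ P k σ)             ≈⟨ KSS.solve 3 (λ i a v → i KSS.:* (a KSS.:* v) KSS.:= (a KSS.:* i) KSS.:* v) ≋-refl A⁻ᵇ Aᵇ (P k σ) ⟩
          (Aᵇ ⊛ A⁻ᵇ) ⊛ P k σ             ≈⟨ Ŝ.*-congʳ Aᵇ-inverse ⟩
          Ŝ.1# ⊛ P k σ                   ≈⟨ Ŝ.*-identityˡ (P k σ) ⟩
          P k σ                          ∎
          where
          open Relation.Binary.Reasoning.Setoid Ŝ.setoid
          V : S
          V m = fromℕ (index σ m C k) * (c ⊛ Aᵇ) m

        Tate-fromℕ : ∀ n → Tate (KS.fromℕ n)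
        Tate-fromℕ n = Tate-resp (≋-sym (SE.fromℕ-const n)) (Tate-const (fromℕ n))

        Tate-neg-fromℕ : ∀ n → Tate (⊝ KS.fromℕ n)
        Tate-neg-fromℕ n = Tate-resp (pw λ { zero → -‿cong (sym (at (SE.fromℕ-const n) 0))
            ; (suc m) → trans (Solver.solve 0 (Solver.con (+ 0) Solver.:= Solver.:- Solver.con (+ 0)) refl) (-‿cong (sym (at (SE.fromℕ-const n) (suc m)))) })
          (Tate-const (- fromℕ n))

        Pol-P : Tate c → ∀ k → Pol (suc k) (P k)
        Pol-P tc zero    = Pol-const c tc
        Pol-P tc (suc k) = Pol-resp eq
          (Pol-+ (Pol-raise (Pol-θ (Pol-P tc k)))
            (Pol-+ (Pol-T (Pol-scale (KS.fromℕ b) (Tate-fromℕ b) (Pol-P tc k)))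
                   (Pol-raise (Pol-scale (KS.fromℕ t ⊖ KS.fromℕ k) (Tate-+ (Tate-fromℕ t) (Tate-neg-fromℕ k)) (Pol-P tc k)))))
          where
          eq : ∀ σ → P (suc k) σ ≋ θ (P k σ) ⊕ (T σ ⊛ (KS.fromℕ b ⊛ P k σ) ⊕ (KS.fromℕ t ⊖ KS.fromℕ k) ⊛ P k σ)
          eq σ = KSS.solve 5 (λ r b t s q → r KSS.:+ (b KSS.:* t KSS.:+ s) KSS.:* q KSS.:= r KSS.:+ (t KSS.:* (b KSS.:* q) KSS.:+ s KSS.:* q)) ≋-refl
            (θ (P k σ)) (KS.fromℕ b) (T σ) (KS.fromℕ t ⊖ KS.fromℕ k) (P k σ)

      -- The case b = 1, t = 0, c = 1. `z.W k` behaves like binom(T σ, k): it is integral, its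
      -- difference in σ is `z.W (k - 1)`, and k! times it is monic of degree k in T σ.
      private module z where
        open Binomial 1 0 Ŝ.1# public

      -- Pascal's rule: for b = 1, passing from σ to σ + 1 raises the upper index by one.
      W-Δ : ∀ k σ → z.W (suc k) (suc σ) ⊖ z.W (suc k) σ ≋ z.W k σ
      W-Δ k σ = ≋-trans (KSS.solve 3 (λ a v w → a KSS.:* v KSS.:- a KSS.:* w KSS.:= a KSS.:* (v KSS.:- w)) ≋-refl z.A⁻ᵇ (V (suc k) (suc σ)) (V (suc k) σ)) (Ŝ.*-congˡ (pw step))
        where
        V : ℕ → ℕ → S
        V k σ m = fromℕ (z.index σ m C k) * (Ŝ.1# ⊛ z.Aᵇ) m
        step : ∀ m → V (suc k) (suc σ) m - V (suc k) σ m ≈ V k σ m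
        step m = trans (+-congʳ (*-congʳ (trans (reflexive (≡.cong fromℕ (≡.trans (≡.cong (_C suc k) (ℕ.+-suc m _)) (≡.sym (C.nCk+nC[k+1]≡[n+1]C[k+1] (z.index σ m) k))))) (fromℕ-+ (z.index σ m C k) _))))
          (Solver.solve 3 (λ a b c → (a Solver.:+ b) Solver.:* c Solver.:- b Solver.:* c Solver.:= a Solver.:* c) refl (fromℕ (z.index σ m C k)) (fromℕ (z.index σ m C suc k)) _)

      W0 : ∀ σ → z.W 0 σ ≋ Ŝ.1#
      W0 σ = ≋-trans (≋-sym (≋-trans (Ŝ.*-congʳ (Ŝ.+-identityʳ Ŝ.1#)) (Ŝ.*-identityˡ _))) (z.W-multiple 0 σ)

      Δ^ : ℕ → (ℕ → S) → ℕ → S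
      Δ^ zero    F = F
      Δ^ (suc k) F = Δ^ k (Δ F)

      Δ^-cong : ∀ k {F G : ℕ → S} → (∀ σ → F σ ≋ G σ) → ∀ σ → Δ^ k F σ ≋ Δ^ k G σ
      Δ^-cong zero    e = e
      Δ^-cong (suc k) e = Δ^-cong k (λ σ → Ŝ.+-cong (e (suc σ)) (Ŝ.-‿cong (e σ)))

      Δ^-linear : ∀ k f F G σ → Δ^ k (λ σ → F σ ⊖ f ⊛ G σ) σ ≋ Δ^ k F σ ⊖ f ⊛ Δ^ k G σ
      Δ^-linear zero    f F G σ = ≋-refl
      Δ^-linear (suc k) f F G σ = ≋-trans (Δ^-cong k (λ σ → KSS.solve 5 (λ a b f c d → (a KSS.:- f KSS.:* c) KSS.:- (b KSS.:- f KSS.:* d) KSS.:= (a KSS.:- b) KSS.:- f KSS.:* (c KSS.:- d)) ≋-refl (F (suc σ)) (F σ) f (G (suc σ)) (G σ)) σ)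
        (Δ^-linear k f (Δ F) (Δ G) σ)

      Δ^-scale : ∀ k f G σ → Δ^ k (λ σ → f ⊛ G σ) σ ≋ f ⊛ Δ^ k G σ
      Δ^-scale zero    f G σ = ≋-refl
      Δ^-scale (suc k) f G σ = ≋-trans (Δ^-cong k (λ σ → KSS.solve 3 (λ f c d → f KSS.:* c KSS.:- f KSS.:* d KSS.:= f KSS.:* (c KSS.:- d)) ≋-refl f (G (suc σ)) (G σ)) σ) (Δ^-scale k f (Δ G) σ)

      Δ^-Pol : ∀ k {F} → Pol k F → ∀ σ → Δ^ k F σ ≋ 0ₛ
      Δ^-Pol zero    (nil z) = z
      Δ^-Pol (suc k) P       = Δ^-Pol k (Pol-Δ P)

      Δ^-W : ∀ k σ → Δ^ k (z.W k) σ ≋ Ŝ.1#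
      Δ^-W zero    σ = W0 σ
      Δ^-W (suc k) σ = ≋-trans (Δ^-cong k (W-Δ k) σ) (Δ^-W k σ)

      Δ^-mod : ∀ k {F : ℕ → S} → (∀ σ → F σ ≡ₚ 0ₛ) → ∀ σ → Δ^ k F σ ≡ₚ 0ₛ
      Δ^-mod zero    e = e
      Δ^-mod (suc k) e = Δ^-mod k (λ σ → S̄.trans (S̄.+-cong (e (suc σ)) (S̄.-‿cong (e σ))) (S̄.-‿inverseʳ 0ₛ))

      -- `z.P n` is monic of degree n in T σ, so subtracting f times it, with f the top coefficient,
      -- lowers the degree.
      leading : ∀ n {F} → Pol (suc n) F → ∃ λ f → Tate f × Pol n (λ σ → F σ ⊖ f ⊛ z.P n σ)
      leading zero {F} (cons f G t (nil zG) q) = f , t , nil (λ σ → ≋-trans (Ŝ.+-cong (≋-trans (q σ) (≋-trans (Ŝ.+-congˡ (≋-trans (Ŝ.*-congˡ (zG σ)) (Ŝ.zeroʳ (T σ)))) (Ŝ.+-identityʳ f)))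
          (Ŝ.-‿cong (Ŝ.*-identityʳ f))) (Ŝ.-‿inverseʳ f))
      leading (suc n) {F} (cons f′ G t′ PG q) with leading n PG
      ... | f , t , PH = f , t , Pol-resp eq
          (Pol-+ (Pol-raise* n (Pol-const f′ t′) ′)
            (Pol-+ (Pol-T PH) (Pol-neg (Pol-scale f t (Pol-+ (Pol-θ (z.Pol-P tate1 n)) (Pol-scale (KS.fromℕ 0 ⊖ KS.fromℕ n) (Tate-+ (z.Tate-fromℕ 0) (z.Tate-neg-fromℕ n)) (z.Pol-P tate1 n)))))))
        where
        tate1 : Tate Ŝ.1#
        tate1 = Tate-const 1#
        _′ : Pol (n ℕ.+ 1) (λ _ → f′) → Pol (suc n) (λ _ → f′)
        _′ = ≡.subst (λ k → Pol k (λ _ → f′)) (ℕ.+-comm n 1)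
        eq : ∀ σ → F σ ⊖ f ⊛ z.P (suc n) σ ≋ f′ ⊕ (T σ ⊛ (G σ ⊖ f ⊛ z.P n σ) ⊕ ⊝ (f ⊛ (θ (z.P n σ) ⊕ (KS.fromℕ 0 ⊖ KS.fromℕ n) ⊛ z.P n σ)))
        eq σ = ≋-trans (Ŝ.+-congʳ (q σ)) (KSS.solve 8 (λ f′ t g f q r z k → (f′ KSS.:+ t KSS.:* g) KSS.:- f KSS.:* (r KSS.:+ ((KSS.con (+ 1) KSS.:+ KSS.con (+ 0)) KSS.:* t KSS.:+ (z KSS.:- k)) KSS.:* q)
            KSS.:= f′ KSS.:+ (t KSS.:* (g KSS.:- f KSS.:* q) KSS.:+ (KSS.:- (f KSS.:* (r KSS.:+ (z KSS.:- k) KSS.:* q))))) ≋-refl f′ (T σ) (G σ) f (z.P n σ) (θ (z.P n σ)) (KS.fromℕ 0) (KS.fromℕ n))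

      cancelₛ : ∀ n {f g} → ¬ n ≡ 0 → KS.fromℕ n ⊛ f ≋ KS.fromℕ n ⊛ g → f ≋ g
      cancelₛ n {f} {g} n≢0 e = pw λ m → cancel-ℕ′ n n≢0 (trans (sym (SE.fromℕ*-apply n f m)) (trans (at e m) (SE.fromℕ*-apply n g m)))

      p^a≢0 : ∀ a → ¬ p ℕ.^ a ≡ 0
      p^a≢0 a = ℕ.≢-nonZero⁻¹ (p ℕ.^ a) {{ℕ.m^n≢0 p a {{prime⇒nonZero pr}}}}

      -- Subtracting a multiple of W k, where Δ W (k+1) = W k, lowers the degree.
      lower-degree : ∀ n a {F : ℕ → S} → Pol (suc (suc n)) (λ σ → pᵃ a ⊛ F σ) → (∀ σ → F (suc σ) ≡ₚ F σ) →
                     ∃ λ F′ → Pol (suc n) (λ σ → pᵃ a ⊛ F′ σ) × (∀ σ → F′ σ ≡ₚ F σ)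
      lower-degree n a {F} PF h with leading (suc n) PF
      ... | f , _ , PG = F′ , Pol-resp P′ PG , F′≡F
        where
        k = suc n
        -- The top difference of F. It satisfies p^a b = f k!, so p^a b W k = f P k is what has to
        -- be subtracted from p^a F. As F is constant modulo p and k > 0, b vanishes modulo p, and F
        -- is unchanged modulo p.
        b : S
        b = Δ^ k F 0
        pb : pᵃ a ⊛ b ≋ f ⊛ KS.fromℕ (k !)
        pb = ≋-trans (≋-sym (Δ^-scale k (pᵃ a) F 0)) (≋-trans (KS.x-y≈0⇒x≈y (≋-trans (≋-sym (Δ^-linear k f (λ σ → pᵃ a ⊛ F σ) (z.P k) 0)) (Δ^-Pol k PG 0)))
          (Ŝ.*-congˡ (≋-trans (Δ^-cong k (λ σ → ≋-sym (z.W-multiple k σ)) 0) (≋-trans (Δ^-scale k (KS.fromℕ (k !)) (z.W k) 0) (≋-trans (Ŝ.*-congˡ (Δ^-W k 0)) (Ŝ.*-identityʳ _))))))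
        F′ : ℕ → S
        F′ σ = F σ ⊖ b ⊛ z.W k σ
        b≡0 : b ≡ₚ 0ₛ
        b≡0 = Δ^-mod n {Δ F} (λ σ → S̄.trans (S̄.+-congʳ (h σ)) (S̄.-‿inverseʳ (F σ))) 0
        F′≡F : ∀ σ → F′ σ ≡ₚ F σ
        F′≡F σ = S̄.trans (S̄.+-congˡ (S̄.trans (S̄.-‿cong (S̄.trans (S̄.*-congʳ b≡0) (S̄.zeroˡ (z.W k σ)))) (S̄.trans (S̄.sym (S̄.+-identityˡ _)) (S̄.-‿inverseʳ 0ₛ)))) (S̄.+-identityʳ (F σ))
        P′ : ∀ σ → pᵃ a ⊛ F′ σ ≋ pᵃ a ⊛ F σ ⊖ f ⊛ z.P k σ
        P′ σ = ≋-trans (KSS.solve 4 (λ p F b w → p KSS.:* (F KSS.:- b KSS.:* w) KSS.:= p KSS.:* F KSS.:- (p KSS.:* b) KSS.:* w) ≋-refl (pᵃ a) (F σ) b (z.W k σ))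
          (Ŝ.+-congˡ (Ŝ.-‿cong (≋-trans (Ŝ.*-congʳ pb) (≋-trans (Ŝ.*-assoc f _ _) (Ŝ.*-congˡ (z.W-multiple k σ))))))

      -- The analogue of a fixed-field theorem: invariance modulo p under σ ↦ σ + 1 leaves only
      -- polynomials in x. Lowering the degree ends with p^a F equal to a Tate series, and then F
      -- itself is Tate.
      constant⇒polynomial : ∀ n a {F : ℕ → S} → Pol n (λ σ → pᵃ a ⊛ F σ) → (∀ σ → F (suc σ) ≡ₚ F σ) → EventuallyZero (F 0)
      constant⇒polynomial zero a {F} (nil e) _ = 0 , λ m _ → ≈⇒∼ (at (cancelₛ (p ℕ.^ a) (p^a≢0 a) (≋-trans (e 0) (≋-sym (Ŝ.zeroʳ (pᵃ a))))) m)
      constant⇒polynomial (suc zero) a {F} (cons f G t (nil zG) q) _ = Tate⇒EventuallyZero (Tate-cancel a (Tate-resp (≋-sym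
          (≋-trans (q 0) (≋-trans (Ŝ.+-congˡ (≋-trans (Ŝ.*-congˡ (zG 0)) (Ŝ.zeroʳ (T 0)))) (Ŝ.+-identityʳ f)))) t))
      constant⇒polynomial (suc (suc n)) a {F} PF h =
        let (F′ , PF′ , e) = lower-degree n a PF h
            (D , z) = constant⇒polynomial (suc n) a {F′} PF′ (λ σ → S̄.trans (e (suc σ)) (S̄.trans (h σ) (S̄.sym (e σ))))
        in D , λ m D≤m → R.trans (R.sym (atₚ (e 0) m)) (z m D≤m)

      instance
        p-nonZero : NonZero p
        p-nonZero = prime⇒nonZero pr

      -- Families F(σ) which are, up to a power of p, polynomials in Y + σ with Tate coefficients.
      record 𝓕 (F : ℕ → S) : Set where
        field
          denominator degree : ℕ
          polynomial : Pol degree (λ σ → pᵃ denominator ⊛ F σ)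
      open 𝓕

      𝓕-Pol : ∀ {n F} → Pol n F → 𝓕 F
      𝓕-Pol {n} {F} P = record { denominator = 0 ; degree = n ; polynomial = Pol-resp (λ σ → ≋-trans (Ŝ.*-congʳ (Ŝ.+-identityʳ Ŝ.1#)) (Ŝ.*-identityˡ (F σ))) P }

      private
        raise-denominator : ∀ {n a} {F : ℕ → S} b → Pol n (λ σ → pᵃ a ⊛ F σ) → Pol n (λ σ → pᵃ (b ℕ.+ a) ⊛ F σ)
        raise-denominator {n} {a} {F} b P = Pol-resp (λ σ → ≋-trans (Ŝ.*-congʳ (split b a)) (Ŝ.*-assoc (pᵃ b) (pᵃ a) (F σ))) (Pol-scale (pᵃ b) (Binomial.Tate-fromℕ 0 0 0ₛ (p ℕ.^ b)) P)
          where
          split : ∀ b a → pᵃ (b ℕ.+ a) ≋ pᵃ b ⊛ pᵃ a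
          split b a = ≋-trans (Ŝ.reflexive (≡.cong KS.fromℕ (ℕ.^-distribˡ-+-* p b a))) (KS.fromℕ-* (p ℕ.^ b) (p ℕ.^ a))

        common : ∀ {n m} {F : ℕ → S} → Pol n F → Pol (n ℕ.+ m) F
        common {n} {m} {F} P = ≡.subst (λ k → Pol k F) (ℕ.+-comm m n) (Pol-raise* m P)

      𝓕-+ : ∀ {F G} → 𝓕 F → 𝓕 G → 𝓕 (λ σ → F σ ⊕ G σ)
      𝓕-+ {F} {G} f g = record
        { denominator = denominator f ℕ.+ denominator g ; degree = degree f ℕ.+ degree g
        ; polynomial = Pol-resp (λ σ → Ŝ.distribˡ (pᵃ (denominator f ℕ.+ denominator g)) (F σ) (G σ))
            (Pol-+ (common {m = degree g} (≡.subst (λ a → Pol (degree f) (λ σ → pᵃ a ⊛ F σ)) (ℕ.+-comm (denominator g) (denominator f)) (raise-denominator (denominator g) (polynomial f))))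
                   (Pol-raise* (degree f) (raise-denominator (denominator f) (polynomial g)))) }

      𝓕-* : ∀ {F G} → 𝓕 F → 𝓕 G → 𝓕 (λ σ → F σ ⊛ G σ)
      𝓕-* {F} {G} f g = record
        { denominator = denominator f ℕ.+ denominator g ; degree = degree f ℕ.+ degree g
        ; polynomial = Pol-resp (λ σ → ≋-trans (Ŝ.*-congʳ (≋-trans (Ŝ.reflexive (≡.cong KS.fromℕ (ℕ.^-distribˡ-+-* p (denominator f) (denominator g)))) (KS.fromℕ-* (p ℕ.^ denominator f) _)))
            (KSS.solve 4 (λ a b f g → (a KSS.:* b) KSS.:* (f KSS.:* g) KSS.:= (a KSS.:* f) KSS.:* (b KSS.:* g)) ≋-refl (pᵃ (denominator f)) (pᵃ (denominator g)) (F σ) (G σ)))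
            (Pol-* (polynomial f) (polynomial g)) }

      𝓕-neg : ∀ {F} → 𝓕 F → 𝓕 (λ σ → ⊝ F σ)
      𝓕-neg {F} f = record { denominator = denominator f ; degree = degree f
        ; polynomial = Pol-resp (λ σ → KSS.solve 2 (λ a f → a KSS.:* (KSS.:- f) KSS.:= KSS.:- (a KSS.:* f)) ≋-refl (pᵃ (denominator f)) (F σ)) (Pol-neg (polynomial f)) }

      τ : ℕ → (ℕ → S) → ℕ → S
      τ t F σ = F (t ℕ.+ σ)

      𝓕-τ : ∀ t {F} → 𝓕 F → 𝓕 (τ t F)
      𝓕-τ zero    f = f
      𝓕-τ (suc t) {F} f = 𝓕-τ t {λ σ → F (suc σ)} (record { denominator = denominator f ; degree = degree f ; polynomial = Pol-shift (polynomial f) })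

      module Σ̄ = Fold S̄.+-commutativeMonoid
      module Π̄ = Fold S̄.*-commutativeMonoid

      𝓕-Σ : ∀ n q {F} → 𝓕 F → 𝓕 (Σ̄.fold n q F)
      𝓕-Σ zero    q f = 𝓕-Pol {0} (nil (λ _ → ≋-refl))
      𝓕-Σ (suc n) q f = 𝓕-+ (𝓕-Σ n q f) (𝓕-τ (n ℕ.* q) f)

      𝓕-Π : ∀ n q {F} → 𝓕 F → 𝓕 (Π̄.fold n q F)
      𝓕-Π zero    q f = 𝓕-Pol (Pol-const Ŝ.1# (Tate-const 1#))
      𝓕-Π (suc n) q f = 𝓕-* (𝓕-Π n q f) (𝓕-τ (n ℕ.* q) f)

      -- Vanishing modulo p of one conjugate implies vanishing of all.

      Periodic : ℕ → (ℕ → S) → Set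
      Periodic q F = ∀ σ → F (q ℕ.+ σ) ≡ₚ F σ

      Periodic-multiple : ∀ {q F} k → Periodic q F → Periodic (k ℕ.* q) F
      Periodic-multiple zero    h σ = S̄.refl
      Periodic-multiple {q} {F} (suc k) h σ = S̄.trans (S̄.reflexive (≡.cong F (ℕ.+-assoc q (k ℕ.* q) σ))) (S̄.trans (h (k ℕ.* q ℕ.+ σ)) (Periodic-multiple k h σ))

      Periodic-≡mod : ∀ {q F a b} → Periodic q F → a ≡ b [mod q ] → F a ≡ₚ F b
      Periodic-≡mod {q} {F} {a} {b} h c with ≡mod⇒multiple {a} {b} {q} c
      ... | inj₁ (k , ≡.refl) = Periodic-multiple k h b
      ... | inj₂ (k , ≡.refl) = S̄.sym (Periodic-multiple k h a)

      𝓕-periodic : ∀ {F} → 𝓕 F → ∃ λ k → Periodic (p ℕ.^ k) F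
      𝓕-periodic {F} f = suc a , λ σ → let (H , e) = Pol-congruence (p ℕ.^ suc a) (polynomial f) σ in
        S̄.trans (exact⇒mod (cancelₛ (p ℕ.^ a) (p^a≢0 a) (≋-trans e (rearrange σ H))))
          (S̄.trans (S̄.+-congˡ (S̄.trans (S̄.*-congʳ {H} πseries) (S̄.zeroˡ H))) (S̄.+-identityʳ (F σ)))
        where
        a = denominator f
        πseries : KS.fromℕ p ≡ₚ 0ₛ
        πseries = S̄.trans (exact⇒mod (SE.fromℕ-const p)) (pwₚ λ { zero → residue-char ; (suc n) → R.refl })
        rearrange : ∀ σ H → pᵃ a ⊛ F σ ⊕ KS.fromℕ (p ℕ.^ suc a) ⊛ H ≋ pᵃ a ⊛ (F σ ⊕ KS.fromℕ p ⊛ H)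
        rearrange σ H = ≋-trans (Ŝ.+-congˡ (Ŝ.*-congʳ (KS.fromℕ-* p (p ℕ.^ a))))
          (KSS.solve 4 (λ a f p h → a KSS.:* f KSS.:+ (p KSS.:* a) KSS.:* h KSS.:= a KSS.:* (f KSS.:+ p KSS.:* h)) ≋-refl (pᵃ a) (F σ) (KS.fromℕ p) H)

      Zero-resp : ∀ {f g} → f ≡ₚ g → Zero f → Zero g
      Zero-resp e z = S̄.trans (S̄.sym e) z

      nonzero-* : ∀ {f g} → ¬ Zero f → ¬ Zero g → ¬ Zero (f ⊛ g)
      nonzero-* {f} {g} nf ng z = ng (series-domain f g z nf)

      -- Y is not a rational function: the gaps between consecutive exponents of Y grow.
      Y-irrational : ∀ g → EventuallyZero g → EventuallyZero (Y ⊛ g) → Zero g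
      Y-irrational g (D , h) (D′ , h′) = pwₚ go
        where
        -- The coefficient of Yg at p^N + m is g_m for m < D: smaller exponents of Y meet
        -- coefficients of g beyond D, and larger ones exceed p^N + m. It is zero because p^N is
        -- beyond D′.
        N = suc (D ℕ.+ D′)
        q = p ℕ.^ N
        D<q : D ℕ.+ D′ ℕ.< q
        D<q = ℕ.<-trans (ℕ.n<1+n _) (j<p^j N)
        q₀ = p ℕ.^ (D ℕ.+ D′)
        go : ∀ m → g m ∼ 0#
        go m with D ℕ.≤? m
        ... | yes D≤m = h m D≤m
        ... | no  D≰m = R.trans (R.sym (R.*-identityˡ (g m))) (R.trans (R.*-congʳ (R.sym (≈⇒∼ (Y-power N))))
            (R.trans (R.sym (M.conv-single q m {Y} {g} vanish)) (h′ (q ℕ.+ m) (ℕ.≤-trans (ℕ.<⇒≤ (ℕ.≤-<-trans (ℕ.m≤n+m D′ D) D<q)) (ℕ.m≤m+n q m)))))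
          where
          m<D : m ℕ.< D
          m<D = ℕ.≰⇒> D≰m
          vanish : ∀ a b → a ℕ.+ b ≡ q ℕ.+ m → ¬ a ≡ q → Y a * g b ∼ 0#
          vanish a b e a≢q with power? a
          ... | no _ = R.zeroˡ _
          ... | yes (j , _ , ≡.refl) with ℕ.<-cmp j N
          ... | tri≈ _ ≡.refl _ = contradiction ≡.refl a≢q
          ... | tri< j<N _ _ = R.trans (R.*-congˡ (h b D≤b)) (R.zeroʳ _)
            where
            open import Relation.Binary.Definitions as Tri
            open ℕ.≤-Reasoning
            -- 2 q₀ ≤ q ≤ q + m = p^j + b ≤ q₀ + b
            D≤b : D ℕ.≤ b
            D≤b = ℕ.≤-trans (ℕ.<⇒≤ (ℕ.≤-<-trans (ℕ.m≤m+n D D′) (j<p^j (D ℕ.+ D′)))) (ℕ.+-cancelˡ-≤ q₀ q₀ b (begin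
              q₀ ℕ.+ q₀             ≡⟨ ≡.cong (q₀ ℕ.+_) (≡.sym (ℕ.+-identityʳ q₀)) ⟩
              2 ℕ.* q₀              ≤⟨ ℕ.*-monoˡ-≤ q₀ p>1 ⟩
              q                     ≤⟨ ℕ.m≤m+n q m ⟩
              q ℕ.+ m               ≡⟨ e ⟨
              p ℕ.^ j ℕ.+ b         ≤⟨ ℕ.+-monoˡ-≤ b (ℕ.^-monoʳ-≤ p (ℕ.s≤s⁻¹ j<N)) ⟩
              q₀ ℕ.+ b              ∎))
          ... | tri> _ _ N<j = ⊥-elim (ℕ.<⇒≱ (begin-strict
              q ℕ.+ m               <⟨ ℕ.+-monoʳ-< q (ℕ.<-trans m<D (ℕ.≤-<-trans (ℕ.m≤m+n D D′) D<q)) ⟩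
              q ℕ.+ q               ≡⟨ ≡.cong (q ℕ.+_) (≡.sym (ℕ.+-identityʳ q)) ⟩
              2 ℕ.* q               ≤⟨ ℕ.*-monoˡ-≤ q p>1 ⟩
              p ℕ.* q               ≤⟨ ℕ.^-monoʳ-≤ p N<j ⟩
              p ℕ.^ j               ∎) (≡.subst (p ℕ.^ j ℕ.≤_) e (ℕ.m≤m+n (p ℕ.^ j) b)))
            where
            open import Relation.Binary.Definitions as Tri
            open ℕ.≤-Reasoning

      -- Minimal counterexample: F has period p^{k+1}, a zero u₀, and a nonzero value F(u), with as few nonzero values as possible.
      -- Then for every t the set of nonzero values is either stable under t or disjoint from its translate.
      module Minimal (k : ℕ) (main : ∀ F → 𝓕 F → Periodic (p ℕ.^ k) F → ∀ u₀ → Zero (F u₀) → ∀ σ → Zero (F σ))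
        (F : ℕ → S) (d : ∀ σ → Dec (Zero (F σ))) (f : 𝓕 F) (periodic : Periodic (p ℕ.^ suc k) F)
        (u₀ : ℕ) (z₀ : Zero (F u₀)) (u : ℕ) (nz : ¬ Zero (F u))
        (smaller : ∀ G → (e : ∀ σ → Dec (Zero (G σ))) → 𝓕 G → Periodic (p ℕ.^ suc k) G → failures e (p ℕ.^ suc k) ℕ.< failures d (p ℕ.^ suc k) →
                   ∀ v₀ → Zero (G v₀) → ∀ v → Zero (G v)) where

        q = p ℕ.^ k
        Q = p ℕ.^ suc k

        instance
          Q≢0 : NonZero Q
          Q≢0 = ℕ.m^n≢0 p (suc k)

        Stable : ℕ → Set
        Stable t = ∀ σ → ¬ Zero (F σ) → ¬ Zero (F (t ℕ.+ σ))

        -- The product F(σ) F(t + σ) vanishes wherever F does. With one more zero it would have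
        -- fewer nonzero values, hence vanish everywhere by minimality, against its value at σ₀.
        dichotomy : ∀ t σ₀ → ¬ Zero (F σ₀) → ¬ Zero (F (t ℕ.+ σ₀)) → Stable t
        dichotomy t σ₀ n₀ n₀′ σ nσ zσ = nonzero-* n₀ n₀′ (smaller G e (𝓕-* f (𝓕-τ t f)) G-periodic fewer σ G-zero σ₀)
          where
          G : ℕ → S
          G σ = F σ ⊛ F (t ℕ.+ σ)
          e : ∀ σ → Dec (Zero (G σ))
          e σ with d σ | d (t ℕ.+ σ)
          ... | yes z | _     = yes (S̄.trans (S̄.*-congʳ z) (S̄.zeroˡ _))
          ... | no _  | yes z = yes (S̄.trans (S̄.*-congˡ z) (S̄.zeroʳ _))
          ... | no n  | no n′ = no (nonzero-* n n′)
          G-zero : Zero (G σ)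
          G-zero = S̄.trans (S̄.*-congˡ zσ) (S̄.zeroʳ (F σ))
          G-periodic : Periodic Q G
          G-periodic σ = S̄.*-cong (periodic σ) (S̄.trans (S̄.reflexive (≡.cong F (solve 3 (λ t q s → t :+ (q :+ s) := q :+ (t :+ s)) ≡.refl t Q σ))) (periodic (t ℕ.+ σ)))
            where open ℕS.+-*-Solver
          reduce : ∀ {H} → Periodic Q H → H (σ % Q) ≡ₚ H σ
          reduce {H} h = S̄.sym (S̄.trans (S̄.reflexive (≡.cong H (≡.trans (ℕ.m≡m%n+[m/n]*n σ Q) (ℕ.+-comm (σ % Q) _)))) (Periodic-multiple (σ / Q) h (σ % Q)))
          fewer : failures e Q ℕ.< failures d Q
          fewer = failures-< d e Q (λ n _ z → S̄.trans (S̄.*-congʳ z) (S̄.zeroˡ _)) (σ % Q) (ℕ.m%n<n σ Q)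
            (λ z → nσ (Zero-resp (reduce periodic) z)) (Zero-resp (S̄.sym (reduce G-periodic)) G-zero)

        Stable-multiple : ∀ {t} j → Stable t → Stable (j ℕ.* t)
        Stable-multiple zero    h σ n = n
        Stable-multiple {t} (suc j) h σ n z = h (j ℕ.* t ℕ.+ σ) (Stable-multiple j h σ n) (≡.subst (λ m → Zero (F m)) (ℕ.+-assoc t (j ℕ.* t) σ) z)

        -- The norm of F down to period q has a zero at u₀ and so vanishes everywhere by `main`;
        -- stability under q would make it nonzero at u.
        unstable : ¬ Stable q
        unstable st = product-nonzero p (S̄.trans (S̄.reflexive (≡.refl)) (main N (𝓕-Π p q f) N-periodic u₀ N-zero u))
          where
          N : ℕ → S
          N = Π̄.fold p q F
          N-periodic : Periodic q N
          N-periodic = ≡.subst (λ m → Periodic q (Π̄.fold m q F)) suc-p-1 (Π̄.fold-periodic p-1 q F (≡.subst (λ m → Periodic (m ℕ.* q) F) (≡.sym suc-p-1) periodic))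
          N-zero : Zero (N u₀)
          N-zero = ≡.subst (λ m → Zero (Π̄.fold m q F u₀)) suc-p-1 (S̄.trans (Π̄.fold-front p-1 q F u₀) (S̄.trans (S̄.*-congʳ z₀) (S̄.zeroˡ _)))
          product-nonzero : ∀ n → ¬ Zero (Π̄.fold n q F u)
          product-nonzero zero    z = 1≁0 (atₚ z 0)
          product-nonzero (suc n) = nonzero-* (product-nonzero n) (Stable-multiple n st u nz)

        -- Stability under (i+1)q would give stability under q, as i + 1 is invertible modulo p. So
        -- among u, u + q, ..., u + (p-1)q only u carries a nonzero value.
        isolated : ∀ i → i ℕ.< p-1 → Zero (F (suc i ℕ.* q ℕ.+ u))
        isolated i i<p-1 = decidable-stable (d _) (λ n → unstable (λ σ nσ → stable-q σ nσ (dichotomy (suc i ℕ.* q) u nz n)))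
          where
          inv = mod-inverse {suc i} {p} (prime-coprime pr (λ e → ℕ.<⇒≱ (≡.subst (suc i ℕ.<_) suc-p-1 (s≤s i<p-1)) (ℕ.∣⇒≤ e)))
          j = proj₁ inv
          congruent : ∀ σ → (j ℕ.* (suc i ℕ.* q)) ℕ.+ σ ≡ q ℕ.+ σ [mod Q ]
          congruent = inverse-scaled {j} {suc i} {p} q (proj₂ inv)
          stable-q : ∀ σ → ¬ Zero (F σ) → Stable (suc i ℕ.* q) → ¬ Zero (F (q ℕ.+ σ))
          stable-q σ nσ st z = Stable-multiple j st σ nσ (Zero-resp (S̄.sym (Periodic-≡mod periodic (congruent σ))) z)

        Tr : (ℕ → S) → ℕ → S
        Tr = Σ̄.fold p q

        Tr-periodic : ∀ {G} → Periodic Q G → Periodic q (Tr G)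
        Tr-periodic {G} h = ≡.subst (λ m → Periodic q (Σ̄.fold m q G)) suc-p-1 (Σ̄.fold-periodic p-1 q G (≡.subst (λ m → Periodic (m ℕ.* q) G) (≡.sym suc-p-1) h))

        Tr-u : ∀ {G} → (∀ i → i ℕ.< p-1 → Zero (G (suc i ℕ.* q ℕ.+ u))) → Tr G u ≡ₚ G u
        Tr-u {G} h = ≡.subst (λ m → Σ̄.fold m q G u ≡ₚ G u) suc-p-1 (Σ̄.fold-single p-1 q G u h)

        -- Here p divides q, so a step 1 + nq is invertible modulo Q. A nonzero value at u + 1 + nq
        -- would make F stable under that step, whose multiples lead from u to the zero u₀. Hence
        -- the trace to period q vanishes at u + 1, so by `main` also at u, where it equals F(u).
        contradiction-suc : ∀ k′ → k ≡ suc k′ → ⊥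
        contradiction-suc k′ k≡ = nz (Zero-resp (Tr-u {F} isolated) (main (Tr F) (𝓕-Σ p q f) (Tr-periodic periodic) (suc u) (Tr-zero p) u))
          where
          p∣q : p ℕ.∣ q
          p∣q = ≡.subst (λ k → p ℕ.∣ p ℕ.^ k) (≡.sym k≡) (ℕ.m∣m*n (p ℕ.^ k′))
          Tr-zero : ∀ n → Zero (Σ̄.fold n q F (suc u))
          Tr-zero zero    = S̄.refl
          Tr-zero (suc n) = S̄.trans (S̄.+-cong (Tr-zero n) vanish) (S̄.+-identityˡ 0ₛ)
            where
            t = suc (n ℕ.* q)
            t-coprime : ¬ p ℕ.∣ t
            t-coprime e = ℕ.<⇒≱ p>1 (ℕ.∣⇒≤ (ℕ.∣m+n∣m⇒∣n (≡.subst (p ℕ.∣_) (ℕ.+-comm 1 (n ℕ.* q)) e) (ℕ.∣n⇒∣m*n n p∣q)))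
            inv = mod-inverse {t} {Q} (coprime-^ (suc k) (prime-coprime pr t-coprime))
            j = proj₁ inv ℕ.* (u₀ ℕ.+ (Q ℕ.∸ 1) ℕ.* u)
            reaches : (j ℕ.* t) ℕ.+ u ≡ u₀ [mod Q ]
            reaches = inverse-reaches {proj₁ inv} {t} u₀ u (proj₂ inv)
            vanish : Zero (F (n ℕ.* q ℕ.+ suc u))
            vanish = decidable-stable (d _) (λ nσ → Stable-multiple j (dichotomy t u nz (λ z → nσ (≡.subst (λ m → Zero (F m)) (≡.sym (ℕ.+-suc (n ℕ.* q) u)) z))) u nz
              (Zero-resp (S̄.sym (Periodic-≡mod periodic reaches)) z₀))

        -- With q = 1 the traces of F and of T F are invariant under σ ↦ σ + 1, hence polynomials in
        -- x modulo p. At u they equal F(u) and (Y + u) F(u), so F(u) and Y F(u) are polynomials,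
        -- against the irrationality of Y.
        contradiction-zero : k ≡ 0 → ⊥
        contradiction-zero k≡ = nz (Y-irrational (F u) ev ev-Y)
          where
          q≡1 : q ≡ 1
          q≡1 = ≡.cong (p ℕ.^_) k≡
          constant : ∀ {G} → Periodic q G → ∀ σ → G (suc σ) ≡ₚ G σ
          constant {G} h σ = ≡.subst (λ m → G (m ℕ.+ σ) ≡ₚ G σ) q≡1 (h σ)
          to-0 : ∀ {G} → Periodic q G → ∀ σ → G σ ≡ₚ G 0
          to-0 h zero    = S̄.refl
          to-0 {G} h (suc σ) = S̄.trans (constant {G} h σ) (to-0 h σ)
          eventually : ∀ {G} → 𝓕 G → Periodic Q G → (∀ i → i ℕ.< p-1 → Zero (G (suc i ℕ.* q ℕ.+ u))) → EventuallyZero (G u)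
          eventually {G} g h z = proj₁ E₀ , λ m D≤m → R.trans (R.sym (atₚ (Tr-u {G} z) m)) (R.trans (atₚ (to-0 (Tr-periodic h) u) m) (proj₂ E₀ m D≤m))
            where
            E₀ : EventuallyZero (Tr G 0)
            E₀ = constant⇒polynomial (degree t) (denominator t) (polynomial t) (constant {Tr G} (Tr-periodic h))
              where
              t : 𝓕 (Tr G)
              t = 𝓕-Σ p q g
          ev : EventuallyZero (F u)
          ev = eventually f periodic isolated
          TF : ℕ → S
          TF σ = T σ ⊛ F σ
          T-periodic : Periodic Q T
          T-periodic σ = S̄.+-congˡ (S̄.trans (exact⇒mod (KS.fromℕ-+ Q σ)) (S̄.trans (S̄.+-congʳ (S̄.trans (exact⇒mod (KS.fromℕ-* p q)) (S̄.trans (S̄.*-congʳ (S̄.trans (exact⇒mod (SE.fromℕ-const p)) (pwₚ λ { zero → residue-char ; (suc n) → R.refl }))) (S̄.zeroˡ _)))) (S̄.+-identityˡ _)))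
          ev-T : EventuallyZero (TF u)
          ev-T = eventually {TF} (𝓕-* (𝓕-Pol T-Pol) f) (λ σ → S̄.*-cong (T-periodic σ) (periodic σ)) (λ i i<p-1 → S̄.trans (S̄.*-congˡ (isolated i i<p-1)) (S̄.zeroʳ _))
            where
            T-Pol : Pol 2 T
            T-Pol = Pol-resp (λ σ → ≋-sym (Ŝ.*-identityʳ (T σ))) (Pol-T (Pol-const Ŝ.1# (Tate-const 1#)))
          ev-Y : EventuallyZero (Y ⊛ F u)
          ev-Y = proj₁ ev ℕ.+ proj₁ ev-T , λ m h → R.trans (atₚ (exact⇒mod split) m) (R.trans
              (R.+-cong (proj₂ ev-T m (ℕ.≤-trans (ℕ.m≤n+m _ _) h))
                (R.-‿cong (R.trans (≈⇒∼ (SE.fromℕ*-apply u (F u) m)) (R.trans (R.*-congˡ (proj₂ ev m (ℕ.≤-trans (ℕ.m≤m+n _ _) h))) (R.zeroʳ _)))))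
              (R.-‿inverseʳ 0#))
            where
            split : Y ⊛ F u ≋ TF u ⊖ KS.fromℕ u ⊛ F u
            split = KSS.solve 3 (λ y s f → y KSS.:* f KSS.:= (y KSS.:+ s) KSS.:* f KSS.:- s KSS.:* f) ≋-refl Y (KS.fromℕ u) (F u)

        absurd : ⊥
        absurd = cases k ≡.refl
          where
          cases : ∀ k′ → k ≡ k′ → ⊥
          cases zero     = contradiction-zero
          cases (suc k′) = contradiction-suc k′

      private
        decide : ∀ {F Q} .{{_ : NonZero Q}} → Periodic Q F → ¬ ¬ (∀ σ → Dec (Zero (F σ)))
        decide {F} {Q} h nd = ¬¬-decidable {λ σ → Zero (F σ)} Q (λ d → nd (λ σ → extend σ (d (σ % Q) (ℕ.m%n<n σ Q))))
          where
          reduce : ∀ σ → F σ ≡ₚ F (σ % Q)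
          reduce σ = S̄.trans (S̄.reflexive (≡.cong F (≡.trans (ℕ.m≡m%n+[m/n]*n σ Q) (ℕ.+-comm (σ % Q) _)))) (Periodic-multiple (σ / Q) h (σ % Q))
          extend : ∀ σ → Dec (Zero (F (σ % Q))) → Dec (Zero (F σ))
          extend σ (yes z) = yes (Zero-resp (S̄.sym (reduce σ)) z)
          extend σ (no n)  = no (λ z → n (Zero-resp (reduce σ) z))

        by-period : ∀ k F → 𝓕 F → Periodic (p ℕ.^ k) F → ∀ u₀ → Zero (F u₀) → ∀ σ → Zero (F σ)
        by-period zero F f h u₀ z₀ σ = Zero-resp (S̄.trans (to-0 u₀) (S̄.sym (to-0 σ))) z₀
          where
          to-0 : ∀ σ → F σ ≡ₚ F 0
          to-0 zero    = S̄.refl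
          to-0 (suc σ) = S̄.trans (h σ) (to-0 σ)
        by-period (suc k) F f h u₀ z₀ σ = zero-stable (λ nz → decide {F} {{ℕ.m^n≢0 p (suc k)}} h (λ d → nz (by-count (suc (failures d (p ℕ.^ suc k))) F d f h ℕ.≤-refl u₀ z₀ σ)))
          where
          by-count : ∀ N F (d : ∀ σ → Dec (Zero (F σ))) → 𝓕 F → Periodic (p ℕ.^ suc k) F → failures d (p ℕ.^ suc k) ℕ.< N → ∀ u₀ → Zero (F u₀) → ∀ σ → Zero (F σ)
          by-count (suc N) F d f h (s≤s d≤N) u₀ z₀ u = decidable-stable (d u) (λ nz → Minimal.absurd k (by-period k) F d f h u₀ z₀ u nz
            (λ G e g h′ e<d → by-count N G e g h′ (ℕ.<-≤-trans e<d d≤N)))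

      -- The substitute for a Galois action: vanishing modulo p does not depend on σ. Induction on
      -- the exponent of the period, and inside it on the number of nonzero values in one period.
      conjugates-zero : ∀ {F} → 𝓕 F → ∀ {u₀} → Zero (F u₀) → ∀ σ → Zero (F σ)
      conjugates-zero {F} f {u₀} = by-period (proj₁ (𝓕-periodic f)) F f (proj₂ (𝓕-periodic f)) u₀

      -- Linear independence modulo p of solutions with distinct β.

      open FinSum M.series
      open Elimination M.series series-domain (λ z → 1≁0 (atₚ z 0))

      -- A pivot that is nonzero at one conjugate is nonzero at all of them.
      dependence-conjugates : ∀ {I : Set} r (W : ℕ → Fin r → I → S) → (∀ k i → 𝓕 (λ σ → W σ k i)) → ∀ σ → Dependent r (W 0) → ¬ ¬ Dependent r (W σ)
      dependence-conjugates zero    W f σ D nd = nontrivial D (λ ())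
      dependence-conjugates (suc r) W f σ D nd = nd (zero⇒dependent (W σ) (λ i → conjugates-zero (f Fin.zero i) (zero-stable (pivot i)) σ))
        where
        pivot : ∀ i → ¬ Zero (W 0 Fin.zero i) → ⊥
        pivot i n = dependence-conjugates r (λ σ → eliminate i (W σ)) f′ σ (descend i (W 0) n D)
          (λ E → nd (ascend i (W σ) (λ z → n (conjugates-zero (f Fin.zero i) z 0)) E))
          where
          f′ : ∀ k j → 𝓕 (λ σ → eliminate i (W σ) k j)
          f′ k j = 𝓕-+ (𝓕-* (f Fin.zero i) (f (Fin.suc k) j)) (𝓕-neg (𝓕-* (f (Fin.suc k) i) (f Fin.zero j)))

      -- binom(N, q-1) mod p is the indicator of N ≡ -1 mod q, because (1+x)^q ≡ 1 + x^q.
      module Indicator (e : ℕ) where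

        q = p ℕ.^ e

        private instance
          q≢0 : NonZero q
          q≢0 = ℕ.m^n≢0 p e

        ψ : ℕ → Carrier
        ψ N = fromℕ (N C (q ℕ.∸ 1))

        private
          suc-q-1 : suc (q ℕ.∸ 1) ≡ q
          suc-q-1 = ≡.trans (ℕ.+-comm 1 (q ℕ.∸ 1)) (ℕ.m∸n+n≡m (ℕ.>-nonZero⁻¹ q))

          row : ℕ → S
          row N k = fromℕ (N C k)

          row-suc : ∀ N → row (suc N) ≋ (Ŝ.1# ⊕ X) ⊛ row N
          row-suc N = pw λ k → sym (trans (at (Ŝ.distribʳ (row N) Ŝ.1# X) k) (trans (+-cong (at (Ŝ.*-identityˡ (row N)) k) (E.X* (row N) k)) (pascal k)))
            where
            pascal : ∀ k → row N k + shift 1 (row N) k ≈ row (suc N) k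
            pascal zero    = trans (+-identityʳ _) (reflexive (≡.cong fromℕ (≡.trans (C0 N) (≡.sym (C0 (suc N))))))
              where
              C0 : ∀ n → n C 0 ≡ 1
              C0 n = ≡.trans (C.nCk≡nC[n∸k] {0} {n} z≤n) (C.nCn≡1 n)
            pascal (suc k) = trans (+-comm _ _) (trans (sym (fromℕ-+ (N C k) (N C suc k))) (reflexive (≡.cong fromℕ (C.nCk+nC[k+1]≡[n+1]C[k+1] N k))))

          row-+ : ∀ m N → row (m ℕ.+ N) ≋ (Ŝ.1# ⊕ X) KS.^ m ⊛ row N
          row-+ zero    N = ≋-sym (Ŝ.*-identityˡ (row N))
          row-+ (suc m) N = ≋-trans (row-suc (m ℕ.+ N)) (≋-trans (Ŝ.*-congˡ (row-+ m N)) (≋-sym (Ŝ.*-assoc _ _ (row N))))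

          open CharP M.series pr series-char

          power : ∀ e → (Ŝ.1# ⊕ X) KS.^ (p ℕ.^ e) ≡ₚ Ŝ.1# ⊕ X KS.^ (p ℕ.^ e)
          power zero    = S̄.trans (S̄.*-identityʳ _) (S̄.+-congˡ (S̄.sym (S̄.*-identityʳ X)))
          power (suc e) = S̄.trans (exact⇒mod (flip (Ŝ.1# ⊕ X))) (S̄.trans (Kit.^-cong M.series p (power e)) (S̄.trans (freshman-char Ŝ.1# (X KS.^ (p ℕ.^ e)))
            (S̄.+-cong (Kit.1^ M.series p) (exact⇒mod (≋-sym (flip X))))))
            where
            flip : ∀ x → x KS.^ (p ℕ.* p ℕ.^ e) ≋ (x KS.^ (p ℕ.^ e)) KS.^ p
            flip x = ≋-trans (Ŝ.reflexive (≡.cong (x KS.^_) (ℕ.*-comm p (p ℕ.^ e)))) (KS.^-* x (p ℕ.^ e) p)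

          -- Multiplication by 1 + x^q adds to a row of Pascal's triangle its shift by q, which does
          -- not reach the entry q - 1.
          ψ-periodic : ∀ N → ψ (q ℕ.+ N) ∼ ψ N
          ψ-periodic N = R.trans (atₚ (S̄.trans (exact⇒mod (row-+ q N)) (S̄.trans (S̄.*-congʳ (power e)) (S̄.distribʳ (row N) Ŝ.1# (X KS.^ q)))) (q ℕ.∸ 1))
            (R.trans (R.+-cong (atₚ (S̄.*-identityˡ (row N)) (q ℕ.∸ 1)) (R.trans (≈⇒∼ (at (SE.X^* q (row N)) (q ℕ.∸ 1)))
              (≈⇒∼ (SE.shift-small q (row N) (q ℕ.∸ 1) (ℕ.≤-reflexive suc-q-1))))) (R.+-identityʳ _))

          ψ-mod : ∀ N → ψ N ∼ ψ (N % q)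
          ψ-mod N = R.trans (R.reflexive (≡.cong ψ (≡.trans (ℕ.m≡m%n+[m/n]*n N q) (ℕ.+-comm (N % q) _)))) (go (N / q))
            where
            go : ∀ k → ψ (k ℕ.* q ℕ.+ N % q) ∼ ψ (N % q)
            go zero    = R.refl
            go (suc k) = R.trans (R.reflexive (≡.cong ψ (ℕ.+-assoc q (k ℕ.* q) (N % q)))) (R.trans (ψ-periodic _) (go k))

          q∣suc-mod : ∀ N → q ℕ.∣ suc N → N % q ≡ q ℕ.∸ 1
          q∣suc-mod N d = ℕ.suc-injective (≡.trans (ℕ.≤-antisym (ℕ.m%n<n N q) (ℕ.∣⇒≤ d′)) (≡.sym suc-q-1))
            where
            d′ : q ℕ.∣ suc (N % q)
            d′ = ℕ.∣m+n∣m⇒∣n (≡.subst (q ℕ.∣_) (≡.trans (≡.cong suc (≡.trans (ℕ.m≡m%n+[m/n]*n N q) (ℕ.+-comm (N % q) _))) (≡.sym (ℕ.+-suc (N / q ℕ.* q) (N % q)))) d) (ℕ.n∣m*n (N / q))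

        ψ-one : ∀ N → q ℕ.∣ suc N → ψ N ∼ 1#
        ψ-one N d = R.trans (ψ-mod N) (R.trans (R.reflexive (≡.cong fromℕ (≡.trans (≡.cong (_C (q ℕ.∸ 1)) (q∣suc-mod N d)) (C.nCn≡1 (q ℕ.∸ 1))))) (≈⇒∼ (+-identityʳ 1#)))

        ψ-zero : ∀ N → ¬ q ℕ.∣ suc N → ψ N ∼ 0#
        ψ-zero N ¬d = R.trans (ψ-mod N) (R.reflexive (≡.cong fromℕ (C.k>n⇒nCk≡0 (ℕ.≤∧≢⇒< (ℕ.s≤s⁻¹ (≡.subst (suc (N % q) ℕ.≤_) (≡.sym suc-q-1) (ℕ.m%n<n N q))) ne))))
          where
          ne : ¬ N % q ≡ q ℕ.∸ 1
          ne e = ¬d (≡.subst (q ℕ.∣_) (≡.cong suc (≡.sym (≡.trans (ℕ.m≡m%n+[m/n]*n N q) (ℕ.+-comm (N % q) _))))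
            (≡.subst (q ℕ.∣_) (ℕ.+-suc (N / q ℕ.* q) (N % q)) (ℕ.∣m∣n⇒∣m+n (ℕ.n∣m*n (N / q)) (≡.subst (λ r → q ℕ.∣ suc r) (≡.sym e) (≡.subst (q ℕ.∣_) (≡.sym suc-q-1) ℕ.∣-refl)))))

        ψ-shift : ∀ a N → q ℕ.∣ a → ψ N ∼ ψ (a ℕ.+ N)
        ψ-shift a N (ℕ.divides k ≡.refl) = R.sym (go k)
          where
          go : ∀ k → ψ (k ℕ.* q ℕ.+ N) ∼ ψ N
          go zero    = R.refl
          go (suc k) = R.trans (R.reflexive (≡.cong ψ (ℕ.+-assoc q (k ℕ.* q) N))) (R.trans (ψ-periodic _) (go k))

      open SeriesSum residue using (∑-coefficient)

      fromℕ∼0⇒∣ : ∀ m → fromℕ m ∼ 0# → p ℕ.∣ m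
      fromℕ∼0⇒∣ m (h Q., e) = ≡.subst (ℕ._∣ m) (ℕ.*-identityʳ p) (Div-fromℕ 1 m (h , trans e (trans (+-identityˡ _)
        (*-congʳ (reflexive (≡.cong fromℕ (≡.sym (ℕ.*-identityʳ p))))))))

      Div? : ∀ k a → Dec (Div (p ℕ.^ k) a)
      Div? k a with approximate a k
      ... | b , h , e with p ℕ.^ k ℕ.∣? b
      ... | yes (ℕ.divides w ≡.refl) = yes (fromℕ w + h , trans e (trans (+-congʳ (trans (fromℕ-* w (p ℕ.^ k)) (*-comm _ _))) (sym (distribˡ _ _ h))))
      ... | no ¬d = no (λ (w , e′) → ¬d (Div-fromℕ k b (w - h , trans (difference (fromℕ b) (fromℕ (p ℕ.^ k)) h) (trans (+-congʳ (trans (sym e) e′)) (factor (fromℕ (p ℕ.^ k)) w h)))))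
        where
        open Solver
        difference : ∀ b q h → b ≈ (b + q * h) - q * h
        difference = solve 3 (λ b q h → b := (b :+ q :* h) :- q :* h) refl
        factor : ∀ q w h → q * w - q * h ≈ q * (w - h)
        factor = solve 3 (λ q w h → q :* w :- q :* h := q :* (w :- h)) refl

      Div-weaken : ∀ {v w} a → v ℕ.≤ w → Div (p ℕ.^ w) a → Div (p ℕ.^ v) a
      Div-weaken {v} {w} a v≤w (h , e) = fromℕ (p ℕ.^ (w ℕ.∸ v)) * h , trans e (trans (*-congʳ (trans (reflexive (≡.cong fromℕ (≡.trans (≡.cong (p ℕ.^_) (≡.sym (ℕ.m+[n∸m]≡n v≤w)))
        (ℕ.^-distribˡ-+-* p v (w ℕ.∸ v))))) (fromℕ-* (p ℕ.^ v) (p ℕ.^ (w ℕ.∸ v))))) (*-assoc _ _ h))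

      -- The valuation v of m is below s; cancelling p^v leaves a unit times x equal to a multiple
      -- of p. Used for θN = q γ Y N: modulo p such an N has only exponents divisible by q.
      divisible-coefficient : ∀ s m x y → ¬ p ℕ.^ s ℕ.∣ m → fromℕ m * x ≈ fromℕ (p ℕ.^ s) * y → x ∼ 0#
      divisible-coefficient s m x y ¬d e = go (prime-split pr m (λ { ≡.refl → ¬d (ℕ.divides 0 ≡.refl) }))
        where
        open Solver
        go : (∃ λ v → ∃ λ u → m ≡ p ℕ.^ v ℕ.* u × ¬ p ℕ.∣ u) → x ∼ 0#
        go (v , u , m≡ , ¬p∣u) = unit (∼-domain {fromℕ u} {x} ((fromℕ (p ℕ.^ d) * y) Q., trans (cancel-ℕ′ (p ℕ.^ v) (p^a≢0 v) eq) (sym (+-identityˡ _))))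
          where
          v<s : v ℕ.< s
          v<s = ℕ.≰⇒> (λ s≤v → ¬d (≡.subst (p ℕ.^ s ℕ.∣_) (≡.sym m≡) (ℕ.∣m⇒∣m*n u (≡.subst (p ℕ.^ s ℕ.∣_) (≡.trans (≡.sym (ℕ.^-distribˡ-+-* p s (v ℕ.∸ s))) (≡.cong (p ℕ.^_) (ℕ.m+[n∸m]≡n s≤v))) (ℕ.m∣m*n (p ℕ.^ (v ℕ.∸ s)))))))
          d = s ℕ.∸ suc v
          s≡ : p ℕ.^ s ≡ p ℕ.^ v ℕ.* (p ℕ.* p ℕ.^ d)
          s≡ = ≡.trans (≡.cong (p ℕ.^_) (≡.trans (≡.sym (ℕ.m+[n∸m]≡n v<s)) (≡.sym (ℕ.+-suc v d)))) (ℕ.^-distribˡ-+-* p v (suc d))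
          assoc₁ : ∀ a b c → (a * b) * c ≈ a * (b * c)
          assoc₁ = *-assoc
          eq : fromℕ (p ℕ.^ v) * (fromℕ u * x) ≈ fromℕ (p ℕ.^ v) * (fromℕ p * (fromℕ (p ℕ.^ d) * y))
          eq = trans (sym (assoc₁ _ _ x)) (trans (*-congʳ (sym (fromℕ-* (p ℕ.^ v) u))) (trans (*-congʳ (reflexive (≡.cong fromℕ (≡.sym m≡)))) (trans e
            (trans (*-congʳ (trans (reflexive (≡.cong fromℕ s≡)) (trans (fromℕ-* (p ℕ.^ v) (p ℕ.* p ℕ.^ d)) (*-congˡ (fromℕ-* p (p ℕ.^ d))))))
              (trans (assoc₁ _ _ y) (*-congˡ (assoc₁ _ _ y)))))))
          unit : fromℕ u ∼ 0# ⊎ x ∼ 0# → x ∼ 0#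
          unit (inj₁ z) = ⊥-elim (¬p∣u (fromℕ∼0⇒∣ u z))
          unit (inj₂ z) = z

      private
        -- The equation is proved after multiplication by G, so the derivative of the inverse series
        -- is never computed.
        ode-quotient : ∀ {B D M G G⁻} → θ M ≋ (B ⊛ Y) ⊛ M → θ G ≋ (D ⊛ Y) ⊛ G → G ⊛ G⁻ ≋ Ŝ.1# → θ (M ⊛ G⁻) ≋ ((B ⊖ D) ⊛ Y) ⊛ (M ⊛ G⁻)
        ode-quotient {B} {D} {M} {G} {G⁻} θM θA inv = begin
          θ N                                        ≈⟨ unit (θ N) ⟩
          G⁻ ⊛ (G ⊛ θ N)                             ≈⟨ Ŝ.*-congˡ GθN ⟩
          G⁻ ⊛ ((B ⊛ Y) ⊛ (G ⊛ N) ⊖ ((D ⊛ Y) ⊛ G) ⊛ N) ≈⟨ rearrange G⁻ B D Y G N ⟩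
          G⁻ ⊛ (G ⊛ (((B ⊖ D) ⊛ Y) ⊛ N))             ≈⟨ unit _ ⟨
          ((B ⊖ D) ⊛ Y) ⊛ N                          ∎
          where
          open Relation.Binary.Reasoning.Setoid Ŝ.setoid
          N : S
          N = M ⊛ G⁻
          unit : ∀ f → f ≋ G⁻ ⊛ (G ⊛ f)
          unit f = ≋-sym (≋-trans (≋-sym (Ŝ.*-assoc G⁻ G f)) (≋-trans (Ŝ.*-congʳ (≋-trans (Ŝ.*-comm G⁻ G) inv)) (Ŝ.*-identityˡ f)))
          rearrange : ∀ i b c y a n → i ⊛ ((b ⊛ y) ⊛ (a ⊛ n) ⊖ ((c ⊛ y) ⊛ a) ⊛ n) ≋ i ⊛ (a ⊛ (((b ⊖ c) ⊛ y) ⊛ n))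
          rearrange = KSS.solve 6 (λ i b c y a n → i KSS.:* ((b KSS.:* y) KSS.:* (a KSS.:* n) KSS.:- ((c KSS.:* y) KSS.:* a) KSS.:* n) KSS.:= i KSS.:* (a KSS.:* (((b KSS.:- c) KSS.:* y) KSS.:* n))) ≋-refl
          GN : G ⊛ N ≋ M
          GN = ≋-trans (KSS.solve 3 (λ a m i → a KSS.:* (m KSS.:* i) KSS.:= (a KSS.:* i) KSS.:* m) ≋-refl G M G⁻) (≋-trans (Ŝ.*-congʳ inv) (Ŝ.*-identityˡ M))
          GθN : G ⊛ θ N ≋ (B ⊛ Y) ⊛ (G ⊛ N) ⊖ ((D ⊛ Y) ⊛ G) ⊛ N
          GθN = ≋-trans (KSS.solve 2 (λ x y → x KSS.:= (y KSS.:+ x) KSS.:- y) ≋-refl (G ⊛ θ N) (θ G ⊛ N))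
            (Ŝ.+-cong (≋-trans (≋-sym (pw (E.θ-* G N))) (≋-trans (pw (E.θ-cong (at GN))) (≋-trans θM (Ŝ.*-congˡ (≋-sym GN))))) (Ŝ.-‿cong (Ŝ.*-congʳ θA)))

      -- The operator w(θ), diagonal on the powers of x.
      weight : (ℕ → Carrier) → S → S
      weight w f m = w m * f m

      weight-zero : ∀ w → weight w 0ₛ ≡ₚ 0ₛ
      weight-zero w = pwₚ (λ m → R.zeroʳ (w m))

      weight-+ : ∀ w f g → weight w (f S̄.+ g) ≡ₚ weight w f S̄.+ weight w g
      weight-+ w f g = pwₚ (λ m → R.distribˡ (w m) (f m) (g m))

      weight-∑ : ∀ w r (f : Fin r → S) → ∑ r (λ k → weight w (f k)) ≡ₚ weight w (∑ r f)
      weight-∑ w r f = ∑-additive r (weight w) (weight-zero w) (weight-+ w) f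

      -- w(θ) with w of period q is linear over series in x^q: in a product x^a x^b with q dividing
      -- a, the weights of b and a + b agree.
      weight-* : ∀ {q} w N f → (∀ a b → q ℕ.∣ a → w b ∼ w (a ℕ.+ b)) → (∀ m → ¬ q ℕ.∣ m → N m ∼ 0#) → N ⊛ weight w f ≡ₚ weight w (N ⊛ f)
      weight-* {q} w N f periodic support = pwₚ λ m → R.trans (M.conv-cong-terms m {N} {weight w f} {N} {λ b → w m * f b} (term m))
          (≈⇒∼ (trans (at (Ŝ.*-comm N (λ b → w m * f b)) m) (trans (E.conv-scaleˡ (w m) f N m) (*-congˡ (at (Ŝ.*-comm f N) m)))))
        where
        term : ∀ m a b → a ℕ.+ b ≡ m → N a * (w b * f b) ∼ N a * (w m * f b)
        term m a b ≡.refl with q ℕ.∣? a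
        ... | yes d = R.*-congˡ (R.*-congʳ (periodic a b d))
        ... | no ¬d = R.trans (R.*-congʳ (support a ¬d)) (R.trans (R.zeroˡ (w b * f b)) (R.sym (R.trans (R.*-congʳ (support a ¬d)) (R.zeroˡ (w (a ℕ.+ b) * f b)))))

      -- Put M_k = N_k A^(b_k), where N_k has modulo p only exponents divisible by q. Applying ψ(θ +
      -- t) to the sum of the c_k M_k gives for every t a relation among the rows W 0, with
      -- coefficients M_k. At σ the rows are independent because their leading exponents differ
      -- modulo q; transport of dependence from 0 to σ is the contradiction.
      module LeadingTerms (r : ℕ) (c Mᵏ : Fin r → S) (o : Fin r → ℕ)
        (lead : ∀ k → ¬ c k (o k) ∼ 0#) (low : ∀ k j → j ℕ.< o k → c k j ∼ 0#) (M0 : ∀ k → Mᵏ k 0 ≈ 1#)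
        (k₀ : Fin r) (vanishes : Zero (∑ r (λ k → c k ⊛ Mᵏ k)))
        (q : ℕ) (q≢0 : NonZero q) (ψ : ℕ → Carrier) (ψ-one : ∀ N → q ℕ.∣ suc N → ψ N ∼ 1#) (ψ-zero : ∀ N → ¬ q ℕ.∣ suc N → ψ N ∼ 0#)
        (ψ-shift : ∀ a N → q ℕ.∣ a → ψ N ∼ ψ (a ℕ.+ N))
        (Aᵇ A⁻ᵇ : Fin r → S) (Aᵇ0 : ∀ k → Aᵇ k 0 ≈ 1#) (inv : ∀ k → Aᵇ k ⊛ A⁻ᵇ k ≋ Ŝ.1#)
        (N-support : ∀ k m → ¬ q ℕ.∣ m → (Mᵏ k ⊛ A⁻ᵇ k) m ∼ 0#)
        (b : Fin r → ℕ) (σ : ℕ) (distinct : ∀ k l → o k ℕ.+ σ ℕ.* b k ≡ o l ℕ.+ σ ℕ.* b l [mod q ] → k ≡ l)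
        (u : ℕ) (¬p∣u : ¬ p ℕ.∣ u) (W : ℕ → Fin r → ℕ → S) (W-𝓕 : ∀ k t → 𝓕 (λ σ → W σ k t))
        (W≋ : ∀ σ k t → W σ k t ≋ KS.fromℕ u ⊛ (A⁻ᵇ k ⊛ weight (λ m → ψ (m ℕ.+ (σ ℕ.* b k ℕ.+ t))) (c k ⊛ Aᵇ k))) where

        uₛ : S
        uₛ = KS.fromℕ u

        N : Fin r → S
        N k = Mᵏ k ⊛ A⁻ᵇ k

        residue-index : Fin r → ℕ
        residue-index k = o k ℕ.+ σ ℕ.* b k

        V : ℕ → Fin r → ℕ → S
        V σ k t = weight (λ m → ψ (m ℕ.+ (σ ℕ.* b k ℕ.+ t))) (c k ⊛ Aᵇ k)

        regroup : ∀ x σ k t → x ⊛ W σ k t ≋ uₛ ⊛ ((x ⊛ A⁻ᵇ k) ⊛ V σ k t)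
        regroup x σ k t = ≋-trans (Ŝ.*-congˡ (W≋ σ k t)) (KSS.solve 4 (λ x u a v → x KSS.:* (u KSS.:* (a KSS.:* v)) KSS.:= u KSS.:* ((x KSS.:* a) KSS.:* v)) ≋-refl x uₛ (A⁻ᵇ k) (V σ k t))

        NV : ∀ k t → N k ⊛ V 0 k t ≡ₚ weight (λ m → ψ (m ℕ.+ t)) (c k ⊛ Mᵏ k)
        NV k t = S̄.trans (weight-* (λ m → ψ (m ℕ.+ t)) (N k) (c k ⊛ Aᵇ k)
            (λ a b d → R.trans (ψ-shift a (b ℕ.+ t) d) (R.reflexive (≡.cong ψ (≡.sym (ℕ.+-assoc a b t))))) (N-support k))
            (pwₚ λ m → R.*-congˡ (≈⇒∼ (at NcA m)))
          where
          NcA : N k ⊛ (c k ⊛ Aᵇ k) ≋ c k ⊛ Mᵏ k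
          NcA = ≋-trans (KSS.solve 4 (λ c a m i → (m KSS.:* i) KSS.:* (c KSS.:* a) KSS.:= (a KSS.:* i) KSS.:* (c KSS.:* m)) ≋-refl (c k) (Aᵇ k) (Mᵏ k) (A⁻ᵇ k))
            (≋-trans (Ŝ.*-congʳ (inv k)) (Ŝ.*-identityˡ (c k ⊛ Mᵏ k)))

        dependent₀ : Dependent r (W 0)
        dependent₀ = record { h = Mᵏ ; nontrivial = λ z → 1≁0 (R.trans (≈⇒∼ (sym (M0 k₀))) (atₚ (z k₀) 0)) ; relation = rel }
          where
          w : ℕ → ℕ → Carrier
          w t m = ψ (m ℕ.+ t)
          rel : ∀ t → Zero (∑ r (λ k → Mᵏ k ⊛ W 0 k t))
          rel t = S̄.trans (∑-cong r (λ k → S̄.trans (exact⇒mod (regroup (Mᵏ k) 0 k t)) (S̄.*-congˡ (NV k t))))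
              (S̄.trans (∑-scale r uₛ (λ k → weight (w t) (c k ⊛ Mᵏ k))) (S̄.trans (S̄.*-congˡ (S̄.trans (weight-∑ (w t) r (λ k → c k ⊛ Mᵏ k))
                (pwₚ (λ m → R.trans (R.*-congˡ (atₚ vanishes m)) (R.zeroʳ (w t m)))))) (S̄.zeroʳ uₛ)))

        cA-low : ∀ k j → j ℕ.< o k → (c k ⊛ Aᵇ k) j ∼ 0#
        cA-low k j j<o = M.conv-zero j {c k} {Aᵇ k} (λ a b e → R.trans (R.*-congʳ (low k a (ℕ.≤-<-trans (≡.subst (a ℕ.≤_) e (ℕ.m≤m+n a b)) j<o))) (R.zeroˡ _))

        cA-lead : ∀ k → ¬ (c k ⊛ Aᵇ k) (o k) ∼ 0#
        cA-lead k z = lead k (R.trans (R.sym (R.*-identityʳ _)) (R.trans (R.*-congˡ (R.sym (≈⇒∼ (Aᵇ0 k))))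
            (R.trans (R.sym (R.trans (R.reflexive (≡.cong (c k ⊛ Aᵇ k) (≡.sym (ℕ.+-identityʳ (o k))))) (M.conv-single (o k) 0 {c k} {Aᵇ k} others))) z)))
          where
          others : ∀ a b → a ℕ.+ b ≡ o k ℕ.+ 0 → ¬ a ≡ o k → c k a * Aᵇ k b ∼ 0#
          others a b e ne = R.trans (R.*-congʳ (low k a (ℕ.≤∧≢⇒< (≡.subst (a ℕ.≤_) (≡.trans e (ℕ.+-identityʳ (o k))) (ℕ.m≤m+n a b)) ne))) (R.zeroˡ _)

        module Descent (g : Fin r → S) (relation′ : ∀ t → Zero (∑ r (λ k → g k ⊛ V σ k t))) where

          -- t makes the indicator ψ equal to 1 at the leading exponent of row k₀ and 0 at those of
          -- the other rows. In the coefficient of x^(i₀ + o k₀) every other product has a vanishing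
          -- factor: a coefficient below the leading one, a leading one in another class, or some g
          -- k i with smaller i + o k.
          module Pivot (k₀ : Fin r) (i₀ t : ℕ) (q∣ : q ℕ.∣ suc (residue-index k₀ ℕ.+ t))
            (rec : ∀ k i → i ℕ.+ o k ℕ.< i₀ ℕ.+ o k₀ → g k i ∼ 0#) where

            n : ℕ
            n = i₀ ℕ.+ o k₀

            index≡ : ∀ k b′ → b′ ≡ o k → b′ ℕ.+ (σ ℕ.* b k ℕ.+ t) ≡ residue-index k ℕ.+ t
            index≡ k b′ ≡.refl = ≡.sym (ℕ.+-assoc (o k) (σ ℕ.* b k) t)

            lead-cases : ψ (o k₀ ℕ.+ (σ ℕ.* b k₀ ℕ.+ t)) ∼ 0# ⊎ (c k₀ ⊛ Aᵇ k₀) (o k₀) ∼ 0# → ⊥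
            lead-cases (inj₁ zψ) = 1≁0 (R.trans (R.sym (R.trans (R.reflexive (≡.cong ψ (index≡ k₀ (o k₀) ≡.refl))) (ψ-one (residue-index k₀ ℕ.+ t) q∣))) zψ)
            lead-cases (inj₂ zc) = cA-lead k₀ zc

            unit : g k₀ i₀ ∼ 0# ⊎ V σ k₀ t (o k₀) ∼ 0# → g k₀ i₀ ∼ 0#
            unit (inj₁ z) = z
            unit (inj₂ z) = ⊥-elim (lead-cases (∼-domain {ψ (o k₀ ℕ.+ (σ ℕ.* b k₀ ℕ.+ t))} {(c k₀ ⊛ Aᵇ k₀) (o k₀)} z))

            V-low : ∀ k b′ → b′ ℕ.< o k → V σ k t b′ ∼ 0#
            V-low k b′ b<o = R.trans (R.*-congˡ (cA-low k b′ b<o)) (R.zeroʳ (ψ (b′ ℕ.+ (σ ℕ.* b k ℕ.+ t))))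

            V-nonresidue : ∀ k b′ → b′ ≡ o k → ¬ k ≡ k₀ → V σ k t b′ ∼ 0#
            V-nonresidue k b′ b≡o ne = R.trans (R.*-congʳ (R.trans (R.reflexive (≡.cong ψ (index≡ k b′ b≡o)))
                (ψ-zero (residue-index k ℕ.+ t) (λ d → ne (distinct k k₀ (mod-difference {residue-index k} {residue-index k₀} {t} d q∣))))))
              (R.zeroˡ ((c k ⊛ Aᵇ k) b′))

            term : ∀ k a b′ → a ℕ.+ b′ ≡ n → (b′ ≡ o k → ¬ k ≡ k₀) → g k a * V σ k t b′ ∼ 0#
            term k a b′ e ne = cases (ℕ.<-cmp b′ (o k))
              where
              cases : Tri (b′ ℕ.< o k) (b′ ≡ o k) (o k ℕ.< b′) → g k a * V σ k t b′ ∼ 0#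
              cases (tri< b<o _ _) = R.trans (R.*-congˡ (V-low k b′ b<o)) (R.zeroʳ (g k a))
              cases (tri≈ _ b≡o _) = R.trans (R.*-congˡ (V-nonresidue k b′ b≡o (ne b≡o))) (R.zeroʳ (g k a))
              cases (tri> _ _ o<b) = R.trans (R.*-congʳ (rec k a (≡.subst (a ℕ.+ o k ℕ.<_) e (ℕ.+-monoʳ-< a o<b)))) (R.zeroˡ (V σ k t b′))

            others : ∀ k → ¬ k ≡ k₀ → (g k ⊛ V σ k t) n ∼ 0#
            others k ne = M.conv-zero n {g k} {V σ k t} (λ a b e → term k a b e (λ _ → ne))

            own : (g k₀ ⊛ V σ k₀ t) n ∼ g k₀ i₀ * V σ k₀ t (o k₀)
            own = M.conv-single i₀ (o k₀) {g k₀} {V σ k₀ t} (λ a b e ne → term k₀ a b e (λ b≡o _ → ne (ℕ.+-cancelʳ-≡ (o k₀) a i₀ (≡.trans (≡.cong (a ℕ.+_) (≡.sym b≡o)) e))))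

            conclusion : g k₀ i₀ ∼ 0#
            conclusion = unit (∼-domain {g k₀ i₀} {V σ k₀ t (o k₀)} (R.trans (R.sym own)
              (R.trans (R.sym (∑-coefficient r (λ k → g k ⊛ V σ k t) n k₀ others)) (atₚ (relation′ t) n))))

          -- The natural number `(q ∸ 1) * suc ρ` is congruent to -1 - ρ modulo q, which is the t
          -- wanted for a leading exponent ρ.
          multiple-of-q : ∀ ρ → q ℕ.∣ suc (ρ ℕ.+ (q ℕ.∸ 1) ℕ.* suc ρ)
          multiple-of-q ρ = ℕ.divides (suc ρ) (≡.trans (≡.cong (ℕ._* suc ρ) (≡.trans (ℕ.+-comm 1 (q ℕ.∸ 1)) (ℕ.m∸n+n≡m (ℕ.>-nonZero⁻¹ q {{q≢0}})))) (ℕ.*-comm q (suc ρ)))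

          g-zero : ∀ N k i → i ℕ.+ o k ℕ.< N → g k i ∼ 0#
          g-zero (suc N) k i (s≤s i≤N) = Pivot.conclusion k i ((q ℕ.∸ 1) ℕ.* suc (residue-index k)) (multiple-of-q (residue-index k))
            (λ k′ i′ lt → g-zero N k′ i′ (ℕ.<-≤-trans lt i≤N))

        uₛ-nonzero : ¬ Zero uₛ
        uₛ-nonzero z = ¬p∣u (fromℕ∼0⇒∣ u (R.trans (≈⇒∼ (sym (at (SE.fromℕ-const u) 0))) (atₚ z 0)))

        normalize : (D : Dependent r (W σ)) → ∀ t → Zero (∑ r (λ k → (h D k ⊛ A⁻ᵇ k) ⊛ V σ k t))
        normalize D t = series-domain uₛ s₀ (S̄.trans (S̄.sym (∑-scale r uₛ (λ k → (h D k ⊛ A⁻ᵇ k) ⊛ V σ k t)))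
            (S̄.trans (∑-cong r (λ k → S̄.sym (exact⇒mod (regroup (h D k) σ k t)))) (relation D t))) uₛ-nonzero
          where
          s₀ : S
          s₀ = ∑ r (λ k → (h D k ⊛ A⁻ᵇ k) ⊛ V σ k t)

        restore : ∀ f k → f ≋ (f ⊛ A⁻ᵇ k) ⊛ Aᵇ k
        restore f k = ≋-sym (≋-trans (Ŝ.*-assoc f (A⁻ᵇ k) (Aᵇ k)) (≋-trans (Ŝ.*-congˡ (≋-trans (Ŝ.*-comm (A⁻ᵇ k) (Aᵇ k)) (inv k))) (Ŝ.*-identityʳ f)))

        independentσ : ¬ Dependent r (W σ)
        independentσ D = nontrivial D (λ k → S̄.trans (exact⇒mod (restore (h D k) k)) (S̄.trans (S̄.*-congʳ (g-Zero k)) (S̄.zeroˡ (Aᵇ k))))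
          where
          g-Zero : ∀ k → Zero (h D k ⊛ A⁻ᵇ k)
          g-Zero k = pwₚ (λ i → Descent.g-zero (λ k → h D k ⊛ A⁻ᵇ k) (normalize D) (suc (i ℕ.+ o k)) k i ℕ.≤-refl)

        absurd : ⊥
        absurd = dependence-conjugates r W W-𝓕 σ dependent₀ independentσ

      module Terms (r : ℕ) (c Mᵏ : Fin r → S) (β : Fin r → Carrier) (o : Fin r → ℕ)
        (tate : ∀ k → Tate (c k)) (lead : ∀ k → ¬ c k (o k) ∼ 0#) (low : ∀ k j → j ℕ.< o k → c k j ∼ 0#)
        (M0 : ∀ k → Mᵏ k 0 ≈ 1#) (θM : ∀ k → θ (Mᵏ k) ≋ (const (β k) ⊛ Y) ⊛ Mᵏ k)
        (k₀ : Fin r) (vanishes : Zero (∑ r (λ k → c k ⊛ Mᵏ k)))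
        (v₀ : ℕ) (separate : ∀ k l → k ≡ l ⊎ ¬ Div (p ℕ.^ v₀) (β k - β l)) where

        -- p^e exceeds all orders o_k, and p^v₀ separates the β_k. Modulo q = p^(e+v₀) the number
        -- o_k + p^e b_k records o_k in its low digits and b_k modulo p^v₀ in its high digits.
        e s : ℕ
        e = proj₁ (∃-bound o)
        s = e ℕ.+ v₀

        open Indicator s using (q; ψ; ψ-one; ψ-zero; ψ-shift)

        b : Fin r → ℕ
        b k = proj₁ (approximate (β k) s)

        module B (k : Fin r) (t : ℕ) = Binomial (b k) t (c k)

        Aᵇ A⁻ᵇ N : Fin r → S
        Aᵇ k  = B.Aᵇ k 0
        A⁻ᵇ k = B.A⁻ᵇ k 0
        N k = Mᵏ k ⊛ A⁻ᵇ k

        -- N_k solves θN = (β_k - b_k) Y N, and q divides β_k - b_k.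
        N-support : ∀ k m → ¬ q ℕ.∣ m → N k m ∼ 0#
        N-support k m ¬d = divisible-coefficient s m (N k m) (u * (Y ⊛ N k) m) ¬d (begin
          fromℕ m * N k m                                               ≈⟨ at (ode-quotient (θM k) (θA^ (b k)) (B.Aᵇ-inverse k 0)) m ⟩
          (((const (β k) ⊖ KS.fromℕ (b k)) ⊛ Y) ⊛ N k) m                ≈⟨ at (Ŝ.*-congʳ (Ŝ.*-congʳ difference)) m ⟩
          ((const (fromℕ q * u) ⊛ Y) ⊛ N k) m                           ≈⟨ at (Ŝ.*-assoc (const (fromℕ q * u)) Y (N k)) m ⟩
          (const (fromℕ q * u) ⊛ (Y ⊛ N k)) m                           ≈⟨ E.conv-const (fromℕ q * u) (Y ⊛ N k) m ⟩
          (fromℕ q * u) * (Y ⊛ N k) m                                   ≈⟨ *-assoc (fromℕ q) u _ ⟩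
          fromℕ q * (u * (Y ⊛ N k) m)                                   ∎)
          where
          open Relation.Binary.Reasoning.Setoid setoid
          u : Carrier
          u = proj₁ (proj₂ (approximate (β k) s))
          β≈ : β k ≈ fromℕ (b k) + fromℕ q * u
          β≈ = proj₂ (proj₂ (approximate (β k) s))
          difference : const (β k) ⊖ KS.fromℕ (b k) ≋ const (fromℕ q * u)
          difference = pw λ
            { zero    → trans (+-cong β≈ (-‿cong (at (SE.fromℕ-const (b k)) 0))) (Solver.solve 2 (λ x y → (x Solver.:+ y) Solver.:- x Solver.:= y) refl (fromℕ (b k)) (fromℕ q * u))
            ; (suc n) → trans (+-congˡ (-‿cong (at (SE.fromℕ-const (b k)) (suc n)))) (-‿inverseʳ 0#) }

        σ : ℕ
        σ = p ℕ.^ e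

        o<σ : ∀ k → o k ℕ.< σ
        o<σ k = ℕ.≤-<-trans (proj₂ (∃-bound o) k) (j<p^j e)

        residue-index : Fin r → ℕ
        residue-index k = o k ℕ.+ σ ℕ.* b k

        q≡ : q ≡ p ℕ.^ v₀ ℕ.* σ
        q≡ = ≡.trans (ℕ.^-distribˡ-+-* p e v₀) (ℕ.*-comm σ (p ℕ.^ v₀))

        -- The leading exponents o_k + σ b_k are distinct modulo q.
        distinct : ∀ k l → residue-index k ≡ residue-index l [mod q ] → k ≡ l
        distinct k l d with separate k l
        ... | inj₁ e = e
        ... | inj₂ ¬d = ⊥-elim (¬d (β-divisible (b-congruent o≡)))
          where
          o≡ : o k ≡ o l
          o≡ = mod-small (o<σ k) (o<σ l) (mod-strip (o k) (o l) (b k) (b l) σ (p ℕ.^ v₀) (≡.subst (λ q → residue-index k ≡ residue-index l [mod q ]) q≡ d))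
          b-congruent : o k ≡ o l → b k ≡ b l [mod p ℕ.^ v₀ ]
          b-congruent o≡ = mod-cancel (o k) (o l) (b k) (b l) σ (p ℕ.^ v₀) {{ℕ.m^n≢0 p e}} o≡ (≡.subst (λ q → residue-index k ≡ residue-index l [mod q ]) q≡ d)
          approximation : ∀ k → Div (p ℕ.^ v₀) (β k - fromℕ (b k))
          approximation k = Div-weaken (β k - fromℕ (b k)) (ℕ.m≤n+m v₀ e) (proj₁ (proj₂ (approximate (β k) s)) ,
            trans (+-congʳ (proj₂ (proj₂ (approximate (β k) s)))) (Solver.solve 2 (λ x y → (x Solver.:+ y) Solver.:- x Solver.:= y) refl (fromℕ (b k)) _))
          multiple : ∀ b b′ w → b ≡ w ℕ.* p ℕ.^ v₀ ℕ.+ b′ → fromℕ b - fromℕ b′ ≈ fromℕ (p ℕ.^ v₀) * fromℕ w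
          multiple b b′ w ≡.refl = trans (+-congʳ (trans (fromℕ-+ (w ℕ.* p ℕ.^ v₀) b′) (+-congʳ (fromℕ-* w (p ℕ.^ v₀)))))
            (Solver.solve 3 (λ w q b → (w Solver.:* q Solver.:+ b) Solver.:- b Solver.:= q Solver.:* w) refl (fromℕ w) (fromℕ (p ℕ.^ v₀)) (fromℕ b′))
          b-div : b k ≡ b l [mod p ℕ.^ v₀ ] → Div (p ℕ.^ v₀) (fromℕ (b k) - fromℕ (b l))
          b-div d with ≡mod⇒multiple {b k} {b l} d
          ... | inj₁ (w , e) = fromℕ w , multiple (b k) (b l) w e
          ... | inj₂ (w , e) = - fromℕ w , trans (Solver.solve 2 (λ x y → x Solver.:- y Solver.:= Solver.:- (y Solver.:- x)) refl (fromℕ (b k)) (fromℕ (b l)))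
                (trans (-‿cong (multiple (b l) (b k) w e)) (-‿distribʳ (fromℕ (p ℕ.^ v₀)) (fromℕ w)))
            where
            -‿distribʳ : ∀ x y → - (x * y) ≈ x * - y
            -‿distribʳ = Solver.solve 2 (λ x y → Solver.:- (x Solver.:* y) Solver.:= x Solver.:* (Solver.:- y)) refl
          β-divisible : b k ≡ b l [mod p ℕ.^ v₀ ] → Div (p ℕ.^ v₀) (β k - β l)
          β-divisible d = let (x , ex) = approximation k ; (y , ey) = b-div d ; (z , ez) = approximation l in
            (x + y) - z , trans (Solver.solve 4 (λ β b c γ → β Solver.:- γ Solver.:= ((β Solver.:- b) Solver.:+ (b Solver.:- c)) Solver.:- (γ Solver.:- c)) refl (β k) (fromℕ (b k)) (fromℕ (b l)) (β l))
              (trans (+-cong (+-cong ex ey) (-‿cong ez)) (Solver.solve 4 (λ q x y z → (q Solver.:* x Solver.:+ q Solver.:* y) Solver.:- q Solver.:* z Solver.:= q Solver.:* ((x Solver.:+ y) Solver.:- z)) refl (fromℕ (p ℕ.^ v₀)) x y z))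

        module Scaled (a u : ℕ) (factorial : (q ℕ.∸ 1) ! ≡ p ℕ.^ a ℕ.* u) where

          W : ℕ → Fin r → ℕ → S
          W σ k t = KS.fromℕ u ⊛ B.W k t (q ℕ.∸ 1) σ

          W-𝓕 : ∀ k t → 𝓕 (λ σ → W σ k t)
          W-𝓕 k t = record { denominator = a ; degree = suc (q ℕ.∸ 1) ; polynomial = Pol-resp eq (B.Pol-P k t (tate k) (q ℕ.∸ 1)) }
            where
            eq : ∀ σ → pᵃ a ⊛ W σ k t ≋ B.P k t (q ℕ.∸ 1) σ
            eq σ = ≋-trans (≋-sym (Ŝ.*-assoc (pᵃ a) (KS.fromℕ u) (B.W k t (q ℕ.∸ 1) σ))) (≋-trans (Ŝ.*-congʳ (≋-trans (≋-sym (KS.fromℕ-* (p ℕ.^ a) u))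
              (Ŝ.reflexive (≡.cong KS.fromℕ (≡.sym factorial))))) (B.W-multiple k t (q ℕ.∸ 1) σ))

        absurd : ⊥
        absurd with prime-split pr ((q ℕ.∸ 1) !) (ℕ.≢-nonZero⁻¹ ((q ℕ.∸ 1) !) {{ℕ._!≢0 (q ℕ.∸ 1)}})
        ... | a , u , factorial , ¬p∣u = LeadingTerms.absurd r c Mᵏ o lead low M0 k₀ vanishes q (ℕ.m^n≢0 p s) ψ ψ-one ψ-zero ψ-shift
            Aᵇ A⁻ᵇ (λ k → SE.^-coeff0 A (b k) A0) (λ k → B.Aᵇ-inverse k 0) N-support b σ distinct u ¬p∣u (Scaled.W a u factorial) (Scaled.W-𝓕 a u factorial) (λ σ k t → ≋-refl)

      -- O is separated, so finitely many distinct β are already distinct modulo some p^v₀. This v₀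
      -- is obtained under double negation, enough for a negative conclusion.
      independence : ∀ r (c Mᵏ : Fin r → S) (β : Fin r → Carrier) (o : Fin r → ℕ) →
        (∀ k → Tate (c k)) → (∀ k → ¬ c k (o k) ∼ 0#) → (∀ k j → j ℕ.< o k → c k j ∼ 0#) →
        (∀ k → Mᵏ k 0 ≈ 1#) → (∀ k → θ (Mᵏ k) ≋ (const (β k) ⊛ Y) ⊛ Mᵏ k) → (∀ k l → ¬ k ≡ l → ¬ β k ≈ β l) →
        Fin r → ¬ Zero (∑ r (λ k → c k ⊛ Mᵏ k))
      independence r c Mᵏ β o tate lead low M0 θM different k₀ z =
        ¬¬-bound (λ k v → ∀ l → k ≡ l ⊎ ¬ Div (p ℕ.^ v) (β k - β l)) (λ k v≤w h l → weaken k l v≤w (h l))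
          (λ k → ¬¬-bound (λ l v → k ≡ l ⊎ ¬ Div (p ℕ.^ v) (β k - β l)) (λ l → weaken k l) (separated-pair k))
          (λ (v₀ , h) → Terms.absurd r c Mᵏ β o tate lead low M0 θM k₀ z v₀ h)
        where
        weaken : ∀ k l {v w} → v ℕ.≤ w → k ≡ l ⊎ ¬ Div (p ℕ.^ v) (β k - β l) → k ≡ l ⊎ ¬ Div (p ℕ.^ w) (β k - β l)
        weaken k l v≤w = Sum.map₂ (λ ¬d d → ¬d (Div-weaken (β k - β l) v≤w d))
        separated-pair : ∀ k l → ¬ ¬ ∃ λ v → k ≡ l ⊎ ¬ Div (p ℕ.^ v) (β k - β l)
        separated-pair k l n with k Fin.≟ l
        ... | yes e = n (0 , inj₁ e)
        ... | no ne = different k l ne (x-y≈0⇒x≈y (separated (β k - β l) (λ v → decidable-stable (Div? v (β k - β l)) (λ ¬d → n (v , inj₂ ¬d)))))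

-- The degree of a primitive n-th root of unity over ℚ.

module Cyclotomic where

  open import Defs using (totient)
  open RingKit
  open PadicRing using (fermat)
  open NatMod
  open Padic using (prime-coprime)
  open import Algebra.Bundles using (CommutativeRing)
  open import Level using (0ℓ)
  open import Data.Empty using (⊥; ⊥-elim)
  open import Data.Integer as ℤ using (ℤ; +_; -[1+_])
  import Data.Integer.Properties as ℤ
  import Data.Integer.Divisibility.Signed as ℤ
  import Data.Integer.Solver as ℤS
  open import Data.List as List using (List; []; _∷_; length)
  import Data.List.Properties as List
  open import Data.List.Membership.Propositional using (_∈_)
  import Data.List.Membership.Propositional.Properties as ∈
  open import Data.List.Relation.Unary.All as All using (All; []; _∷_)
  import Data.List.Relation.Unary.All.Properties as All
  open import Data.List.Relation.Unary.AllPairs as AllPairs using (AllPairs; []; _∷_)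
  import Data.List.Relation.Unary.AllPairs.Properties as AllPairs
  open import Data.Nat as ℕ using (ℕ; zero; suc; NonZero; s≤s; z≤n; _≤_; _<_)
  import Data.Nat.Properties as ℕ
  import Data.Nat.Divisibility as ℕ
  open import Data.Nat.Coprimality as Coprime using (Coprime)
  open import Data.Nat.DivMod as ℕ using (_/_; _%_)
  open import Data.Nat.GCD as ℕ using (gcd)
  open import Data.Nat.ListAction using (product)
  open import Data.Nat.ListAction.Properties using (∈⇒∣product)
  open import Data.Nat.Primality using (Prime; prime⇒nonZero; prime⇒nonTrivial; euclidsLemma)
  open import Data.Nat.Primality.Factorisation using (factorise; factors; PrimeFactorisation)
  open import Data.Product using (Σ; _×_; _,_; proj₁; proj₂; ∃)
  open import Data.Sum as Sum using (_⊎_; inj₁; inj₂)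
  open import Data.Vec as Vec using (Vec; []; _∷_)
  import Data.Vec.Relation.Unary.All as VAll
  open VAll using ([]; _∷_)
  open import Relation.Binary.PropositionalEquality as ≡ using (_≡_)
  open import Relation.Nullary using (Dec; yes; no; ¬_; contradiction; ¬?)
  open import Relation.Nullary.Decidable using (decidable-stable)

  module Polynomial (R : CommutativeRing 0ℓ 0ℓ) where

    open CommutativeRing R hiding (zero)
    open Kit R
    open Solver

    eval : ∀ {m} → Vec Carrier m → Carrier → Carrier
    eval []      x = 0#
    eval (c ∷ P) x = c + x * eval P x

    quot : ∀ {m} → Carrier → Vec Carrier (suc m) → Vec Carrier m
    quot r (c ∷ [])        = []
    quot r (c ∷ P@(_ ∷ _)) = eval P r ∷ quot r P

    eval-quot : ∀ {m} r (P : Vec Carrier (suc m)) x → eval P x - eval P r ≈ (x - r) * eval (quot r P) x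
    eval-quot r (c ∷ []) x = solve 3 (λ c x r → (c :+ x :* con (+ 0)) :- (c :+ r :* con (+ 0)) := (x :- r) :* con (+ 0)) refl c x r
    eval-quot r (c ∷ P@(_ ∷ _)) x = trans (solve 5 (λ c x r p q → (c :+ x :* p) :- (c :+ r :* q) := (x :- r) :* q :+ x :* (p :- q)) refl c x r (eval P x) (eval P r))
      (trans (+-congˡ (*-congˡ (eval-quot r P x))) (solve 4 (λ x r p q → (x :- r) :* p :+ x :* ((x :- r) :* q) := (x :- r) :* (p :+ x :* q)) refl x r (eval P r) (eval (quot r P) x)))

    AllZero : ∀ {m} → Vec Carrier m → Set
    AllZero = VAll.All (_≈ 0#)

    quot-zero : ∀ {m} r (P : Vec Carrier (suc m)) → eval P r ≈ 0# → AllZero (quot r P) → AllZero P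
    quot-zero r (c ∷ []) e [] = trans (solve 2 (λ c r → c := c :+ r :* con (+ 0)) refl c r) e ∷ []
    quot-zero r (c ∷ P@(_ ∷ _)) e (z ∷ zs) = trans (sym (trans (+-congˡ (trans (*-congˡ z) (zeroʳ r))) (+-identityʳ c))) e ∷ quot-zero r P z zs

    -- Takes the place of being nonzero: R is an arbitrary commutative ring here, and cancellation
    -- is what splitting off a linear factor uses.
    Cancellable : Carrier → Set
    Cancellable c = ∀ y → c * y ≈ 0# → y ≈ 0#

    Torsion-free : Set
    Torsion-free = ∀ m → Cancellable (fromℕ (suc m))

    Nontrivial : Set
    Nontrivial = ¬ 1# ≈ 0#

    record PrimitiveRoot (ζ : Carrier) (n : ℕ) : Set where
      field
        n>0      : 0 < n
        ζ^n      : ζ ^ n ≈ 1#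
        distinct : ∀ i j → 0 < i → i < j → j ≤ n → Cancellable (ζ ^ j - ζ ^ i)

    -- Split off T - r; cancelling s - r shows that every other root s is a root of the quotient.
    roots : ∀ {m} (P : Vec Carrier m) rs → AllPairs (λ r s → Cancellable (s - r)) rs → All (λ r → eval P r ≈ 0#) rs → m ≤ length rs → AllZero P
    roots [] rs d z m≤ = []
    roots P@(_ ∷ _) (r ∷ rs) (d ∷ ds) (z ∷ zs) (s≤s m≤) = quot-zero r P z (roots (quot r P) rs ds (All.zipWith step (d , zs)) m≤)
      where
      step : ∀ {s} → Cancellable (s - r) × eval P s ≈ 0# → eval (quot r P) s ≈ 0#
      step {s} (c , e) = c _ (trans (sym (eval-quot r P s)) (trans (+-cong e (-‿cong z)) (-‿inverseʳ 0#)))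

    monomial : ∀ m → Vec Carrier (suc m)
    monomial zero    = 1# ∷ []
    monomial (suc m) = 0# ∷ monomial m

    eval-monomial : ∀ m x → eval (monomial m) x ≈ x ^ m
    eval-monomial zero    x = trans (+-congˡ (zeroʳ x)) (+-identityʳ 1#)
    eval-monomial (suc m) x = trans (+-identityˡ _) (*-congˡ (eval-monomial m x))

  prime-divisor : ∀ m → 1 < m → ∃ λ r → Prime r × r ℕ.∣ m
  prime-divisor m@(suc _) 1<m with factorise m
  ... | record { factors = [] ; isFactorisation = e } = contradiction (≡.sym e) (ℕ.<⇒≢ 1<m)
  ... | record { factors = r ∷ rs ; isFactorisation = e ; factorsPrime = pr ∷ _ } = r , pr , ℕ.divides (product rs) (≡.trans e (ℕ.*-comm r (product rs)))

  length-filter-¬ : {P : ℕ → Set} (P? : ∀ x → Dec (P x)) → ∀ xs → length (List.filter P? xs) ℕ.+ length (List.filter (λ x → ¬? (P? x)) xs) ≡ length xs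
  length-filter-¬ P? []       = ≡.refl
  length-filter-¬ P? (x ∷ xs) with P? x
  ... | yes _ = ≡.cong suc (length-filter-¬ P? xs)
  ... | no _  = ≡.trans (ℕ.+-suc _ _) (≡.cong suc (length-filter-¬ P? xs))

  module Powers (R : CommutativeRing 0ℓ 0ℓ) where

    open CommutativeRing R hiding (zero)
    open Kit R

    ^-multiple : ∀ z m k → z ^ m ≈ 1# → z ^ (k ℕ.* m) ≈ 1#
    ^-multiple z m k e = trans (reflexive (≡.cong (z ^_) (ℕ.*-comm k m))) (trans (^-* z m k) (trans (^-cong k e) (1^ k)))

    -- Bézout in the form jk ≡ 1 modulo m; the two directions of the congruence are treated apart
    -- because exponents are natural numbers.
    coprime-powers : ∀ z k m .{{_ : NonZero m}} → Coprime k m → z ^ k ≈ 1# → z ^ m ≈ 1# → z ≈ 1#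
    coprime-powers z k m c ek em = combine (mod-inverse {k} {m} c)
      where
      cases : ∀ j → ((∃ λ w → j ℕ.* k ≡ w ℕ.* m ℕ.+ 1) ⊎ (∃ λ w → 1 ≡ w ℕ.* m ℕ.+ j ℕ.* k)) → z ≈ 1#
      cases j (inj₁ (w , e)) = trans (sym (trans (reflexive (≡.cong (z ^_) e)) (trans (^-+ z (w ℕ.* m) 1) (trans (*-congʳ (^-multiple z m w em)) (trans (*-identityˡ (z ^ 1)) (*-identityʳ z)))))) (^-multiple z k j ek)
      cases j (inj₂ (w , e)) = trans (sym (*-identityʳ z)) (trans (reflexive (≡.cong (z ^_) e)) (trans (^-+ z (w ℕ.* m) (j ℕ.* k)) (trans (*-cong (^-multiple z m w em) (^-multiple z k j ek)) (*-identityˡ 1#))))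
      combine : (∃ λ j → (j ℕ.* k) ≡ 1 [mod m ]) → z ≈ 1#
      combine (j , d) = cases j (≡mod⇒multiple {j ℕ.* k} {1} d)

  ¬¬-dec : {P : Set} → ¬ ¬ Dec P
  ¬¬-dec c = c (no (λ p → c (yes p)))

  module TorsionFree (R : CommutativeRing 0ℓ 0ℓ) (torsion-free : Polynomial.Torsion-free R) (nontrivial : Polynomial.Nontrivial R) where

    open CommutativeRing R hiding (zero)
    open Kit R
    open Polynomial R
    open Solver

    fromℤ-cancel : ∀ {c} → ¬ c ≡ + 0 → Cancellable (fromℤ c)
    fromℤ-cancel {+ zero}    nz y e = ⊥-elim (nz ≡.refl)
    fromℤ-cancel {+ suc m}   nz y e = torsion-free m y e
    fromℤ-cancel { -[1+ m ]} nz y e = torsion-free m y (trans (solve 2 (λ a y → a :* y := :- ((:- a) :* y)) refl (fromℕ (suc m)) y) (trans (-‿cong e) (solve 0 (:- con (+ 0) := con (+ 0)) refl)))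

    fromℤ-injective : ∀ {c} → fromℤ c ≈ 0# → c ≡ + 0
    fromℤ-injective {c} e = decidable-stable (c ℤ.≟ + 0) (λ nz → nontrivial (fromℤ-cancel nz 1# (trans (*-identityʳ _) e)))

  -- The argument runs over ℤ, with a shortest integral relation among 1, ζ, ζ^2, ... in the role of
  -- the minimal polynomial. Its degree is bounded by φ(n) from both sides, without irreducibility
  -- or a field of fractions.
  module RootOfUnity (R : CommutativeRing 0ℓ 0ℓ) (torsion-free : Polynomial.Torsion-free R) (nontrivial : Polynomial.Nontrivial R)
    (ζ : CommutativeRing.Carrier R) (n : ℕ) (primroot : Polynomial.PrimitiveRoot R ζ n) where

    open CommutativeRing R hiding (zero)
    open Kit R
    open Polynomial R
    open PrimitiveRoot primroot
    open Solver
    open TorsionFree R torsion-free nontrivial public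

    private
      instance
        n≢0 : NonZero n
        n≢0 = ℕ.>-nonZero n>0

    ev : ∀ {m} → Vec ℤ m → Carrier → Carrier
    ev V x = eval (Vec.map fromℤ V) x

    ev-cong : ∀ {m} (V : Vec ℤ m) {x y} → x ≈ y → ev V x ≈ ev V y
    ev-cong []      e = refl
    ev-cong (c ∷ V) e = +-congˡ (*-cong e (ev-cong V e))

    IsZero : ∀ {m} → Vec ℤ m → Set
    IsZero = VAll.All (_≡ + 0)

    isZero? : ∀ {m} (V : Vec ℤ m) → Dec (IsZero V)
    isZero? = VAll.all? (ℤ._≟ + 0)

    AllZero⇒IsZero : ∀ {m} (V : Vec ℤ m) → AllZero (Vec.map fromℤ V) → IsZero V
    AllZero⇒IsZero []      []       = []
    AllZero⇒IsZero (c ∷ V) (z ∷ zs) = fromℤ-injective z ∷ AllZero⇒IsZero V zs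

    ev-IsZero : ∀ {m} {V : Vec ℤ m} → IsZero V → ∀ x → ev V x ≈ 0#
    ev-IsZero []              x = refl
    ev-IsZero (≡.refl ∷ zs) x = trans (+-identityˡ _) (trans (*-congˡ (ev-IsZero zs x)) (zeroʳ x))

    Dependent : ℕ → Set
    Dependent m = Σ (Vec ℤ m) λ V → ¬ IsZero V × ev V ζ ≈ 0#

    linear : ∀ {m} → ℤ → Vec ℤ m → ℤ → Vec ℤ m → Vec ℤ m
    linear a V b W = Vec.zipWith (λ v w → a ℤ.* v ℤ.+ b ℤ.* w) V W

    ev-linear : ∀ {m} a (V : Vec ℤ m) b W x → ev (linear a V b W) x ≈ fromℤ a * ev V x + fromℤ b * ev W x
    ev-linear a []      b []      x = solve 2 (λ a b → con (+ 0) := a :* con (+ 0) :+ b :* con (+ 0)) refl (fromℤ a) (fromℤ b)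
    ev-linear a (v ∷ V) b (w ∷ W) x = trans (+-cong (trans (fromℤ-+ (a ℤ.* v) (b ℤ.* w)) (+-cong (fromℤ-* a v) (fromℤ-* b w))) (*-congˡ (ev-linear a V b W x)))
      (solve 7 (λ a b v w x V W → (a :* v :+ b :* w) :+ x :* (a :* V :+ b :* W) := a :* (v :+ x :* V) :+ b :* (w :+ x :* W)) refl (fromℤ a) (fromℤ b) (fromℤ v) (fromℤ w) x (ev V x) (ev W x))

    zeros : ∀ m → Vec ℤ m
    zeros m = Vec.replicate m (+ 0)

    ev-zeros : ∀ m x → ev (zeros m) x ≈ 0#
    ev-zeros zero    x = refl
    ev-zeros (suc m) x = trans (+-identityˡ _) (trans (*-congˡ (ev-zeros m x)) (zeroʳ x))

    -- Multiplication by x plus c at fixed length; the coefficient pushed out at the top is returned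
    -- separately, to be reduced by F.
    push : ∀ {m} → ℤ → Vec ℤ m → Vec ℤ m × ℤ
    push c []      = [] , c
    push c (v ∷ V) = c ∷ proj₁ (push v V) , proj₂ (push v V)

    ev-push : ∀ {m} c (V : Vec ℤ m) x → ev (proj₁ (push c V)) x + fromℤ (proj₂ (push c V)) * x ^ m ≈ fromℤ c + x * ev V x
    ev-push c [] x = solve 2 (λ c x → con (+ 0) :+ c :* con (+ 1) := c :+ x :* con (+ 0)) refl (fromℤ c) x
    ev-push {suc m} c (v ∷ V) x = trans (solve 5 (λ c x r l z → (c :+ x :* r) :+ l :* (x :* z) := c :+ x :* (r :+ l :* z)) refl (fromℤ c) x (ev (proj₁ (push v V)) x) (fromℤ (proj₂ (push v V))) (x ^ m))
      (+-congˡ (*-congˡ (ev-push v V x)))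

    ev-∷ʳ : ∀ {m} (V : Vec ℤ m) a x → ev (V Vec.∷ʳ a) x ≈ ev V x + fromℤ a * x ^ m
    ev-∷ʳ [] a x = solve 2 (λ a x → a :+ x :* con (+ 0) := con (+ 0) :+ a :* con (+ 1)) refl (fromℤ a) x
    ev-∷ʳ {suc m} (v ∷ V) a x = trans (+-congˡ (*-congˡ (ev-∷ʳ V a x))) (solve 5 (λ v x w a z → v :+ x :* (w :+ a :* z) := (v :+ x :* w) :+ a :* (x :* z)) refl (fromℤ v) x (ev V x) (fromℤ a) (x ^ m))

    T^n-1 : Vec ℤ (suc n)
    T^n-1 = linear (+ 1) (zeros n Vec.∷ʳ + 1) -[1+ 0 ] (+ 1 ∷ zeros n)
    ev-T^n-1 : ∀ x → ev T^n-1 x ≈ x ^ n - 1#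
    ev-T^n-1 x = trans (ev-linear (+ 1) (zeros n Vec.∷ʳ + 1) -[1+ 0 ] (+ 1 ∷ zeros n) x)
      (trans (+-cong (*-congˡ (trans (ev-∷ʳ (zeros n) (+ 1) x) (+-congʳ (ev-zeros n x)))) (*-congˡ (+-congˡ (trans (*-congˡ (ev-zeros n x)) (zeroʳ x)))))
        (solve 1 (λ y → (con (+ 1) :+ con (+ 0)) :* (con (+ 0) :+ (con (+ 1) :+ con (+ 0)) :* y) :+ con -[1+ 0 ] :* ((con (+ 1) :+ con (+ 0)) :+ con (+ 0)) := y :- con (+ 1)) refl (x ^ n)))
    0^ : ∀ {k} → 0 < k → 0# ^ k ≈ 0#
    0^ {suc k} _ = zeroˡ _

    ^-multiple : ∀ k → ζ ^ (k ℕ.* n) ≈ 1#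
    ^-multiple k = trans (reflexive (≡.cong (ζ ^_) (ℕ.*-comm k n))) (trans (^-* ζ n k) (trans (^-cong k ζ^n) (1^ k)))

    ^-% : ∀ k → ζ ^ k ≈ ζ ^ (k % n)
    ^-% k = trans (reflexive (≡.cong (ζ ^_) (ℕ.m≡m%n+[m/n]*n k n))) (trans (^-+ ζ (k % n) (k / n ℕ.* n)) (trans (*-congˡ (^-multiple (k / n))) (*-identityʳ _)))

    exponents : List ℕ
    exponents = List.map suc (List.upTo n)

    exponents-positive : All (λ i → 0 < i × i ≤ n) exponents
    exponents-positive = All.map⁺ (All.applyUpTo⁺₁ (λ i → i) n (λ i<n → s≤s z≤n , i<n))

    exponents-distinct : AllPairs (λ i j → Cancellable (ζ ^ j - ζ ^ i)) exponents
    exponents-distinct = go exponents-positive (AllPairs.map⁺ (AllPairs.applyUpTo⁺₁ (λ i → i) n (λ i<j _ → s≤s i<j)))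
      where
      go : ∀ {xs} → All (λ i → 0 < i × i ≤ n) xs → AllPairs _<_ xs → AllPairs (λ i j → Cancellable (ζ ^ j - ζ ^ i)) xs
      go [] [] = []
      go {i ∷ _} ((0<i , _) ∷ bs) (os ∷ oss) = All.zipWith (λ {j} (i<j , _ , j≤n) → distinct i j 0<i i<j j≤n) (os , bs) ∷ go bs oss

    roots-filter : ∀ {m} (V : Vec ℤ m) {P : ℕ → Set} (P? : ∀ i → Dec (P i)) → (∀ i → 0 < i → i ≤ n → P i → ev V (ζ ^ i) ≈ 0#) →
      m ≤ length (List.filter P? exponents) → IsZero V
    roots-filter V P? h m≤ = AllZero⇒IsZero V (roots (Vec.map fromℤ V) (List.map (ζ ^_) (List.filter P? exponents))
      (AllPairs.map⁺ (AllPairs.filter⁺ P? exponents-distinct))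
      (All.map⁺ (All.zipWith (λ {i} (pi , 0<i , i≤n) → h i 0<i i≤n pi) (All.all-filter P? exponents , All.filter⁺ P? exponents-positive)))
      (≡.subst (_ ≤_) (≡.sym (List.length-map (ζ ^_) (List.filter P? exponents))) m≤))

    coprime? : ∀ i → Dec (gcd i n ≡ 1)
    coprime? i = gcd i n ℕ.≟ 1

    height : ∀ {m} → Vec ℤ m → ℕ
    height []      = 0
    height (c ∷ V) = ℤ.∣ c ∣ ℕ.+ height V

    bounded : ∀ m (h : ℕ → ℕ) → ∃ λ b → ∀ i → i < m → h i ≤ b
    bounded zero    h = 0 , λ _ ()
    bounded (suc m) h with bounded m (λ i → h (suc i))
    ... | b , g = h 0 ℕ.+ b , λ { zero _ → ℕ.m≤m+n (h 0) b ; (suc i) (s≤s i<m) → ℕ.≤-trans (g i i<m) (ℕ.m≤n+m b (h 0)) }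

    -- F = low + a T^d is a relation of least degree. Since a may differ from 1, each reduction step
    -- modulo F costs a factor a, and `α e` below is a^e.
    module Minimal (d : ℕ) (low : Vec ℤ d) (a : ℤ) (a≢0 : ¬ a ≡ + 0) (root : ev (low Vec.∷ʳ a) ζ ≈ 0#) (minimal : ¬ Dependent d) where

      F : Carrier → Carrier
      F = ev (low Vec.∷ʳ a)

      vanish : (V : Vec ℤ d) → ev V ζ ≈ 0# → IsZero V
      vanish V e = decidable-stable (isZero? V) (λ nz → minimal (V , nz , e))

      α : ℕ → ℤ
      α zero    = + 1
      α (suc e) = a ℤ.* α e

      α≢0 : ∀ e → ¬ α e ≡ + 0
      α≢0 (suc e) z = Sum.[ a≢0 , α≢0 e ] (ℤ.i*j≡0⇒i≡0∨j≡0 a z)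

      α-+ : ∀ e e′ → α (e ℕ.+ e′) ≡ α e ℤ.* α e′
      α-+ zero    e′ = ≡.sym (ℤ.*-identityˡ _)
      α-+ (suc e) e′ = ≡.trans (≡.cong (a ℤ.*_) (α-+ e e′)) (≡.sym (ℤ.*-assoc a (α e) (α e′)))

      ⟦α⟧-+ : ∀ e e′ → fromℤ (α (e ℕ.+ e′)) ≈ fromℤ (α e) * fromℤ (α e′)
      ⟦α⟧-+ e e′ = trans (reflexive (≡.cong fromℤ (α-+ e e′))) (fromℤ-* (α e) (α e′))

      top : ℤ → Vec ℤ d → ℤ
      top c V = proj₂ (push c V)

      remainder : ℤ → Vec ℤ d → Vec ℤ d
      remainder c V = linear a (proj₁ (push c V)) (ℤ.- top c V) low

      division : ∀ c V x → fromℤ a * (fromℤ c + x * ev V x) ≈ F x * fromℤ (top c V) + ev (remainder c V) x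
      division c V x = trans (*-congˡ (sym (ev-push c V x))) (trans
        (solve 5 (λ a ys l z f → a :* (ys :+ l :* z) := (f :+ a :* z) :* l :+ (a :* ys :+ (:- l) :* f)) refl (fromℤ a) (ev (proj₁ (push c V)) x) (fromℤ (top c V)) (x ^ d) (ev low x))
        (+-cong (*-congʳ (sym (ev-∷ʳ low a x))) (sym (trans (ev-linear a (proj₁ (push c V)) (ℤ.- top c V) low x) (+-congˡ (*-congʳ (fromℤ-neg (top c V))))))))

      divide : ∀ e (P : Vec ℤ (e ℕ.+ d)) → Σ (Vec ℤ e) λ Q → Σ (Vec ℤ d) λ V → ∀ x → fromℤ (α e) * ev P x ≈ F x * ev Q x + ev V x
      divide zero    P       = [] , P , λ x → trans (solve 1 (λ p → ((con (+ 1) :+ con (+ 0)) :* p) := p) refl (ev P x)) (sym (trans (+-congʳ (zeroʳ (F x))) (+-identityˡ _)))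
      divide (suc e) (c ∷ P) with divide e P
      ... | Q , V , h = top (α e ℤ.* c) V ∷ linear a Q (+ 0) Q , remainder (α e ℤ.* c) V , λ x →
        trans (*-congʳ (fromℤ-* a (α e))) (trans (solve 5 (λ a b c x p → (a :* b) :* (c :+ x :* p) := a :* (b :* c :+ x :* (b :* p))) refl (fromℤ a) (fromℤ (α e)) (fromℤ c) x (ev P x))
        (trans (*-congˡ (+-cong (sym (fromℤ-* (α e) c)) (*-congˡ (h x)))) (trans
          (solve 6 (λ a c x f q v → a :* (c :+ x :* (f :* q :+ v)) := f :* (x :* (a :* q)) :+ a :* (c :+ x :* v)) refl (fromℤ a) (fromℤ (α e ℤ.* c)) x (F x) (ev Q x) (ev V x))
        (trans (+-congˡ (division (α e ℤ.* c) V x)) (trans (solve 5 (λ f x q t v → f :* (x :* q) :+ (f :* t :+ v) := f :* (t :+ x :* q) :+ v) refl (F x) x (fromℤ a * ev Q x) (fromℤ (top (α e ℤ.* c) V)) (ev (remainder (α e ℤ.* c) V) x))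
          (+-congʳ (*-congˡ (+-congˡ (*-congˡ (sym (trans (ev-linear a Q (+ 0) Q x) (trans (+-congˡ (zeroˡ (ev Q x))) (+-identityʳ _)))))))))))))

      -- Pseudo-division of G by F. Only values of the quotient are ever needed, so it is a mere
      -- function, while the remainder keeps its integer coefficients because minimality and size
      -- are applied to them.
      record Reducible (G : Carrier → Carrier) : Set where
        field
          exponent : ℕ
          rest     : Vec ℤ d
          quotient : Carrier → Carrier
          equation : ∀ x → fromℤ (α exponent) * G x ≈ F x * quotient x + ev rest x

      open Reducible

      red-constant : ∀ c → Reducible (λ _ → fromℤ c)
      red-constant c = record { exponent = 1 ; rest = remainder c (zeros d) ; quotient = λ _ → fromℤ (top c (zeros d))
        ; equation = λ x → trans (*-cong (trans (fromℤ-* a (+ 1)) (trans (*-congˡ (+-identityʳ 1#)) (*-identityʳ _))) (sym (trans (+-congˡ (trans (*-congˡ (ev-zeros d x)) (zeroʳ x))) (+-identityʳ _)))) (division c (zeros d) x) }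

      red-resp : ∀ {G H} → (∀ x → G x ≈ H x) → Reducible G → Reducible H
      red-resp h G = record { exponent = exponent G ; rest = rest G ; quotient = quotient G ; equation = λ x → trans (*-congˡ (sym (h x))) (equation G x) }

      red-X : ∀ {G} → Reducible G → Reducible (λ x → x * G x)
      red-X {G} r = record { exponent = suc (exponent r) ; rest = remainder (+ 0) (rest r) ; quotient = λ x → fromℤ a * (x * quotient r x) + fromℤ (top (+ 0) (rest r))
        ; equation = λ x → trans (*-congʳ (fromℤ-* a (α (exponent r)))) (trans (solve 4 (λ a b x g → (a :* b) :* (x :* g) := a :* (x :* (b :* g))) refl (fromℤ a) (fromℤ (α (exponent r))) x (G x))
          (trans (*-congˡ (*-congˡ (equation r x))) (trans (solve 5 (λ a x f q v → a :* (x :* (f :* q :+ v)) := f :* (a :* (x :* q)) :+ a :* (con (+ 0) :+ x :* v)) refl (fromℤ a) x (F x) (quotient r x) (ev (rest r) x))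
          (trans (+-congˡ (division (+ 0) (rest r) x)) (solve 4 (λ f q t v → f :* q :+ (f :* t :+ v) := f :* (q :+ t) :+ v) refl (F x) (fromℤ a * (x * quotient r x)) (fromℤ (top (+ 0) (rest r))) (ev (remainder (+ 0) (rest r)) x)))))) }

      red-+ : ∀ {G H} → Reducible G → Reducible H → Reducible (λ x → G x + H x)
      red-+ {G} {H} r s = record { exponent = exponent r ℕ.+ exponent s ; rest = linear (α (exponent s)) (rest r) (α (exponent r)) (rest s)
        ; quotient = λ x → fromℤ (α (exponent s)) * quotient r x + fromℤ (α (exponent r)) * quotient s x
        ; equation = λ x → trans (*-congʳ (⟦α⟧-+ (exponent r) (exponent s))) (trans (solve 4 (λ a b g h → (a :* b) :* (g :+ h) := b :* (a :* g) :+ a :* (b :* h)) refl (fromℤ (α (exponent r))) (fromℤ (α (exponent s))) (G x) (H x))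
          (trans (+-cong (*-congˡ (equation r x)) (*-congˡ (equation s x))) (trans
            (solve 7 (λ a b f q q′ v v′ → b :* (f :* q :+ v) :+ a :* (f :* q′ :+ v′) := f :* (b :* q :+ a :* q′) :+ (b :* v :+ a :* v′)) refl (fromℤ (α (exponent r))) (fromℤ (α (exponent s))) (F x) (quotient r x) (quotient s x) (ev (rest r) x) (ev (rest s) x))
            (+-congˡ (sym (ev-linear (α (exponent s)) (rest r) (α (exponent r)) (rest s) x)))))) }

      red-scale : ∀ c {G} → Reducible G → Reducible (λ x → fromℤ c * G x)
      red-scale c {G} r = record { exponent = exponent r ; rest = linear c (rest r) (+ 0) (rest r) ; quotient = λ x → fromℤ c * quotient r x
        ; equation = λ x → trans (solve 3 (λ a c g → a :* (c :* g) := c :* (a :* g)) refl (fromℤ (α (exponent r))) (fromℤ c) (G x)) (trans (*-congˡ (equation r x))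
          (trans (solve 4 (λ c f q v → c :* (f :* q :+ v) := f :* (c :* q) :+ (c :* v :+ con (+ 0) :* v)) refl (fromℤ c) (F x) (quotient r x) (ev (rest r) x)) (+-congˡ (sym (ev-linear c (rest r) (+ 0) (rest r) x))))) }

      red-ev-* : ∀ {m} (V : Vec ℤ m) {G} → Reducible G → Reducible (λ x → ev V x * G x)
      red-ev-* []      {G} r = red-resp (λ x → sym (zeroˡ (G x))) (red-constant (+ 0))
      red-ev-* (c ∷ V) {G} r = red-resp (λ x → solve 4 (λ c x v g → c :* g :+ x :* (v :* g) := (c :+ x :* v) :* g) refl (fromℤ c) x (ev V x) (G x)) (red-+ (red-scale c r) (red-X (red-ev-* V r)))

      red-* : ∀ {G H} → Reducible G → Reducible H → Reducible (λ x → G x * H x)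
      red-* {G} {H} r s = let t = red-ev-* (rest r) s in record { exponent = exponent t ℕ.+ exponent r ; rest = rest t ; quotient = λ x → fromℤ (α (exponent t)) * (quotient r x * H x) + quotient t x
        ; equation = λ x → trans (*-congʳ (⟦α⟧-+ (exponent t) (exponent r))) (trans (solve 4 (λ a b g h → (a :* b) :* (g :* h) := a :* ((b :* g) :* h)) refl (fromℤ (α (exponent t))) (fromℤ (α (exponent r))) (G x) (H x))
          (trans (*-congˡ (*-congʳ (equation r x))) (trans (solve 5 (λ a f q v h → a :* ((f :* q :+ v) :* h) := f :* (a :* (q :* h)) :+ a :* (v :* h)) refl (fromℤ (α (exponent t))) (F x) (quotient r x) (ev (rest r) x) (H x))
          (trans (+-congˡ (equation t x)) (solve 4 (λ f q q′ v → f :* q :+ (f :* q′ :+ v) := f :* (q :+ q′) :+ v) refl (F x) (fromℤ (α (exponent t)) * (quotient r x * H x)) (quotient t x) (ev (rest t) x)))))) }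

      red-one : Reducible (λ _ → 1#)
      red-one = red-resp (λ _ → +-identityʳ 1#) (red-constant (+ 1))

      red-^ : ∀ k → Reducible (λ x → x ^ k)
      red-^ zero    = red-one
      red-^ (suc k) = red-X (red-^ k)

      red-ev : ∀ {m} (V : Vec ℤ m) {G} → Reducible G → Reducible (λ x → ev V (G x))
      red-ev []      r = red-constant (+ 0)
      red-ev (c ∷ V) r = red-+ (red-constant c) (red-* r (red-ev V r))

      at-root : ∀ {G} (r : Reducible G) → fromℤ (α (exponent r)) * G ζ ≈ ev (rest r) ζ
      at-root r = trans (equation r ζ) (trans (+-congʳ (trans (*-congʳ root) (zeroˡ _))) (+-identityˡ _))

      -- At ζ only the remainder survives, and d is minimal. So F divides a power of a times G as
      -- soon as G(ζ) = 0.
      vanish-reducible : ∀ {G} (r : Reducible G) → G ζ ≈ 0# → IsZero (rest r)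
      vanish-reducible r e = vanish (rest r) (trans (sym (at-root r)) (trans (*-congˡ e) (zeroʳ _)))

      -- If h = gcd(i, n) > 1, the polynomial 1 + T^m + … + T^((h-1)m) with hm = n vanishes at ζ but is h at ζ^i,
      -- so F, which divides a multiple of it, does not vanish at ζ^i.
      module NonCoprime (i h m : ℕ) (n≡ : n ≡ h ℕ.* m) (h>1 : 1 < h) (n∣im : n ℕ.∣ i ℕ.* m) where

        geometric : ℕ → Carrier → Carrier
        geometric zero    x = 0#
        geometric (suc k) x = 1# + x ^ m * geometric k x

        red-geometric : ∀ k → Reducible (geometric k)
        red-geometric zero    = red-constant (+ 0)
        red-geometric (suc k) = red-+ red-one (red-* (red-^ m) (red-geometric k))

        telescope : ∀ k x → (x ^ m - 1#) * geometric k x ≈ x ^ (k ℕ.* m) - 1#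
        telescope zero    x = solve 1 (λ y → (y :- con (+ 1)) :* con (+ 0) := con (+ 1) :- con (+ 1)) refl (x ^ m)
        telescope (suc k) x = trans (solve 2 (λ y g → (y :- con (+ 1)) :* (con (+ 1) :+ y :* g) := (y :- con (+ 1)) :+ y :* ((y :- con (+ 1)) :* g)) refl (x ^ m) (geometric k x))
          (trans (+-congˡ (*-congˡ (telescope k x))) (trans (solve 2 (λ y z → (y :- con (+ 1)) :+ y :* (z :- con (+ 1)) := y :* z :- con (+ 1)) refl (x ^ m) (x ^ (k ℕ.* m))) (+-congʳ (sym (^-+ x m (k ℕ.* m))))))

        m>0 : 0 < m
        m>0 = ℕ.n≢0⇒n>0 (λ z → ℕ.<⇒≢ n>0 (≡.sym (≡.trans n≡ (≡.trans (≡.cong (h ℕ.*_) z) (ℕ.*-zeroʳ h)))))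

        m<n : m < n
        m<n = ≡.subst (m <_) (≡.trans (ℕ.*-comm m h) (≡.sym n≡)) (ℕ.m<m*n m h {{ℕ.>-nonZero m>0}} h>1)

        zero-at-ζ : geometric h ζ ≈ 0#
        zero-at-ζ = distinct m n m>0 m<n ℕ.≤-refl _ (trans (*-congʳ (+-congʳ ζ^n)) (trans (solve 2 (λ y g → (con (+ 1) :- y) :* g := :- ((y :- con (+ 1)) :* g)) refl (ζ ^ m) (geometric h ζ))
          (trans (-‿cong (trans (telescope h ζ) (x≈y⇒x-y≈0 (trans (reflexive (≡.cong (ζ ^_) (≡.sym n≡))) ζ^n)))) (solve 0 (:- con (+ 0) := con (+ 0)) refl))))

        geometric-one : ∀ k x → x ^ m ≈ 1# → geometric k x ≈ fromℕ k
        geometric-one zero    x e = refl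
        geometric-one (suc k) x e = +-congˡ (trans (*-congʳ e) (trans (*-identityˡ _) (geometric-one k x e)))

        ζⁱ^m : (ζ ^ i) ^ m ≈ 1#
        ζⁱ^m = trans (sym (^-* ζ i m)) (trans (reflexive (≡.cong (ζ ^_) (ℕ._∣_.equality n∣im))) (^-multiple (ℕ._∣_.quotient n∣im)))

        F-cancel : Cancellable (F (ζ ^ i))
        F-cancel y e = cancel h>1 (fromℤ-cancel (α≢0 (exponent r)) _ (trans (solve 3 (λ a h y → a :* (h :* y) := (a :* h) :* y) refl (fromℤ (α (exponent r))) (fromℕ h) y)
          (trans (*-congʳ (trans (*-congˡ (sym (geometric-one h (ζ ^ i) ζⁱ^m))) (trans (equation r (ζ ^ i)) (trans (+-congˡ (ev-IsZero (vanish-reducible r zero-at-ζ) (ζ ^ i))) (+-identityʳ _)))))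
            (trans (solve 3 (λ f q y → (f :* q) :* y := q :* (f :* y)) refl (F (ζ ^ i)) (quotient r (ζ ^ i)) y) (trans (*-congˡ e) (zeroʳ _))))))
          where
          r = red-geometric h
          cancel : ∀ {h} → 1 < h → fromℕ h * y ≈ 0# → y ≈ 0#
          cancel {suc h} _ = torsion-free h y

      divide-≡ : ∀ e {m} (P : Vec ℤ m) → m ≡ e ℕ.+ d → Σ (Vec ℤ e) λ Q → Σ (Vec ℤ d) λ V → ∀ x → fromℤ (α e) * ev P x ≈ F x * ev Q x + ev V x
      divide-≡ e P ≡.refl = divide e P

      -- Here a^e (T^n - 1) = F Q, and Q vanishes at the n - φ(n) powers ζ^i with i not prime to n,
      -- where F can be cancelled. If φ(n) < d, the n + 1 - d coefficients of Q are no more than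
      -- these roots, so Q = 0, which fails at T = 0.
      degree≤ : d ≤ n → d ≤ totient n
      degree≤ d≤n = ℕ.≮⇒≥ λ φ<d → absurd φ<d (divide-≡ e T^n-1 (≡.sym (ℕ.m∸n+n≡m (ℕ.m≤n⇒m≤1+n d≤n))))
        where
        e = suc n ℕ.∸ d
        absurd : totient n < d → (Σ (Vec ℤ e) λ Q → Σ (Vec ℤ d) λ V → ∀ x → fromℤ (α e) * ev T^n-1 x ≈ F x * ev Q x + ev V x) → ⊥
        absurd φ<d (Q , V , h) = nontrivial (fromℤ-cancel (α≢0 e) 1# (trans (solve 1 (λ a → a :* con (+ 1) := :- (a :* (con (+ 0) :- con (+ 1)))) refl (fromℤ (α e)))
          (trans (-‿cong (trans (*-congˡ (+-congʳ (sym (0^ n>0)))) (trans (FQ 0#) (trans (*-congˡ (ev-IsZero Q-zero 0#)) (zeroʳ _))))) (solve 0 (:- con (+ 0) := con (+ 0)) refl))))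
          where
          V-zero : IsZero V
          V-zero = vanish V (trans (sym (trans (+-congʳ (trans (*-congʳ root) (zeroˡ _))) (+-identityˡ _))) (trans (sym (h ζ)) (trans (*-congˡ (trans (ev-T^n-1 ζ) (x≈y⇒x-y≈0 ζ^n))) (zeroʳ _))))
          FQ : ∀ x → fromℤ (α e) * (x ^ n - 1#) ≈ F x * ev Q x
          FQ x = trans (*-congˡ (sym (ev-T^n-1 x))) (trans (h x) (trans (+-congˡ (ev-IsZero V-zero x)) (+-identityʳ _)))
          non-coprime-root : ∀ i → 0 < i → i ≤ n → ¬ gcd i n ≡ 1 → ev Q (ζ ^ i) ≈ 0#
          non-coprime-root i _ _ ne with ℕ.gcd[m,n]∣n i n | ℕ.gcd[m,n]∣m i n
          ... | ℕ.divides m n≡ | ℕ.divides w i≡ = NonCoprime.F-cancel i (gcd i n) m (≡.trans n≡ (ℕ.*-comm m (gcd i n)))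
            (ℕ.≤∧≢⇒< (ℕ.n≢0⇒n>0 (λ z → ℕ.<⇒≢ n>0 (≡.sym (≡.trans n≡ (≡.trans (≡.cong (m ℕ.*_) z) (ℕ.*-zeroʳ m)))))) (λ z → ne (≡.sym z)))
            (ℕ.divides w (≡.trans (≡.cong (ℕ._* m) i≡) (≡.trans (ℕ.*-assoc w (gcd i n) m) (≡.cong (w ℕ.*_) (≡.trans (ℕ.*-comm (gcd i n) m) (≡.sym n≡)))))) _
            (trans (sym (FQ (ζ ^ i))) (trans (*-congˡ (x≈y⇒x-y≈0 (trans (sym (^-* ζ i n)) (^-multiple i)))) (zeroʳ _)))
          Q-zero : IsZero Q
          Q-zero = roots-filter Q (λ i → ¬? (coprime? i)) non-coprime-root (ℕ.+-cancelˡ-≤ (totient n) _ _ (ℕ.≤-trans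
            (ℕ.≤-pred (≡.subst (suc (totient n ℕ.+ e) ≤_) (ℕ.m+[n∸m]≡n (ℕ.m≤n⇒m≤1+n d≤n)) (ℕ.+-monoˡ-≤ e φ<d)))
            (ℕ.≤-reflexive (≡.sym (≡.trans (length-filter-¬ coprime? exponents) (≡.trans (List.length-map suc (List.upTo n)) (List.length-upTo n)))))))

      -- Elements given at ζ by a function that can be reduced modulo F; it plays the role of ℤ[ζ].
      Red : Carrier → Set
      Red z = Σ (Carrier → Carrier) λ G → Reducible G × z ≈ G ζ

      red-subring : Subring Red
      red-subring = record
        { resp  = λ e (G , r , e′) → G , r , trans (sym e) e′
        ; zero∈ = _ , red-constant (+ 0) , refl
        ; one∈  = _ , red-one , refl
        ; add∈  = λ (_ , r , e) (_ , s , e′) → _ , red-+ r s , +-cong e e′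
        ; mul∈  = λ (_ , r , e) (_ , s , e′) → _ , red-* r s , *-cong e e′ }

      -- Landau's argument: for a prime l exceeding all coefficients of the reductions of the F(ζ^j),
      -- F(ζ^k) = 0 gives l ∣ F(ζ^(kl)) in ℤ[ζ], hence F(ζ^(kl)) = 0.
      red-F : ∀ j → Reducible (λ x → F (x ^ j))
      red-F j = red-ev (low Vec.∷ʳ a) (red-^ j)

      -- The summand for a ensures that primes beyond A do not divide the leading coefficient of F.
      A : ℕ
      A = ℤ.∣ a ∣ ℕ.+ proj₁ (bounded n (λ j → height (rest (red-F j))))

      module Large (l : ℕ) (lp : Prime l) (A<l : A < l) where

        open Frobenius R lp

        l>0 : 0 < l
        l>0 = ℕ.n≢0⇒n>0 (ℕ.≢-nonZero⁻¹ l {{prime⇒nonZero lp}})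

        -- V(y^l) ≡ V(y)^l modulo l: induction over the coefficients, with the freshman's dream for
        -- the sum c + y V′(y) and Fermat for c. The cofactor u stays reducible, so remainders
        -- modulo F can be compared.
        raise : ∀ {m} (V : Vec ℤ m) y → Red y → Σ Carrier λ u → Red u × ev V (y ^ l) ≈ ev V y ^ l + fromℕ l * u
        raise [] y r = 0# , Subring.zero∈ red-subring , sym (trans (+-cong (0^ l>0) (zeroʳ _)) (+-identityˡ _))
        raise (c ∷ V) y r with raise V y r | fermat lp c | freshman red-subring (fromℤ c) (y * ev V y) (_ , red-constant c , refl) (Subring.mul∈ red-subring r (red-at V))
          where
          red-at : ∀ {m} (V : Vec ℤ m) → Red (ev V y)
          red-at V = let (G , s , e) = r in (λ x → ev V (G x)) , red-ev V s , ev-cong V e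
        ... | u , ru , e | ℤ.divides t e′ | w , rw , e″ = (y ^ l * u - fromℤ t) - w
          , add∈ (add∈ (mul∈ (pow∈ l r) ru) (neg t)) (negate rw)
          , trans (+-congˡ (*-congˡ e)) (trans (solve 7 (λ c yl v l u t w → c :+ yl :* (v :+ l :* u) := (((c :+ t :* l) :+ yl :* v) :+ l :* w) :+ l :* ((yl :* u :- t) :- w)) refl (fromℤ c) (y ^ l) (ev V y ^ l) (fromℕ l) u (fromℤ t) w)
              (+-congʳ (sym (trans e″ (+-congʳ (+-cong (c^l c t e′) (^-distrib-* y (ev V y) l)))))))
          where
          open Subring red-subring
          neg : ∀ t → Red (- fromℤ t)
          neg t = resp (fromℤ-neg t) (_ , red-constant (ℤ.- t) , refl)
          negate : ∀ {w} → Red w → Red (- w)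
          negate {w} rw = resp (solve 1 (λ w → (con (+ 0) :- con (+ 1)) :* w := :- w) refl w) (mul∈ (resp (solve 0 (con -[1+ 0 ] := con (+ 0) :- con (+ 1)) refl) (_ , red-constant -[1+ 0 ] , refl)) rw)
          pow : ∀ c k → fromℤ (c ℤ.^ k) ≈ fromℤ c ^ k
          pow c zero    = +-identityʳ 1#
          pow c (suc k) = trans (fromℤ-* c (c ℤ.^ k)) (*-congˡ (pow c k))
          c^l : ∀ c t → c ℤ.^ l ℤ.- c ≡ t ℤ.* + l → fromℤ c ^ l ≈ fromℤ c + fromℤ t * fromℕ l
          c^l c t e = trans (sym (pow c l)) (trans (reflexive (≡.cong fromℤ (≡.trans (split (c ℤ.^ l) c) (≡.cong (λ z → c ℤ.+ z) e)))) (trans (fromℤ-+ c (t ℤ.* + l)) (+-congˡ (fromℤ-* t (+ l)))))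
            where
            open ℤS.+-*-Solver using () renaming (solve to ℤ-solve; _:=_ to _:=ℤ_; _:+_ to _:+ℤ_; _:-_ to _:-ℤ_)
            split : ∀ x c → x ≡ c ℤ.+ (x ℤ.- c)
            split = ℤ-solve 2 (λ x c → x :=ℤ c :+ℤ (x :-ℤ c)) ≡.refl

        l∤α : ∀ e → ¬ l ℕ.∣ ℤ.∣ α e ∣
        l∤α zero    d = ℕ.<⇒≱ (ℕ.nonTrivial⇒n>1 l {{prime⇒nonTrivial lp}}) (ℕ.∣⇒≤ d)
        l∤α (suc e) d = Sum.[ (λ d′ → ℕ.<⇒≱ (ℕ.≤-<-trans (ℕ.m≤m+n ℤ.∣ a ∣ _) A<l) (ℕ.∣⇒≤ {{ℕ.≢-nonZero (λ z → a≢0 (ℤ.∣i∣≡0⇒i≡0 z))}} d′)) , l∤α e ]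
          (euclidsLemma ℤ.∣ a ∣ ℤ.∣ α e ∣ lp (≡.subst (l ℕ.∣_) (ℤ.abs-* a (α e)) d))

        -- Coordinatewise a^e v = b w l, so l divides a^e v. It does not divide a, and |v| < l
        -- leaves v = 0.
        small : ∀ {m} e b (V W : Vec ℤ m) → height V < l → IsZero (linear (α e) V (ℤ.- (b ℤ.* + l)) W) → IsZero V
        small e b [] [] h [] = []
        small e b (v ∷ V) (w ∷ W) h (z ∷ zs) = v-zero ∷ small e b V W (ℕ.≤-<-trans (ℕ.m≤n+m (height V) ℤ.∣ v ∣) h) zs
          where
          open ℤS.+-*-Solver using () renaming (solve to ℤ-solve; _:=_ to _:=ℤ_; _:+_ to _:+ℤ_; _:-_ to _:-ℤ_; _:*_ to _:*ℤ_; :-_ to :-ℤ_)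
          move : ∀ x y b l → x ≡ (x ℤ.+ ℤ.- (b ℤ.* l) ℤ.* y) ℤ.+ (b ℤ.* y) ℤ.* l
          move = ℤ-solve 4 (λ x y b l → x :=ℤ (x :+ℤ (:-ℤ (b :*ℤ l)) :*ℤ y) :+ℤ (b :*ℤ y) :*ℤ l) ≡.refl
          αv : α e ℤ.* v ≡ (b ℤ.* w) ℤ.* + l
          αv = ≡.trans (move (α e ℤ.* v) w b (+ l)) (≡.trans (≡.cong (ℤ._+ (b ℤ.* w) ℤ.* + l) z) (ℤ.+-identityˡ _))
          v-zero : v ≡ + 0
          v-zero = decidable-stable (v ℤ.≟ + 0) λ nz → Sum.[ l∤α e , (λ d → ℕ.<⇒≱ (ℕ.≤-<-trans (ℕ.m≤m+n ℤ.∣ v ∣ (height V)) h) (ℕ.∣⇒≤ {{ℕ.≢-nonZero (λ y → nz (ℤ.∣i∣≡0⇒i≡0 y))}} d)) ]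
            (euclidsLemma ℤ.∣ α e ∣ ℤ.∣ v ∣ lp (ℕ.divides ℤ.∣ b ℤ.* w ∣ (≡.trans (≡.sym (ℤ.abs-* (α e) v)) (≡.trans (≡.cong ℤ.∣_∣ αv) (ℤ.abs-* (b ℤ.* w) (+ l))))))

        -- F(ζ^(kl)) is l times an element of ℤ[ζ]. By minimality of d the coordinates of both
        -- remainders agree up to powers of a, and the bound on coefficients makes those of
        -- F(ζ^(kl)) vanish.
        next : ∀ k → F (ζ ^ k) ≈ 0# → F (ζ ^ (k ℕ.* l)) ≈ 0#
        next k z with raise (low Vec.∷ʳ a) (ζ ^ k) (Subring.pow∈ red-subring k (_ , red-^ 1 , sym (*-identityʳ ζ)))
        ... | u , (G , s , eu) , e = trans (ev-cong (low Vec.∷ʳ a) (^-% (k ℕ.* l))) (fromℤ-cancel (α≢0 (exponent r)) _ (trans (at-root r)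
            (ev-IsZero (small (exponent s) (α (exponent r)) (rest r) (rest s) (ℕ.≤-<-trans (ℕ.≤-trans (proj₂ (bounded n (λ j → height (rest (red-F j)))) i (ℕ.m%n<n (k ℕ.* l) n)) (ℕ.m≤n+m _ ℤ.∣ a ∣)) A<l) (vanish _ combination)) ζ)))
          where
          i = (k ℕ.* l) % n
          r = red-F i
          F≈ : F (ζ ^ i) ≈ fromℕ l * G ζ
          F≈ = trans (ev-cong (low Vec.∷ʳ a) (trans (sym (^-% (k ℕ.* l))) (^-* ζ k l))) (trans e (trans (+-congʳ (trans (^-cong l z) (0^ l>0))) (trans (+-identityˡ _) (*-congˡ eu))))
          combination : ev (linear (α (exponent s)) (rest r) (ℤ.- (α (exponent r) ℤ.* + l)) (rest s)) ζ ≈ 0#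
          combination = trans (ev-linear (α (exponent s)) (rest r) (ℤ.- (α (exponent r) ℤ.* + l)) (rest s) ζ) (trans
            (+-cong (*-congˡ (trans (sym (at-root r)) (*-congˡ F≈))) (*-cong (trans (fromℤ-neg (α (exponent r) ℤ.* + l)) (-‿cong (fromℤ-* (α (exponent r)) (+ l)))) (sym (at-root s))))
            (solve 4 (λ a b l g → a :* (b :* (l :* g)) :+ (:- (b :* l)) :* (a :* g) := con (+ 0)) refl (fromℤ (α (exponent s))) (fromℤ (α (exponent r))) (fromℕ l) (G ζ)))

      -- k + nW has no prime factor up to A.
      coprime-root : ∀ k → gcd k n ≡ 1 → F (ζ ^ k) ≈ 0#
      coprime-root zero g = trans (ev-cong (low Vec.∷ʳ a) (trans (sym ζ^n) (trans (reflexive (≡.cong (ζ ^_) (≡.trans (≡.sym (ℕ.gcd-identityˡ n)) g))) (*-identityʳ ζ)))) root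
      coprime-root k@(suc _) g = trans (ev-cong (low Vec.∷ʳ a) (sym (trans (^-+ ζ k (W ℕ.* n)) (trans (*-congˡ (^-multiple W)) (*-identityʳ _))))) (conclude (factorise (k ℕ.+ W ℕ.* n)))
        where
        coprime-k? : ∀ j → Dec (gcd j k ≡ 1)
        coprime-k? j = gcd j k ℕ.≟ 1
        -- W is the product of the numbers up to A prime to k. Let a prime l ≤ A divide k + Wn. If l
        -- divides k, it divides W or n, both prime to k; if not, it is a factor of W and therefore
        -- divides k.
        W = product (List.filter coprime-k? (List.map suc (List.upTo A)))
        large : ∀ l → Prime l → l ℕ.∣ k ℕ.+ W ℕ.* n → A < l
        large l lp d = ℕ.≰⇒> λ l≤A → decide (in-k l≤A) (out l≤A) (l ℕ.∣? k)
          where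
          decide : {P : Set} → (P → ⊥) → (¬ P → ⊥) → Dec P → ⊥
          decide f g (yes x) = f x
          decide f g (no x)  = g x
          not-one : ¬ l ℕ.∣ 1
          not-one d = ℕ.<⇒≱ (ℕ.nonTrivial⇒n>1 l {{prime⇒nonTrivial lp}}) (ℕ.∣⇒≤ d)
          in-k : l ≤ A → l ℕ.∣ k → ⊥
          in-k _ l∣k = Sum.[ factor-W , (λ l∣n → not-one (≡.subst (l ℕ.∣_) g (ℕ.gcd-greatest l∣k l∣n))) ] (euclidsLemma W n lp (ℕ.∣m+n∣m⇒∣n d l∣k))
            where
            go : ∀ xs → All (λ j → gcd j k ≡ 1) xs → l ℕ.∣ product xs → ⊥
            go []       []       e = not-one e
            go (x ∷ xs) (y ∷ ys) e = Sum.[ (λ l∣x → not-one (≡.subst (l ℕ.∣_) y (ℕ.gcd-greatest l∣x l∣k))) , go xs ys ] (euclidsLemma x (product xs) lp e)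
            factor-W : l ℕ.∣ W → ⊥
            factor-W = go _ (All.all-filter coprime-k? (List.map suc (List.upTo A)))
          out : l ≤ A → ¬ l ℕ.∣ k → ⊥
          out l≤A ¬d = ¬d (ℕ.∣m+n∣m⇒∣n (≡.subst (l ℕ.∣_) (ℕ.+-comm k (W ℕ.* n)) d) (ℕ.∣m⇒∣m*n n (∈⇒∣product (∈.∈-filter⁺ coprime-k? (member (ℕ.n≢0⇒n>0 (ℕ.≢-nonZero⁻¹ l {{prime⇒nonZero lp}})) l≤A) (≡.trans (ℕ.gcd-comm l k) (Coprime.coprime⇒gcd≡1 (prime-coprime lp ¬d)))))))
            where
            member : ∀ {l} → 0 < l → l ≤ A → l ∈ List.map suc (List.upTo A)
            member {suc l} _ l<A = ∈.∈-map⁺ suc (∈.∈-upTo⁺ l<A)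
        primes : ∀ j ls → F (ζ ^ j) ≈ 0# → All Prime ls → All (A <_) ls → F (ζ ^ (j ℕ.* product ls)) ≈ 0#
        primes j [] z [] [] = trans (reflexive (≡.cong (λ i → F (ζ ^ i)) (ℕ.*-identityʳ j))) z
        primes j (l ∷ ls) z (lp ∷ lps) (b ∷ bs) = trans (reflexive (≡.cong (λ i → F (ζ ^ i)) (≡.sym (ℕ.*-assoc j l (product ls))))) (primes (j ℕ.* l) ls (Large.next l lp b j z) lps bs)
        all-large : ∀ ls → All Prime ls → product ls ℕ.∣ k ℕ.+ W ℕ.* n → All (A <_) ls
        all-large [] [] d = []
        all-large (l ∷ ls) (lp ∷ lps) d = large l lp (ℕ.∣-trans (ℕ.m∣m*n (product ls)) d) ∷ all-large ls lps (ℕ.∣-trans (ℕ.n∣m*n l) d)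
        conclude : PrimeFactorisation (k ℕ.+ W ℕ.* n) → F (ζ ^ (k ℕ.+ W ℕ.* n)) ≈ 0#
        conclude record { factors = ls ; isFactorisation = e ; factorsPrime = ps } = trans (reflexive (≡.cong (λ i → F (ζ ^ i)) (≡.trans e (≡.sym (ℕ.*-identityˡ _)))))
          (primes 1 ls (trans (ev-cong (low Vec.∷ʳ a) (*-identityʳ ζ)) root) ps (all-large ls ps (ℕ.∣-reflexive (≡.sym e))))

      -- F has d + 1 coefficients and vanishes at the φ(n) powers ζ^i with i prime to n.
      degree≥ : totient n ≤ d
      degree≥ = ℕ.≮⇒≥ λ d<φ → a≢0 (last-zero low (roots-filter (low Vec.∷ʳ a) coprime? (λ i _ _ → coprime-root i) (≡.subst (suc d ≤_) ≡.refl d<φ)))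
        where
        last-zero : ∀ {m} (V : Vec ℤ m) {a} → IsZero (V Vec.∷ʳ a) → a ≡ + 0
        last-zero []      (z ∷ []) = z
        last-zero (v ∷ V) (_ ∷ zs) = last-zero V zs

      exponent-^ : ∀ k → exponent (red-^ k) ≡ suc k
      exponent-^ zero    = ≡.refl
      exponent-^ (suc k) = ≡.cong suc (exponent-^ k)

      -- Reducing T^k costs a^(k+1); the power is evened out to a^n so that one denominator serves
      -- all k < n.
      express : ∀ k → k < n → Σ (Vec ℤ d) λ V → fromℤ (α n) * ζ ^ k ≈ ev V ζ
      express k k<n = linear (α m) (rest r) (+ 0) (rest r) , trans (*-congʳ (trans (reflexive (≡.cong (λ i → fromℤ (α i)) (≡.sym (≡.trans (≡.cong (m ℕ.+_) (exponent-^ k)) (ℕ.m∸n+n≡m k<n))))) (⟦α⟧-+ m (exponent r))))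
        (trans (*-assoc _ _ _) (trans (*-congˡ (at-root r)) (sym (trans (ev-linear (α m) (rest r) (+ 0) (rest r) ζ) (trans (+-congˡ (zeroˡ _)) (+-identityʳ _))))))
        where
        r = red-^ k
        m = n ℕ.∸ suc k

    minimal-relation : ∀ m → Dependent m → ¬ ¬ ∃ λ d → d < m × Dependent (suc d) × ¬ Dependent d
    minimal-relation zero    ([] , nz , _) c = nz []
    minimal-relation (suc m) D c = ¬¬-dec {Dependent m} λ { (yes D′) → minimal-relation m D′ (λ (d , d<m , x) → c (d , ℕ.m≤n⇒m≤1+n d<m , x)) ; (no ¬D) → c (m , ℕ.≤-refl , D , ¬D) }

    Minimals : Set
    Minimals = Σ (Vec ℤ (totient n)) λ low → Σ ℤ λ a → ¬ a ≡ + 0 × ev (low Vec.∷ʳ a) ζ ≈ 0# × ¬ Dependent (totient n)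

    minimals : ¬ ¬ Minimals
    minimals c = minimal-relation (suc n) (T^n-1 , nonzero , ev-zero) λ (d , d<sn , (V , nz , e) , min) → split d (ℕ.≤-pred d<sn) V (Vec.initLast V) nz e min
      where
      ev-zero = trans (ev-T^n-1 ζ) (x≈y⇒x-y≈0 ζ^n)
      nonzero : ¬ IsZero T^n-1
      nonzero z = nontrivial (trans (solve 1 (λ x → con (+ 1) := x :- (x :- con (+ 1))) refl (0# ^ n)) (trans (+-cong (0^ n>0) (-‿cong (trans (sym (ev-T^n-1 0#)) (ev-IsZero z 0#)))) (solve 0 (con (+ 0) :- con (+ 0) := con (+ 0)) refl)))
      snoc-zero : ∀ {m} (V : Vec ℤ m) {a} → IsZero V → a ≡ + 0 → IsZero (V Vec.∷ʳ a)
      snoc-zero [] [] z = z ∷ []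
      snoc-zero (v ∷ V) (y ∷ ys) z = y ∷ snoc-zero V ys z
      split : ∀ d → d ≤ n → (V : Vec ℤ (suc d)) → (∃ λ low → ∃ λ a → V ≡ low Vec.∷ʳ a) → ¬ IsZero V → ev V ζ ≈ 0# → ¬ Dependent d → ⊥
      split d d≤n .(low Vec.∷ʳ a) (low , a , ≡.refl) nz e min = c (≡.subst (λ d → Σ (Vec ℤ d) λ low → Σ ℤ λ a → ¬ a ≡ + 0 × ev (low Vec.∷ʳ a) ζ ≈ 0# × ¬ Dependent d) (ℕ.≤-antisym (degree≤ d≤n) degree≥) (low , a , a≢0 , e , min))
        where
        a≢0 : ¬ a ≡ + 0
        a≢0 ≡.refl = nz (snoc-zero low (decidable-stable (isZero? low) (λ ¬z → min (low , ¬z , trans (sym (trans (ev-∷ʳ low (+ 0) ζ) (trans (+-congˡ (zeroˡ _)) (+-identityʳ _)))) e))) ≡.refl)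
        open Minimal d low a a≢0 e min

    ζ-independent : (V : Vec ℤ (totient n)) → ev V ζ ≈ 0# → IsZero V
    ζ-independent V e = decidable-stable (isZero? V) (λ nz → minimals (λ (_ , _ , _ , _ , min) → min (V , nz , e)))

    -- The integer D clears the denominators of all powers of ζ in the basis 1, ..., ζ^(φ(n)-1).
    -- Double negation remains because a shortest relation is found only by deciding dependence.
    ζ-expressible : ¬ ¬ ∃ λ D → ¬ D ≡ + 0 × ∀ k → Σ (Vec ℤ (totient n)) λ V → fromℤ D * ζ ^ k ≈ ev V ζ
    ζ-expressible c = minimals λ (low , a , a≢0 , e , min) → let open Minimal (totient n) low a a≢0 e min in
      c (α n , α≢0 n , λ k → let (V , q) = express (k % n) (ℕ.m%n<n k n) in V , trans (*-congˡ (^-% k)) q)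

-- Roots of unity in O and a primitive root modulo p.

module Teichmuller where

  open RingKit
  open PadicRing
  open NatMod
  open Cyclotomic
  open Padic using (prime-coprime; coprime-^; ∣-resp; euclid)
  open PadicSeries using (module Padics; prime-split)
  open import Algebra.Bundles using (CommutativeRing)
  open import Level using (0ℓ)
  import Relation.Binary.Reasoning.Setoid
  open import Data.Empty using (⊥; ⊥-elim)
  open import Data.Fin as Fin using (Fin; toℕ; fromℕ<)
  import Data.Fin.Properties as Fin
  open import Data.Integer as ℤ using (ℤ; +_; -[1+_])
  import Data.Integer.Properties as ℤ
  import Data.Integer.Divisibility.Signed as ℤ
  import Data.Integer.Solver as ℤS
  open import Data.List as List using (List; []; _∷_; length)
  import Data.List.Properties as List
  open import Data.List.Relation.Unary.All as All using (All; []; _∷_)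
  import Data.List.Relation.Unary.All.Properties as All
  open import Data.List.Relation.Unary.AllPairs as AllPairs using (AllPairs; []; _∷_)
  import Data.List.Relation.Unary.AllPairs.Properties as AllPairs
  open import Data.Nat as ℕ using (ℕ; zero; suc; NonZero; s≤s; z≤n; _≤_; _<_)
  import Data.Nat.Properties as ℕ
  import Data.Nat.Divisibility as ℕ
  open import Data.Nat.Coprimality as Coprime using (Coprime)
  open import Data.Nat.DivMod as ℕ using (_/_; _%_)
  open import Data.Nat.GCD as ℕ using (gcd)
  open import Data.Nat.Induction using (<-rec)
  open import Data.Nat.ListAction using (product)
  open import Data.Nat.Primality using (Prime; prime?; prime⇒nonZero; prime⇒nonTrivial; euclidsLemma; prime⇒irreducible)
  open import Data.Nat.Primality.Factorisation using (factorise; factors; PrimeFactorisation)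
  import Data.Nat.Solver as ℕS
  open import Data.Product using (Σ; _×_; _,_; proj₁; proj₂; ∃)
  open import Data.Sum as Sum using (_⊎_; inj₁; inj₂)
  open import Data.Vec as Vec using (Vec; []; _∷_)
  import Data.Vec.Relation.Unary.All as VAll
  open VAll using ([]; _∷_)
  open import Relation.Binary.PropositionalEquality as ≡ using (_≡_)
  open import Relation.Nullary using (Dec; yes; no; ¬_; contradiction; ¬?)
  open import Relation.Nullary.Decidable using (decidable-stable)

  module Units (p : ℕ) (pr : Prime p) (𝕂 : PadicIntegers p) where

    open Padics p pr 𝕂 hiding (module E; module M; module SE; module SM)
    open Polynomial ring
    open Powers ring
    open Solver

    n : ℕ
    n = p ℕ.∸ 1

    suc-n : suc n ≡ p
    suc-n = ≡.trans (ℕ.+-comm 1 n) (ℕ.m∸n+n≡m (ℕ.<⇒≤ p>1))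

    -- From cy = 0 with c nonzero modulo p follows y = ph; without torsion ch = 0, and the argument
    -- repeats, so that every p^k divides y.
    unit-cancel : ∀ {c} → ¬ c ∼ 0# → Cancellable c
    unit-cancel {c} nz y e = separated y (λ k → divide k y e)
      where
      divide : ∀ k y → c * y ≈ 0# → Div (p ℕ.^ k) y
      divide zero    y e = y , sym (trans (*-congʳ (+-identityʳ 1#)) (*-identityˡ y))
      divide (suc k) y e with ∼-domain {c} {y} (≈⇒∼ e)
      ... | inj₁ z = ⊥-elim (nz z)
      ... | inj₂ (h Q., e′) with divide k h (torsion-free (c * h) (trans (solve 3 (λ p c h → p :* (c :* h) := c :* (con (+ 0) :+ p :* h)) refl (fromℕ p) c h) (trans (*-congˡ (sym e′)) e)))
      ... | w , e″ = w , trans e′ (trans (+-identityˡ _) (trans (*-congˡ e″) (trans (sym (*-assoc _ _ w)) (*-congʳ (sym (fromℕ-* p (p ℕ.^ k)))))))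

    teich-^ : ∀ c k → teich c ^ k ≈ teich (c ℕ.^ k)
    teich-^ c zero    = sym teich-1
    teich-^ c (suc k) = trans (*-congˡ (teich-^ c k)) (sym (teich-* c (c ℕ.^ k)))

    teich∼ : ∀ c → teich c ∼ fromℕ c
    teich∼ c = let (h , e) = teich-reduce c in h Q., trans (solve 2 (λ a b → a := b :+ (a :- b)) refl (teich c) (fromℕ c)) (+-congˡ e)

    fromℕ∼⇒mod : ∀ a b → a ≤ b → fromℕ b ∼ fromℕ a → p ℕ.∣ b ℕ.∸ a
    fromℕ∼⇒mod a b a≤b (h Q., e) = ≡.subst (ℕ._∣ b ℕ.∸ a) (ℕ.*-identityʳ p) (Div-fromℕ 1 (b ℕ.∸ a) (h , trans
      (trans (solve 2 (λ x y → x := (y :+ x) :- y) refl (fromℕ (b ℕ.∸ a)) (fromℕ a)) (trans (+-congʳ (trans (sym (fromℕ-+ a (b ℕ.∸ a))) (trans (reflexive (≡.cong fromℕ (ℕ.m+[n∸m]≡n a≤b))) e)))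
        (solve 2 (λ x y → (x :+ y) :- x := y) refl (fromℕ a) (fromℕ p * h))))
      (*-congʳ (reflexive (≡.cong fromℕ (≡.sym (ℕ.*-identityʳ p)))))))

    ∣∸⇒teich : ∀ a b → a ≤ b → p ℕ.∣ b ℕ.∸ a → teich b ≈ teich a
    ∣∸⇒teich a b a≤b (ℕ.divides k e) = teich-cong b a (ℤ.divides (+ k) (≡.trans (≡.cong (λ z → + z ℤ.- + a) (≡.trans (≡.sym (ℕ.m∸n+n≡m a≤b)) (≡.cong (ℕ._+ a) e)))
      (≡.trans (≡.cong (ℤ._- + a) (ℤ.pos-+ (k ℕ.* p) a)) (≡.trans (ℤsolve (+ (k ℕ.* p)) (+ a)) (ℤ.pos-* k p)))))
      where
      open ℤS.+-*-Solver using () renaming (solve to ℤ-solve; _:=_ to _:=ℤ_; _:+_ to _:+ℤ_; _:-_ to _:-ℤ_)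
      ℤsolve : ∀ x y → (x ℤ.+ y) ℤ.- y ≡ x
      ℤsolve = ℤ-solve 2 (λ x y → (x :+ℤ y) :-ℤ y :=ℤ x) ≡.refl

    teich-injective : ∀ a b → teich a ∼ teich b → teich a ≈ teich b
    teich-injective a b e with ℕ.≤-total a b
    ... | inj₁ a≤b = sym (∣∸⇒teich a b a≤b (fromℕ∼⇒mod a b a≤b (R.trans (R.sym (teich∼ b)) (R.trans (R.sym e) (teich∼ a)))))
    ... | inj₂ b≤a = ∣∸⇒teich b a b≤a (fromℕ∼⇒mod b a b≤a (R.trans (R.sym (teich∼ a)) (R.trans e (teich∼ b))))

    teich-difference : ∀ a b → ¬ teich a ≈ teich b → Cancellable (teich b - teich a)
    teich-difference a b ne = unit-cancel (λ { (h Q., e) → ne (teich-injective a b (R.sym (h Q., trans (solve 2 (λ x y → x := y :+ (x :- y)) refl (teich b) (teich a)) (+-congˡ (trans e (+-identityˡ _)))))) })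

    nonzero-residue : ∀ c → 0 < c → c < p → ¬ teich c ∼ 0#
    nonzero-residue c 0<c c<p z = ℕ.<⇒≱ c<p (ℕ.∣⇒≤ {{ℕ.>-nonZero 0<c}} (fromℕ∼⇒mod 0 c z≤n (R.trans (R.sym (teich∼ c)) z)))

    teich-^n : ∀ c → ¬ teich c ∼ 0# → teich c ^ n ≈ 1#
    teich-^n c nz = x-y≈0⇒x≈y (unit-cancel nz _ (trans (solve 2 (λ x y → x :* (y :- con (+ 1)) := x :* y :- x) refl (teich c) (teich c ^ n))
      (x≈y⇒x-y≈0 (trans (reflexive (≡.cong (teich c ^_) suc-n)) (teich-^p c)))))

    teich^-difference : ∀ a b c k → teich a ^ b ∼ teich c ^ k → teich a ^ b ≈ teich c ^ k
    teich^-difference a b c k e = trans (teich-^ a b) (trans (teich-injective (a ℕ.^ b) (c ℕ.^ k) (R.trans (R.sym (≈⇒∼ (teich-^ a b))) (R.trans e (≈⇒∼ (teich-^ c k))))) (sym (teich-^ c k)))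

    power-one? : ∀ c k → Dec (teich c ^ k ≈ 1#)
    power-one? c k with teich c ^ k ∼? 1#
    ... | yes e = yes (teich^-difference c k c 0 e)
    ... | no ne = no (λ e → ne (≈⇒∼ e))

    residues : List Carrier
    residues = List.map (λ i → teich (suc i)) (List.upTo n)

    -- x^d - 1 has at most d roots, so it does not kill all n residues if d < n.
    non-root : ∀ d → 0 < d → d < n → ∃ λ c → ¬ teich c ∼ 0# × ¬ teich c ^ d ≈ 1#
    non-root d@(suc d′) _ d<n = extract (Fin.any? {n} (λ i → ¬? (power-one? (suc (toℕ i)) d)))
      where
      P : Vec Carrier (suc d)
      P = - 1# ∷ monomial d′
      eval-P : ∀ x → eval P x ≈ x ^ d - 1#
      eval-P x = trans (+-congˡ (*-congˡ (eval-monomial d′ x))) (+-comm _ _)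
      ordered : AllPairs (λ a b → a < b) (List.upTo n)
      ordered = AllPairs.applyUpTo⁺₁ (λ i → i) n (λ i<j _ → i<j)
      bounded : All (_< n) (List.upTo n)
      bounded = All.applyUpTo⁺₁ (λ i → i) n (λ i<n → i<n)
      distinct : AllPairs (λ a b → Cancellable (teich (suc b) - teich (suc a))) (List.upTo n)
      distinct = go′ ordered bounded
        where
        go′ : ∀ {xs} → AllPairs _<_ xs → All (_< n) xs → AllPairs (λ a b → Cancellable (teich (suc b) - teich (suc a))) xs
        go′ [] [] = []
        go′ (o ∷ os) (b ∷ bs) = All.zipWith (λ {x} (a<b , b<n) → teich-difference _ (suc x) (λ e → ℕ.<⇒≱ (≡.subst (suc x ≤_) suc-n (ℕ.m≤n⇒m≤1+n b<n)) (small _ x a<b b<n e))) (o , bs) ∷ go′ os bs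
          where
          small : ∀ a x → a < x → x < n → teich (suc a) ≈ teich (suc x) → p ≤ x
          small a x a<x x<n e = ℕ.≤-trans (ℕ.∣⇒≤ {{ℕ.>-nonZero (ℕ.m<n⇒0<n∸m a<x)}} (fromℕ∼⇒mod (suc a) (suc x) (s≤s (ℕ.<⇒≤ a<x)) (R.trans (R.sym (teich∼ (suc x))) (R.trans (R.sym (≈⇒∼ e)) (teich∼ (suc a)))))) (ℕ.m∸n≤m x a)
      extract : Dec (∃ λ i → ¬ teich (suc (toℕ i)) ^ d ≈ 1#) → ∃ λ c → ¬ teich c ∼ 0# × ¬ teich c ^ d ≈ 1#
      extract (yes (i , ne)) = suc (toℕ i) , nonzero-residue (suc (toℕ i)) (s≤s z≤n) (≡.subst (suc (toℕ i) <_) suc-n (s≤s (Fin.toℕ<n i))) , ne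
      extract (no none) = ⊥-elim (1≁0 (≈⇒∼ (last-one d′ (VAll.tail all-zero))))
        where
        all-roots : ∀ {i} → i < n → eval P (teich (suc i)) ≈ 0#
        all-roots {i} i<n = trans (eval-P (teich (suc i))) (x≈y⇒x-y≈0 (decidable-stable (power-one? (suc i) d) (λ ne → none (fromℕ< i<n , ≡.subst (λ j → ¬ teich (suc j) ^ d ≈ 1#) (≡.sym (Fin.toℕ-fromℕ< i<n)) ne))))
        all-zero : AllZero P
        all-zero = roots P residues (AllPairs.map⁺ distinct) (All.map⁺ (All.map all-roots bounded))
          (≡.subst (suc d ≤_) (≡.sym (≡.trans (List.length-map (λ i → teich (suc i)) (List.upTo n)) (List.length-upTo n))) d<n)
        last-one : ∀ m → AllZero (monomial m) → 1# ≈ 0#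
        last-one zero    (z ∷ []) = z
        last-one (suc m) (_ ∷ zs) = last-one m zs

    Order : Carrier → ℕ → Set
    Order z m = z ^ m ≈ 1# × ∀ k → z ^ k ≈ 1# → m ℕ.∣ k

    private
      -- If r does not divide k, then k and r^(a+1) are coprime and z = 1, against the hypothesis on
      -- z^(r^a). Otherwise replace z by z^r and k by k/r.
      prime-power-order : ∀ {r} → Prime r → ∀ a z → z ^ (r ℕ.^ suc a) ≈ 1# → ¬ z ^ (r ℕ.^ a) ≈ 1# → ∀ k → z ^ k ≈ 1# → r ℕ.^ suc a ℕ.∣ k
      prime-power-order {r} rp a z e ne k ek with r ℕ.∣? k
      ... | no ¬d = ⊥-elim (ne (trans (^-cong (r ℕ.^ a) (coprime-powers z k (r ℕ.^ suc a) {{ℕ.m^n≢0 r (suc a) {{prime⇒nonZero rp}}}} (coprime-^ (suc a) (prime-coprime rp ¬d)) ek e)) (1^ (r ℕ.^ a))))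
      prime-power-order {r} rp zero z e ne k ek | yes d = ≡.subst (ℕ._∣ k) (≡.sym (ℕ.*-identityʳ r)) d
      prime-power-order {r} rp (suc a) z e ne k ek | yes (ℕ.divides k₁ ≡.refl) = ≡.subst (r ℕ.^ suc (suc a) ℕ.∣_) (ℕ.*-comm r k₁) (ℕ.*-monoʳ-∣ r
        (prime-power-order rp a (z ^ r) (trans (sym (^-* z r (r ℕ.^ suc a))) e) (λ e′ → ne (trans (^-* z r (r ℕ.^ a)) e′)) k₁
          (trans (sym (^-* z r k₁)) (trans (reflexive (≡.cong (z ^_) (ℕ.*-comm r k₁))) ek))))

      order-* : ∀ {x y a b} → Coprime a b → Order x a → Order y b → Order (x * y) (a ℕ.* b)
      order-* {x} {y} {a} {b} c (ex , ox) (ey , oy) =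
        trans (^-distrib-* x y (a ℕ.* b)) (trans (*-cong (trans (reflexive (≡.cong (x ^_) (ℕ.*-comm a b))) (^-multiple x a b ex)) (^-multiple y b a ey)) (*-identityˡ 1#)) ,
        λ k e → product-divides (half k b x y a ox ey (Coprime.sym (Coprime.sym c)) e)
          (half k a y x b oy ex (Coprime.sym c) (trans (^-cong k (*-comm y x)) e))
        where
        half : ∀ k b x y a → (∀ k → x ^ k ≈ 1# → a ℕ.∣ k) → y ^ b ≈ 1# → Coprime a b → (x * y) ^ k ≈ 1# → a ℕ.∣ k
        half k b x y a ox ey c e = Coprime.coprime-divisor c (≡.subst (a ℕ.∣_) (ℕ.*-comm k b) (ox (k ℕ.* b) (trans (sym (trans (*-congˡ (^-multiple y b k ey)) (*-identityʳ _)))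
          (trans (sym (^-distrib-* x y (k ℕ.* b))) (trans (^-* (x * y) k b) (trans (^-cong b e) (1^ b)))))))
        product-divides : ∀ {k} → a ℕ.∣ k → b ℕ.∣ k → a ℕ.* b ℕ.∣ k
        product-divides {k} (ℕ.divides w ≡.refl) d = ≡.subst (a ℕ.* b ℕ.∣_) (ℕ.*-comm a w) (ℕ.*-monoʳ-∣ a (Coprime.coprime-divisor (Coprime.sym c) (≡.subst (b ℕ.∣_) (ℕ.*-comm w a) d)))

    -- Split the full power r^(a+1) of a prime off m. With y not a root of T^(n/r) - 1, the power
    -- y^(n/r^(a+1)) has order r^(a+1); elements of coprime orders are then multiplied.
    element-of-order : ∀ m → 0 < m → m ℕ.∣ n → ∃ λ c → Order (teich c) m
    element-of-order = <-rec _ go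
      where
      n>0 : 0 < n
      n>0 = ℕ.m<n⇒0<n∸m p>1
      go : ∀ m → (∀ {k} → k < m → 0 < k → k ℕ.∣ n → ∃ λ c → Order (teich c) k) → 0 < m → m ℕ.∣ n → ∃ λ c → Order (teich c) m
      go (suc zero) rec _ _ = 1 , trans (*-identityʳ _) teich-1 , λ k _ → ℕ.1∣ k
      go m@(suc (suc _)) rec 0<m m∣n with prime-divisor m (s≤s (s≤s z≤n))
      ... | r , rp , r∣m with prime-split rp m (λ ())
      ... | zero , m′ , e , ¬d = ⊥-elim (¬d (≡.subst (r ℕ.∣_) (≡.trans e (ℕ.*-identityˡ m′)) r∣m))
      ... | suc a , m′ , e , ¬d = combine (rec m′<m 0<m′ (ℕ.∣-trans (ℕ.divides (r ℕ.^ suc a) e) m∣n)) (non-root (n /r) n/r>0 n/r<n)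
        where
        instance
          r≢0 : NonZero r
          r≢0 = prime⇒nonZero rp
        r>1 : 1 < r
        r>1 = ℕ.nonTrivial⇒n>1 r {{prime⇒nonTrivial rp}}
        0<m′ : 0 < m′
        0<m′ = ℕ.n≢0⇒n>0 (λ { ≡.refl → ¬d (ℕ.divides 0 ≡.refl) })
        m′<m : m′ < m
        m′<m = ≡.subst (m′ <_) (≡.trans (ℕ.*-comm m′ (r ℕ.^ suc a)) (≡.sym e)) (ℕ.m<m*n m′ (r ℕ.^ suc a) {{ℕ.>-nonZero 0<m′}} (ℕ.<-≤-trans r>1 (ℕ.m≤m*n r (r ℕ.^ a) {{ℕ.m^n≢0 r a}})))
        rᵃ∣n : r ℕ.^ suc a ℕ.∣ n
        rᵃ∣n = ℕ.∣-trans (ℕ.divides m′ (≡.trans e (ℕ.*-comm (r ℕ.^ suc a) m′))) m∣n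
        w = ℕ._∣_.quotient rᵃ∣n
        n≡ : n ≡ w ℕ.* r ℕ.^ suc a
        n≡ = ℕ._∣_.equality rᵃ∣n
        _/r : ℕ → ℕ
        _ /r = w ℕ.* r ℕ.^ a
        n≡r : n ≡ (n /r) ℕ.* r
        n≡r = ≡.trans n≡ (≡.trans (≡.cong (w ℕ.*_) (ℕ.*-comm r (r ℕ.^ a))) (≡.sym (ℕ.*-assoc w (r ℕ.^ a) r)))
        n/r>0 : 0 < n /r
        n/r>0 = ℕ.n≢0⇒n>0 (λ z → ℕ.<⇒≢ n>0 (≡.sym (≡.trans n≡r (≡.cong (ℕ._* r) z))))
        n/r<n : n /r < n
        n/r<n = ≡.subst (n /r <_) (≡.sym n≡r) (ℕ.m<m*n (n /r) r {{ℕ.>-nonZero n/r>0}} r>1)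
        combine : (∃ λ c → Order (teich c) m′) → (∃ λ c → ¬ teich c ∼ 0# × ¬ teich c ^ (n /r) ≈ 1#) → ∃ λ c → Order (teich c) m
        combine (c′ , o′) (y , nz , ne) = c′ ℕ.* y ℕ.^ w , transport (order-* {teich c′} {teich y ^ w} {m′} {r ℕ.^ suc a}
            (coprime-^ (suc a) (prime-coprime rp ¬d)) o′ (e₁ , prime-power-order rp a (teich y ^ w) e₁ (λ e₂ → ne (trans (^-* (teich y) w (r ℕ.^ a)) e₂))))
          where
          e₁ : (teich y ^ w) ^ (r ℕ.^ suc a) ≈ 1#
          e₁ = trans (sym (^-* (teich y) w (r ℕ.^ suc a))) (trans (reflexive (≡.cong (teich y ^_) (≡.sym n≡))) (teich-^n y nz))
          z≈ : teich c′ * teich y ^ w ≈ teich (c′ ℕ.* y ℕ.^ w)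
          z≈ = trans (*-congˡ (teich-^ y w)) (sym (teich-* c′ (y ℕ.^ w)))
          transport : Order (teich c′ * teich y ^ w) (m′ ℕ.* r ℕ.^ suc a) → Order (teich (c′ ℕ.* y ℕ.^ w)) m
          transport (e₂ , o) = ≡.subst (Order (teich (c′ ℕ.* y ℕ.^ w))) (≡.trans (ℕ.*-comm m′ (r ℕ.^ suc a)) (≡.sym e))
            (trans (^-cong (m′ ℕ.* r ℕ.^ suc a) (sym z≈)) e₂ , λ k ek → o k (trans (^-cong k z≈) ek))

    primitive-root : ∃ λ g → Order (teich g) n
    primitive-root = element-of-order n (ℕ.m<n⇒0<n∸m p>1) ℕ.∣-refl

    g : ℕ
    g = proj₁ primitive-root

    ζ : Carrier
    ζ = teich g

    O-torsion-free : Torsion-free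
    O-torsion-free m y e = cancel-ℕ (suc m) y (λ ()) e

    O-nontrivial : Nontrivial
    O-nontrivial e = 1≁0 (≈⇒∼ e)

    ζ-primitive : PrimitiveRoot ζ n
    ζ-primitive = record { n>0 = ℕ.m<n⇒0<n∸m p>1 ; ζ^n = proj₁ (proj₂ primitive-root) ; distinct = distinct }
      where
      cancel-ζ : ∀ i → Cancellable (ζ ^ i)
      cancel-ζ i y e = trans (sym (trans (*-congʳ (^-multiple ζ n i (proj₁ (proj₂ primitive-root)))) (*-identityˡ y))) (trans (*-congʳ (^-* ζ i n)) (pull n (ℕ.m<n⇒0<n∸m p>1)))
        where
        pull : ∀ m → 0 < m → (ζ ^ i) ^ m * y ≈ 0#
        pull (suc m) _ = trans (solve 3 (λ a b y → (a :* b) :* y := b :* (a :* y)) refl (ζ ^ i) ((ζ ^ i) ^ m) y) (trans (*-congˡ e) (zeroʳ _))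
      distinct : ∀ i j → 0 < i → i < j → j ≤ n → Cancellable (ζ ^ j - ζ ^ i)
      distinct i j 0<i i<j j≤n y e = teich-difference (g ℕ.^ i) (g ℕ.^ j) ne y (trans (*-congʳ (+-cong (sym (teich-^ g j)) (-‿cong (sym (teich-^ g i))))) e)
        where
        ne : ¬ teich (g ℕ.^ i) ≈ teich (g ℕ.^ j)
        ne e = ℕ.<⇒≱ (ℕ.<-≤-trans (ℕ.∸-monoʳ-< 0<i (ℕ.<⇒≤ i<j)) j≤n) (ℕ.∣⇒≤ {{ℕ.>-nonZero (ℕ.m<n⇒0<n∸m i<j)}} (proj₂ (proj₂ primitive-root) (j ℕ.∸ i)
          (x-y≈0⇒x≈y (cancel-ζ i _ (trans (solve 2 (λ a b → a :* (b :- con (+ 1)) := a :* b :- a) refl (ζ ^ i) (ζ ^ (j ℕ.∸ i)))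
            (x≈y⇒x-y≈0 (trans (sym (^-+ ζ i (j ℕ.∸ i))) (trans (reflexive (≡.cong (ζ ^_) (ℕ.m+[n∸m]≡n (ℕ.<⇒≤ i<j)))) (trans (teich-^ g j) (trans (sym e) (sym (teich-^ g i))))))))))))

-- The rational Artin-Hasse series and its image in O.

module ArtinHasse where

  open import Defs using (sumQ; mulQ; oneQ; ahLog; powQ; artinHasse)
  open RingKit
  open PowerSeries
  open Cyclotomic using (module Polynomial; module TorsionFree)
  open PadicSeries using (module SeriesPowers)
  open import Algebra.Bundles using (CommutativeRing)
  open import Level using (0ℓ)
  open import Data.Empty using (⊥-elim)
  open import Data.Integer as ℤ using (ℤ; +_; -[1+_])
  import Data.Integer.Properties as ℤ
  import Data.Integer.Solver as ℤS
  open import Data.List as List using (List; []; _∷_)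
  import Data.List.Properties as List
  open import Data.Nat as ℕ using (ℕ; zero; suc; NonZero; s≤s; z≤n; _≤_; _<_; _!)
  import Data.Nat.Properties as ℕ
  open import Data.Nat.Coprimality as Coprime using (1-coprimeTo)
  open import Data.Nat.Induction using (<-rec)
  open import Data.Product using (Σ; _×_; _,_; proj₁; proj₂; ∃)
  open import Data.Rational as ℚ using (ℚ; mkℚ; 0ℚ; 1ℚ; ↥_; ↧_; toℚᵘ)
  import Data.Rational.Properties as ℚ
  open import Data.Rational.Unnormalised as ℚᵘ using (mkℚᵘ; *≡*)
  import Data.Rational.Unnormalised.Properties as ℚᵘ
  open import Relation.Binary.PropositionalEquality as ≡ using (_≡_)
  open import Relation.Nullary using (Dec; yes; no; ¬_)

  private
    module ℚR = CommutativeRing ℚ.+-*-commutativeRing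
    module ℚK = Kit ℚ.+-*-commutativeRing
    module ℚS = Series ℚ.+-*-commutativeRing
    module ℚP = SeriesPowers ℚ.+-*-commutativeRing

  open ℚS using (S; conv; θ; _≋_; at; pw)

  toℚᵘ-fromℕ : ∀ m → toℚᵘ (ℚK.fromℕ m) ℚᵘ.≃ mkℚᵘ (+ m) 0
  toℚᵘ-fromℕ zero    = ℚᵘ.≃-refl
  toℚᵘ-fromℕ (suc m) = ℚᵘ.≃-trans (ℚ.toℚᵘ-homo-+ 1ℚ (ℚK.fromℕ m)) (ℚᵘ.≃-trans (ℚᵘ.+-congʳ (toℚᵘ 1ℚ) (toℚᵘ-fromℕ m)) (*≡* (≡.cong (ℤ._* + 1) (≡.cong (λ z → + 1 ℤ.+ z) (ℤ.*-identityʳ (+ m))))))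

  fromℕ*1/ : ∀ m .{{_ : NonZero m}} → ℚK.fromℕ m ℚ.* (+ 1 ℚ./ m) ≡ 1ℚ
  fromℕ*1/ m@(suc k) = ≡.trans (≡.cong (ℚK.fromℕ m ℚ.*_) (ℚ.normalize-coprime (1-coprimeTo m))) (ℚ.toℚᵘ-injective
    (ℚᵘ.≃-trans (ℚ.toℚᵘ-homo-* (ℚK.fromℕ m) (mkℚ (+ 1) k (1-coprimeTo m))) (ℚᵘ.≃-trans (ℚᵘ.*-congʳ {mkℚᵘ (+ 1) k} (toℚᵘ-fromℕ m))
      (*≡* (≡.trans (ℤ.*-identityʳ _) (≡.trans (ℤ.*-identityʳ (+ m)) (≡.sym (≡.trans (ℤ.*-identityˡ _) (≡.cong +_ (ℕ.*-identityˡ m))))))))))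

  -- The local function of ahLog has no name outside Defs; unification finds it.
  mutual
    ahLog-term : (p : ℕ) .{{_ : NonZero p}} → ℕ → ℕ → ℚ
    ahLog-term p m = _

    ahLog-unfold : (p : ℕ) .{{_ : NonZero p}} (m : ℕ) → ¬ 1 ≡ m → ahLog p m ≡ 0ℚ ℚ.+ List.foldr ℚ._+_ 0ℚ (List.map (ahLog-term p m) (List.applyUpTo suc m))
    ahLog-unfold p m ne with 1 ℕ.≟ m
    ... | yes e = ⊥-elim (ne e)
    ... | no _  = ≡.refl

  module Exponential (p : ℕ) .{{_ : NonZero p}} where

    ∑ℚ : List ℚ → ℚ
    ∑ℚ = sumQ p

    sum-conv : ∀ f g n → ∑ℚ (List.map (λ i → f i ℚ.* g (n ℕ.∸ i)) (List.upTo (suc n))) ≡ conv f g n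
    sum-conv f g n = ≡.trans (≡.cong ∑ℚ (List.map-upTo (λ i → f i ℚ.* g (n ℕ.∸ i)) (suc n))) (go f n)
      where
      go : ∀ f n → ∑ℚ (List.applyUpTo (λ i → f i ℚ.* g (n ℕ.∸ i)) (suc n)) ≡ conv f g n
      go f zero    = ℚ.+-identityʳ _
      go f (suc n) = ≡.cong (λ z → f 0 ℚ.* g (suc n) ℚ.+ z) (go (λ i → f (suc i)) n)

    sum-last : ∀ h n → ∑ℚ (List.applyUpTo h (suc n)) ≡ ∑ℚ (List.applyUpTo h n) ℚ.+ h n
    sum-last h zero    = ℚ.+-comm (h 0) 0ℚ
    sum-last h (suc n) = ≡.trans (≡.cong (λ z → h 0 ℚ.+ z) (sum-last (λ i → h (suc i)) n)) (≡.sym (ℚ.+-assoc (h 0) _ _))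

    sum-zero : ∀ h n → (∀ i → i < n → h i ≡ 0ℚ) → ∑ℚ (List.applyUpTo h n) ≡ 0ℚ
    sum-zero h zero    z = ≡.refl
    sum-zero h (suc n) z = ≡.trans (≡.cong₂ ℚ._+_ (z 0 (s≤s z≤n)) (sum-zero (λ i → h (suc i)) n (λ i i<n → z (suc i) (s≤s i<n)))) (ℚ.+-identityˡ 0ℚ)

    sum-one : ∀ h n i → i < n → (∀ j → j < n → ¬ j ≡ i → h j ≡ 0ℚ) → ∑ℚ (List.applyUpTo h n) ≡ h i
    sum-one h (suc n) zero    _         z = ≡.trans (≡.cong (λ t → h 0 ℚ.+ t) (sum-zero (λ i → h (suc i)) n (λ i i<n → z (suc i) (s≤s i<n) (λ ())))) (ℚ.+-identityʳ _)
    sum-one h (suc n) (suc i) (s≤s i<n) z = ≡.trans (≡.cong₂ ℚ._+_ (z 0 (s≤s z≤n) (λ ())) (sum-one (λ i → h (suc i)) n i i<n (λ j j<n ne → z (suc j) (s≤s j<n) (λ e → ne (ℕ.suc-injective e))))) (ℚ.+-identityˡ _)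

    module Exp (g : S) (g0 : g 0 ≡ 0ℚ) where

      powQ-^ : ∀ k n → powQ p g k n ≡ (g ℚP.K.^ k) n
      powQ-^ zero    zero    = ≡.refl
      powQ-^ zero    (suc n) = ≡.refl
      powQ-^ (suc k) n = ≡.trans (sum-conv g (powQ p g k) n) (ℚS.conv-cong-terms n (λ a b _ → ≡.cong (g a ℚ.*_) (powQ-^ k b)))

      ^-low : ∀ k n → n < k → (g ℚP.K.^ k) n ≡ 0ℚ
      ^-low (suc k) n (s≤s n≤k) = ℚS.conv-zero n term
        where
        term : ∀ a b → a ℕ.+ b ≡ n → g a ℚ.* (g ℚP.K.^ k) b ≡ 0ℚ
        term zero    b e = ≡.trans (≡.cong (ℚ._* (g ℚP.K.^ k) b) g0) (ℚ.*-zeroˡ ((g ℚP.K.^ k) b))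
        term (suc a) b e = ≡.trans (≡.cong (g (suc a) ℚ.*_) (^-low k b (ℕ.≤-trans (s≤s (ℕ.m≤n+m b a)) (ℕ.≤-trans (ℕ.≤-reflexive e) n≤k)))) (ℚ.*-zeroʳ (g (suc a)))

      1/! : ℕ → ℚ
      1/! k = (+ 1 ℚ./ (k !)) {{k ℕ.!≢0}}

      1/!-suc : ∀ k → ℚK.fromℕ (suc k) ℚ.* 1/! (suc k) ≡ 1/! k
      1/!-suc k = ≡.trans (≡.sym (ℚ.*-identityˡ _)) (≡.trans (≡.cong (ℚ._* (ℚK.fromℕ (suc k) ℚ.* 1/! (suc k))) (≡.sym (fromℕ*1/ (k !) {{k ℕ.!≢0}}))) (≡.trans
        (ℚK.Solver.solve 4 (λ f c m d → ((f ℚK.Solver.:* c) ℚK.Solver.:* (m ℚK.Solver.:* d)) ℚK.Solver.:= c ℚK.Solver.:* ((m ℚK.Solver.:* f) ℚK.Solver.:* d)) ≡.refl (ℚK.fromℕ (k !)) (1/! k) (ℚK.fromℕ (suc k)) (1/! (suc k)))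
        (≡.trans (≡.cong (1/! k ℚ.*_) (≡.trans (≡.cong (ℚ._* 1/! (suc k)) (≡.sym (ℚK.fromℕ-* (suc k) (k !)))) (fromℕ*1/ (suc k !) {{suc k ℕ.!≢0}}))) (ℚ.*-identityʳ _))))

      partial : ℕ → S
      partial K m = ∑ℚ (List.applyUpTo (λ k → powQ p g k m ℚ.* 1/! k) K)

      exp : S
      exp n = ∑ℚ (List.map (λ k → powQ p g k n ℚ.* 1/! k) (List.upTo (suc n)))

      partial-suc : ∀ K m → partial (suc K) m ≡ partial K m ℚ.+ 1/! K ℚ.* (g ℚP.K.^ K) m
      partial-suc K m = ≡.trans (sum-last (λ k → powQ p g k m ℚ.* 1/! k) K) (≡.cong (λ z → partial K m ℚ.+ z) (≡.trans (≡.cong (ℚ._* 1/! K) (powQ-^ K m)) (ℚ.*-comm _ (1/! K))))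

      partial-exp : ∀ d n → partial (d ℕ.+ suc n) n ≡ exp n
      partial-exp zero    n = ≡.sym (≡.cong ∑ℚ (List.map-upTo (λ k → powQ p g k n ℚ.* 1/! k) (suc n)))
      partial-exp (suc d) n = ≡.trans (partial-suc (d ℕ.+ suc n) n) (≡.trans (≡.cong₂ (λ y z → y ℚ.+ 1/! (d ℕ.+ suc n) ℚ.* z) (partial-exp d n) (^-low (d ℕ.+ suc n) n (ℕ.m≤n+m (suc n) d)))
        (≡.trans (≡.cong (λ z → exp n ℚ.+ z) (ℚ.*-zeroʳ (1/! (d ℕ.+ suc n)))) (ℚ.+-identityʳ (exp n))))

      -- θ(g^k/k!) = (g^(k-1)/(k-1)!) θg, so θ of a partial sum is the previous partial sum times
      -- θg.
      θ-partial : ∀ K m → ℚK.fromℕ m ℚ.* partial (suc K) m ≡ conv (partial K) (θ g) m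
      θ-partial zero m = ≡.trans (base m) (≡.sym (ℚS.conv-zero m (λ a b _ → ℚ.*-zeroˡ (θ g b))))
        where
        base : ∀ m → ℚK.fromℕ m ℚ.* partial 1 m ≡ 0ℚ
        base zero    = ℚ.*-zeroˡ (partial 1 0)
        base (suc m) = ≡.trans (≡.cong (λ z → ℚK.fromℕ (suc m) ℚ.* (z ℚ.+ 0ℚ)) (ℚ.*-zeroˡ (1/! 0))) (ℚ.*-zeroʳ (ℚK.fromℕ (suc m)))
      θ-partial (suc K) m = ≡.trans (≡.cong (ℚK.fromℕ m ℚ.*_) (partial-suc (suc K) m)) (≡.trans (ℚ.*-distribˡ-+ (ℚK.fromℕ m) _ _)
        (≡.trans (≡.cong₂ ℚ._+_ (θ-partial K m) power) (≡.sym (≡.trans (ℚS.conv-cong-terms m (λ a b _ → ≡.cong (ℚ._* θ g b) (partial-suc K a))) (at (CommutativeRing.distribʳ ℚS.series (θ g) (partial K) (λ i → 1/! K ℚ.* (g ℚP.K.^ K) i)) m)))))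
        where
        open ℚK.Solver
        power : ℚK.fromℕ m ℚ.* (1/! (suc K) ℚ.* (g ℚP.K.^ suc K) m) ≡ conv (λ i → 1/! K ℚ.* (g ℚP.K.^ K) i) (θ g) m
        power = ≡.trans (solve 3 (λ m d x → m :* (d :* x) := d :* (m :* x)) ≡.refl (ℚK.fromℕ m) (1/! (suc K)) ((g ℚP.K.^ suc K) m))
          (≡.trans (≡.cong (1/! (suc K) ℚ.*_) (≡.trans (at (ℚP.θ-^ g K) m) (ℚP.fromℕ*-apply (suc K) (conv (g ℚP.K.^ K) (θ g)) m)))
          (≡.trans (solve 3 (λ d n x → d :* (n :* x) := (n :* d) :* x) ≡.refl (1/! (suc K)) (ℚK.fromℕ (suc K)) (conv (g ℚP.K.^ K) (θ g) m))
          (≡.trans (≡.cong (ℚ._* conv (g ℚP.K.^ K) (θ g) m) (1/!-suc K)) (≡.sym (ℚS.conv-scaleˡ (1/! K) (g ℚP.K.^ K) (θ g) m)))))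

      θ-exp : ∀ n → ℚK.fromℕ n ℚ.* exp n ≡ conv exp (θ g) n
      θ-exp n = ≡.trans (≡.cong (ℚK.fromℕ n ℚ.*_) (≡.sym (partial-exp 0 n))) (≡.trans (θ-partial n n) (ℚS.conv-cong-terms n term))
        where
        term : ∀ a b → a ℕ.+ b ≡ n → partial n a ℚ.* θ g b ≡ exp a ℚ.* θ g b
        -- θg has no constant term, so only b > 0 matters; then a < n and `partial n a` is already
        -- complete.
        term a zero    e = ≡.trans (≡.cong (partial n a ℚ.*_) (ℚ.*-zeroˡ (g 0))) (≡.trans (ℚ.*-zeroʳ (partial n a)) (≡.sym (≡.trans (≡.cong (exp a ℚ.*_) (ℚ.*-zeroˡ (g 0))) (ℚ.*-zeroʳ (exp a)))))
        term a (suc b) e = ≡.cong (ℚ._* θ g (suc b)) (≡.trans (≡.cong (λ k → partial k a) (≡.trans (≡.sym e) (≡.trans (ℕ.+-suc a b) (≡.trans (≡.cong suc (ℕ.+-comm a b)) (≡.sym (ℕ.+-suc b a)))))) (partial-exp b a))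

    module _ (m : ℕ) where
      private
        h = ahLog-term p m

        h-power : ∀ j → p ℕ.^ j ≡ m → ℚK.fromℕ m ℚ.* h j ≡ 1ℚ
        h-power j e with p ℕ.^ j ℕ.≟ m
        ... | yes e′ = ≡.trans (≡.cong (λ z → ℚK.fromℕ z ℚ.* (+ 1 ℚ./ (p ℕ.^ j)) {{ℕ.m^n≢0 p j}}) (≡.sym e′)) (fromℕ*1/ (p ℕ.^ j) {{ℕ.m^n≢0 p j}})
        ... | no ne = ⊥-elim (ne e)

        h-nonpower : ∀ j → ¬ p ℕ.^ j ≡ m → h j ≡ 0ℚ
        h-nonpower j ne with p ℕ.^ j ℕ.≟ m
        ... | yes e = ⊥-elim (ne e)
        ... | no _  = ≡.refl

        list : ahLog p m ≡ ∑ℚ (List.applyUpTo h (suc m))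
        list = ≡.cong ∑ℚ (List.map-upTo h (suc m))

      ahLog-nonpower : (∀ j → ¬ p ℕ.^ j ≡ m) → ahLog p m ≡ 0ℚ
      ahLog-nonpower ne = ≡.trans list (sum-zero h (suc m) (λ j _ → h-nonpower j (ne j)))

      ahLog-power : 1 < p → ∀ j → j < suc m → p ℕ.^ j ≡ m → ℚK.fromℕ m ℚ.* ahLog p m ≡ 1ℚ
      ahLog-power p>1 j j≤m e = ≡.trans (≡.cong (ℚK.fromℕ m ℚ.*_) (≡.trans list (sum-one h (suc m) j j≤m
        (λ i _ ne → h-nonpower i (λ e′ → ne (ℕ.≤-antisym (cancel i j (≡.trans e′ (≡.sym e))) (cancel j i (≡.trans e (≡.sym e′))))))))) (h-power j e)
        where
        cancel : ∀ i j → p ℕ.^ i ≡ p ℕ.^ j → i ≤ j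
        cancel i j e = ℕ.≮⇒≥ (λ j<i → ℕ.<⇒≢ (ℕ.^-monoʳ-< p p>1 j<i) (≡.sym e))

  -- q Represents o when the rational number q is the image of o, i.e. numerator = denominator · o.
  module Represent (R : CommutativeRing 0ℓ 0ℓ) (torsion-free : Polynomial.Torsion-free R) (nontrivial : Polynomial.Nontrivial R) where

    open CommutativeRing R hiding (zero)
    open Kit R
    open Polynomial R
    open TorsionFree R torsion-free nontrivial
    open Solver
    private module RS = Series R

    Represents : ℚ → Carrier → Set
    Represents q o = fromℤ (↥ q) ≈ fromℤ (↧ q) * o

    private
      ↧≢0 : ∀ q → ¬ ↧ q ≡ + 0
      ↧≢0 q ()

      cancel : ∀ {c x y} → ¬ c ≡ + 0 → fromℤ c * x ≈ fromℤ c * y → x ≈ y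
      cancel {c} {x} {y} nz e = x-y≈0⇒x≈y (fromℤ-cancel nz (x - y) (trans (solve 3 (λ c x y → c :* (x :- y) := c :* x :- c :* y) refl (fromℤ c) x y) (x≈y⇒x-y≈0 e)))

      ⟦_⟧ : ∀ {a b} → a ≡ b → fromℤ a ≈ fromℤ b
      ⟦ e ⟧ = reflexive (≡.cong fromℤ e)

      unfold : ∀ q {r} → toℚᵘ q ℚᵘ.≃ r → ↥ q ℤ.* ℚᵘ.↧ r ≡ ℚᵘ.↥ r ℤ.* ↧ q
      unfold record{} (*≡* e) = e

      sum-equation : ∀ a b → ↥ (a ℚ.+ b) ℤ.* (↧ a ℤ.* ↧ b) ≡ (↥ a ℤ.* ↧ b ℤ.+ ↥ b ℤ.* ↧ a) ℤ.* ↧ (a ℚ.+ b)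
      sum-equation a@record{} b@record{} = unfold (a ℚ.+ b) (ℚ.toℚᵘ-homo-+ a b)

      product-equation : ∀ a b → ↥ (a ℚ.* b) ℤ.* (↧ a ℤ.* ↧ b) ≡ (↥ a ℤ.* ↥ b) ℤ.* ↧ (a ℚ.* b)
      product-equation a@record{} b@record{} = unfold (a ℚ.* b) (ℚ.toℚᵘ-homo-* a b)

      ↧*↧≢0 : ∀ a b → ¬ ↧ a ℤ.* ↧ b ≡ + 0
      ↧*↧≢0 a b ()

    represents-+ : ∀ {a b x y} → Represents a x → Represents b y → Represents (a ℚ.+ b) (x + y)
    represents-+ {a} {b} {x} {y} e f = cancel (↧*↧≢0 a b) (trans (*-comm _ _) (trans (sym (fromℤ-* (↥ (a ℚ.+ b)) (↧ a ℤ.* ↧ b))) (trans ⟦ sum-equation a b ⟧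
      (trans (fromℤ-* (↥ a ℤ.* ↧ b ℤ.+ ↥ b ℤ.* ↧ a) (↧ (a ℚ.+ b))) (trans (*-congʳ (trans (fromℤ-+ (↥ a ℤ.* ↧ b) (↥ b ℤ.* ↧ a)) (+-cong (trans (fromℤ-* (↥ a) (↧ b)) (*-congʳ e)) (trans (fromℤ-* (↥ b) (↧ a)) (*-congʳ f)))))
      (trans (solve 5 (λ a b c x y → ((a :* x) :* b :+ (b :* y) :* a) :* c := (a :* b) :* (c :* (x :+ y))) refl (fromℤ (↧ a)) (fromℤ (↧ b)) (fromℤ (↧ (a ℚ.+ b))) x y) (*-congʳ (sym (fromℤ-* (↧ a) (↧ b))))))))))

    represents-* : ∀ {a b x y} → Represents a x → Represents b y → Represents (a ℚ.* b) (x * y)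
    represents-* {a} {b} {x} {y} e f = cancel (↧*↧≢0 a b) (trans (*-comm _ _) (trans (sym (fromℤ-* (↥ (a ℚ.* b)) (↧ a ℤ.* ↧ b))) (trans ⟦ product-equation a b ⟧
      (trans (fromℤ-* (↥ a ℤ.* ↥ b) (↧ (a ℚ.* b))) (trans (*-congʳ (trans (fromℤ-* (↥ a) (↥ b)) (*-cong e f)))
      (trans (solve 5 (λ a b c x y → ((a :* x) :* (b :* y)) :* c := (a :* b) :* (c :* (x :* y))) refl (fromℤ (↧ a)) (fromℤ (↧ b)) (fromℤ (↧ (a ℚ.* b))) x y) (*-congʳ (sym (fromℤ-* (↧ a) (↧ b))))))))))

    represents-0 : Represents 0ℚ 0#
    represents-0 = sym (zeroʳ _)

    represents-1 : Represents 1ℚ 1#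
    represents-1 = sym (*-identityʳ _)

    represents-resp : ∀ {a b x y} → a ≡ b → x ≈ y → Represents a x → Represents b y
    represents-resp ≡.refl e r = trans r (*-congˡ e)

    represents-fromℕ : ∀ m → Represents (ℚK.fromℕ m) (fromℕ m)
    represents-fromℕ zero    = represents-0
    represents-fromℕ (suc m) = represents-+ {1ℚ} {ℚK.fromℕ m} represents-1 (represents-fromℕ m)

    represents-cancel : ∀ m {q o} → 0 < m → Represents (ℚK.fromℕ m ℚ.* q) (fromℕ m * o) → Represents q o
    represents-cancel m {q} {o} m>0 e = cancel d≢0 (trans (*-congʳ D) (trans (solve 4 (λ m a c x → (m :* (a :* c)) :* x := ((a :* m) :* x) :* c) refl (fromℕ m) (fromℤ (↧ ν)) (fromℤ (↧ (ν ℚ.* q))) (fromℤ (↥ q)))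
      (trans (*-congʳ (*-congʳ (sym (represents-fromℕ m)))) (trans (*-congʳ (sym (fromℤ-* (↥ ν) (↥ q)))) (trans (sym (fromℤ-* (↥ ν ℤ.* ↥ q) (↧ (ν ℚ.* q)))) (trans ⟦ ≡.sym (product-equation ν q) ⟧ (trans (fromℤ-* (↥ (ν ℚ.* q)) (↧ ν ℤ.* ↧ q)) (trans (*-cong e (fromℤ-* (↧ ν) (↧ q)))
      (trans (solve 5 (λ c m o a b → (c :* (m :* o)) :* (a :* b) := (m :* (a :* c)) :* (b :* o)) refl (fromℤ (↧ (ν ℚ.* q))) (fromℕ m) o (fromℤ (↧ ν)) (fromℤ (↧ q))) (*-congʳ (sym D)))))))))))
      where
      ν = ℚK.fromℕ m
      D : fromℤ (+ m ℤ.* (↧ ν ℤ.* ↧ (ν ℚ.* q))) ≈ fromℕ m * (fromℤ (↧ ν) * fromℤ (↧ (ν ℚ.* q)))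
      D = trans (fromℤ-* (+ m) (↧ ν ℤ.* ↧ (ν ℚ.* q))) (*-congˡ (fromℤ-* (↧ ν) (↧ (ν ℚ.* q))))
      d≢0 : ¬ + m ℤ.* (↧ ν ℤ.* ↧ (ν ℚ.* q)) ≡ + 0
      d≢0 = nz m>0 ν (ν ℚ.* q)
        where
        nz : ∀ {m} → 0 < m → ∀ a b → ¬ + m ℤ.* (↧ a ℤ.* ↧ b) ≡ + 0
        nz {suc m} _ a b ()

    represents-conv : ∀ n {f g : S} {F G : RS.S} → (∀ a b → a ℕ.+ b ≡ n → Represents (f a ℚ.* g b) (F a * G b)) → Represents (conv f g n) (RS.conv F G n)
    represents-conv zero    h = h 0 0 ≡.refl
    represents-conv (suc n) {f} {g} {F} {G} h = represents-+ {f 0 ℚ.* g (suc n)} {conv (λ i → f (suc i)) g n} (h 0 (suc n) ≡.refl) (represents-conv n {λ i → f (suc i)} {g} {λ i → F (suc i)} {G} (λ a b e → h (suc a) b (≡.cong suc e)))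

    module ArtinHasse (p : ℕ) .{{_ : NonZero p}} (p>1 : 1 < p) (Y e : RS.S) (power? : ∀ m → Dec (∃ λ j → j < suc m × p ℕ.^ j ≡ m))
      (j<p^j : ∀ j → j < p ℕ.^ j) (Y-power : ∀ j → Y (p ℕ.^ j) ≈ 1#) (Y-nonpower : ∀ m → (∀ j → ¬ p ℕ.^ j ≡ m) → Y m ≈ 0#)
      (e0 : e 0 ≈ 1#) (θe : ∀ n → fromℕ n * e n ≈ RS.conv e Y n) where

      open Exponential p

      not-zero : ∀ j → ¬ p ℕ.^ j ≡ 0
      not-zero j z = ℕ.n≮0 (≡.subst (j <_) z (j<p^j j))

      log0 : ahLog p 0 ≡ 0ℚ
      log0 = ahLog-nonpower 0 not-zero

      open Exp (ahLog p) log0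

      -- θ multiplies the coefficient 1/p^j of x^(p^j) by p^j. This is where Y comes from, and why O
      -- suffices despite the denominators of the logarithm.
      represents-log : ∀ m → Represents (θ (ahLog p) m) (Y m)
      represents-log m with power? m
      ... | yes (j , j≤m , eq) = represents-resp (≡.sym (ahLog-power m p>1 j j≤m eq)) (sym (trans (reflexive (≡.cong Y (≡.sym eq))) (Y-power j))) represents-1
      ... | no none = represents-resp (≡.sym (≡.trans (≡.cong (ℚK.fromℕ m ℚ.*_) (ahLog-nonpower m ne)) (ℚ.*-zeroʳ (ℚK.fromℕ m)))) (sym (Y-nonpower m ne)) represents-0
        where
        ne : ∀ j → ¬ p ℕ.^ j ≡ m
        ne j eq = none (j , ℕ.m<n⇒m<1+n (≡.subst (j <_) eq (j<p^j j)) , eq)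

      -- Both sides satisfy n e_n = Σ e_a Y_b with a + b = n and b > 0, and n > 0 can be cancelled.
      represents-artinHasse : ∀ n → Represents (artinHasse p n) (e n)
      represents-artinHasse = <-rec _ go
        where
        go : ∀ n → (∀ {k} → k < n → Represents (artinHasse p k) (e k)) → Represents (artinHasse p n) (e n)
        go zero    rec = represents-resp {1ℚ} ≡.refl (sym e0) represents-1
        go n@(suc _) rec = represents-cancel n (s≤s z≤n) (represents-resp (≡.sym (θ-exp n)) (sym (θe n)) (represents-conv n {artinHasse p} {θ (ahLog p)} {e} {Y} term))
          where
          term : ∀ a b → a ℕ.+ b ≡ n → Represents (artinHasse p a ℚ.* θ (ahLog p) b) (e a * Y b)
          term a zero    eq = represents-resp (≡.sym (≡.trans (≡.cong (artinHasse p a ℚ.*_) (ℚ.*-zeroˡ (ahLog p 0))) (ℚ.*-zeroʳ (artinHasse p a)))) (sym (trans (*-congˡ (Y-nonpower 0 not-zero)) (zeroʳ _))) represents-0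
          term a (suc b) eq = represents-* {artinHasse p a} {θ (ahLog p) (suc b)} (rec (≡.subst (a <_) eq (ℕ.m<m+n a (s≤s z≤n)))) (represents-log (suc b))

-- Laurent series and values of polynomials as series modulo p.

module Evaluate where

  open import Defs using (Laurent; Poly; coeffs; eval; _+ᴸ_; _*ᴸ_; zeroᴸ; _≈ᴸ_; _+ₛ_; _*ₛ_; EpBar; redQ; artinHasse; IsZeroPoly; AlgIndep; InL; gens; TrDegIs; totient)
  import Defs
  open RingKit
  open PowerSeries
  open PadicRing
  open Padic using (prime-coprime)
  open PadicSeries using (module Padics; module FinSum; module SeriesPowers)
  open Cyclotomic
  open Teichmuller
  open ArtinHasse using (module Represent)
  open import Algebra.Bundles using (CommutativeRing)
  open import Level using (0ℓ)
  import Data.Fin as Fin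
  open import Data.Empty using (⊥; ⊥-elim)
  open import Data.Integer as ℤ using (ℤ; +_; -[1+_])
  import Data.Integer.Properties as ℤ
  import Data.Integer.DivMod as ℤ
  open import Data.List as List using (List; []; _∷_)
  import Data.List.Properties as List
  open import Data.Nat as ℕ using (ℕ; zero; suc; NonZero; s≤s; z≤n; _≤_; _<_; _%_; _/_)
  import Data.Nat.Properties as ℕ
  import Data.Nat.DivMod as ℕ
  import Data.Nat.Divisibility as ℕ
  open import Data.Nat.Coprimality as Coprime using (Coprime)
  open import Data.Nat.ListAction using (sum)
  open import Data.Nat.Primality using (Prime; prime⇒nonZero; prime⇒nonTrivial)
  open import Data.Product using (Σ; _×_; _,_; proj₁; proj₂; ∃)
  open import Data.Rational as ℚ using (ℚ; mkℚ; ↥_; ↧_; ↧ₙ_)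
  open import Data.Sum as Sum using (_⊎_; inj₁; inj₂)
  open import Data.Unit using (⊤; tt)
  open import Data.Vec as Vec using (Vec; []; _∷_)
  open import Relation.Binary.PropositionalEquality as ≡ using (_≡_)
  open import Relation.Nullary using (Dec; yes; no; ¬_)

  module EvaluationAlgebra (A : CommutativeRing 0ℓ 0ℓ) where

    open CommutativeRing A hiding (zero)
    open Kit A
    open Solver

    value-step : ∀ {a b c s r t w u h} → s ≈ a * w → r ≈ b * u → t ≈ c * h → (b * c) * s + a * (r * t) ≈ (a * (b * c)) * (w + u * h)
    value-step {a} {b} {c} {s} {r} {t} {w} {u} {h} e f k = trans (+-cong (*-congˡ e) (*-congˡ (*-cong f k)))
      (solve 6 (λ a b c w u h → (b :* c) :* (a :* w) :+ a :* ((b :* u) :* (c :* h)) := (a :* (b :* c)) :* (w :+ u :* h)) refl a b c w u h)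

    -- One Horner step for fractions, w/V + (u/v)(h/(Vq)) = (vqw + uh)/(Vvq), where a, b, c are the
    -- powers of x carried by the Laurent pairs.
    clear-step : ∀ {a b c s r t w u h V v q} → s * V ≈ a * w → r * v ≈ b * u → t * (V * q) ≈ c * h →
      ((b * c) * s + a * (r * t)) * (V * (v * q)) ≈ (a * (b * c)) * ((v * q) * w + u * h)
    clear-step {a} {b} {c} {s} {r} {t} {w} {u} {h} {V} {v} {q} e f k = trans
      (solve 9 (λ a b c s r t V v q → ((b :* c) :* s :+ a :* (r :* t)) :* (V :* (v :* q)) := ((b :* c) :* (v :* q)) :* (s :* V) :+ a :* ((r :* v) :* (t :* (V :* q)))) refl a b c s r t V v q)
      (trans (+-cong (*-congˡ e) (*-congˡ (*-cong f k)))
      (solve 8 (λ a b c w u h v q → ((b :* c) :* (v :* q)) :* (a :* w) :+ a :* ((b :* u) :* (c :* h)) := (a :* (b :* c)) :* ((v :* q) :* w :+ u :* h)) refl a b c w u h v q))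

    log-derivative-* : ∀ {d b c y f g df dg} → d ≈ df * g + f * dg → df ≈ (b * y) * f → dg ≈ (c * y) * g → d ≈ ((b + c) * y) * (f * g)
    log-derivative-* {d} {b} {c} {y} {f} {g} e h k = trans e (trans (+-cong (*-congʳ h) (*-congˡ k))
      (solve 5 (λ b c y f g → ((b :* y) :* f) :* g :+ f :* ((c :* y) :* g) := ((b :+ c) :* y) :* (f :* g)) refl b c y f g))

    factor-step : ∀ {d e} → d * (d * e) ≈ d → d * ((d * e) - 1#) ≈ 0#
    factor-step {d} {e} h = trans (solve 2 (λ d y → d :* (y :- con (+ 1)) := d :* y :- d) refl d (d * e)) (trans (+-congʳ h) (-‿inverseʳ d))

    residue-step : ∀ {N d o e} → N ≈ d * o → d * e ≈ 1# → N * e ≈ o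
    residue-step {N} {d} {o} {e} h k = trans (*-congʳ h) (trans (solve 3 (λ d o e → (d :* o) :* e := o :* (d :* e)) refl d o e) (trans (*-congˡ k) (*-identityʳ o)))

    ratio-step : ∀ {xp xq xk s u w tq tp} → xp * (s * tq) ≈ (xk * xq) * tp → tq ≈ xq * u → tp ≈ xp * w → (xp * xq) * (s * u) ≈ (xp * xq) * (xk * w)
    ratio-step {xp} {xq} {xk} {s} {u} {w} {tq} {tp} e f g = trans (solve 4 (λ p q s u → (p :* q) :* (s :* u) := p :* (s :* (q :* u))) refl xp xq s u)
      (trans (*-congˡ (*-congˡ (sym f))) (trans e (trans (*-congˡ g) (solve 4 (λ k q p w → (k :* q) :* (p :* w) := (p :* q) :* (k :* w)) refl xk xq xp w))))

  module SumAlgebra (A : CommutativeRing 0ℓ 0ℓ) where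

    open CommutativeRing A hiding (zero)
    open Kit.Solver A
    open FinSum A

    ∑-+ : ∀ r (f g : Fin.Fin r → Carrier) → ∑ r (λ k → f k + g k) ≈ ∑ r f + ∑ r g
    ∑-+ zero    f g = sym (+-identityˡ 0#)
    ∑-+ (suc r) f g = trans (+-congˡ (∑-+ r (λ k → f (Fin.suc k)) (λ k → g (Fin.suc k))))
      (solve 4 (λ a b c d → (a :+ b) :+ (c :+ d) := (a :+ c) :+ (b :+ d)) refl (f Fin.zero) (g Fin.zero) (∑ r (λ k → f (Fin.suc k))) (∑ r (λ k → g (Fin.suc k))))

    ∑-split : ∀ a b (f : Fin.Fin (a ℕ.+ b) → Carrier) → ∑ (a ℕ.+ b) f ≈ ∑ a (λ i → f (i Fin.↑ˡ b)) + ∑ b (λ j → f (a Fin.↑ʳ j))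
    ∑-split zero    b f = sym (+-identityˡ (∑ b f))
    ∑-split (suc a) b f = trans (+-congˡ (∑-split a b (λ k → f (Fin.suc k)))) (sym (+-assoc (f Fin.zero) (∑ a (λ i → f (Fin.suc (i Fin.↑ˡ b)))) (∑ b (λ j → f (suc a Fin.↑ʳ j)))))

    ∑-rows : ∀ a b (c : Fin.Fin a → Carrier) (m : Fin.Fin a → Fin.Fin b → Carrier) (G : Fin.Fin b → Carrier) →
      ∑ a (λ i → c i * ∑ b (λ j → m i j * G j)) ≈ ∑ b (λ j → ∑ a (λ i → c i * m i j) * G j)
    ∑-rows zero    b c m G = sym (∑-zero b (λ j → zeroˡ (G j)))
    ∑-rows (suc a) b c m G = trans (+-cong (sym (∑-scale b (c Fin.zero) (λ j → m Fin.zero j * G j))) (∑-rows a b (λ i → c (Fin.suc i)) (λ i → m (Fin.suc i)) G))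
      (trans (sym (∑-+ b (λ j → c Fin.zero * (m Fin.zero j * G j)) (λ j → ∑ a (λ i → c (Fin.suc i) * m (Fin.suc i) j) * G j)))
        (∑-cong b (λ j → solve 4 (λ c m s g → c :* (m :* g) :+ s :* g := (c :* m :+ s) :* g) refl (c Fin.zero) (m Fin.zero j) (∑ a (λ i → c (Fin.suc i) * m (Fin.suc i) j)) (G j))))

    ∑-cons : ∀ r (f : Fin.Fin (suc r) → Carrier) a b → a ≈ f Fin.zero → b ≈ ∑ r (λ k → f (Fin.suc k)) → a + b ≈ ∑ (suc r) f
    ∑-cons r f a b e h = +-cong e h

    interchange : ∀ a b c d → (a * b) * (c * d) ≈ (a * c) * (b * d)
    interchange a b c d = solve 4 (λ a b c d → (a :* b) :* (c :* d) := (a :* c) :* (b :* d)) refl a b c d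

    swap : ∀ a b c → a * (b * c) ≈ b * (a * c)
    swap a b c = solve 3 (λ a b c → a :* (b :* c) := b :* (a :* c)) refl a b c

  module SumMap (A B : CommutativeRing 0ℓ 0ℓ) where

    private
      module A = CommutativeRing A
      module B = CommutativeRing B
      module A∑ = FinSum A
      module B∑ = FinSum B

    ∑-map : (φ : A.Carrier → B.Carrier) → φ A.0# B.≈ B.0# → (∀ x y → φ (x A.+ y) B.≈ φ x B.+ φ y) → ∀ r f → B∑.∑ r (λ i → φ (f i)) B.≈ φ (A∑.∑ r f)
    ∑-map φ φ0 φ+ zero    f = B.sym φ0
    ∑-map φ φ0 φ+ (suc r) f = B.trans (B.+-congˡ (∑-map φ φ0 φ+ r (λ i → f (Fin.suc i)))) (B.sym (φ+ (f Fin.zero) (A∑.∑ r (λ i → f (Fin.suc i)))))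

  module Evaluation (p : ℕ) .{{nz : NonZero p}} (pr : Prime p) (𝕂 : PadicIntegers p) where

    open Padics p pr 𝕂
    open Units p pr 𝕂 using (fromℕ∼⇒mod; teich∼; O-torsion-free; O-nontrivial)
    open CommutativeRing M.series using () renaming (_+_ to _⊕_; _*_ to _⊛_)
    module KM = Kit M.series
    open EvaluationAlgebra M.series

    1ₛ : S
    1ₛ = const 1#

    lift : (ℕ → ℕ) → S
    lift s n = fromℕ (s n)

    fromℕ-% : ∀ m → fromℕ m ∼ fromℕ (m % p)
    fromℕ-% m = fromℕ (m / p) Q., trans (reflexive (≡.cong fromℕ (ℕ.m≡m%n+[m/n]*n m p))) (trans (fromℕ-+ (m % p) (m / p ℕ.* p)) (+-congˡ (trans (fromℕ-* (m / p) p) (*-comm _ _))))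

    %⇒∼ : ∀ {a b} → a % p ≡ b % p → fromℕ a ∼ fromℕ b
    %⇒∼ {a} {b} e = R.trans (fromℕ-% a) (R.trans (R.reflexive (≡.cong fromℕ e)) (R.sym (fromℕ-% b)))

    ∼⇒%′ : ∀ {a b} → a ≤ b → fromℕ b ∼ fromℕ a → b % p ≡ a % p
    ∼⇒%′ {a} {b} a≤b e with fromℕ∼⇒mod a b a≤b e
    ... | ℕ.divides k eq = ≡.trans (≡.cong (_% p) (≡.trans (≡.sym (ℕ.m+[n∸m]≡n a≤b)) (≡.cong (λ z → a ℕ.+ z) eq))) (ℕ.[m+kn]%n≡m%n a k p)

    ∼⇒% : ∀ {a b} → fromℕ a ∼ fromℕ b → a % p ≡ b % p
    ∼⇒% {a} {b} e = cases (ℕ.≤-total a b)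
      where
      cases : a ≤ b ⊎ b ≤ a → a % p ≡ b % p
      cases (inj₁ a≤b) = ≡.sym (∼⇒%′ a≤b (R.sym e))
      cases (inj₂ b≤a) = ∼⇒%′ b≤a e

    lift-conv : ∀ (s t : ℕ → ℕ) n → fromℕ (sum (List.applyUpTo (λ i → s i ℕ.* t (n ℕ.∸ i)) (suc n))) ≈ conv (lift s) (lift t) n
    lift-conv s t zero    = trans (reflexive (≡.cong fromℕ (ℕ.+-identityʳ (s 0 ℕ.* t 0)))) (fromℕ-* (s 0) (t 0))
    lift-conv s t (suc n) = trans (fromℕ-+ (s 0 ℕ.* t (suc n)) (sum (List.applyUpTo (λ i → s (suc i) ℕ.* t (n ℕ.∸ i)) (suc n)))) (+-cong (fromℕ-* (s 0) (t (suc n))) (lift-conv (λ i → s (suc i)) t n))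

    lift-* : ∀ s t → lift (_*ₛ_ p s t) ≡ₚ lift s ⊛ lift t
    lift-* s t = pwₚ (λ n → ≈⇒∼ (trans (reflexive (≡.cong (λ xs → fromℕ (sum xs)) (List.map-upTo (λ i → s i ℕ.* t (n ℕ.∸ i)) (suc n)))) (lift-conv s t n)))

    lift-+ : ∀ s t → lift (_+ₛ_ p s t) ≡ₚ lift s ⊕ lift t
    lift-+ s t = pwₚ (λ n → ≈⇒∼ (fromℕ-+ (s n) (t n)))

    x^ : ℕ → S
    x^ k = X KM.^ k

    lift-shift′ : ∀ k s n → fromℕ (Defs.shift p k s n) ≈ shift k (lift s) n
    lift-shift′ zero    s n       = refl
    lift-shift′ (suc k) s zero    = refl
    lift-shift′ (suc k) s (suc n) = lift-shift′ k s n

    lift-shift : ∀ k s → lift (Defs.shift p k s) ≡ₚ x^ k ⊛ lift s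
    lift-shift k s = S̄.trans (pwₚ (λ n → ≈⇒∼ (lift-shift′ k s n))) (S̄.sym (SM.X^* k (lift s)))

    shift-at : ∀ k (f : S) n → shift k f (k ℕ.+ n) ≡ f n
    shift-at zero    f n = ≡.refl
    shift-at (suc k) f n = shift-at k f n

    x^-cancel : ∀ k {f g} → x^ k ⊛ f ≡ₚ x^ k ⊛ g → f ≡ₚ g
    x^-cancel k {f} {g} e = pwₚ (λ n → R.trans (R.reflexive (≡.sym (shift-at k f n))) (R.trans (atₚ e′ (k ℕ.+ n)) (R.reflexive (shift-at k g n))))
      where
      e′ : shift k f ≡ₚ shift k g
      e′ = S̄.trans (S̄.sym (SM.X^* k f)) (S̄.trans e (SM.X^* k g))

    x^-+ : ∀ k l → x^ (k ℕ.+ l) ≡ₚ x^ k ⊛ x^ l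
    x^-+ k l = KM.^-+ X k l

    ≈ᴸ⇒ : ∀ a b → _≈ᴸ_ p a b → x^ (proj₁ b) ⊛ lift (proj₂ a) ≡ₚ x^ (proj₁ a) ⊛ lift (proj₂ b)
    ≈ᴸ⇒ (k , s) (l , t) e = S̄.trans (S̄.sym (lift-shift l s)) (S̄.trans (pwₚ (λ n → %⇒∼ (e n))) (lift-shift k t))

    ⇒≈ᴸ : ∀ a b → x^ (proj₁ b) ⊛ lift (proj₂ a) ≡ₚ x^ (proj₁ a) ⊛ lift (proj₂ b) → _≈ᴸ_ p a b
    ⇒≈ᴸ (k , s) (l , t) e n = ∼⇒% (atₚ (S̄.trans (lift-shift l s) (S̄.trans e (S̄.sym (lift-shift k t)))) n)

    lift-zero : lift (λ _ → 0) ≡ₚ 0ₛ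
    lift-zero = S̄.refl

    ≈zero⇒ : ∀ a → _≈ᴸ_ p a (zeroᴸ p) → Zero (lift (proj₂ a))
    ≈zero⇒ a e = x^-cancel 0 (S̄.trans (≈ᴸ⇒ a (zeroᴸ p) e) (S̄.trans (S̄.zeroʳ (x^ (proj₁ a))) (S̄.sym (S̄.zeroʳ (x^ 0)))))

    ⇒≈zero : ∀ a → Zero (lift (proj₂ a)) → _≈ᴸ_ p a (zeroᴸ p)
    ⇒≈zero a z = ⇒≈ᴸ a (zeroᴸ p) (S̄.trans (S̄.*-congˡ z) (S̄.trans (S̄.zeroʳ (x^ 0)) (S̄.sym (S̄.zeroʳ (x^ (proj₁ a))))))

    -- The Laurent series x^(-k) s equals u, respectively u / v.
    Val : Laurent p → S → Set
    Val (k , s) u = lift s ≡ₚ x^ k ⊛ u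

    Frac : Laurent p → S → S → Set
    Frac (k , s) u v = lift s ⊛ v ≡ₚ x^ k ⊛ u

    lift-cons : ∀ c a t → lift (proj₂ (_+ᴸ_ p c (_*ᴸ_ p a t))) ≡ₚ ((x^ (proj₁ a) ⊛ x^ (proj₁ t)) ⊛ lift (proj₂ c)) ⊕ (x^ (proj₁ c) ⊛ (lift (proj₂ a) ⊛ lift (proj₂ t)))
    lift-cons (k , s) (l , r) (m , t) = S̄.trans (lift-+ (Defs.shift p (l ℕ.+ m) s) (Defs.shift p k (_*ₛ_ p r t)))
      (S̄.+-cong (S̄.trans (lift-shift (l ℕ.+ m) s) (S̄.*-congʳ (x^-+ l m))) (S̄.trans (lift-shift k (_*ₛ_ p r t)) (S̄.*-congˡ (lift-* r t))))

    x^-cons : ∀ k l m → x^ (k ℕ.+ (l ℕ.+ m)) ≡ₚ x^ k ⊛ (x^ l ⊛ x^ m)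
    x^-cons k l m = S̄.trans (x^-+ k (l ℕ.+ m)) (S̄.*-congˡ (x^-+ l m))

    Val-cons : ∀ c a t {w u h} → Val c w → Val a u → Val t h → Val (_+ᴸ_ p c (_*ᴸ_ p a t)) (w ⊕ (u ⊛ h))
    Val-cons c@(k , s) a@(l , r) t@(m , q) {w} {u} {h} e f g = S̄.trans (lift-cons c a t) (S̄.trans
      (value-step {x^ k} {x^ l} {x^ m} {lift s} {lift r} {lift q} {w} {u} {h} e f g) (S̄.*-congʳ (S̄.sym (x^-cons k l m))))

    Frac-cons : ∀ c a t {w u h V v q} → Frac c w V → Frac a u v → Frac t h (V ⊛ q) → Frac (_+ᴸ_ p c (_*ᴸ_ p a t)) (((v ⊛ q) ⊛ w) ⊕ (u ⊛ h)) (V ⊛ (v ⊛ q))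
    Frac-cons c@(k , s) a@(l , r) t@(m , z) {w} {u} {h} {V} {v} {q} e f g = S̄.trans (S̄.*-congʳ (lift-cons c a t)) (S̄.trans
      (clear-step {x^ k} {x^ l} {x^ m} {lift s} {lift r} {lift z} {w} {u} {h} {V} {v} {q} e f g) (S̄.*-congʳ (S̄.sym (x^-cons k l m))))

    value : ∀ m → Poly p m → Vec S m → S
    value zero    cs       []       = lift (coeffs p cs)
    value (suc m) []       (F ∷ Fs) = 0ₛ
    value (suc m) (c ∷ cs) (F ∷ Fs) = value m c Fs ⊕ (F ⊛ value (suc m) cs (F ∷ Fs))

    Vals : ∀ {m} → Vec (Laurent p) m → Vec S m → Set
    Vals []       []       = ⊤
    Vals (a ∷ as) (F ∷ Fs) = Val a F × Vals as Fs

    eval-value : ∀ m P as Fs → Vals as Fs → Val (eval p m P as) (value m P Fs)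
    eval-value zero    cs       []       []       _        = S̄.sym (S̄.*-identityˡ (lift (coeffs p cs)))
    eval-value (suc m) []       (a ∷ as) (F ∷ Fs) _        = S̄.sym (S̄.zeroʳ (x^ 0))
    eval-value (suc m) (c ∷ cs) (a ∷ as) (F ∷ Fs) (v , vs) = Val-cons (eval p m c as) a (eval p (suc m) cs (a ∷ as)) (eval-value m c as Fs vs) v (eval-value (suc m) cs (a ∷ as) (F ∷ Fs) (v , vs))

    coeffs-∷ : ∀ c cs → lift (coeffs p (c ∷ cs)) ≡ₚ const (fromℕ c) ⊕ (X ⊛ lift (coeffs p cs))
    coeffs-∷ c cs = S̄.trans (pwₚ at′) (S̄.+-congˡ (S̄.sym (S̄.trans (S̄.*-congʳ (S̄.sym (S̄.*-identityʳ X))) (SM.X^* 1 (lift (coeffs p cs))))))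
      where
      at′ : ∀ n → fromℕ (coeffs p (c ∷ cs) n) ∼ const (fromℕ c) n + shift 1 (lift (coeffs p cs)) n
      at′ zero    = ≈⇒∼ (sym (+-identityʳ (fromℕ c)))
      at′ (suc n) = ≈⇒∼ (sym (+-identityˡ (fromℕ (coeffs p cs n))))

    -- Formally f = exp(β Σ x^(p^j)/p^j), the power of `Ẽ` with p-adic exponent β, described without
    -- denominators.
    record Exp (β : Carrier) (f : S) : Set where
      field
        ode     : θ f ≋ conv (conv (const β) Y) f
        initial : f 0 ≈ 1#

    open Exp public

    const-+ : ∀ b c → const (b + c) ≋ (λ i → const b i + const c i)
    const-+ b c = pw λ { zero → refl ; (suc n) → sym (+-identityˡ 0#) }

    Exp-* : ∀ {b c f g} → Exp b f → Exp c g → Exp (b + c) (conv f g)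
    Exp-* {b} {c} {f} {g} e h = record
      { ode = Ŝ.trans (EvaluationAlgebra.log-derivative-* series {θ (conv f g)} {const b} {const c} {Y} {f} {g} {θ f} {θ g} (pw (E.θ-* f g)) (ode e) (ode h)) (Ŝ.*-congʳ (Ŝ.*-congʳ (Ŝ.sym (const-+ b c))))
      ; initial = trans (*-cong (initial e) (initial h)) (*-identityˡ 1#) }

    Exp-1 : Exp 0# 1ₛ
    Exp-1 = record { ode = pw (λ n → trans (left n) (sym (E.conv-zero n (λ a b _ → trans (*-congʳ (E.conv-zero a (λ { zero d _ → zeroˡ _ ; (suc c) d _ → zeroˡ _ }))) (zeroˡ _))))) ; initial = refl }
      where
      left : ∀ n → θ 1ₛ n ≈ 0#
      left zero    = zeroˡ _
      left (suc n) = zeroʳ _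

    Exp-resp : ∀ {b c f} → b ≈ c → Exp b f → Exp c f
    Exp-resp {b} {c} e h = record { ode = Ŝ.trans (ode h) (Ŝ.*-congʳ (Ŝ.*-congʳ (pw λ { zero → e ; (suc n) → refl }))) ; initial = initial h }

    Exp-^ : ∀ {b f} → Exp b f → ∀ k → Exp (fromℕ k * b) (f KS.^ k)
    Exp-^ {b} h zero    = Exp-resp (sym (zeroˡ b)) Exp-1
    Exp-^ {b} h (suc k) = Exp-resp (trans (+-congʳ (sym (*-identityˡ b))) (sym (distribʳ b 1# (fromℕ k)))) (Exp-* h (Exp-^ h k))

    Exp-unique : ∀ {b c f g} → b ≈ c → Exp b f → Exp c g → f ≋ g
    Exp-unique {b} {c} e h k = ode-unique {conv (const c) Y} (trans (*-congˡ Y0) (zeroʳ c)) (ode (Exp-resp e h)) (ode k) (trans (initial h) (sym (initial k)))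

    teich-^p^ : ∀ c j → teich c ^ (p ℕ.^ j) ≈ teich c
    teich-^p^ c zero    = *-identityʳ _
    teich-^p^ c (suc j) = trans (^-* (teich c) p (p ℕ.^ j)) (trans (^-cong (p ℕ.^ j) (teich-^p c)) (teich-^p^ c j))

    -- The reason for Teichmüller lifts: [c]^(p^j) = [c], so the substitution of [c]x multiplies all
    -- terms of Y by the same factor.
    scale-Y : ∀ c → scale (teich c) Y ≋ conv (const (teich c)) Y
    scale-Y c = pw (λ n → trans (cases n (power? n)) (sym (E.conv-const (teich c) Y n)))
      where
      cases : ∀ n → Dec (∃ λ j → j < suc n × p ℕ.^ j ≡ n) → teich c ^ n * Y n ≈ teich c * Y n
      cases n (yes (j , _ , ≡.refl)) = *-congʳ (teich-^p^ c j)
      cases n (no none) = trans (*-congˡ z) (trans (zeroʳ _) (sym (trans (*-congˡ z) (zeroʳ _))))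
        where
        z : Y n ≈ 0#
        z = Y-nonpower n (λ j e → none (j , ℕ.m<n⇒m<1+n (≡.subst (j <_) e (j<p^j j)) , e))

    Ec : ℕ → S
    Ec c = scale (teich c) Ẽ

    Exp-Ec : ∀ c → Exp (teich c) (Ec c)
    Exp-Ec c = record
      { ode = Ŝ.trans (pw (λ n → trans (sym (E.scale-θ (teich c) Ẽ n)) (trans (E.scale-cong (teich c) (at θẼ) n) (E.scale-* (teich c) Y Ẽ n)))) (Ŝ.*-congʳ (scale-Y c))
      ; initial = *-identityˡ 1# }

    module AHR = Represent ring O-torsion-free O-nontrivial

    represents : ∀ n → AHR.Represents (artinHasse p n) (Ẽ n)
    represents = AHR.ArtinHasse.represents-artinHasse p p>1 Y Ẽ power? j<p^j Y-power Y-nonpower Ẽ0 (λ n → trans (at θẼ n) (at (Ŝ.*-comm Y Ẽ) n))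

    fromℤ∼0⇒∣ : ∀ z → fromℤ z ∼ 0# → p ℕ.∣ ℤ.∣ z ∣
    fromℤ∼0⇒∣ (+ m)    e = fromℕ∼⇒mod 0 m z≤n e
    fromℤ∼0⇒∣ -[1+ m ] e = fromℕ∼⇒mod 0 (suc m) z≤n (R.trans (≈⇒∼ (sym (-‿involutive (fromℕ (suc m))))) (R.trans (R.-‿cong e) (≈⇒∼ -0#≈0#)))
      where
      open import Algebra.Properties.Ring (CommutativeRing.ring ring) using (-‿involutive; -0#≈0#)

    fromℤ-%ℕ : ∀ z → fromℤ z ∼ fromℕ (z ℤ.%ℕ p)
    fromℤ-%ℕ z = fromℤ (z ℤ./ℕ p) Q., trans (reflexive (≡.cong fromℤ (ℤ.a≡a%ℕn+[a/ℕn]*n z p))) (trans (fromℤ-+ (+ (z ℤ.%ℕ p)) ((z ℤ./ℕ p) ℤ.* + p)) (+-congˡ (trans (fromℤ-* (z ℤ./ℕ p) (+ p)) (*-comm _ _))))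

    power-p : ∀ d → d * (d * d ^ (p ℕ.∸ 2)) ∼ d
    power-p d = R.trans (≈⇒∼ (reflexive (≡.cong (λ k → d ^ k) (ℕ.m+[n∸m]≡n p>1)))) (residue-fermat d)

    fermat-unit : ∀ d e → ¬ d ∼ 0# → d * (d * e) ∼ d → d * e ∼ 1#
    fermat-unit d e nz h = cases (∼-domain {d} {d * e - 1#} (EvaluationAlgebra.factor-step residue {d} {e} h))
      where
      cases : d ∼ 0# ⊎ (d * e - 1#) ∼ 0# → d * e ∼ 1#
      cases (inj₁ z) = ⊥-elim (nz z)
      cases (inj₂ z) = Kit.x-y≈0⇒x≈y residue {d * e} {1#} z

    -- The numerator is d times the image in O, and d^(p-2) inverts d modulo p.
    redQ-represents : ∀ q {o} → AHR.Represents q o → fromℕ (redQ p q) ∼ o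
    redQ-represents q@(mkℚ N d-1 coprime) {o} e = R.trans (R.sym (fromℕ-% ((N ℤ.%ℕ p) ℕ.* d ℕ.^ (p ℕ.∸ 2)))) (R.trans (≈⇒∼ (trans (fromℕ-* (N ℤ.%ℕ p) (d ℕ.^ (p ℕ.∸ 2))) (*-congˡ (fromℕ-^ d (p ℕ.∸ 2)))))
      (R.trans (R.*-congʳ (R.sym (fromℤ-%ℕ N))) (EvaluationAlgebra.residue-step residue {fromℤ N} {fromℕ d} {o} {fromℕ d ^ (p ℕ.∸ 2)} (≈⇒∼ e) (fermat-unit (fromℕ d) (fromℕ d ^ (p ℕ.∸ 2)) d≁0 (power-p (fromℕ d))))))
      where
      d = suc d-1
      -- If p divided d, it would divide the numerator, equal to d o in O, against lowest terms.
      d≁0 : ¬ fromℕ d ∼ 0#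
      d≁0 z = ℕ.<⇒≢ p>1 (≡.sym (Coprime.recompute coprime (fromℤ∼0⇒∣ N (R.trans (≈⇒∼ e) (R.trans (R.*-congʳ z) (R.zeroˡ o))) , fromℕ∼⇒mod 0 d z≤n z)))

    lift-EpBar : ∀ c → lift (EpBar p c) ≡ₚ Ec c
    lift-EpBar c = pwₚ (λ n → R.trans (≈⇒∼ (trans (fromℕ-* (redQ p (artinHasse p n)) (c ℕ.^ n)) (*-congˡ (fromℕ-^ c n)))) (R.trans (R.*-cong (redQ-represents (artinHasse p n) (represents n)) (Kit.^-cong residue n (R.sym (teich∼ c)))) (R.*-comm (Ẽ n) (teich c ^ n))))

    Val-EpBar : ∀ c → Val (0 , EpBar p c) (Ec c)
    Val-EpBar c = S̄.trans (lift-EpBar c) (S̄.sym (S̄.*-identityˡ (Ec c)))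

    Egens : Vec S (p ℕ.∸ 1)
    Egens = Vec.tabulate (λ i → Ec (suc (Fin.toℕ i)))


    Vals-tabulate : ∀ {m} (f : Fin.Fin m → ℕ) → Vals (Vec.tabulate (λ i → 0 , EpBar p (f i))) (Vec.tabulate (λ i → Ec (f i)))
    Vals-tabulate {zero}  f = tt
    Vals-tabulate {suc m} f = Val-EpBar (f Fin.zero) , Vals-tabulate (λ i → f (Fin.suc i))

    Vals-gens : Vals (gens p) Egens
    Vals-gens = Vals-tabulate (λ i → suc (Fin.toℕ i))

-- Lower bound: φ(p-1) algebraically independent generators.

module Independent where

  open import Defs using (Laurent; Poly; coeffs; eval; _+ᴸ_; _*ᴸ_; zeroᴸ; _≈ᴸ_; EpBar; IsZeroPoly; AlgIndep; InL; gens; totient)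
  open RingKit
  open PowerSeries
  open PadicRing
  open PadicSeries using (module Padics; module FinSum)
  open Cyclotomic
  open Teichmuller
  open Evaluate
  open import Algebra.Bundles using (CommutativeRing)
  open import Level using (0ℓ)
  open import Data.Empty using (⊥; ⊥-elim)
  import Data.Fin as Fin
  import Data.Fin.Properties as Fin
  open import Data.Integer as ℤ using (ℤ; +_; -[1+_])
  import Data.Integer.Properties as ℤ
  open import Data.List as List using (List; []; _∷_)
  open import Data.List.Relation.Unary.All as All using (All; []; _∷_)
  import Data.List.Relation.Unary.All.Properties as All
  open import Data.List.Relation.Unary.AllPairs as AllPairs using (AllPairs; []; _∷_)
  import Data.List.Relation.Unary.AllPairs.Properties as AllPairs
  open import Data.Nat as ℕ using (ℕ; zero; suc; NonZero; s≤s; z≤n; _≤_; _<_; _%_; _/_)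
  import Data.Nat.Properties as ℕ
  import Data.Nat.DivMod as ℕ
  import Data.Nat.Divisibility as ℕ
  open import Data.Nat.Primality using (Prime)
  open import Data.Product using (Σ; _×_; _,_; proj₁; proj₂; ∃)
  open import Data.Sum as Sum using (_⊎_; inj₁; inj₂)
  open import Data.Unit using (⊤; tt)
  open import Data.Vec as Vec using (Vec; []; _∷_)
  import Data.Vec.Properties as Vec
  import Data.Vec.Relation.Unary.All as VAll
  open VAll using ([]; _∷_)
  open import Relation.Binary.PropositionalEquality as ≡ using (_≡_)
  open import Relation.Nullary using (Dec; yes; no; ¬_)
  open import Relation.Nullary.Decidable using (decidable-stable)

  module LowerBound (p : ℕ) .{{nz : NonZero p}} (pr : Prime p) (𝕂 : PadicIntegers p) where

    open Evaluation p pr 𝕂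
    open Padics p pr 𝕂
    open Units p pr 𝕂 using (n; suc-n; g; ζ; teich-^; ∣∸⇒teich; teich∼; fromℕ∼⇒mod; O-torsion-free; O-nontrivial; ζ-primitive)
    open CommutativeRing M.series using () renaming (_+_ to _⊕_; _*_ to _⊛_)
    open Conjugates Ẽ Ẽ0 θẼ using (independence; Tate)
    open RootOfUnity ring O-torsion-free O-nontrivial ζ n ζ-primitive using (ev; linear; ev-linear; IsZero; ζ-independent; ^-multiple)

    -- A coefficient nonzero modulo p together with its order at x = 0, the data that `independence`
    -- asks for.
    Leading : List ℕ → Set
    Leading cs = Σ ℕ λ o → ¬ coeffs p cs o % p ≡ 0 × (∀ j → j < o → coeffs p cs j % p ≡ 0)

    zero-or-leading : ∀ cs → IsZeroPoly p 0 cs ⊎ Leading cs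
    zero-or-leading []       = inj₁ []
    zero-or-leading (c ∷ cs) = cases (c % p ℕ.≟ 0) (zero-or-leading cs)
      where
      cases : Dec (c % p ≡ 0) → IsZeroPoly p 0 cs ⊎ Leading cs → IsZeroPoly p 0 (c ∷ cs) ⊎ Leading (c ∷ cs)
      cases (no ne) _                     = inj₂ (0 , ne , λ _ ())
      cases (yes e) (inj₁ z)              = inj₁ (e ∷ z)
      cases (yes e) (inj₂ (o , ne , low)) = inj₂ (suc o , ne , λ { zero _ → e ; (suc j) (s≤s j<o) → low j j<o })

    -- An exponent vector with a coefficient in F_p[x]. Only nonzero coefficients will be listed, so
    -- that a polynomial without terms is zero.
    Term : ℕ → Set
    Term m = Vec ℕ m × List ℕ

    leaf : ∀ cs → IsZeroPoly p 0 cs ⊎ Leading cs → List (Term 0)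
    leaf cs (inj₁ _) = []
    leaf cs (inj₂ _) = ([] , cs) ∷ []

    prepend : ∀ {m} → ℕ → Term m → Term (suc m)
    prepend e (k , cs) = e ∷ k , cs

    mutual
      terms : ∀ m → Poly p m → List (Term m)
      terms zero    cs = leaf cs (zero-or-leading cs)
      terms (suc m) P  = terms-from m 0 P

      terms-from : ∀ m → ℕ → List (Poly p m) → List (Term (suc m))
      terms-from m e []       = []
      terms-from m e (c ∷ cs) = List.map (prepend e) (terms m c) List.++ terms-from m (suc e) cs

    monomial-of : ∀ {m} → Vec ℕ m → Vec S m → S
    monomial-of []      []       = 1ₛ
    monomial-of (e ∷ k) (F ∷ Fs) = (F KS.^ e) ⊛ monomial-of k Fs

    term-value : ∀ {m} → Vec S m → Term m → S
    term-value Fs (k , cs) = lift (coeffs p cs) ⊛ monomial-of k Fs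

    total : ∀ {m} → Vec S m → List (Term m) → S
    total Fs []       = 0ₛ
    total Fs (t ∷ ts) = term-value Fs t ⊕ total Fs ts

    total-++ : ∀ {m} (Fs : Vec S m) ts us → total Fs (ts List.++ us) ≡ₚ total Fs ts ⊕ total Fs us
    total-++ Fs []       us = S̄.sym (S̄.+-identityˡ (total Fs us))
    total-++ Fs (t ∷ ts) us = S̄.trans (S̄.+-congˡ {term-value Fs t} (total-++ Fs ts us)) (S̄.sym (S̄.+-assoc (term-value Fs t) (total Fs ts) (total Fs us)))

    total-prepend : ∀ {m} e F (Fs : Vec S m) ts → total (F ∷ Fs) (List.map (prepend e) ts) ≡ₚ (F KS.^ e) ⊛ total Fs ts
    total-prepend e F Fs []             = S̄.sym (S̄.zeroʳ (F KS.^ e))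
    total-prepend e F Fs ((k , cs) ∷ ts) = S̄.trans (S̄.+-cong (swap (lift (coeffs p cs)) (F KS.^ e) (monomial-of k Fs)) (total-prepend e F Fs ts)) (S̄.sym (S̄.distribˡ (F KS.^ e) (term-value Fs (k , cs)) (total Fs ts)))
      where
      swap : ∀ a b c → a ⊛ (b ⊛ c) ≡ₚ b ⊛ (a ⊛ c)
      swap a b c = S̄.trans (S̄.sym (S̄.*-assoc a b c)) (S̄.trans (S̄.*-congʳ (S̄.*-comm a b)) (S̄.*-assoc b a c))

    total-leaf : ∀ cs d → lift (coeffs p cs) ≡ₚ total [] (leaf cs d)
    total-leaf cs (inj₁ z) = pwₚ (λ i → %⇒∼ {coeffs p cs i} {0} (≡.trans (vanish cs z i) (≡.sym (ℕ.m<n⇒m%n≡m (ℕ.<⇒≤ p>1)))))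
      where
      vanish : ∀ cs → All (λ c → c % p ≡ 0) cs → ∀ i → coeffs p cs i % p ≡ 0
      vanish []       []       i       = ℕ.m<n⇒m%n≡m (ℕ.<⇒≤ p>1)
      vanish (c ∷ cs) (z ∷ zs) zero    = z
      vanish (c ∷ cs) (z ∷ zs) (suc i) = vanish cs zs i
    total-leaf cs (inj₂ _) = S̄.sym (S̄.trans (S̄.+-identityʳ (lift (coeffs p cs) ⊛ 1ₛ)) (S̄.*-identityʳ (lift (coeffs p cs))))

    mutual
      value-total : ∀ m P Fs → value m P Fs ≡ₚ total Fs (terms m P)
      value-total zero    cs []       = total-leaf cs (zero-or-leading cs)
      value-total (suc m) P  (F ∷ Fs) = S̄.trans (S̄.sym (S̄.*-identityˡ (value (suc m) P (F ∷ Fs)))) (value-total-from m 0 P F Fs)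

      value-total-from : ∀ m e P F Fs → (F KS.^ e) ⊛ value (suc m) P (F ∷ Fs) ≡ₚ total (F ∷ Fs) (terms-from m e P)
      value-total-from m e []       F Fs = S̄.zeroʳ (F KS.^ e)
      value-total-from m e (c ∷ cs) F Fs = S̄.trans (S̄.distribˡ (F KS.^ e) (value m c Fs) (F ⊛ value (suc m) cs (F ∷ Fs))) (S̄.trans
        (S̄.+-cong (S̄.trans (S̄.*-congˡ (value-total m c Fs)) (S̄.sym (total-prepend e F Fs (terms m c))))
          (S̄.trans (S̄.sym (S̄.*-assoc (F KS.^ e) F (value (suc m) cs (F ∷ Fs)))) (S̄.trans (S̄.*-congʳ (S̄.*-comm (F KS.^ e) F)) (value-total-from m (suc e) cs F Fs))))
        (S̄.sym (total-++ (F ∷ Fs) (List.map (prepend e) (terms m c)) (terms-from m (suc e) cs))))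

    Distinct : ∀ {m} → Term m → Term m → Set
    Distinct s t = ¬ proj₁ s ≡ proj₁ t

    Above : ∀ {m} → ℕ → Term (suc m) → Set
    Above e t = e ≤ Vec.head (proj₁ t)

    terms-above : ∀ m e P → All (Above e) (terms-from m e P)
    terms-above m e []       = []
    terms-above m e (c ∷ cs) = All.++⁺ (All.map⁺ (All.universal (λ _ → ℕ.≤-refl) (terms m c))) (All.map (λ e<h → ℕ.<⇒≤ e<h) (terms-above m (suc e) cs))

    mutual
      terms-distinct : ∀ m P → AllPairs Distinct (terms m P)
      terms-distinct zero    cs = leaf-distinct (zero-or-leading cs)
        where
        leaf-distinct : ∀ d → AllPairs Distinct (leaf cs d)
        leaf-distinct (inj₁ _) = []
        leaf-distinct (inj₂ _) = [] ∷ []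
      terms-distinct (suc m) P  = terms-from-distinct m 0 P

      terms-from-distinct : ∀ m e P → AllPairs Distinct (terms-from m e P)
      terms-from-distinct m e []       = []
      terms-from-distinct m e (c ∷ cs) = AllPairs.++⁺ (AllPairs.map⁺ (AllPairs.map (λ ne eq → ne (Vec.∷-injectiveʳ eq)) (terms-distinct m c))) (terms-from-distinct m (suc e) cs)
        (All.map⁺ (All.universal (λ t → All.map (λ {u} e<h eq → ℕ.<⇒≢ e<h (≡.cong Vec.head eq)) (terms-above m (suc e) cs)) (terms m c)))

    mutual
      terms-leading : ∀ m P → All (λ t → Leading (proj₂ t)) (terms m P)
      terms-leading zero    cs = leaf-leading (zero-or-leading cs)
        where
        leaf-leading : ∀ d → All (λ t → Leading (proj₂ t)) (leaf cs d)
        leaf-leading (inj₁ _) = []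
        leaf-leading (inj₂ l) = l ∷ []
      terms-leading (suc m) P  = terms-from-leading m 0 P

      terms-from-leading : ∀ m e P → All (λ t → Leading (proj₂ t)) (terms-from m e P)
      terms-from-leading m e []       = []
      terms-from-leading m e (c ∷ cs) = All.++⁺ (All.map⁺ (terms-leading m c)) (terms-from-leading m (suc e) cs)

    mutual
      no-terms : ∀ m P → terms m P ≡ [] → IsZeroPoly p m P
      no-terms zero    cs e = none (zero-or-leading cs) e
        where
        none : ∀ d → leaf cs d ≡ [] → IsZeroPoly p 0 cs
        none (inj₁ z) _ = z
        none (inj₂ _) ()
      no-terms (suc m) P  e = no-terms-from m 0 P e

      no-terms-from : ∀ m e P → terms-from m e P ≡ [] → IsZeroPoly p (suc m) P
      no-terms-from m e []       _  = []
      no-terms-from m e (c ∷ cs) eq = no-terms m c (empty-map (terms m c) eq) ∷ no-terms-from m (suc e) cs (empty-rest (terms m c) eq)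
        where
        empty-map : ∀ ts {us} → List.map (prepend e) ts List.++ us ≡ [] → ts ≡ []
        empty-map [] _ = ≡.refl
        empty-map (_ ∷ _) ()
        empty-rest : ∀ ts {us} → List.map (prepend e) ts List.++ us ≡ [] → us ≡ []
        empty-rest [] eq = eq
        empty-rest (_ ∷ _) ()

    -- A residue representing g^s, so that its Teichmüller lift is ζ^s. It lies between 1 and p - 1,
    -- hence belongs to one of the given generators.
    base : ℕ → ℕ
    base s = (g ℕ.^ s) % p

    teich-base : ∀ s → teich (base s) ≈ ζ ^ s
    teich-base s = trans (sym (∣∸⇒teich (base s) (g ℕ.^ s) (ℕ.m%n≤m (g ℕ.^ s) p) (ℕ.divides (g ℕ.^ s / p)
      (≡.trans (≡.cong (ℕ._∸ base s) (ℕ.m≡m%n+[m/n]*n (g ℕ.^ s) p)) (ℕ.m+n∸m≡n (base s) (g ℕ.^ s / p ℕ.* p)))))) (sym (teich-^ g s))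

    bases : ∀ s m → Vec S m
    bases s zero    = []
    bases s (suc m) = Ec (base s) ∷ bases (suc s) m

    exponent : ∀ {m} → ℕ → Vec ℕ m → Carrier
    exponent s []      = 0#
    exponent s (e ∷ k) = fromℕ e * teich (base s) + exponent (suc s) k

    Exp-monomial : ∀ {m} s (k : Vec ℕ m) → Exp (exponent s k) (monomial-of k (bases s m))
    Exp-monomial s []      = Exp-1
    Exp-monomial s (e ∷ k) = Exp-* (Exp-^ (Exp-Ec (base s)) e) (Exp-monomial (suc s) k)

    exponent-ev : ∀ {m} s (k : Vec ℕ m) → exponent s k ≈ ζ ^ s * ev (Vec.map +_ k) ζ
    exponent-ev s []      = sym (zeroʳ (ζ ^ s))
    exponent-ev s (e ∷ k) = trans (+-cong (*-congˡ (teich-base s)) (exponent-ev (suc s) k))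
      (solve 4 (λ e z w v → e :* z :+ (w :* z) :* v := z :* (e :+ w :* v)) refl (fromℕ e) (ζ ^ s) ζ (ev (Vec.map +_ k) ζ))
      where open Solver

    -- The exponent β of a monomial is the value at ζ of its exponent vector, and the first φ(p-1)
    -- powers of ζ are independent over ℤ.
    exponent-injective : (k l : Vec ℕ (totient n)) → exponent 0 k ≈ exponent 0 l → k ≡ l
    exponent-injective k l e = equal k l (ζ-independent (linear (+ 1) (Vec.map +_ k) -[1+ 0 ] (Vec.map +_ l))
      (trans (ev-linear (+ 1) (Vec.map +_ k) -[1+ 0 ] (Vec.map +_ l) ζ) (trans (+-congʳ (*-congˡ k≈l)) (solve 1 (λ x → (con (+ 1) :+ con (+ 0)) :* x :+ con -[1+ 0 ] :* x := con (+ 0)) refl (ev (Vec.map +_ l) ζ)))))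
      where
      open Solver
      k≈l : ev (Vec.map +_ k) ζ ≈ ev (Vec.map +_ l) ζ
      k≈l = trans (sym (*-identityˡ _)) (trans (sym (exponent-ev 0 k)) (trans e (trans (exponent-ev 0 l) (*-identityˡ _))))
      difference : ∀ x y → + 1 ℤ.* + x ℤ.+ -[1+ 0 ] ℤ.* + y ≡ + 0 → x ≡ y
      difference x y z = ℤ.+-injective (ℤ.i-j≡0⇒i≡j (+ x) (+ y) (≡.trans (≡.cong₂ ℤ._+_ (≡.sym (ℤ.*-identityˡ (+ x))) (≡.sym (ℤ.-1*i≡-i (+ y)))) z))
      equal : ∀ {m} (k l : Vec ℕ m) → IsZero (linear (+ 1) (Vec.map +_ k) -[1+ 0 ] (Vec.map +_ l)) → k ≡ l
      equal []      []      []       = ≡.refl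
      equal (x ∷ k) (y ∷ l) (z ∷ zs) = ≡.cong₂ _∷_ (difference x y z) (equal k l zs)

    all-lookup : ∀ {A : Set} {P : A → Set} {xs} → All P xs → ∀ i → P (List.lookup xs i)
    all-lookup (a ∷ as) Fin.zero    = a
    all-lookup (a ∷ as) (Fin.suc i) = all-lookup as i

    lookup-distinct : ∀ {A : Set} {R : A → A → Set} {xs} → (∀ {x y} → R x y → R y x) → AllPairs R xs → ∀ i j → ¬ i ≡ j → R (List.lookup xs i) (List.lookup xs j)
    lookup-distinct sy (a ∷ as) Fin.zero    Fin.zero    ne = ⊥-elim (ne ≡.refl)
    lookup-distinct sy (a ∷ as) Fin.zero    (Fin.suc j) ne = all-lookup a j
    lookup-distinct sy (a ∷ as) (Fin.suc i) Fin.zero    ne = sy (all-lookup a i)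
    lookup-distinct sy (a ∷ as) (Fin.suc i) (Fin.suc j) ne = lookup-distinct sy as i j (λ e → ne (≡.cong Fin.suc e))

    total-∑ : ∀ {m} (Fs : Vec S m) ts → total Fs ts ≡ₚ FinSum.∑ M.series (List.length ts) (λ i → term-value Fs (List.lookup ts i))
    total-∑ Fs []       = S̄.refl
    total-∑ Fs (t ∷ ts) = SumAlgebra.∑-cons M.series (List.length ts) (λ i → term-value Fs (List.lookup (t ∷ ts) i)) (term-value Fs t) (total Fs ts) S̄.refl (total-∑ Fs ts)

    coeffs-Tate : ∀ cs → Tate (lift (coeffs p cs))
    coeffs-Tate cs B = List.length cs , λ m h → record { witness = 0# ; eq = trans (reflexive (≡.cong fromℕ (beyond cs m h))) (sym (zeroʳ (fromℕ (p ℕ.^ B)))) }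
      where
      beyond : ∀ cs m → List.length cs ≤ m → coeffs p cs m ≡ 0
      beyond []       m       h       = ≡.refl
      beyond (c ∷ cs) (suc m) (s≤s h) = beyond cs m h

    ∼0⇒% : ∀ m → fromℕ m ∼ 0# → m % p ≡ 0
    ∼0⇒% m e = ≡.trans (∼⇒% {m} {0} e) (ℕ.m<n⇒m%n≡m (ℕ.<⇒≤ p>1))

    total-nonzero : (ts : List (Term (totient n))) → AllPairs Distinct ts → All (λ t → Leading (proj₂ t)) ts → ¬ ts ≡ [] → ¬ Zero (total (bases 0 (totient n)) ts)
    total-nonzero []           _ _ ne _ = ne ≡.refl
    total-nonzero ts@(t₀ ∷ _) ds ls _ z = independence (List.length ts) (λ i → lift (coeffs p (proj₂ (List.lookup ts i)))) (λ i → monomial-of (proj₁ (List.lookup ts i)) (bases 0 (totient n)))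
      (λ i → exponent 0 (proj₁ (List.lookup ts i))) (λ i → proj₁ (all-lookup ls i))
      (λ i → coeffs-Tate (proj₂ (List.lookup ts i)))
      (λ i e → proj₁ (proj₂ (all-lookup ls i)) (∼0⇒% (coeffs p (proj₂ (List.lookup ts i)) (proj₁ (all-lookup ls i))) e))
      (λ i j j<o → %⇒∼ {coeffs p (proj₂ (List.lookup ts i)) j} {0} (≡.trans (proj₂ (proj₂ (all-lookup ls i)) j j<o) (≡.sym (ℕ.m<n⇒m%n≡m (ℕ.<⇒≤ p>1)))))
      (λ i → initial (Exp-monomial 0 (proj₁ (List.lookup ts i))))
      (λ i → ode (Exp-monomial 0 (proj₁ (List.lookup ts i))))
      (λ i j ne e → lookup-distinct (λ d e → d (≡.sym e)) ds i j ne (exponent-injective (proj₁ (List.lookup ts i)) (proj₁ (List.lookup ts j)) e))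
      Fin.zero (S̄.trans (S̄.sym (total-∑ (bases 0 (totient n)) ts)) z)

    elements : ∀ s m → Vec (Laurent p) m
    elements s zero    = []
    elements s (suc m) = (0 , EpBar p (base s)) ∷ elements (suc s) m

    Vals-elements : ∀ s m → Vals (elements s m) (bases s m)
    Vals-elements s zero    = tt
    Vals-elements s (suc m) = Val-EpBar (base s) , Vals-elements (suc s) m

    algebraically-independent : AlgIndep p (totient n) (elements 0 (totient n))
    algebraically-independent P nonzero e = total-nonzero (terms (totient n) P) (terms-distinct (totient n) P) (terms-leading (totient n) P) (λ none → nonzero (no-terms (totient n) P none))
      (S̄.trans (S̄.sym (value-total (totient n) P (bases 0 (totient n)))) (x^-cancel (proj₁ (eval p (totient n) P (elements 0 (totient n))))
        (S̄.trans (S̄.sym (eval-value (totient n) P (elements 0 (totient n)) (bases 0 (totient n)) (Vals-elements 0 (totient n)))) (S̄.trans (≈zero⇒ (eval p (totient n) P (elements 0 (totient n))) e) (S̄.sym (S̄.zeroʳ _))))))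

    one : ∀ m → Poly p m
    one zero    = 1 ∷ []
    one (suc m) = one m ∷ []

    nil : ∀ m → Poly p m
    nil zero    = []
    nil (suc m) = []

    variable-poly : ∀ {m} → Fin.Fin m → Poly p m
    variable-poly {suc m} Fin.zero    = nil m ∷ one m ∷ []
    variable-poly {suc m} (Fin.suc i) = variable-poly i ∷ []

    value-one : ∀ m Fs → value m (one m) Fs ≡ₚ 1ₛ
    value-one zero    []       = pwₚ λ { zero → ≈⇒∼ (+-identityʳ 1#) ; (suc i) → R.refl }
    value-one (suc m) (F ∷ Fs) = S̄.trans (S̄.+-cong (value-one m Fs) (S̄.zeroʳ F)) (S̄.+-identityʳ 1ₛ)

    value-nil : ∀ m Fs → value m (nil m) Fs ≡ₚ 0ₛ
    value-nil zero    []       = S̄.refl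
    value-nil (suc m) (F ∷ Fs) = S̄.refl

    value-variable : ∀ {m} (i : Fin.Fin m) Fs → value m (variable-poly i) Fs ≡ₚ Vec.lookup Fs i
    value-variable {suc m} Fin.zero    (F ∷ Fs) = S̄.trans (S̄.+-cong (value-nil m Fs) (S̄.trans (S̄.*-congˡ (value-one (suc m) (F ∷ Fs))) (S̄.*-identityʳ F))) (S̄.+-identityˡ F)
    value-variable {suc m} (Fin.suc i) (F ∷ Fs) = S̄.trans (S̄.+-cong (value-variable i Fs) (S̄.zeroʳ F)) (S̄.+-identityʳ (Vec.lookup Fs i))

    base≢0 : ∀ s → ¬ base s ≡ 0
    base≢0 s e = 1≁0 (R.trans (≈⇒∼ (sym (^-multiple s))) (R.trans (≈⇒∼ (^-* ζ s n)) (R.trans (Kit.^-cong residue n ζˢ∼0) (zero-power n (PrimitiveRoot.n>0 ζ-primitive)))))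
      where
      open Polynomial ring using (module PrimitiveRoot)
      ζˢ∼0 : ζ ^ s ∼ 0#
      ζˢ∼0 = R.trans (≈⇒∼ (sym (teich-base s))) (R.trans (≈⇒∼ (reflexive (≡.cong teich e))) (teich∼ 0))
      zero-power : ∀ k → 0 < k → 0# ^ k ∼ 0#
      zero-power (suc k) _ = ≈⇒∼ (zeroˡ _)

    base-index : ∀ s → Σ (Fin.Fin (p ℕ.∸ 1)) λ i → suc (Fin.toℕ i) ≡ base s
    base-index s = go (base s) (base≢0 s) (ℕ.m%n<n (g ℕ.^ s) p)
      where
      go : ∀ b → ¬ b ≡ 0 → b < p → Σ (Fin.Fin (p ℕ.∸ 1)) λ i → suc (Fin.toℕ i) ≡ b
      go zero    ne _   = ⊥-elim (ne ≡.refl)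
      go (suc b) _  b<p = Fin.fromℕ< {b} b<n , ≡.cong suc (Fin.toℕ-fromℕ< b<n)
        where
        b<n : b < p ℕ.∸ 1
        b<n = ℕ.s≤s⁻¹ (≡.subst (suc b <_) (≡.sym suc-n) b<p)

    element-in-L : ∀ s → InL p (0 , EpBar p (base s))
    element-in-L s = variable-poly i , one (p ℕ.∸ 1) , nonzero , ⇒≈ᴸ (_*ᴸ_ p (0 , EpBar p (base s)) Q) P
      (S̄.trans (S̄.*-congˡ {x^ (proj₁ P)} (S̄.trans (lift-* (EpBar p (base s)) (proj₂ Q)) (S̄.*-cong (lift-EpBar (base s)) Q-value)))
        (S̄.trans (rearrange (x^ (proj₁ P)) (Ec (base s)) (x^ (proj₁ Q))) (S̄.*-congˡ {x^ (proj₁ Q)} (S̄.sym P-value))))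
      where
      i = proj₁ (base-index s)
      P = eval p (p ℕ.∸ 1) (variable-poly i) (gens p)
      Q = eval p (p ℕ.∸ 1) (one (p ℕ.∸ 1)) (gens p)
      Q-value : lift (proj₂ Q) ≡ₚ x^ (proj₁ Q)
      Q-value = S̄.trans (eval-value (p ℕ.∸ 1) (one (p ℕ.∸ 1)) (gens p) Egens Vals-gens) (S̄.trans (S̄.*-congˡ {x^ (proj₁ Q)} (value-one (p ℕ.∸ 1) Egens)) (S̄.*-identityʳ (x^ (proj₁ Q))))
      P-value : lift (proj₂ P) ≡ₚ x^ (proj₁ P) ⊛ Ec (base s)
      P-value = S̄.trans (eval-value (p ℕ.∸ 1) (variable-poly i) (gens p) Egens Vals-gens) (S̄.*-congˡ {x^ (proj₁ P)} (S̄.trans (value-variable i Egens)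
        (S̄.reflexive (≡.trans (Vec.lookup∘tabulate (λ i → Ec (suc (Fin.toℕ i))) i) (≡.cong Ec (proj₂ (base-index s)))))))
      rearrange : ∀ a b c → a ⊛ (b ⊛ c) ≡ₚ c ⊛ (a ⊛ b)
      rearrange a b c = S̄.trans (S̄.sym (S̄.*-assoc a b c)) (S̄.*-comm (a ⊛ b) c)
      nonzero : ¬ _≈ᴸ_ p Q (zeroᴸ p)
      nonzero e = 1≁0 (atₚ (x^-cancel (proj₁ Q) {1ₛ} {0ₛ} (S̄.trans (S̄.*-identityʳ (x^ (proj₁ Q))) (S̄.trans (S̄.sym Q-value) (S̄.trans (≈zero⇒ Q e) (S̄.sym (S̄.zeroʳ (x^ (proj₁ Q)))))))) 0)

    elements-in-L : ∀ s m → VAll.All (InL p) (elements s m)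
    elements-in-L s zero    = []
    elements-in-L s (suc m) = element-in-L s ∷ elements-in-L (suc s) m

-- Upper bound: counting polynomials against their values.

module Dependent where

  open import Defs using (Laurent; Poly; coeffs; eval; _+ᴸ_; _*ᴸ_; zeroᴸ; _≈ᴸ_; EpBar; IsZeroPoly; AlgIndep; InL; gens; totient)
  open RingKit
  open PowerSeries
  open PadicRing
  open NatMod using (¬¬-decidable)
  open PadicSeries using (module Padics; module FinSum)
  open Cyclotomic
  open Teichmuller
  open Evaluate
  open import Algebra.Bundles using (CommutativeRing)
  open import Level using (0ℓ)
  open import Data.Empty using (⊥; ⊥-elim)
  open import Data.Fin as Fin using (Fin; toℕ; fromℕ<; _↑ˡ_; _↑ʳ_; splitAt; combine; remQuot; finToFun; funToFin)
  import Data.Fin.Properties as Fin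
  open import Data.Integer as ℤ using (ℤ; +_; -[1+_])
  import Data.Integer.Properties as ℤ
  open import Data.List as List using (List; []; _∷_)
  open import Data.List.Relation.Unary.All as All using (All; []; _∷_)
  import Data.List.Relation.Unary.All.Properties as All
  open import Data.List.Relation.Unary.AllPairs as AllPairs using (AllPairs; []; _∷_)
  import Data.List.Relation.Unary.AllPairs.Properties as AllPairs
  import Data.List.Relation.Unary.Any as Any
  import Data.List.Properties as List
  open import Data.Nat as ℕ using (ℕ; zero; suc; NonZero; s≤s; z≤n; _≤_; _<_; _%_; _/_)
  import Data.Nat.Properties as ℕ
  import Data.Nat.DivMod as ℕ
  import Data.Nat.Divisibility as ℕ
  import Data.Nat.Solver as ℕS
  open import Data.Nat.Primality using (Prime)
  open import Data.Product using (Σ; _×_; _,_; proj₁; proj₂; ∃)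
  open import Data.Sum as Sum using (_⊎_; inj₁; inj₂)
  open import Data.Unit using (⊤; tt)
  open import Data.Vec as Vec using (Vec; []; _∷_)
  import Data.Vec.Relation.Unary.All as VAll
  open VAll using ([]; _∷_)
  open import Relation.Binary.PropositionalEquality as ≡ using (_≡_)
  open import Relation.Nullary using (Dec; yes; no; ¬_; ¬?)
  open import Relation.Nullary.Decidable using (decidable-stable)

  module UpperBound (p : ℕ) .{{nz : NonZero p}} (pr : Prime p) (𝕂 : PadicIntegers p) where

    open Evaluation p pr 𝕂
    open Padics p pr 𝕂
    open Units p pr 𝕂 using (n; suc-n; g; ζ; teich-^; teich-injective; unit-cancel; nonzero-residue; teich-^n; fromℕ∼⇒mod; O-torsion-free; O-nontrivial; ζ-primitive)
    open CommutativeRing M.series using () renaming (_+_ to _⊕_; _*_ to _⊛_)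
    open RootOfUnity ring O-torsion-free O-nontrivial ζ n ζ-primitive
    open Polynomial ring using (Cancellable; roots)
    open FinSum M.series
    open SumAlgebra M.series
    module RΣ = FinSum residue

    -- Otherwise T^n - 1 would have [c] as a root besides the n powers of ζ, one root too many.
    power-of-ζ : ∀ c → 0 < c → c < p → ∃ λ k → teich c ≈ ζ ^ k
    power-of-ζ c 0<c c<p = cases (Any.any? (λ k → teich c ∼? (ζ ^ k)) exponents)
      where
      cases : Dec (Any.Any (λ k → teich c ∼ ζ ^ k) exponents) → ∃ λ k → teich c ≈ ζ ^ k
      cases (yes a) = let (k , e) = Any.satisfied a in k , trans (teich-injective c (g ℕ.^ k) (R.trans e (≈⇒∼ (teich-^ g k)))) (sym (teich-^ g k))
      cases (no none) = ⊥-elim (O-nontrivial (trans (sym (trans (ev-T^n-1′) refl)) one-zero))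
        where
        separate : All (λ k → Cancellable (ζ ^ k - teich c)) exponents
        separate = All.map (λ {k} ne → unit-cancel (λ z → ne (R.sym (Kit.x-y≈0⇒x≈y residue z)))) (All.¬Any⇒All¬ exponents none)
        zero-poly : IsZero T^n-1
        zero-poly = AllZero⇒IsZero T^n-1 (roots (Vec.map fromℤ T^n-1) (teich c ∷ List.map (ζ ^_) exponents) (All.map⁺ separate ∷ AllPairs.map⁺ exponents-distinct)
          (trans (ev-T^n-1 (teich c)) (x≈y⇒x-y≈0 (teich-^n c (nonzero-residue c 0<c c<p))) ∷ All.map⁺ (All.universal (λ k → trans (ev-T^n-1 (ζ ^ k)) (x≈y⇒x-y≈0 (trans (sym (^-* ζ k n)) (^-multiple k)))) exponents))
          (s≤s (ℕ.≤-reflexive (≡.sym (≡.trans (List.length-map (ζ ^_) exponents) (≡.trans (List.length-map suc (List.upTo n)) (List.length-upTo n)))))))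
        ev-T^n-1′ : 0# - (0# ^ n - 1#) ≈ 1#
        ev-T^n-1′ = trans (+-cong refl (-‿cong (+-congʳ (0^ (Polynomial.PrimitiveRoot.n>0 ζ-primitive))))) (solve 0 (con (+ 0) :- (con (+ 0) :- con (+ 1)) := con (+ 1)) refl)
          where open Solver
        one-zero : 0# - (0# ^ n - 1#) ≈ 0#
        one-zero = trans (+-congˡ (-‿cong (trans (sym (ev-T^n-1 0#)) (ev-IsZero zero-poly 0#)))) (-‿inverseʳ 0#)

    evℕ : ∀ {m} → Vec ℕ m → Carrier
    evℕ k = ev (Vec.map +_ k) ζ

    _⊞_ : ∀ {m} → Vec ℕ m → Vec ℕ m → Vec ℕ m
    _⊞_ = Vec.zipWith ℕ._+_

    evℕ-⊞ : ∀ {m} (k l : Vec ℕ m) → evℕ (k ⊞ l) ≈ evℕ k + evℕ l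
    evℕ-⊞ []      []      = sym (+-identityˡ 0#)
    evℕ-⊞ (x ∷ k) (y ∷ l) = trans (+-cong (fromℕ-+ x y) (*-congˡ (evℕ-⊞ k l))) (solve 5 (λ x y z k l → (x :+ y) :+ z :* (k :+ l) := (x :+ z :* k) :+ (y :+ z :* l)) refl (fromℕ x) (fromℕ y) ζ (evℕ k) (evℕ l))
      where open Solver

    evℕ-zeros : ∀ m → evℕ (Vec.replicate m 0) ≈ 0#
    evℕ-zeros zero    = refl
    evℕ-zeros (suc m) = trans (+-identityˡ _) (trans (*-congˡ (evℕ-zeros m)) (zeroʳ ζ))

    residue-class : Carrier → Fin p
    residue-class x = fromℕ< (ℕ.m%n<n (proj₁ (approximate x 1)) p)

    approximate∼ : ∀ x → x ∼ fromℕ (proj₁ (approximate x 1))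
    approximate∼ x = let (b , h , e) = approximate x 1 in h Q., trans e (+-congˡ (*-congʳ (reflexive (≡.cong fromℕ (ℕ.*-identityʳ p)))))

    residue-class-injective : ∀ x y → residue-class x ≡ residue-class y → x ∼ y
    residue-class-injective x y e = R.trans (approximate∼ x) (R.trans (%⇒∼ (Fin.fromℕ<-injective _ _ (ℕ.m%n<n (proj₁ (approximate x 1)) p) (ℕ.m%n<n (proj₁ (approximate y 1)) p) e)) (R.sym (approximate∼ y)))

    funToFin-cong : ∀ {a b} {f h : Fin a → Fin b} → (∀ i → f i ≡ h i) → funToFin f ≡ funToFin h
    funToFin-cong {zero}  e = ≡.refl
    funToFin-cong {suc a} e = ≡.cong₂ combine (e Fin.zero) (funToFin-cong (λ i → e (Fin.suc i)))

    Combination : ∀ a b (m : Fin a → Fin b → Carrier) → Set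
    Combination a b m = Σ (Fin a → ℕ) λ d → (∃ λ i → ¬ d i % p ≡ 0) × (∀ j → RΣ.∑ a (λ i → fromℕ (d i) * m i j) ∼ 0#)

    -- Pigeonhole as in Siegel's lemma: the p^a coefficient vectors over F_p have at most p^b rows
    -- of values, and the difference of two vectors with equal rows is a relation.
    module Siegel (a b : ℕ) (b<a : b < a) (m : Fin a → Fin b → Carrier) where

      digit : Fin (p ℕ.^ a) → Fin a → ℕ
      digit c i = toℕ (finToFun {p} {a} c i)

      row : Fin (p ℕ.^ a) → Fin b → Carrier
      row c j = RΣ.∑ a (λ i → fromℕ (digit c i) * m i j)

      table : Fin (p ℕ.^ a) → Fin (p ℕ.^ b)
      table c = funToFin (λ j → residue-class (row c j))

      row-equal : ∀ c d → table c ≡ table d → ∀ j → row c j ∼ row d j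
      row-equal c d e j = residue-class-injective (row c j) (row d j) (≡.trans (≡.sym (Fin.finToFun-funToFin (λ j → residue-class (row c j)) j))
        (≡.trans (≡.cong (λ z → finToFun {p} {b} z j) e) (Fin.finToFun-funToFin (λ j → residue-class (row d j)) j)))

      -- A difference modulo p without subtraction: p minus the digit stands for its negative.
      difference : Fin (p ℕ.^ a) → Fin (p ℕ.^ a) → Fin a → ℕ
      difference c d i = digit c i ℕ.+ (p ℕ.∸ digit d i)

      difference∼ : ∀ c d i → fromℕ (difference c d i) + fromℕ (digit d i) ∼ fromℕ (digit c i)
      difference∼ c d i = R.trans (≈⇒∼ (trans (sym (fromℕ-+ (difference c d i) (digit d i))) (trans (reflexive (≡.cong fromℕ (≡.trans (ℕ.+-assoc (digit c i) (p ℕ.∸ digit d i) (digit d i)) (≡.cong (λ z → digit c i ℕ.+ z) (ℕ.m∸n+n≡m (ℕ.<⇒≤ (Fin.toℕ<n (finToFun {p} {a} d i)))))))) (fromℕ-+ (digit c i) p))))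
        (R.trans (R.+-congˡ residue-char) (R.+-identityʳ (fromℕ (digit c i))))

      difference-zero : ∀ c d i → difference c d i % p ≡ 0 → finToFun {p} {a} c i ≡ finToFun {p} {a} d i
      difference-zero c d i e = Fin.toℕ-injective (≡.trans (≡.sym (ℕ.m<n⇒m%n≡m (Fin.toℕ<n (finToFun {p} {a} c i)))) (≡.trans (∼⇒% {digit c i} {digit d i} (R.trans (R.sym (difference∼ c d i))
        (R.trans (R.+-congʳ (R.trans (fromℕ-% (difference c d i)) (R.reflexive (≡.cong fromℕ e)))) (R.+-identityˡ (fromℕ (digit d i)))))) (ℕ.m<n⇒m%n≡m (Fin.toℕ<n (finToFun {p} {a} d i)))))

      combination-zero : ∀ c d → table c ≡ table d → ∀ j → RΣ.∑ a (λ i → fromℕ (difference c d i) * m i j) ∼ 0#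
      combination-zero c d e j = R.trans (R.sym (R.+-identityʳ _)) (R.trans (R.+-congˡ (R.sym (R.-‿inverseʳ (row d j)))) (R.trans (R.sym (R.+-assoc _ _ _)) (R.trans (R.+-congʳ
        (R.trans (R.sym (SumAlgebra.∑-+ residue a (λ i → fromℕ (difference c d i) * m i j) (λ i → fromℕ (digit d i) * m i j)))
        (R.trans (RΣ.∑-cong a (λ i → R.trans (R.sym (R.distribʳ (m i j) (fromℕ (difference c d i)) (fromℕ (digit d i)))) (R.*-congʳ (difference∼ c d i)))) (row-equal c d e j)))) (R.-‿inverseʳ (row d j)))))

      some-difference : ∀ c d → ¬ c ≡ d → ∃ λ i → ¬ difference c d i % p ≡ 0
      some-difference c d ne = cases (Fin.any? (λ i → ¬? (difference c d i % p ℕ.≟ 0)))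
        where
        cases : Dec (∃ λ i → ¬ difference c d i % p ≡ 0) → ∃ λ i → ¬ difference c d i % p ≡ 0
        cases (yes x)   = x
        cases (no none) = ⊥-elim (ne (≡.trans (≡.sym (Fin.funToFin-finToFin {a} {p} c)) (≡.trans (funToFin-cong (λ i → difference-zero c d i (decidable-stable (difference c d i % p ℕ.≟ 0) (λ x → none (i , x))))) (Fin.funToFin-finToFin {a} {p} d))))

      combination : Combination a b m
      combination = let (c , d , c<d , e) = Fin.pigeonhole (ℕ.^-monoʳ-< p p>1 b<a) table in
        difference c d , some-difference c d (λ eq → ℕ.<⇒≢ c<d (≡.cong toℕ eq)) , combination-zero c d e

    code : ∀ {m} q (k : Vec ℕ m) → VAll.All (_< q) k → Fin (q ℕ.^ m)
    code q []      []       = Fin.zero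
    code q (x ∷ k) (b ∷ bs) = combine (fromℕ< b) (code q k bs)

    code-injective : ∀ {m} q (k l : Vec ℕ m) bs cs → code q k bs ≡ code q l cs → k ≡ l
    code-injective q []      []      []       []       e = ≡.refl
    code-injective q (x ∷ k) (y ∷ l) (b ∷ bs) (c ∷ cs) e = let (e₁ , e₂) = Fin.combine-injective (fromℕ< b) (code q k bs) (fromℕ< c) (code q l cs) e in
      ≡.cong₂ _∷_ (Fin.fromℕ<-injective x y b c e₁) (code-injective q k l bs cs e₂)

    -- The exponents β are rational combinations of 1, ζ, .... Multiplication by D makes them
    -- integral, and adding `offset` makes the coordinates natural numbers. The offset is added once
    -- per factor, so only products with equally many factors can be compared; the constant series
    -- `pad` equalises the numbers.
    record Generators : Set₁ where
      field
        I      : Set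
        gen    : I → S
        β      : I → Carrier
        expo   : ∀ i → Exp (β i) (gen i)
        D      : ℤ
        D≢0    : ¬ D ≡ + 0
        offset : Carrier
        κ      : I → Vec ℕ (totient n)
        κ-β    : ∀ i → fromℤ D * β i + offset ≈ evℕ (κ i)
        bound  : ℕ
        κ≤     : ∀ i → VAll.All (_≤ bound) (κ i)
        pad    : I
        pad≋1  : gen pad ≋ 1ₛ

    module Monomials (𝔾 : Generators) where
      open Generators 𝔾

      data Mono : ℕ → S → Set where
        one  : Mono 0 1ₛ
        step : ∀ {K f} i → Mono K f → Mono (suc K) (gen i ⊛ f)

      key : ∀ {K f} → Mono K f → Vec ℕ (totient n)
      key one        = Vec.replicate (totient n) 0
      key (step i m) = κ i ⊞ key m

      total-β : ∀ {K f} → Mono K f → Carrier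
      total-β one        = 0#
      total-β (step i m) = β i + total-β m

      mono-Exp : ∀ {K f} (m : Mono K f) → Exp (total-β m) f
      mono-Exp one        = Exp-1
      mono-Exp (step i m) = Exp-* (expo i) (mono-Exp m)

      mono-key : ∀ {K f} (m : Mono K f) → fromℤ D * total-β m + fromℕ K * offset ≈ evℕ (key m)
      mono-key one = trans (+-cong (zeroʳ (fromℤ D)) (zeroˡ offset)) (trans (+-identityˡ 0#) (sym (evℕ-zeros (totient n))))
      mono-key (step {K} i m) = trans (solve 5 (λ d b c k o → d :* (b :+ c) :+ (con (+ 1) :+ k) :* o := (d :* b :+ o) :+ (d :* c :+ k :* o)) refl (fromℤ D) (β i) (total-β m) (fromℕ K) offset)
        (trans (+-cong (κ-β i) (mono-key m)) (sym (evℕ-⊞ (κ i) (key m))))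
        where open Solver

      -- The key determines D β + K offset, hence β, and β determines the solution of the
      -- differential equation.
      mono-unique : ∀ {K f h} (m : Mono K f) (m′ : Mono K h) → key m ≡ key m′ → f ≋ h
      mono-unique {K} m m′ e = Exp-unique (x-y≈0⇒x≈y (fromℤ-cancel D≢0 _ (trans (solve 4 (λ d b c o → d :* (b :- c) := (d :* b :+ o) :- (d :* c :+ o)) refl (fromℤ D) (total-β m) (total-β m′) (fromℕ K * offset))
        (x≈y⇒x-y≈0 (trans (mono-key m) (trans (reflexive (≡.cong evℕ e)) (sym (mono-key m′)))))))) (mono-Exp m) (mono-Exp m′)
        where open Solver

      ⊞-≤ : ∀ {m a b} (k l : Vec ℕ m) → VAll.All (_≤ a) k → VAll.All (_≤ b) l → VAll.All (_≤ a ℕ.+ b) (k ⊞ l)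
      ⊞-≤ []      []      []       []       = []
      ⊞-≤ (x ∷ k) (y ∷ l) (b ∷ bs) (c ∷ cs) = ℕ.+-mono-≤ b c ∷ ⊞-≤ k l bs cs

      zeros-≤ : ∀ m → VAll.All (_≤ 0) (Vec.replicate m 0)
      zeros-≤ zero    = []
      zeros-≤ (suc m) = z≤n ∷ zeros-≤ m

      key-≤ : ∀ {K f} (m : Mono K f) → VAll.All (_≤ K ℕ.* bound) (key m)
      key-≤ one        = zeros-≤ (totient n)
      key-≤ (step i m) = ⊞-≤ (κ i) (key m) (κ≤ i) (key-≤ m)

      mono-* : ∀ {K L f h} → Mono K f → Mono L h → Σ S λ k → Mono (K ℕ.+ L) k × k ≡ₚ f ⊛ h
      mono-* {h = h} one m′ = h , m′ , S̄.sym (S̄.*-identityˡ h)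
      mono-* {h = h} (step {f = f} i m) m′ = let (k , m″ , e) = mono-* m m′ in gen i ⊛ k , step i m″ , S̄.trans (S̄.*-congˡ {gen i} e) (S̄.sym (S̄.*-assoc (gen i) f h))

      -- The F_p-span of x^j f with j < J and f a product of exactly K generators. Scalars come from
      -- O, but `resp` makes them count modulo p only.
      data Span (J K : ℕ) : S → Set where
        mono  : ∀ {j f} → j < J → Mono K f → Span J K (x^ j ⊛ f)
        zero  : Span J K 0ₛ
        add   : ∀ {f h} → Span J K f → Span J K h → Span J K (f ⊕ h)
        times : ∀ {f} a → Span J K f → Span J K (const a ⊛ f)
        resp  : ∀ {f h} → f ≡ₚ h → Span J K f → Span J K h

      span-mono-* : ∀ {J K J′ K′ j f h} → j < J → Mono K f → Span J′ K′ h → Span (J ℕ.+ J′) (K ℕ.+ K′) ((x^ j ⊛ f) ⊛ h)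
      span-mono-* {j = j} {f = f} j<J m (mono {j′} {f′} j′<J′ m′) = let (k , m″ , e) = mono-* m m′ in
        resp (S̄.trans (S̄.*-cong (x^-+ j j′) e) (interchange (x^ j) (x^ j′) f f′)) (mono (ℕ.+-mono-<-≤ j<J (ℕ.<⇒≤ j′<J′)) m″)
      span-mono-* {j = j} {f = f} j<J m zero = resp (S̄.sym (S̄.zeroʳ (x^ j ⊛ f))) zero
      span-mono-* {j = j} {f = f} j<J m (add {a} {b} s t) = resp (S̄.sym (S̄.distribˡ (x^ j ⊛ f) a b)) (add (span-mono-* j<J m s) (span-mono-* j<J m t))
      span-mono-* {j = j} {f = f} j<J m (times {h} a s) = resp (swap (const a) (x^ j ⊛ f) h) (times a (span-mono-* j<J m s))
      span-mono-* {j = j} {f = f} j<J m (resp e s) = resp (S̄.*-congˡ {x^ j ⊛ f} e) (span-mono-* j<J m s)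

      span-* : ∀ {J K J′ K′ f h} → Span J K f → Span J′ K′ h → Span (J ℕ.+ J′) (K ℕ.+ K′) (f ⊛ h)
      span-* (mono j<J m)   t = span-mono-* j<J m t
      span-* {h = h} zero   t = resp (S̄.sym (S̄.zeroˡ h)) zero
      span-* {h = h} (add {a} {b} s s′) t = resp (S̄.sym (S̄.distribʳ h a b)) (add (span-* s t) (span-* s′ t))
      span-* {h = h} (times {f} a s)    t = resp (S̄.sym (S̄.*-assoc (const a) f h)) (times a (span-* s t))
      span-* {h = h} (resp e s)     t = resp (S̄.*-congʳ {h} e) (span-* s t)

      span-J : ∀ {J J′ K f} → J ≤ J′ → Span J K f → Span J′ K f
      span-J J≤ (mono j<J m) = mono (ℕ.<-≤-trans j<J J≤) m
      span-J J≤ zero         = zero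
      span-J J≤ (add s t)    = add (span-J J≤ s) (span-J J≤ t)
      span-J J≤ (times a s)  = times a (span-J J≤ s)
      span-J J≤ (resp e s)   = resp e (span-J J≤ s)

      span-pad : ∀ {J K f} → Span J K f → Span J (suc K) f
      span-pad (mono {j} {f} j<J m) = resp (S̄.*-congˡ {x^ j} (S̄.trans (S̄.*-congʳ {f} (exact⇒mod pad≋1)) (S̄.*-identityˡ f))) (mono j<J (step pad m))
      span-pad zero         = zero
      span-pad (add s t)    = add (span-pad s) (span-pad t)
      span-pad (times a s)  = times a (span-pad s)
      span-pad (resp e s)   = resp e (span-pad s)

      span-K : ∀ {J K f} L → Span J K f → Span J (L ℕ.+ K) f
      span-K zero    s = s
      span-K (suc L) s = span-pad (span-K L s)

      SomeSpan : S → Set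
      SomeSpan f = Σ ℕ λ J → Σ ℕ λ K → Span J K f

      some-enlarge : ∀ {J K f} J′ K′ → Span J K f → Span (J ℕ.+ J′) (K ℕ.+ K′) f
      some-enlarge {J} {K} {f} J′ K′ s = ≡.subst (λ z → Span (J ℕ.+ J′) z f) (ℕ.+-comm K′ K) (span-K K′ (span-J (ℕ.m≤m+n J J′) s))

      some-enlargeʳ : ∀ {J K f} J′ K′ → Span J K f → Span (J′ ℕ.+ J) (K′ ℕ.+ K) f
      some-enlargeʳ {J} {K} J′ K′ s = span-K K′ (span-J (ℕ.m≤n+m J J′) s)

      some-+ : ∀ {f h} → SomeSpan f → SomeSpan h → SomeSpan (f ⊕ h)
      some-+ (J , K , s) (J′ , K′ , t) = J ℕ.+ J′ , K ℕ.+ K′ , add (some-enlarge J′ K′ s) (some-enlargeʳ J K t)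

      some-* : ∀ {f h} → SomeSpan f → SomeSpan h → SomeSpan (f ⊛ h)
      some-* (J , K , s) (J′ , K′ , t) = J ℕ.+ J′ , K ℕ.+ K′ , span-* s t

      span-1 : Span 1 0 1ₛ
      span-1 = resp (S̄.*-identityˡ 1ₛ) (mono (s≤s z≤n) one)

      some-const : ∀ a → SomeSpan (const a)
      some-const a = 1 , 0 , resp (S̄.*-identityʳ (const a)) (times a span-1)

      some-X : SomeSpan X
      some-X = 2 , 0 , resp (S̄.trans (S̄.*-identityʳ (x^ 1)) (S̄.*-identityʳ X)) (mono (s≤s (s≤s z≤n)) one)

      some-gen : ∀ i → SomeSpan (gen i)
      some-gen i = 1 , 1 , resp (S̄.trans (S̄.*-identityˡ (gen i ⊛ 1ₛ)) (S̄.*-identityʳ (gen i))) (mono (s≤s z≤n) (step i one))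

      some-coeffs : ∀ cs → SomeSpan (lift (coeffs p cs))
      some-coeffs []       = 0 , 0 , resp S̄.refl zero
      some-coeffs (c ∷ cs) = let (J , K , s) = some-+ (some-const (fromℕ c)) (some-* some-X (some-coeffs cs)) in J , K , resp (S̄.sym (coeffs-∷ c cs)) s

      AllSome : ∀ {m} → Vec S m → Set
      AllSome []       = ⊤
      AllSome (F ∷ Fs) = SomeSpan F × AllSome Fs

      some-value : ∀ m P Fs → AllSome Fs → SomeSpan (value m P Fs)
      some-value zero    cs       []       _        = some-coeffs cs
      some-value (suc m) []       (F ∷ Fs) _        = 0 , 0 , zero
      some-value (suc m) (c ∷ cs) (F ∷ Fs) (s , ss) = some-+ (some-value m c Fs ss) (some-* s (some-value (suc m) cs (F ∷ Fs) (s , ss)))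

      module Coordinates (J K q : ℕ) (K<q : K ℕ.* bound < q) where

        Code : ∀ {f} → Mono K f → Fin (q ℕ.^ totient n)
        Code m = code q (key m) (VAll.map (λ b → ℕ.≤-<-trans b K<q) (key-≤ m))

        -- Whether a code comes from a monomial is not decided here; decisions for the finitely many
        -- codes are supplied later under double negation. One monomial per code suffices by
        -- `mono-unique`.
        HasCode : ℕ → Set
        HasCode c = Σ S λ f → Σ (Mono K f) λ m → toℕ (Code m) ≡ c

        choose : ∀ {c} → Dec (HasCode c) → S
        choose (yes (f , _)) = f
        choose (no _)        = 0ₛ

        choose-code : ∀ {c} (d : Dec (HasCode c)) {f} (m : Mono K f) → toℕ (Code m) ≡ c → f ≡ₚ choose d
        choose-code (yes (h , m′ , e′)) m e = exact⇒mod (mono-unique m m′ (code-injective q (key m) (key m′) _ _ (Fin.toℕ-injective (≡.trans e (≡.sym e′)))))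
        choose-code (no none)           m e = ⊥-elim (none (_ , m , e))

        module Basis (decide : ∀ c → c < q ℕ.^ totient n → Dec (HasCode c)) where

          size : ℕ
          size = J ℕ.* q ℕ.^ totient n

          basis-of : Fin J × Fin (q ℕ.^ totient n) → S
          basis-of (j , c) = x^ (toℕ j) ⊛ choose (decide (toℕ c) (Fin.toℕ<n c))

          basis : Fin size → S
          basis i = basis-of (remQuot {J} (q ℕ.^ totient n) i)

          Coords : S → Set
          Coords f = Σ (Fin size → Carrier) λ m → f ≡ₚ ∑ size (λ i → const (m i) ⊛ basis i)

          indicator : Fin size → Fin size → Carrier
          indicator i k with k Fin.≟ i
          ... | yes _ = 1#
          ... | no _  = 0#

          indicator-same : ∀ i → indicator i i ≈ 1#
          indicator-same i with i Fin.≟ i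
          ... | yes _ = refl
          ... | no ne = ⊥-elim (ne ≡.refl)

          indicator-other : ∀ i k → ¬ k ≡ i → indicator i k ≈ 0#
          indicator-other i k ne with k Fin.≟ i
          ... | yes e = ⊥-elim (ne e)
          ... | no _  = refl

          const-cong : ∀ {a b} → a ∼ b → const a ≡ₚ const b
          const-cong e = pwₚ λ { zero → e ; (suc i) → R.refl }

          const-0 : const 0# ≡ₚ 0ₛ
          const-0 = pwₚ λ { zero → R.refl ; (suc i) → R.refl }

          coords-basis : ∀ i → Coords (basis i)
          coords-basis i = indicator i , S̄.sym (S̄.trans (∑-single size {λ k → const (indicator i k) ⊛ basis k} i (λ k ne → S̄.trans (S̄.*-congʳ {basis k} (S̄.trans (const-cong (≈⇒∼ (indicator-other i k ne))) const-0)) (S̄.zeroˡ (basis k))))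
            (S̄.trans (S̄.*-congʳ {basis i} (const-cong (≈⇒∼ (indicator-same i)))) (S̄.*-identityˡ (basis i))))

          coords-resp : ∀ {f h} → f ≡ₚ h → Coords h → Coords f
          coords-resp e (m , e′) = m , S̄.trans e e′

          coords-mono : ∀ {j f} → j < J → Mono K f → Coords (x^ j ⊛ f)
          coords-mono {j} {f} j<J m = coords-resp (S̄.trans (S̄.*-congˡ {x^ j} (choose-code (decide (toℕ (Code m)) (Fin.toℕ<n (Code m))) m ≡.refl))
              (S̄.trans (S̄.*-congʳ {choose (decide (toℕ (Code m)) (Fin.toℕ<n (Code m)))} (S̄.reflexive (≡.cong x^ (≡.sym (Fin.toℕ-fromℕ< j<J))))) (S̄.reflexive (≡.sym (≡.cong basis-of (Fin.remQuot-combine (fromℕ< j<J) (Code m)))))))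
            (coords-basis (combine (fromℕ< j<J) (Code m)))

          const-add : ∀ a b → const (a + b) ≡ₚ const a ⊕ const b
          const-add a b = exact⇒mod (const-+ a b)

          const-mul : ∀ a b → const (a * b) ≡ₚ const a ⊛ const b
          const-mul a b = S̄.sym (exact⇒mod (SE.const-* a b))

          coords : ∀ {f} → Span J K f → Coords f
          coords (mono j<J m) = coords-mono j<J m
          coords zero         = (λ _ → 0#) , S̄.sym (∑-zero size (λ i → S̄.trans (S̄.*-congʳ {basis i} const-0) (S̄.zeroˡ (basis i))))
          coords (add s t)    = let (m , e) = coords s ; (m′ , e′) = coords t in (λ i → m i + m′ i) , S̄.trans (S̄.+-cong e e′) (S̄.trans (S̄.sym (∑-+ size (λ i → const (m i) ⊛ basis i) (λ i → const (m′ i) ⊛ basis i)))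
            (∑-cong size (λ i → S̄.trans (S̄.sym (S̄.distribʳ (basis i) (const (m i)) (const (m′ i)))) (S̄.*-congʳ {basis i} (S̄.sym (const-add (m i) (m′ i)))))))
          coords (times a s)  = let (m , e) = coords s in (λ i → a * m i) , S̄.trans (S̄.*-congˡ {const a} e) (S̄.trans (S̄.sym (∑-scale size (const a) (λ i → const (m i) ⊛ basis i)))
            (∑-cong size (λ i → S̄.trans (S̄.sym (S̄.*-assoc (const a) (const (m i)) (basis i))) (S̄.*-congʳ {basis i} (S̄.sym (const-mul a (m i)))))))
          coords (resp e s)   = coords-resp (S̄.sym e) (coords s)

          const-∑ : ∀ a (f : Fin a → Carrier) → ∑ a (λ i → const (f i)) ≡ₚ const (RΣ.∑ a f)
          const-∑ = SumMap.∑-map residue M.series const const-0 const-add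

          dependent : ∀ a → size < a → (V : Fin a → S) → (∀ i → Span J K (V i)) → Σ (Fin a → ℕ) λ d → (∃ λ i → ¬ d i % p ≡ 0) × Zero (∑ a (λ i → const (fromℕ (d i)) ⊛ V i))
          dependent a size<a V s = d , proj₁ (proj₂ found) , S̄.trans (∑-cong a (λ i → S̄.*-congˡ {const (fromℕ (d i))} (proj₂ (coords (s i)))))
            (S̄.trans (∑-rows a size (λ i → const (fromℕ (d i))) (λ i j → const (m i j)) basis) (∑-zero size (λ j → S̄.trans (S̄.*-congʳ {basis j} (column j)) (S̄.zeroˡ (basis j)))))
            where
            m : Fin a → Fin size → Carrier
            m i = proj₁ (coords (s i))
            found = Siegel.combination a size size<a m
            d = proj₁ found
            column : ∀ j → ∑ a (λ i → const (fromℕ (d i)) ⊛ const (m i j)) ≡ₚ 0ₛ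
            column j = S̄.trans (∑-cong a (λ i → S̄.sym (const-mul (fromℕ (d i)) (m i j)))) (S̄.trans (const-∑ a (λ i → fromℕ (d i) * m i j)) (S̄.trans (const-cong (proj₂ (proj₂ found) j)) const-0))

    Fracs : ∀ {m} → Vec (Laurent p) m → Vec (S × S) m → Set
    Fracs []       []              = ⊤
    Fracs (a ∷ as) ((u , v) ∷ uvs) = Frac a u v × Fracs as uvs

    combo : ∀ a → (Fin a → ℕ) → (Fin a → S) → S
    combo a d V = ∑ a (λ i → const (fromℕ (d i)) ⊛ V i)

    module Family (J₀ N : ℕ) where

      size : ℕ → ℕ
      size zero    = J₀
      size (suc m) = N ℕ.* size m

      build-list : ∀ {m a} → ((Fin a → ℕ) → Poly p m) → ∀ L → (Fin (L ℕ.* a) → ℕ) → List (Poly p m)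
      build-list         b zero    d = []
      build-list {m} {a} b (suc L) d = b (λ i → d (i ↑ˡ (L ℕ.* a))) ∷ build-list {m} {a} b L (λ j → d (a ↑ʳ j))

      -- The general polynomial of degree below N in each variable and below J₀ in x, with
      -- coefficient vector d.
      build : ∀ m → (Fin (size m) → ℕ) → Poly p m
      build zero    d = List.tabulate d
      build (suc m) d = build-list {m} {size m} (build m) N d

      -- Consists of u^e v^(L-e) V(i) for e < L: the powers (u/v)^e multiplied by v^L, so that no
      -- fractions remain.
      family-list : ∀ {a} → S → S → (Fin a → S) → ∀ L → Fin (L ℕ.* a) → S
      family-list {a} u v V (suc L) c = Sum.[ (λ i → (v KM.^ suc L) ⊛ V i) , (λ j → u ⊛ family-list u v V L j) ] (splitAt a c)

      family : ∀ m → Vec (S × S) m → Fin (size m) → S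
      family zero    []              i = x^ (toℕ i)
      family (suc m) ((u , v) ∷ uvs) i = family-list u v (family m uvs) N i

      denominator : ∀ {m} → Vec (S × S) m → S
      denominator []              = 1ₛ
      denominator ((u , v) ∷ uvs) = denominator uvs ⊛ (v KM.^ N)

      combo-split : ∀ a L u v (V : Fin a → S) d → combo (suc L ℕ.* a) d (family-list u v V (suc L)) ≡ₚ
        ((v KM.^ suc L) ⊛ combo a (λ i → d (i ↑ˡ (L ℕ.* a))) V) ⊕ (u ⊛ combo (L ℕ.* a) (λ j → d (a ↑ʳ j)) (family-list u v V L))
      combo-split a L u v V d = S̄.trans (∑-split a (L ℕ.* a) (λ c → const (fromℕ (d c)) ⊛ family-list u v V (suc L) c)) (S̄.+-cong
        (S̄.trans (∑-cong a (λ i → S̄.trans (S̄.*-congˡ {const (fromℕ (d (i ↑ˡ (L ℕ.* a))))} (S̄.reflexive (≡.cong (Sum.[ (λ i → (v KM.^ suc L) ⊛ V i) , (λ j → u ⊛ family-list u v V L j) ]) (Fin.splitAt-↑ˡ a i (L ℕ.* a))))) (swap (const (fromℕ (d (i ↑ˡ (L ℕ.* a))))) (v KM.^ suc L) (V i))))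
          (∑-scale a (v KM.^ suc L) (λ i → const (fromℕ (d (i ↑ˡ (L ℕ.* a)))) ⊛ V i)))
        (S̄.trans (∑-cong (L ℕ.* a) (λ j → S̄.trans (S̄.*-congˡ {const (fromℕ (d (a ↑ʳ j)))} (S̄.reflexive (≡.cong (Sum.[ (λ i → (v KM.^ suc L) ⊛ V i) , (λ j → u ⊛ family-list u v V L j) ]) (Fin.splitAt-↑ʳ a (L ℕ.* a) j)))) (swap (const (fromℕ (d (a ↑ʳ j)))) u (family-list u v V L j))))
          (∑-scale (L ℕ.* a) u (λ j → const (fromℕ (d (a ↑ʳ j))) ⊛ family-list u v V L j))))

      mutual
        coeffs-tail : ∀ J (d : Fin (suc J) → ℕ) → X ⊛ lift (coeffs p (List.tabulate (λ i → d (Fin.suc i)))) ≡ₚ ∑ J (λ i → const (fromℕ (d (Fin.suc i))) ⊛ x^ (suc (toℕ i)))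
        coeffs-tail J d = S̄.trans (S̄.*-congˡ {X} (coeffs-tabulate J (λ i → d (Fin.suc i)))) (S̄.trans (S̄.sym (∑-scale J X (λ i → const (fromℕ (d (Fin.suc i))) ⊛ x^ (toℕ i)))) (∑-cong J (λ i → swap X (const (fromℕ (d (Fin.suc i)))) (x^ (toℕ i)))))

        coeffs-tabulate : ∀ J (d : Fin J → ℕ) → lift (coeffs p (List.tabulate d)) ≡ₚ combo J d (λ i → x^ (toℕ i))
        coeffs-tabulate zero    d = S̄.refl
        coeffs-tabulate (suc J) d = S̄.trans (coeffs-∷ (d Fin.zero) (List.tabulate (λ i → d (Fin.suc i))))
          (∑-cons J (λ i → const (fromℕ (d i)) ⊛ x^ (toℕ i)) (const (fromℕ (d Fin.zero))) (X ⊛ lift (coeffs p (List.tabulate (λ i → d (Fin.suc i))))) (S̄.sym (S̄.*-identityʳ (const (fromℕ (d Fin.zero))))) (coeffs-tail J d))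

      Frac-resp : ∀ a {u u′ v} → u ≡ₚ u′ → Frac a u v → Frac a u′ v
      Frac-resp (k , s) e f = S̄.trans f (S̄.*-congˡ {x^ k} e)

      mutual
        build-clear : ∀ m d as uvs → Fracs as uvs → Frac (eval p m (build m d) as) (combo (size m) d (family m uvs)) (denominator uvs)
        build-clear zero    d []       []              _        = S̄.trans (S̄.*-identityʳ (lift (coeffs p (List.tabulate d)))) (S̄.trans (coeffs-tabulate J₀ d) (S̄.sym (S̄.*-identityˡ (combo J₀ d (λ i → x^ (toℕ i))))))
        build-clear (suc m) d (a ∷ as) ((u , v) ∷ uvs) (f , fs) = list-clear m N d a as u v uvs f fs

        list-clear : ∀ m L d a as u v uvs → Frac a u v → Fracs as uvs → Frac (eval p (suc m) (build-list {m} {size m} (build m) L d) (a ∷ as)) (combo (L ℕ.* size m) d (family-list u v (family m uvs) L)) (denominator uvs ⊛ (v KM.^ L))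
        list-clear m zero    d a as u v uvs f fs = S̄.trans (S̄.zeroˡ (denominator uvs ⊛ 1ₛ)) (S̄.sym (S̄.zeroʳ (x^ 0)))
        list-clear m (suc L) d a as u v uvs f fs = Frac-resp (eval p (suc m) (build-list {m} {size m} (build m) (suc L) d) (a ∷ as)) (S̄.sym (combo-split (size m) L u v (family m uvs) d))
          (Frac-cons (eval p m (build m (λ i → d (i ↑ˡ (L ℕ.* size m)))) as) a (eval p (suc m) (build-list {m} {size m} (build m) L (λ j → d (size m ↑ʳ j))) (a ∷ as))
            (build-clear m (λ i → d (i ↑ˡ (L ℕ.* size m))) as uvs fs) f (list-clear m L (λ j → d (size m ↑ʳ j)) a as u v uvs f fs))

      mutual
        build-zero : ∀ m d → IsZeroPoly p m (build m d) → ∀ i → d i % p ≡ 0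
        build-zero zero    d z i = All.tabulate⁻ {f = d} z i
        build-zero (suc m) d z i = list-zero m N d z i

        list-zero : ∀ m L d → IsZeroPoly p (suc m) (build-list {m} {size m} (build m) L d) → ∀ i → d i % p ≡ 0
        list-zero m (suc L) d (z ∷ zs) i = ≡.subst (λ i → d i % p ≡ 0) (Fin.join-splitAt (size m) (L ℕ.* size m) i)
          (either (splitAt (size m) i))
          where
          either : ∀ s → d (Fin.join (size m) (L ℕ.* size m) s) % p ≡ 0
          either (inj₁ j) = build-zero m (λ i → d (i ↑ˡ (L ℕ.* size m))) z j
          either (inj₂ j) = list-zero m L (λ j → d (size m ↑ʳ j)) zs j

      module Spans (𝔾 : Generators) (j k : ℕ) where
        open Monomials 𝔾

        AllSpan : ∀ {m} → Vec (S × S) m → Set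
        AllSpan []              = ⊤
        AllSpan ((u , v) ∷ uvs) = Span j k u × Span j k v × AllSpan uvs

        span-cast : ∀ {J K J′ K′ f} → J ≡ J′ → K ≡ K′ → Span J K f → Span J′ K′ f
        span-cast ≡.refl ≡.refl s = s

        span-^ : ∀ {v} L → Span j k v → Span (suc L ℕ.* j) (suc L ℕ.* k) (v KM.^ suc L)
        span-^ {v} zero    s = span-cast (≡.sym (ℕ.+-identityʳ j)) (≡.sym (ℕ.+-identityʳ k)) (resp (S̄.sym (S̄.*-identityʳ v)) s)
        span-^ {v} (suc L) s = span-* s (span-^ L s)

        list-span : ∀ {a J K u v} (V : Fin a → S) → Span j k u → Span j k v → (∀ i → Span J K (V i)) → ∀ L c → Span (L ℕ.* j ℕ.+ J) (L ℕ.* k ℕ.+ K) (family-list u v V L c)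
        list-span {a} {J} {K} {u} {v} V su sv sV (suc L) c = either (splitAt a c)
          where
          either : ∀ s → Span (suc L ℕ.* j ℕ.+ J) (suc L ℕ.* k ℕ.+ K) (Sum.[ (λ i → (v KM.^ suc L) ⊛ V i) , (λ j → u ⊛ family-list u v V L j) ] s)
          either (inj₁ i) = span-* (span-^ L sv) (sV i)
          either (inj₂ i) = span-cast (≡.sym (ℕ.+-assoc j (L ℕ.* j) J)) (≡.sym (ℕ.+-assoc k (L ℕ.* k) K)) (span-* su (list-span V su sv sV L i))

        degreeJ degreeK : ℕ → ℕ
        degreeJ zero    = J₀
        degreeJ (suc m) = N ℕ.* j ℕ.+ degreeJ m
        degreeK zero    = 0
        degreeK (suc m) = N ℕ.* k ℕ.+ degreeK m

        family-span : ∀ m uvs → AllSpan uvs → ∀ i → Span (degreeJ m) (degreeK m) (family m uvs i)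
        family-span zero    []              _              i = resp (S̄.*-identityʳ (x^ (toℕ i))) (mono (Fin.toℕ<n i) one)
        family-span (suc m) ((u , v) ∷ uvs) (su , sv , ss) i = list-span (family m uvs) su sv (family-span m uvs ss) N i

        degreeJ≡ : ∀ m → degreeJ m ≡ N ℕ.* (m ℕ.* j) ℕ.+ J₀
        degreeJ≡ zero    = ≡.cong (ℕ._+ J₀) (≡.sym (ℕ.*-zeroʳ N))
        degreeJ≡ (suc m) = ≡.trans (≡.cong (λ z → N ℕ.* j ℕ.+ z) (degreeJ≡ m)) (≡.trans (≡.sym (ℕ.+-assoc (N ℕ.* j) (N ℕ.* (m ℕ.* j)) J₀)) (≡.cong (ℕ._+ J₀) (≡.sym (ℕ.*-distribˡ-+ N j (m ℕ.* j)))))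

        degreeK≡ : ∀ m → degreeK m ≡ N ℕ.* (m ℕ.* k)
        degreeK≡ zero    = ≡.sym (ℕ.*-zeroʳ N)
        degreeK≡ (suc m) = ≡.trans (≡.cong (λ z → N ℕ.* k ℕ.+ z) (degreeK≡ m)) (≡.sym (ℕ.*-distribˡ-+ N k (m ℕ.* k)))

        size≡ : ∀ m → size m ≡ N ℕ.^ m ℕ.* J₀
        size≡ zero    = ≡.sym (ℕ.+-identityʳ J₀)
        size≡ (suc m) = ≡.trans (≡.cong (N ℕ.*_) (size≡ m)) (≡.sym (ℕ.*-assoc N (N ℕ.^ m) J₀))

    NonZeros : ∀ {m} → Vec (S × S) m → Set
    NonZeros []              = ⊤
    NonZeros ((u , v) ∷ uvs) = ¬ Zero v × NonZeros uvs

    product-nonzero : ∀ {f h} → ¬ Zero f → ¬ Zero h → ¬ Zero (f ⊛ h)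
    product-nonzero {f} {h} nf nh z = nh (series-domain f h z nf)

    1ₛ-nonzero : ¬ Zero 1ₛ
    1ₛ-nonzero z = 1≁0 (atₚ z 0)

    power-nonzero : ∀ {f} → ¬ Zero f → ∀ L → ¬ Zero (f KM.^ L)
    power-nonzero nf zero    = 1ₛ-nonzero
    power-nonzero {f} nf (suc L) = product-nonzero {f} {f KM.^ L} nf (power-nonzero nf L)

    ^-distrib-*ℕ : ∀ a b m → (a ℕ.* b) ℕ.^ m ≡ a ℕ.^ m ℕ.* b ℕ.^ m
    ^-distrib-*ℕ a b zero    = ≡.refl
    ^-distrib-*ℕ a b (suc m) = ≡.trans (≡.cong ((a ℕ.* b) ℕ.*_) (^-distrib-*ℕ a b m)) (ℕS.+-*-Solver.solve 4 (λ a b x y → (a ℕS.+-*-Solver.:* b) ℕS.+-*-Solver.:* (x ℕS.+-*-Solver.:* y) ℕS.+-*-Solver.:= (a ℕS.+-*-Solver.:* x) ℕS.+-*-Solver.:* (b ℕS.+-*-Solver.:* y)) ≡.refl a b (a ℕ.^ m) (b ℕ.^ m))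

    -- With N > 2C^m there are more polynomials of degree < N in m + 1 variables than values they can take.
    counting : ∀ m j C → let N = suc (2 ℕ.* C ℕ.^ m) ; J₀ = N ℕ.* suc j in (N ℕ.* j ℕ.+ J₀) ℕ.* (N ℕ.* C) ℕ.^ m < N ℕ.^ suc m ℕ.* J₀
    -- J₀ is at least Nj, so Nj + J₀ is at most 2 J₀. What remains to compare is 2 C^m with N.
    counting m j C = ℕ.≤-<-trans (ℕ.*-mono-≤ (ℕ.+-monoˡ-≤ J₀ (ℕ.*-monoʳ-≤ N (ℕ.n≤1+n j))) (ℕ.≤-reflexive (^-distrib-*ℕ N C m)))
      (≡.subst₂ _<_ (shuffle J₀ (N ℕ.^ m) (C ℕ.^ m)) (shuffle′ N (N ℕ.^ m) J₀) (ℕ.*-monoʳ-< (J₀ ℕ.* N ℕ.^ m) {{ℕ.m*n≢0 J₀ (N ℕ.^ m) {{_}} {{ℕ.m^n≢0 N m}}}} (ℕ.n<1+n (2 ℕ.* C ℕ.^ m))))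
      where
      N = suc (2 ℕ.* C ℕ.^ m)
      J₀ = N ℕ.* suc j
      open ℕS.+-*-Solver
      shuffle : ∀ J x c → (J ℕ.* x) ℕ.* (2 ℕ.* c) ≡ (J ℕ.+ J) ℕ.* (x ℕ.* c)
      shuffle = solve 3 (λ J x c → (J :* x) :* (con 2 :* c) := (J :+ J) :* (x :* c)) ≡.refl
      shuffle′ : ∀ n x J → (J ℕ.* x) ℕ.* n ≡ (n ℕ.* x) ℕ.* J
      shuffle′ = solve 3 (λ n x J → (J :* x) :* n := (n :* x) :* J) ≡.refl

    module Dependence (𝔾 : Generators) (j k : ℕ) (as : Vec (Laurent p) (suc (totient n))) (uvs : Vec (S × S) (suc (totient n))) (fracs : Fracs as uvs) (nonzeros : NonZeros uvs) where
      open Generators 𝔾 using (bound)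
      open Monomials 𝔾

      r : ℕ
      r = suc (totient n)

      -- The entries of the keys that occur are at most N r k `bound`, so they are below NC.
      C : ℕ
      C = suc ((r ℕ.* k) ℕ.* bound)

      N : ℕ
      N = suc (2 ℕ.* C ℕ.^ totient n)

      J₀ : ℕ
      J₀ = N ℕ.* suc (r ℕ.* j)

      open Family J₀ N
      open Spans 𝔾 j k

      K<q : degreeK r ℕ.* bound < N ℕ.* C
      K<q = ≡.subst (_< N ℕ.* C) (≡.sym (≡.trans (≡.cong (ℕ._* bound) (degreeK≡ r)) (ℕ.*-assoc N (r ℕ.* k) bound))) (ℕ.*-monoʳ-< N (ℕ.n<1+n ((r ℕ.* k) ℕ.* bound)))

      open Coordinates (degreeJ r) (degreeK r) (N ℕ.* C) K<q

      basis-small : degreeJ r ℕ.* (N ℕ.* C) ℕ.^ totient n < size r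
      basis-small = ≡.subst₂ _<_ (≡.cong (ℕ._* (N ℕ.* C) ℕ.^ totient n) (≡.sym (degreeJ≡ r))) (≡.sym (size≡ r)) (counting (totient n) (r ℕ.* j) C)

      denominator-nonzero : ∀ {m} (uvs : Vec (S × S) m) → NonZeros uvs → ¬ Zero (denominator uvs)
      denominator-nonzero []              _        = 1ₛ-nonzero
      denominator-nonzero ((u , v) ∷ uvs) (nv , ns) = product-nonzero {denominator uvs} {v KM.^ N} (denominator-nonzero uvs ns) (power-nonzero nv N)

      vanishing : ∀ d → Zero (combo (size r) d (family r uvs)) → _≈ᴸ_ p (eval p r (build r d) as) (zeroᴸ p)
      vanishing d z = ⇒≈zero T (series-domain (denominator uvs) (lift (proj₂ T)) (S̄.trans (S̄.*-comm (denominator uvs) (lift (proj₂ T))) (S̄.trans (build-clear r d as uvs fracs) (S̄.trans (S̄.*-congˡ {x^ (proj₁ T)} z) (S̄.zeroʳ (x^ (proj₁ T)))))) (denominator-nonzero uvs nonzeros))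
        where T = eval p r (build r d) as

      absurd : AllSpan uvs → AlgIndep p r as → ⊥
      absurd ss indep = ¬¬-decidable {HasCode} ((N ℕ.* C) ℕ.^ totient n) λ decide →
        let (d , (i , di) , z) = Basis.dependent decide (size r) basis-small (family r uvs) (family-span r uvs ss) in
        indep (build r d) (λ zero-poly → di (build-zero r d zero-poly i)) (vanishing d z)

    data Index : Set where
      pad-index : Index
      gen-index : Fin (p ℕ.∸ 1) → Index

    -- The number a bounds the coordinates of every D[c], so adding a to each coordinate gives
    -- natural numbers up to 2a; the offset is a(1 + ζ + ... + ζ^(φ(p-1)-1)).
    generators : (∃ λ D → ¬ D ≡ + 0 × (∀ k → Σ (Vec ℤ (totient n)) λ V → fromℤ D * ζ ^ k ≈ ev V ζ)) → Σ Generators λ 𝔾 → Σ (Fin (p ℕ.∸ 1) → Generators.I 𝔾) λ ι → ∀ i → Generators.gen 𝔾 (ι i) ≡ Ec (suc (toℕ i))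
    generators (D , D≢0 , express) = record
      { I = Index ; gen = gen ; β = β ; expo = expo ; D = D ; D≢0 = D≢0 ; offset = evℕ (Vec.replicate (totient n) a) ; κ = κ ; κ-β = κ-β ; bound = a ℕ.+ a ; κ≤ = κ≤ ; pad = pad-index ; pad≋1 = Ŝ.refl } , gen-index , λ i → ≡.refl
      where
      gen : Index → S
      gen pad-index     = 1ₛ
      gen (gen-index i) = Ec (suc (toℕ i))
      β : Index → Carrier
      β pad-index     = 0#
      β (gen-index i) = teich (suc (toℕ i))
      expo : ∀ i → Exp (β i) (gen i)
      expo pad-index     = Exp-1
      expo (gen-index i) = Exp-Ec (suc (toℕ i))
      log : (i : Fin (p ℕ.∸ 1)) → ∃ λ k → teich (suc (toℕ i)) ≈ ζ ^ k
      log i = power-of-ζ (suc (toℕ i)) (s≤s z≤n) (≡.subst (suc (toℕ i) <_) suc-n (s≤s (Fin.toℕ<n i)))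
      V : Fin (p ℕ.∸ 1) → Vec ℤ (totient n)
      V i = proj₁ (express (proj₁ (log i)))
      total-height : ∀ {m} (f : Fin m → ℕ) → ∃ λ b → ∀ i → f i ≤ b
      total-height {zero}  f = 0 , λ ()
      total-height {suc m} f = let (b , h) = total-height (λ i → f (Fin.suc i)) in f Fin.zero ℕ.+ b , λ { Fin.zero → ℕ.m≤m+n (f Fin.zero) b ; (Fin.suc i) → ℕ.≤-trans (h i) (ℕ.m≤n+m b (f Fin.zero)) }
      a : ℕ
      a = proj₁ (total-height (λ i → height (V i)))
      shifted : ∀ {m} → Vec ℤ m → Vec ℕ m
      shifted = Vec.map (λ z → ℤ.∣ z ℤ.+ + a ∣)
      nonneg : ∀ z → ℤ.∣ z ∣ ≤ a → + ℤ.∣ z ℤ.+ + a ∣ ≡ z ℤ.+ + a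
      nonneg (+ x)    h = ≡.refl
      nonneg -[1+ x ] h = ≡.trans (≡.cong (λ w → + ℤ.∣ w ∣) (ℤ.⊖-≥ h)) (≡.sym (ℤ.⊖-≥ h))
      shifted-ev : ∀ {m} (W : Vec ℤ m) → height W ≤ a → evℕ (shifted W) ≈ ev W ζ + evℕ (Vec.replicate m a)
      shifted-ev []      h = sym (+-identityˡ 0#)
      shifted-ev {suc m} (z ∷ W) h = trans (+-cong (trans (reflexive (≡.cong fromℤ (nonneg z (ℕ.≤-trans (ℕ.m≤m+n ℤ.∣ z ∣ (height W)) h)))) (fromℤ-+ z (+ a))) (*-congˡ (shifted-ev W (ℕ.≤-trans (ℕ.m≤n+m (height W) ℤ.∣ z ∣) h))))
        (solve 5 (λ z a y w r → (z :+ a) :+ y :* (w :+ r) := (z :+ y :* w) :+ (a :+ y :* r)) refl (fromℤ z) (fromℕ a) ζ (ev W ζ) (evℕ (Vec.replicate m a)))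
        where open Solver
      shifted-≤ : ∀ {m} (W : Vec ℤ m) → height W ≤ a → VAll.All (_≤ a ℕ.+ a) (shifted W)
      shifted-≤ []      h = []
      shifted-≤ (z ∷ W) h = ℕ.≤-trans (ℤ.∣i+j∣≤∣i∣+∣j∣ z (+ a)) (ℕ.+-monoˡ-≤ a (ℕ.≤-trans (ℕ.m≤m+n ℤ.∣ z ∣ (height W)) h)) ∷ shifted-≤ W (ℕ.≤-trans (ℕ.m≤n+m (height W) ℤ.∣ z ∣) h)
      replicate-≤ : ∀ m → VAll.All (_≤ a ℕ.+ a) (Vec.replicate m a)
      replicate-≤ zero    = []
      replicate-≤ (suc m) = ℕ.m≤m+n a a ∷ replicate-≤ m
      V≤ : ∀ i → height (V i) ≤ a
      V≤ = proj₂ (total-height (λ i → height (V i)))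
      κ : Index → Vec ℕ (totient n)
      κ pad-index     = Vec.replicate (totient n) a
      κ (gen-index i) = shifted (V i)
      κ-β : ∀ i → fromℤ D * β i + evℕ (Vec.replicate (totient n) a) ≈ evℕ (κ i)
      κ-β pad-index     = trans (+-congʳ (zeroʳ (fromℤ D))) (+-identityˡ _)
      κ-β (gen-index i) = trans (+-congʳ (trans (*-congˡ (proj₂ (log i))) (proj₂ (express (proj₁ (log i)))))) (sym (shifted-ev (V i) (V≤ i)))
      κ≤ : ∀ i → VAll.All (_≤ a ℕ.+ a) (κ i)
      κ≤ pad-index     = replicate-≤ (totient n)
      κ≤ (gen-index i) = shifted-≤ (V i) (V≤ i)

    module Fractions (𝔾 : Generators) (ι : Fin (p ℕ.∸ 1) → Generators.I 𝔾) (gen-ι : ∀ i → Generators.gen 𝔾 (ι i) ≡ Ec (suc (toℕ i))) where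
      open Monomials 𝔾

      all-some : ∀ {m} (f : Fin m → S) → (∀ i → SomeSpan (f i)) → AllSome (Vec.tabulate f)
      all-some {zero}  f h = tt
      all-some {suc m} f h = h Fin.zero , all-some (λ i → f (Fin.suc i)) (λ i → h (Fin.suc i))

      Egens-some : AllSome Egens
      Egens-some = all-some (λ i → Ec (suc (toℕ i))) (λ i → ≡.subst SomeSpan (gen-ι i) (some-gen (ι i)))

      Represented : Laurent p → Set
      Represented a = Σ S λ u → Σ S λ v → Frac a u v × ¬ Zero v × SomeSpan u × SomeSpan v

      represent : ∀ a → InL p a → Represented a
      represent (k , s) (P , Q , Q≢0 , e) = u , v , frac , v≢0 , some-value (p ℕ.∸ 1) P Egens Egens-some , some-value (p ℕ.∸ 1) Q Egens Egens-some
        where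
        u = value (p ℕ.∸ 1) P Egens
        v = value (p ℕ.∸ 1) Q Egens
        EP = eval p (p ℕ.∸ 1) P (gens p)
        EQ = eval p (p ℕ.∸ 1) Q (gens p)
        vP : Val EP u
        vP = eval-value (p ℕ.∸ 1) P (gens p) Egens Vals-gens
        vQ : Val EQ v
        vQ = eval-value (p ℕ.∸ 1) Q (gens p) Egens Vals-gens
        v≢0 : ¬ Zero v
        v≢0 z = Q≢0 (⇒≈zero EQ (S̄.trans vQ (S̄.trans (S̄.*-congˡ {x^ (proj₁ EQ)} z) (S̄.zeroʳ (x^ (proj₁ EQ))))))
        equation : x^ (proj₁ EP) ⊛ (lift s ⊛ lift (proj₂ EQ)) ≡ₚ (x^ k ⊛ x^ (proj₁ EQ)) ⊛ lift (proj₂ EP)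
        equation = S̄.trans (S̄.*-congˡ {x^ (proj₁ EP)} (S̄.sym (lift-* s (proj₂ EQ)))) (S̄.trans (≈ᴸ⇒ (_*ᴸ_ p (k , s) EQ) EP e) (S̄.*-congʳ {lift (proj₂ EP)} (x^-+ k (proj₁ EQ))))
        frac : Frac (k , s) u v
        frac = x^-cancel (proj₁ EP ℕ.+ proj₁ EQ) (S̄.trans (S̄.*-congʳ {lift s ⊛ v} (x^-+ (proj₁ EP) (proj₁ EQ))) (S̄.trans
          (EvaluationAlgebra.ratio-step M.series {x^ (proj₁ EP)} {x^ (proj₁ EQ)} {x^ k} {lift s} {v} {u} {lift (proj₂ EQ)} {lift (proj₂ EP)} equation vQ vP) (S̄.*-congʳ {x^ k ⊛ u} (S̄.sym (x^-+ (proj₁ EP) (proj₁ EQ))))))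

      AllSpans : ∀ {m} → ℕ → ℕ → Vec (S × S) m → Set
      AllSpans j k []              = ⊤
      AllSpans j k ((u , v) ∷ uvs) = Span j k u × Span j k v × AllSpans j k uvs

      enlarge-all : ∀ {m j k} J K (uvs : Vec (S × S) m) → AllSpans j k uvs → AllSpans (J ℕ.+ j) (K ℕ.+ k) uvs
      enlarge-all J K []              _              = tt
      enlarge-all J K ((u , v) ∷ uvs) (su , sv , ss) = some-enlargeʳ J K su , some-enlargeʳ J K sv , enlarge-all J K uvs ss

      represent-all : ∀ {m} (as : Vec (Laurent p) m) → VAll.All (InL p) as → Σ (Vec (S × S) m) λ uvs → Fracs as uvs × NonZeros uvs × Σ ℕ λ j → Σ ℕ λ k → AllSpans j k uvs
      represent-all []       []       = [] , tt , tt , 0 , 0 , tt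
      represent-all (a ∷ as) (l ∷ ls) = let (u , v , f , nv , (J , K , su) , (J′ , K′ , sv)) = represent a l ; (uvs , fs , ns , j , k , ss) = represent-all as ls in
        (u , v) ∷ uvs , (f , fs) , (nv , ns) , (J ℕ.+ J′) ℕ.+ j , (K ℕ.+ K′) ℕ.+ k ,
        some-enlarge j k (some-enlarge J′ K′ su) , some-enlarge j k (some-enlargeʳ J K sv) , enlarge-all (J ℕ.+ J′) (K ℕ.+ K′) uvs ss

      module _ (J₀ N j k : ℕ) where
        open Family.Spans J₀ N 𝔾 j k using (AllSpan)

        spans : ∀ {m} (uvs : Vec (S × S) m) → AllSpans j k uvs → AllSpan uvs
        spans []              _              = tt
        spans ((u , v) ∷ uvs) (su , sv , ss) = su , sv , spans uvs ss

      dependent : ∀ as → VAll.All (InL p) as → ¬ AlgIndep p (suc (totient n)) as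
      dependent as ls indep = let (uvs , fs , ns , j , k , ss) = represent-all as ls in
        Dependence.absurd 𝔾 j k as uvs fs ns (spans (Dependence.J₀ 𝔾 j k as uvs fs ns) (Dependence.N 𝔾 j k as uvs fs ns) j k uvs ss) indep

    algebraically-dependent : ∀ as → VAll.All (InL p) as → ¬ AlgIndep p (suc (totient n)) as
    algebraically-dependent as ls indep = ζ-expressible λ relation → let (𝔾 , ι , gen-ι) = generators relation in Fractions.dependent 𝔾 ι gen-ι as ls indep


open import Defs
open PadicRing using (padicRing)
open Independent using (module LowerBound)
open Dependent using (module UpperBound)
open import Data.Nat using (ℕ; NonZero; _∸_)
open import Data.Nat.Primality using (Prime)
open import Data.Product using (_,_)

theorem1p4 : (p : ℕ) .{{_ : NonZero p}} → Prime p → TrDegIs p (totient (p ∸ 1))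
theorem1p4 p pr = (elements 0 (totient (p ∸ 1)) , elements-in-L 0 (totient (p ∸ 1)) , algebraically-independent) , algebraically-dependent
  where
  open LowerBound p pr (padicRing p pr) using (elements; elements-in-L; algebraically-independent)
  open UpperBound p pr (padicRing p pr) using (algebraically-dependent)
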